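{- Let $\alpha\in\mathbb{Z}^\ell_{\ge0}$, $\eta=(\alpha^+)'$ (the conjugate of the partition $\alpha^+$) and $m=|\alpha|$. If $m\le\ell$, put $\mu=1^m0^{\ell-m}$; then \[ \tilde E_\alpha(x_1,\dots,x_\ell;q)=H(\Delta'_\ell(\eta);\mu;\tilde{\mathsf p}(\alpha))(x_1,\dots,x_\ell;q). \] If $m>\ell$, put $\mu=1^m$; then \[ \tilde E_\alpha(x_1,\dots,x_\ell;q)=H(\Delta'(\eta);\mu;\tilde{\mathsf p}(\alpha,0^{m-\ell}))(x_1,\dots,x_m;q)\big|_{x_{\ell+1}=\cdots=x_m=0}. \]
   Context: For $n\ge1$: $\pi_i(f)=\frac{x_if-x_{i+1}s_i(f)}{x_i-x_{i+1}}$ on polynomials in $x_1,\dots,x_n$; $H_n$ the 0-Hecke monoid on $\bar s_1,\dots,\bar s_{n-1}$ ($\bar s_i^2=\bar s_i$, commutation, braid), $\pi_w$ along any expression; $H_n$ acts on $\mathbb{Z}^n$ by $\bar s_i\beta=s_i\beta$ if $\beta_i\ge\beta_{i+1}$, else $\beta$. $\beta^+$ is the weakly decreasing rearrangement; $\mathsf p(\beta)$ (resp. $\tilde{\mathsf p}(\beta)$) is the shortest (resp. longest) element $z$ of $H_n$ with $z\beta^+=\beta$. Key polynomials $\kappa_\beta=\pi_{\mathsf p(\beta)}\mathbf x^{\beta^+}$, $\beta\in\mathbb{Z}^n$, form a basis of Laurent polynomials; $\mathrm{poly}(\kappa_\beta)=\kappa_\beta$ if $\beta\ge0$ and $0$ otherwise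 (linear, coefficientwise in $q$). A root ideal is an upper order ideal $\Psi$ of $\Delta^+_n=\{(i,j):1\le i<j\le n\}$ under $(a,b)\le(c,d)$ iff $a\ge c,b\le d$; $\mathrm{nr}(\Psi)_i=|\{j\in\{i,\dots,n\}:(i,j)\notin\Psi\}|$ for $i\in[n-1]$, and $\Psi=\{(i,j):j\ge i+\mathrm{nr}(\Psi)_i\}$. $H(\Psi;\gamma;w)=\pi_w\mathrm{poly}\big(\prod_{(i,j)\in\Psi}(1-qx_i/x_j)^{ -1}\mathbf x^\gamma\big)$ in $n$ variables. For a partition $\eta=(\eta_1,\dots,\eta_k)$ of $m$, $\Delta'(\eta)\subset\Delta^+_m$ is the root ideal with $\mathrm{nr}(\Delta'(\eta))=\big((\eta_1)^{\eta_2},\eta_1,\eta_1-1,\dots,\eta_2+1,(\eta_2)^{\eta_3},\eta_2,\eta_2-1,\dots,\eta_3+1,\dots,(\eta_{k-1})^{\eta_k},\eta_{k-1},\dots,\eta_k+1,\eta_k,\eta_k-1,\dots,2\big)$, where $(a)^b$ means $a$ repeated $b$ times. For $\ell\ge m$, $\Delta'_\ell(\eta)=\Delta'(\eta)\sqcup\{(i,j)\in\Delta^+_\ell:j>m\}$. $\Phi$ on polynomials in $x_1,\dots,x_\ell$: ring map $x_i\mapsto x_{i+1}$ ($i<\ell$), $x_\ell\mapsto qx_1$. The renormalized $t=0$ nonsymmetric Macdonald polynomials $\tilde E_\beta(x_1,\dots,x_\ell;q)$, $\beta\in\mathbb{Z}^\ell_{\ge0}$, are determined by $\tilde E_{(0,\dots,0)}=1$,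 $\tilde E_{\bar s_i\beta}=\pi_i(\tilde E_\beta)$ for $i\in[\ell-1]$, and $\tilde E_{(\beta_\ell+1,\beta_1,\dots,\beta_{\ell-1})}=x_1\Phi(\tilde E_\beta)$; they satisfy $E_\beta(\mathbf x;q,0)=q^{\sum_i\binom{\beta_i}2}\tilde E_\beta(\mathbf x;q^{ -1})$ for the nonsymmetric Macdonald polynomials $E_\beta(\mathbf x;q,t)$. -}

module Defs where

-- Conventions: variables x_1..x_n are indexed 0..n-1;
-- the letter i (a natural number with suc i < n) stands for s̄_{i+1},
-- acting on positions i and i+1.

open import Data.Nat as ℕ using (ℕ; zero; suc; _<_; _≤_; _<ᵇ_; _≤ᵇ_)
open import Data.Integer as ℤ using (ℤ; +_; -_; _+_; _-_; _*_; ∣_∣)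
open import Data.Bool using (Bool; true; false; if_then_else_; _∧_; _∨_; not)
open import Data.List as List using (List; []; _∷_; _++_; map; concatMap; filterᵇ; applyUpTo; length; foldr)
open import Data.List.Relation.Unary.All using (All)
open import Data.Vec as Vec using (Vec; []; _∷_; tabulate; toList; init; last)
import Data.Vec.Properties as VecP
open import Data.Fin using (Fin; toℕ)
open import Data.Product using (Σ; _×_; _,_; proj₁; proj₂)
open import Relation.Nullary using (does)
open import Relation.Binary.PropositionalEquality using (_≡_)

infix 4 _≤ℤ_ _==ℤ_

_≤ℤ_ : ℤ → ℤ → Bool
a ≤ℤ b = does (a ℤ.≤? b)

_==ℤ_ : ℤ → ℤ → Bool
a ==ℤ b = does (a ℤ.≟ b)

-- Laurent polynomials in x_1..x_n and q with integer coefficients,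
-- as finite lists of terms (coefficient, q-exponent, x-exponent vector).

Term : ℕ → Set
Term n = ℤ × ℤ × Vec ℤ n

Poly : ℕ → Set
Poly n = List (Term n)

_==V_ : ∀ {n} → Vec ℤ n → Vec ℤ n → Bool
e ==V e' = does (VecP.≡-dec ℤ._≟_ e e')

coeff : ∀ {n} → Poly n → ℤ → Vec ℤ n → ℤ
coeff [] d e = + 0
coeff ((c , d' , e') ∷ p) d e =
  (if (d ==ℤ d') ∧ (e ==V e') then c else + 0) + coeff p d e

_≈_ : ∀ {n} → Poly n → Poly n → Set
f ≈ g = ∀ d e → coeff f d e ≡ coeff g d e

zeroV : ∀ n → Vec ℤ n
zeroV n = Vec.replicate n (+ 0)

mono : ∀ {n} → Vec ℤ n → Poly n
mono e = (+ 1 , + 0 , e) ∷ []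

onePoly : ∀ n → Poly n
onePoly n = mono (zeroV n)

scale : ∀ {n} → ℤ → Poly n → Poly n
scale c = map (λ { (c' , d , e) → (c * c' , d , e) })

_·P_ : ∀ {n} → Poly n → Poly n → Poly n
f ·P g = concatMap (λ { (c , d , e) →
           map (λ { (c' , d' , e') → (c * c' , d + d' , Vec.zipWith _+_ e e') }) g }) f

qPart : ∀ {n} → Poly n → ℤ → Poly n
qPart f d = map (λ { (c , _ , e) → (c , + 0 , e) })
                (filterᵇ (λ { (_ , d' , _) → d ==ℤ d' }) f)

allB : {A : Set} → (A → Bool) → List A → Bool
allB p = foldr (λ a acc → p a ∧ acc) true

getAt : ∀ {n} → ℕ → Vec ℤ n → ℤ
getAt i [] = + 0
getAt zero (a ∷ _) = a
getAt (suc i) (_ ∷ xs) = getAt i xs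

setPair : ∀ {n} → ℕ → ℤ → ℤ → Vec ℤ n → Vec ℤ n
setPair zero a b (_ ∷ _ ∷ xs) = a ∷ b ∷ xs
setPair zero a b xs = xs
setPair (suc i) a b [] = []
setPair (suc i) a b (x ∷ xs) = x ∷ setPair i a b xs

-- 0-Hecke action of s̄_{i+1} on ℤ^n: swap if β_i ≥ β_{i+1}
hstep : ∀ {n} → ℕ → Vec ℤ n → Vec ℤ n
hstep zero (a ∷ b ∷ xs) = if b ≤ℤ a then b ∷ a ∷ xs else a ∷ b ∷ xs
hstep zero xs = xs
hstep (suc i) [] = []
hstep (suc i) (x ∷ xs) = x ∷ hstep i xs

swapAt : ∀ {n} → ℕ → Vec ℤ n → Vec ℤ n
swapAt zero (a ∷ b ∷ xs) = b ∷ a ∷ xs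
swapAt zero xs = xs
swapAt (suc i) [] = []
swapAt (suc i) (x ∷ xs) = x ∷ swapAt i xs

-- Words in the generators of H_n; the word i₁ i₂ … i_k denotes
-- s̄_{i₁} s̄_{i₂} ⋯ s̄_{i_k} (rightmost letter acts first).

Word : Set
Word = List ℕ

Valid : ℕ → Word → Set
Valid n w = All (λ i → suc i < n) w

act : ∀ {n} → Word → Vec ℤ n → Vec ℤ n
act [] β = β
act (i ∷ w) β = hstep i (act w β)

permOf : ∀ n → Word → Vec ℤ n
permOf n [] = tabulate (λ p → + toℕ p)
permOf n (i ∷ w) = swapAt i (permOf n w)

inversions : List ℤ → ℕ
inversions [] = 0
inversions (a ∷ xs) = length (filterᵇ (λ b → not (a ≤ℤ b)) xs) ℕ.+ inversions xs

Reduced : ℕ → Word → Set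
Reduced n w = length w ≡ inversions (toList (permOf n w))

insertDesc : ∀ {n} → ℤ → Vec ℤ n → Vec ℤ (suc n)
insertDesc x [] = x ∷ []
insertDesc x (y ∷ ys) = if x ≤ℤ y then y ∷ insertDesc x ys else x ∷ y ∷ ys

sortDesc : ∀ {n} → Vec ℤ n → Vec ℤ n
sortDesc [] = []
sortDesc (x ∷ xs) = insertDesc x (sortDesc xs)

IsShortest : ∀ n → Vec ℤ n → Word → Set
IsShortest n β w =
  Valid n w × act w (sortDesc β) ≡ β ×
  (∀ v → Valid n v → act v (sortDesc β) ≡ β → length w ≤ length v)

IsLongest : ∀ n → Vec ℤ n → Word → Set
IsLongest n β w =
  Valid n w × Reduced n w × act w (sortDesc β) ≡ β ×
  (∀ v → Valid n v → Reduced n v → act v (sortDesc β) ≡ β → length v ≤ length w)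

-- Demazure operators π_i (the exact quotient
-- (x_i f - x_{i+1} s_i f)/(x_i - x_{i+1}), computed monomialwise)

intRange : ℤ → ℤ → List ℤ
intRange lo hi = if lo ≤ℤ hi then applyUpTo (λ t → lo + + t) (suc ∣ hi - lo ∣) else []

piTerm : ∀ {n} → ℕ → Term n → Poly n
piTerm i (c , d , e) =
  let a = getAt i e ; b = getAt (suc i) e in
  if b ≤ℤ a
  then map (λ k → (c , d , setPair i k (a + b - k) e)) (intRange b a)
  else map (λ k → (- c , d , setPair i k (a + b - k) e)) (intRange (a + + 1) (b - + 1))

piOp : ∀ {n} → ℕ → Poly n → Poly n
piOp i = concatMap (piTerm i)

piWord : ∀ {n} → Word → Poly n → Poly n
piWord [] f = f
piWord (i ∷ w) f = piOp i (piWord w f)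

IsKey : ∀ n → Vec ℤ n → Poly n → Set
IsKey n β k = Σ Word (λ w → IsShortest n β w × (k ≈ piWord w (mono (sortDesc β))))

KeyEntry : ℕ → Set
KeyEntry n = ℤ × Vec ℤ n × Poly n

sumEntries : ∀ {n} → List (KeyEntry n) → Poly n
sumEntries = foldr (λ { (c , β , k) acc → scale c k ++ acc }) []

KeyExpansion : ∀ n → Poly n → List (KeyEntry n) → Set
KeyExpansion n f L = All (λ { (c , β , k) → IsKey n β k }) L × (f ≈ sumEntries L)

nonneg : ∀ {n} → Vec ℤ n → Bool
nonneg β = allB (λ b → + 0 ≤ℤ b) (toList β)

polyPart : ∀ {n} → List (KeyEntry n) → Poly n
polyPart L = sumEntries (filterᵇ (λ { (_ , β , _) → nonneg β }) L)

-- Root ideals Δ'(η), Δ'_ℓ(η); roots (i,j) with 0-based i < j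

descList : ℕ → ℕ → List ℕ
descList a b = applyUpTo (λ t → a ℕ.∸ t) (a ℕ.∸ b)

nrΔ' : List ℕ → List ℕ
nrΔ' [] = []
nrΔ' (a ∷ []) = descList a 1
nrΔ' (a ∷ b ∷ rest) = List.replicate b a ++ descList a b ++ nrΔ' (b ∷ rest)

nthℕ : ℕ → List ℕ → ℕ
nthℕ _ [] = 0
nthℕ zero (x ∷ _) = x
nthℕ (suc i) (_ ∷ xs) = nthℕ i xs

-- Δ'_ℓ(η) ⊆ Δ⁺_ℓ where m = |η| ≤ ℓ:
-- (i,j) with j ≥ m (0-based: j ≥ m means 1-based j > m), or j < m and j ≥ i + nr_i
Δ'ℓ : (ℓ : ℕ) → (η : List ℕ) → (m : ℕ) → List (ℕ × ℕ)
Δ'ℓ ℓ η m =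
  filterᵇ (λ { (i , j) → (i <ᵇ j) ∧ ((m ≤ᵇ j) ∨ ((i ℕ.+ nthℕ i (nrΔ' η)) ≤ᵇ j)) })
          (concatMap (λ i → map (λ j → (i , j)) (List.upTo ℓ)) (List.upTo ℓ))

maxℕ : List ℕ → ℕ
maxℕ = foldr ℕ._⊔_ 0

conjugate : List ℕ → List ℕ
conjugate α = applyUpTo (λ r → length (filterᵇ (λ a → suc r ≤ᵇ a) α)) (maxℕ α)

rootExp : ∀ n → ℕ → ℕ → ℕ → Vec ℤ n
rootExp n i j k = tabulate (λ p →
  if toℕ p ℕ.≡ᵇ i then + k else if toℕ p ℕ.≡ᵇ j then - (+ k) else + 0)

-- coefficient of q^d in ∏_{(i,j) ∈ Ψ} (1 - q x_i/x_j)^{-1}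
geoCoeff : ∀ n → List (ℕ × ℕ) → ℕ → Poly n
geoCoeff n [] zero = onePoly n
geoCoeff n [] (suc d) = []
geoCoeff n ((i , j) ∷ Ψ) d =
  concatMap (λ k → mono (rootExp n i j k) ·P geoCoeff n Ψ (d ℕ.∸ k)) (List.upTo (suc d))

productCoeff : ∀ n → List (ℕ × ℕ) → Vec ℤ n → ℤ → Poly n
productCoeff n Ψ γ (+ d) = geoCoeff n Ψ d ·P mono γ
productCoeff n Ψ γ (ℤ.-[1+ _ ]) = []

-- "h is the q^d-coefficient of H(Ψ;γ;w)" is expressed as: for every key
-- expansion L of the q^d-coefficient of ∏(1-qx_i/x_j)^{-1}x^γ,
-- h ≈ π_w (polyPart L).

pad : (m : ℕ) → List ℤ → Vec ℤ m
pad zero _ = []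
pad (suc m) [] = + 0 ∷ pad m []
pad (suc m) (x ∷ xs) = x ∷ pad m xs

onesThenZeros : (n m : ℕ) → Vec ℤ n
onesThenZeros n m = tabulate (λ p → if toℕ p <ᵇ m then + 1 else + 0)

specialize : ∀ {m} (ℓ : ℕ) → Poly m → Poly ℓ
specialize ℓ f =
  map (λ { (c , d , e) → (c , d , pad ℓ (List.take ℓ (toList e))) })
      (filterᵇ (λ { (_ , _ , e) → allB (λ b → b ==ℤ + 0) (List.drop ℓ (toList e)) }) f)

-- Renormalized t = 0 nonsymmetric Macdonald polynomials Ẽ_β (ℓ = suc k)

Φ : ∀ {k} → Poly (suc k) → Poly (suc k)
Φ = map (λ { (c , d , e) → (c , d + last e , last e ∷ init e) })

x₁· : ∀ {k} → Poly (suc k) → Poly (suc k)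
x₁· = map (λ { (c , d , e ∷ es) → (c , d , (e + + 1) ∷ es) })

rot : ∀ {k} → Vec ℤ (suc k) → Vec ℤ (suc k)
rot β = (last β + + 1) ∷ init β

data IsE (k : ℕ) : Vec ℤ (suc k) → Poly (suc k) → Set where
  base : IsE k (zeroV (suc k)) (onePoly (suc k))
  hecke : ∀ {β f} (i : ℕ) → suc i < suc k → IsE k β f → IsE k (hstep i β) (piOp i f)
  cyclic : ∀ {β f} → IsE k β f → IsE k (rot β) (x₁· (Φ f))

toZ : ∀ {n} → Vec ℕ n → Vec ℤ n
toZ = Vec.map (λ a → + a)

{-# OPTIONS --safe #-}
module Submission where

-- The operators π_i and ρ = x₁Φ satisfy the relations of the affine 0-Hecke monoid, so the
-- polynomial Ẽ_β does not depend on how β is reached from 0; hence it suffices to compute the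
-- right-hand side along one derivation.
--
-- Let K be the span of the key polynomials κ_β with β ≱ 0. The form (h , f) ↦ CT(h f ∏_{i<j}(1 - x_i/x_j))
-- makes every π_i self-adjoint, and K is the annihilator of ℤ[x₁⁻¹, …, xₙ⁻¹]. Therefore K is stable
-- under the π_i and under multiplication by the x_j⁻¹, contains the monomials with negative last
-- exponent, and meets the polynomials only in 0; since every Laurent polynomial is congruent mod K to a
-- polynomial, poly(f) may be computed modulo K.
--
-- Modulo K the first row ∏_{j>n₁}(1 - q x₁/x_j)⁻¹ of the root ideal is the rotation x₁Φ preceded by
-- symmetrisation in x_{n₁}, …, xₙ, provided that the outer π_w absorbs π_i for i > n₁. Peeling off the
-- rows one by one leads from the zero vector to α⁺ column by column, and the longest word for α absorbs
-- the π_i acting on the zeros of α⁺. For m > ℓ one uses that Ẽ_{(β,0)} restricts to Ẽ_β at x_{ℓ+1} = 0.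

open import Defs
open import Data.Nat as ℕ using (ℕ; zero; suc; s≤s; z≤n; _≤_; _<_)
import Data.Nat.Properties as ℕP
open import Data.Integer as ℤ using (ℤ; +_; -[1+_]; -_; _+_; _-_; _*_; ∣_∣)
import Data.Integer.Properties as ℤP
open import Data.Integer.Tactic.RingSolver using (solve-∀)
open import Data.Bool as 𝔹 using (Bool; true; false; if_then_else_; _∧_; _∨_; not; T)
open import Data.List as List using (List; []; _∷_; _++_; map; concatMap; filterᵇ; applyUpTo; length; foldr)
import Data.List.Properties as LP
open import Data.List.Relation.Unary.All as All using (All; []; _∷_)
import Data.List.Relation.Unary.All.Properties as AllP
open import Data.Vec as Vec using (Vec; []; _∷_; _∷ʳ_; tabulate; toList; init; last; sum; zipWith)
import Data.Vec.Properties as VecP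
import Data.Fin as Fin
open import Data.Product using (∃; _×_; _,_; proj₁; proj₂)
open import Data.Sum using (_⊎_; inj₁; inj₂)
open import Data.Empty using (⊥; ⊥-elim)
open import Data.Unit using (⊤; tt)
open import Function using (_∘_; id)
open import Relation.Nullary using (¬_; Dec; yes; no; does)
open import Relation.Nullary.Decidable using (dec-true; dec-false)
open import Relation.Binary.Definitions using (tri<; tri≈; tri>)
open import Relation.Binary.PropositionalEquality using (_≡_; _≢_; refl; sym; trans; cong; cong₂; subst; subst₂; module ≡-Reasoning)

-- The rotation step rests on one computation. Up to renumbering of the variables, a row expands as
-- Σ q^k x₁^k h_k(x_j⁻¹ : j > n₁), whereas x₁Φ turns a last exponent k into q^k x₁^(k+1). The claim
-- is therefore that, for p symmetric in x_s, ..., x_N, the coefficient of x_(N+1)^k in π_s ⋯ π_N p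
-- is h_k(x_s⁻¹, ..., x_N⁻¹) p modulo K. For s = N this is π(x^a) = Σ_(k ≤ a) x^(a-k) y^k: the
-- x^(a-k) with k > a have negative last exponent and lie in K. Longer cycles follow from π_s
-- (h_k(x_(s+1)⁻¹, ...) p) = h_k(x_s⁻¹, ...) p. Polynomials are unnormalised lists of terms, on
-- which division and cancellation are awkward. On functions of exponents, which may have infinite
-- support, the transpose of multiplication by x_i - x_(i+1) is surjective, so that each relation
-- between the π_i becomes a telescoping identity. For the same reason K enters only through its
-- annihilator `Span`.

addˡ : ∀ x {y z} → y ≡ z → x + y ≡ x + z
addˡ x = cong (λ u → x + u)

subˡ : ∀ x {y z} → y ≡ z → x - y ≡ x - z
subˡ x = cong (λ u → x - u)

-- Pairings of polynomials with functions of exponents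

Fn : ℕ → Set
Fn n = Vec ℤ n → ℤ

-- All identities between polynomials are checked on the dual side: a linear
-- operator is replaced by its transpose, acting on functions of exponents.
⟪_,_⟫ : ∀ {n} → Poly n → (ℤ → Fn n) → ℤ
⟪ [] , φ ⟫ = + 0
⟪ (c , d , e) ∷ f , φ ⟫ = c * φ d e + ⟪ f , φ ⟫

infix 4 _≋_
record _≋_ {n} (f g : Poly n) : Set where
  constructor eqP
  field pair : ∀ φ → ⟪ f , φ ⟫ ≡ ⟪ g , φ ⟫
open _≋_ public

≋-refl : ∀ {n} {f : Poly n} → f ≋ f
≋-refl = eqP λ _ → refl

≋-sym : ∀ {n} {f g : Poly n} → f ≋ g → g ≋ f
≋-sym p = eqP λ φ → sym (pair p φ)

≋-trans : ∀ {n} {f g h : Poly n} → f ≋ g → g ≋ h → f ≋ h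
≋-trans p q = eqP λ φ → trans (pair p φ) (pair q φ)

≡⇒≋ : ∀ {n} {f g : Poly n} → f ≡ g → f ≋ g
≡⇒≋ refl = ≋-refl

pair-ext : ∀ {n} (f : Poly n) {φ ψ : ℤ → Fn n} → (∀ d e → φ d e ≡ ψ d e) → ⟪ f , φ ⟫ ≡ ⟪ f , ψ ⟫
pair-ext [] h = refl
pair-ext ((c , d , e) ∷ f) h = cong₂ _+_ (cong (c *_) (h d e)) (pair-ext f h)

pair-extAll : ∀ {n} {P : Term n → Set} {f : Poly n} {φ ψ : ℤ → Fn n} → All P f →
  (∀ c d e → P (c , d , e) → φ d e ≡ ψ d e) → ⟪ f , φ ⟫ ≡ ⟪ f , ψ ⟫
pair-extAll [] h = refl
pair-extAll {f = (c , d , e) ∷ f} (p ∷ ps) h = cong₂ _+_ (cong (c *_) (h c d e p)) (pair-extAll ps h)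

pair-++ : ∀ {n} (f g : Poly n) φ → ⟪ f ++ g , φ ⟫ ≡ ⟪ f , φ ⟫ + ⟪ g , φ ⟫
pair-++ [] g φ = sym (ℤP.+-identityˡ _)
pair-++ ((c , d , e) ∷ f) g φ =
  trans (addˡ (c * φ d e) (pair-++ f g φ)) (sym (ℤP.+-assoc (c * φ d e) ⟪ f , φ ⟫ ⟪ g , φ ⟫))

pair-+ : ∀ {n} (f : Poly n) φ ψ → ⟪ f , (λ d e → φ d e + ψ d e) ⟫ ≡ ⟪ f , φ ⟫ + ⟪ f , ψ ⟫
pair-+ [] φ ψ = refl
pair-+ ((c , d , e) ∷ f) φ ψ = trans (addˡ (c * (φ d e + ψ d e)) (pair-+ f φ ψ)) (lem c (φ d e) (ψ d e) _ _)
  where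
  lem : ∀ c x y u v → c * (x + y) + (u + v) ≡ (c * x + u) + (c * y + v)
  lem = solve-∀

pair-- : ∀ {n} (f : Poly n) φ ψ → ⟪ f , (λ d e → φ d e - ψ d e) ⟫ ≡ ⟪ f , φ ⟫ - ⟪ f , ψ ⟫
pair-- [] φ ψ = refl
pair-- ((c , d , e) ∷ f) φ ψ = trans (addˡ (c * (φ d e - ψ d e)) (pair-- f φ ψ)) (lem c (φ d e) (ψ d e) _ _)
  where
  lem : ∀ c x y u v → c * (x - y) + (u - v) ≡ (c * x + u) - (c * y + v)
  lem = solve-∀

pair-0 : ∀ {n} (f : Poly n) {φ : ℤ → Fn n} → (∀ d e → φ d e ≡ + 0) → ⟪ f , φ ⟫ ≡ + 0
pair-0 [] h = refl
pair-0 ((c , d , e) ∷ f) h = trans (cong₂ _+_ (trans (cong (c *_) (h d e)) (ℤP.*-zeroʳ c)) (pair-0 f h)) refl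

pair-map : ∀ {n m} (δ : ℤ → Vec ℤ n → ℤ) (ε : ℤ → Vec ℤ n → Vec ℤ m) (F : Term n → Term m) →
  (∀ c d e → F (c , d , e) ≡ (c , δ d e , ε d e)) → (f : Poly n) → ∀ φ →
  ⟪ map F f , φ ⟫ ≡ ⟪ f , (λ d e → φ (δ d e) (ε d e)) ⟫
pair-map δ ε F h [] φ = refl
pair-map δ ε F h ((c , d , e) ∷ f) φ rewrite h c d e = addˡ (c * φ (δ d e) (ε d e)) (pair-map δ ε F h f φ)

pair-concatMap : ∀ {n m} (S : Term n → Poly m) (S* : (ℤ → Fn m) → ℤ → Fn n) → ∀ φ →
  (∀ c d e → ⟪ S (c , d , e) , φ ⟫ ≡ c * S* φ d e) → (f : Poly n) →
  ⟪ concatMap S f , φ ⟫ ≡ ⟪ f , S* φ ⟫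
pair-concatMap S S* φ h [] = refl
pair-concatMap S S* φ h ((c , d , e) ∷ f) =
  trans (pair-++ (S (c , d , e)) (concatMap S f) φ) (cong₂ _+_ (h c d e) (pair-concatMap S S* φ h f))

pair-scale : ∀ {n} k (f : Poly n) φ → ⟪ scale k f , φ ⟫ ≡ k * ⟪ f , φ ⟫
pair-scale k [] φ = sym (ℤP.*-zeroʳ k)
pair-scale k ((c , d , e) ∷ f) φ = trans (addˡ (k * c * φ d e) (pair-scale k f φ)) (lem k c (φ d e) ⟪ f , φ ⟫)
  where
  lem : ∀ k c x u → k * c * x + k * u ≡ k * (c * x + u)
  lem = solve-∀

++-cong : ∀ {n} {f f' g g' : Poly n} → f ≋ f' → g ≋ g' → f ++ g ≋ f' ++ g'
++-cong {f = f} {f'} {g} {g'} p q = eqP λ φ →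
  trans (pair-++ f g φ) (trans (cong₂ _+_ (pair p φ) (pair q φ)) (sym (pair-++ f' g' φ)))

negP : ∀ {n} → Poly n → Poly n
negP = scale (- (+ 1))

-- The coefficientwise equality of the statement is equality of all pairings.

keyEq : ∀ {n} → ℤ → Vec ℤ n → ℤ → Vec ℤ n → Bool
keyEq d e d' e' = (d ==ℤ d') ∧ (e ==V e')

keyEq-sound : ∀ {n} d (e : Vec ℤ n) d' e' → keyEq d e d' e' ≡ true → d ≡ d' × e ≡ e'
keyEq-sound d e d' e' h with d ℤ.≟ d' | VecP.≡-dec ℤ._≟_ e e'
... | yes p | yes q = p , q
keyEq-sound d e d' e' () | yes p | no q
keyEq-sound d e d' e' () | no p | _

keyEq-complete : ∀ {n} d (e : Vec ℤ n) d' e' → d ≡ d' → e ≡ e' → keyEq d e d' e' ≡ true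
keyEq-complete d e d' e' p q = cong₂ _∧_ (dec-true (d ℤ.≟ d') p) (dec-true (VecP.≡-dec ℤ._≟_ e e') q)

≋⇒≈ : ∀ {n} {f g : Poly n} → f ≋ g → f ≈ g
≋⇒≈ {f = f} {g} p d e = trans (lem f) (trans (pair p δ) (sym (lem g)))
  where
  δ : ℤ → Fn _
  δ d' e' = if keyEq d e d' e' then + 1 else + 0
  sel : ∀ b c → (if b then c else + 0) ≡ c * (if b then + 1 else + 0)
  sel true c = sym (ℤP.*-identityʳ c)
  sel false c = sym (ℤP.*-zeroʳ c)
  lem : ∀ f → coeff f d e ≡ ⟪ f , δ ⟫
  lem [] = refl
  lem ((c , d' , e') ∷ f) = cong₂ _+_ (sel (keyEq d e d' e') c) (lem f)

drop-key : ∀ {n} → ℤ → Vec ℤ n → Poly n → Poly n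
drop-key d e [] = []
drop-key d e ((c , d' , e') ∷ f) = if keyEq d e d' e' then drop-key d e f else (c , d' , e') ∷ drop-key d e f

drop-key-length : ∀ {n} d (e : Vec ℤ n) f → length (drop-key d e f) ℕ.≤ length f
drop-key-length d e [] = z≤n
drop-key-length d e ((c , d' , e') ∷ f) with keyEq d e d' e'
... | true = ℕP.m≤n⇒m≤1+n (drop-key-length d e f)
... | false = s≤s (drop-key-length d e f)

drop-key-pair : ∀ {n} d (e : Vec ℤ n) f φ → ⟪ f , φ ⟫ ≡ coeff f d e * φ d e + ⟪ drop-key d e f , φ ⟫
drop-key-pair d e [] φ = sym (trans (ℤP.+-identityʳ _) (ℤP.*-zeroˡ (φ d e)))
drop-key-pair d e ((c , d' , e') ∷ f) φ with keyEq d e d' e' in eq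
... | true with keyEq-sound d e d' e' eq
... | refl , refl = trans (addˡ (c * φ d e) (drop-key-pair d e f φ)) (lem c (φ d e) (coeff f d e) _)
  where
  lem : ∀ c x k r → c * x + (k * x + r) ≡ (c + k) * x + r
  lem = solve-∀
drop-key-pair d e ((c , d' , e') ∷ f) φ | false =
  trans (addˡ (c * φ d' e') (drop-key-pair d e f φ)) (lem (c * φ d' e') (φ d e) (coeff f d e) _)
  where
  lem : ∀ c x k r → c + (k * x + r) ≡ (+ 0 + k) * x + (c + r)
  lem = solve-∀

drop-key-coeff : ∀ {n} d (e : Vec ℤ n) f → f ≈ [] → drop-key d e f ≈ []
drop-key-coeff d e f h d₁ e₁ with keyEq d e d₁ e₁ in eq
... | true with keyEq-sound d e d₁ e₁ eq
... | refl , refl = go f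
  where
  go : ∀ f → coeff (drop-key d e f) d e ≡ + 0
  go [] = refl
  go ((c , d' , e') ∷ f) with keyEq d e d' e' in eq'
  ... | true = go f
  ... | false rewrite eq' = trans (ℤP.+-identityˡ _) (go f)
drop-key-coeff d e f h d₁ e₁ | false = trans (go f) (h d₁ e₁)
  where
  go : ∀ f → coeff (drop-key d e f) d₁ e₁ ≡ coeff f d₁ e₁
  go [] = refl
  go ((c , d' , e') ∷ f) with keyEq d e d' e' in eq₁
  ... | false = addˡ (if keyEq d₁ e₁ d' e' then c else + 0) (go f)
  ... | true with keyEq-sound d e d' e' eq₁
  ... | refl , refl with keyEq d₁ e₁ d e in eq₂
  ... | false = trans (go f) (sym (ℤP.+-identityˡ _))
  ... | true with keyEq-sound d₁ e₁ d e eq₂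
  ... | refl , refl with trans (sym eq) eq₁
  ... | ()

-- All terms with the exponents of the head together contribute `coeff` times `φ d e`, that is 0,
-- and can be deleted at once. They may sit anywhere in the list, so the induction is on a bound for
-- its length.
pair-null : ∀ {n} N (f : Poly n) → length f ℕ.≤ N → f ≈ [] → ∀ φ → ⟪ f , φ ⟫ ≡ + 0
pair-null N [] l h φ = refl
pair-null (suc N) ((c , d , e) ∷ f) (s≤s l) h φ =
  begin
    ⟪ (c , d , e) ∷ f , φ ⟫
  ≡⟨ drop-key-pair d e ((c , d , e) ∷ f) φ ⟩
    coeff ((c , d , e) ∷ f) d e * φ d e + ⟪ drop-key d e ((c , d , e) ∷ f) , φ ⟫
  ≡⟨ cong₂ _+_ (trans (cong (_* φ d e) (h d e)) (ℤP.*-zeroˡ (φ d e)))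
       (pair-null N (drop-key d e ((c , d , e) ∷ f)) shorter (drop-key-coeff d e ((c , d , e) ∷ f) h) φ) ⟩
    + 0
  ∎
  where
  open ≡-Reasoning
  shorter : length (drop-key d e ((c , d , e) ∷ f)) ℕ.≤ N
  shorter rewrite keyEq-complete d e d e refl refl = ℕP.≤-trans (drop-key-length d e f) l

coeff-++ : ∀ {n} (f g : Poly n) d e → coeff (f ++ g) d e ≡ coeff f d e + coeff g d e
coeff-++ [] g d e = sym (ℤP.+-identityˡ _)
coeff-++ ((c , d' , e') ∷ f) g d e = trans (addˡ (if keyEq d e d' e' then c else + 0) (coeff-++ f g d e)) (sym (ℤP.+-assoc (if keyEq d e d' e' then c else + 0) (coeff f d e) (coeff g d e)))

coeff-negP : ∀ {n} (f : Poly n) d e → coeff (negP f) d e ≡ - coeff f d e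
coeff-negP [] d e = refl
coeff-negP ((c , d' , e') ∷ f) d e =
  trans (cong₂ _+_ (lem (keyEq d e d' e') c) (coeff-negP f d e)) (sym (ℤP.neg-distrib-+ (if keyEq d e d' e' then c else + 0) (coeff f d e)))
  where
  lem : ∀ b c → (if b then - (+ 1) * c else + 0) ≡ - (if b then c else + 0)
  lem true c = ℤP.-1*i≡-i c
  lem false c = refl

-≡0 : ∀ x y → x + - (+ 1) * y ≡ + 0 → x ≡ y
-≡0 x y h = ℤP.i-j≡0⇒i≡j x y (trans (addˡ (x) (sym (ℤP.-1*i≡-i y))) h)

≈⇒≋ : ∀ {n} {f g : Poly n} → f ≈ g → f ≋ g
≈⇒≋ {f = f} {g} h = eqP λ φ → -≡0 _ _
  (trans (addˡ (⟪ f , φ ⟫) (sym (pair-scale (- (+ 1)) g φ)))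
  (trans (sym (pair-++ f (negP g) φ)) (pair-null _ (f ++ negP g) ℕP.≤-refl null φ)))
  where
  null : (f ++ negP g) ≈ []
  null d e = trans (coeff-++ f (negP g) d e)
    (trans (cong₂ _+_ (h d e) (coeff-negP g d e)) (ℤP.+-inverseʳ (coeff g d e)))

-- Transposed Demazure operators in two and three variables

sc : ℤ → ℤ
-- With `+ 1` on the left, `sc (+ n)` reduces to `+ suc n`.
sc a = + 1 + a

module _ (F : ℤ → ℤ) where
  private
    up : ℕ → ℤ
    up zero = + 0
    up (suc n) = up n + F (+ n)

    down : ℕ → ℤ
    down zero = F (-[1+ 0 ])
    down (suc n) = down n + F (-[1+ suc n ])

  -- The discrete antiderivative of F vanishing at 0.
  ∫ : ℤ → ℤ
  ∫ (+ n) = up n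
  ∫ -[1+ n ] = - down n

  ∫-sc : ∀ a → ∫ (sc a) ≡ ∫ a + F a
  ∫-sc (+ n) = refl
  ∫-sc -[1+ zero ] = sym (ℤP.+-inverseˡ (F -[1+ 0 ]))
  ∫-sc -[1+ suc n ] = lem (down n) (F -[1+ suc n ])
    where
    lem : ∀ x y → - x ≡ - (x + y) + y
    lem = solve-∀

  ∫-unique : ∀ (G : ℤ → ℤ) → (∀ k → F k ≡ G (sc k) - G k) → ∀ a → ∫ a ≡ G a - G (+ 0)
  ∫-unique G h (+ zero) = sym (ℤP.+-inverseʳ (G (+ 0)))
  ∫-unique G h (+ suc n) = trans (cong₂ _+_ (∫-unique G h (+ n)) (h (+ n))) (lem (G (+ n)) (G (+ 0)) (G (+ suc n)))
    where
    lem : ∀ x y z → (x - y) + (z - x) ≡ z - y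
    lem = solve-∀
  ∫-unique G h -[1+ zero ] = trans (cong -_ (h -[1+ 0 ])) (lem (G (+ 0)) (G -[1+ 0 ]))
    where
    lem : ∀ x y → - (x - y) ≡ y - x
    lem = solve-∀
  ∫-unique G h -[1+ suc n ] =
    trans (lem (down n) (F -[1+ suc n ]))
      (trans (cong₂ _-_ (∫-unique G h -[1+ n ]) (h -[1+ suc n ])) (lem' (G -[1+ n ]) (G (+ 0)) (G -[1+ suc n ])))
    where
    lem : ∀ x y → - (x + y) ≡ - x - y
    lem = solve-∀
    lem' : ∀ x y z → (x - y) - (x - z) ≡ z - y
    lem' = solve-∀

∫-ext : ∀ {F G : ℤ → ℤ} → (∀ k → F k ≡ G k) → ∀ a → ∫ F a ≡ ∫ G a
∫-ext {F} {G} h a = trans (∫-unique F (∫ G) (λ k → trans (h k) (sym (lem (∫ G k) (∫-sc G k)))) a) (ℤP.+-identityʳ (∫ G a))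
  where
  lem : ∀ x {y z} → y ≡ x + z → y - x ≡ z
  lem x {_} {z} refl = lem' x z
    where
    lem' : ∀ x z → (x + z) - x ≡ z
    lem' = solve-∀

∫-interval : ∀ (F G : ℤ → ℤ) → (∀ k → F k ≡ G (sc k) - G k) → ∀ a b → ∫ F a - ∫ F b ≡ G a - G b
∫-interval F G h a b = trans (cong₂ _-_ (∫-unique F G h a) (∫-unique F G h b)) (lem (G a) (G (+ 0)) (G b))
  where
  lem : ∀ x y z → (x - y) - (z - y) ≡ x - z
  lem = solve-∀

Fn² : Set
Fn² = ℤ → ℤ → ℤ

line : Fn² → ℤ → ℤ → ℤ
line φ N k = φ k (N - k)

-- The transpose of a Demazure operator, in the two variables on which it acts.
dem : Fn² → Fn²
dem φ a b = ∫ (line φ (a + b)) (sc a) - ∫ (line φ (a + b)) b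

dem-ext : ∀ {φ ψ : Fn²} → (∀ a b → φ a b ≡ ψ a b) → ∀ a b → dem φ a b ≡ dem ψ a b
dem-ext h a b = cong₂ _-_ (∫-ext (λ k → h k (a + b - k)) (sc a)) (∫-ext (λ k → h k (a + b - k)) b)

l1 : ∀ N k → + 1 + (N - (+ 1 + k)) ≡ N - k
l1 = solve-∀
l2 : ∀ a b → + 1 + ((a + b) - (+ 1 + a)) ≡ b
l2 = solve-∀
l3 : ∀ a b → + 1 + ((a + b) - b) ≡ + 1 + a
l3 = solve-∀
l4 : ∀ x y → (+ 1 + x) + y - (+ 1 + x) ≡ y
l4 = solve-∀
l5 : ∀ x y t → (+ 1 + x) + y - (+ 1 + t) ≡ x + (+ 1 + y) - (+ 1 + t)
l5 = solve-∀

-- Transposed form of (x_i - x_{i+1}) π_i f = x_i f - x_{i+1} s_i f.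
dem-tele : ∀ {φ : Fn²} (ψ : Fn²) → (∀ x y → φ x y ≡ ψ (sc x) y - ψ x (sc y)) →
  ∀ a b → dem φ a b ≡ ψ (sc a) b - ψ b (sc a)
dem-tele {φ} ψ h a b = trans
  (∫-interval (line φ (a + b)) G (λ k → trans (h k (a + b - k)) (cong (λ z → ψ (sc k) z - G k) (sym (l1 (a + b) k)))) (sc a) b)
  (cong₂ _-_ (cong (ψ (sc a)) (l2 a b)) (cong (ψ b) (l3 a b)))
  where
  G : ℤ → ℤ
  G k = ψ k (sc (a + b - k))

-- Division by x_i - x_(i+1) on the dual side: summing along each line x + y = const inverts the
-- transpose of the multiplication. It succeeds for every φ because functions of exponents need not
-- have finite support; `dem-tele` thus applies to every φ.
primitive² : Fn² → Fn²
primitive² φ x y = ∫ (λ t → φ t (x + y - sc t)) x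

primitive²-spec : ∀ φ x y → φ x y ≡ primitive² φ (sc x) y - primitive² φ x (sc y)
primitive²-spec φ x y = sym (trans
  (cong₂ _-_ (∫-sc (λ t → φ t (sc x + y - sc t)) x) (∫-ext (λ t → cong (φ t) (sym (l5 x y t))) x))
  (trans (lem (∫ (λ t → φ t (sc x + y - sc t)) x) _) (cong (φ x) (l4 x y))))
  where
  lem : ∀ u v → u + v - u ≡ v
  lem = solve-∀

dem-+ : ∀ φ ψ a b → dem (λ x y → φ x y + ψ x y) a b ≡ dem φ a b + dem ψ a b
dem-+ φ ψ a b = trans
  (dem-tele (λ x y → Φ' x y + Ψ' x y) (λ x y → trans (cong₂ _+_ (primitive²-spec φ x y) (primitive²-spec ψ x y)) (lem (Φ' (sc x) y) _ (Ψ' (sc x) y) _)) a b)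
  (trans (sym (lem (Φ' (sc a) b) _ (Ψ' (sc a) b) _)) (sym (cong₂ _+_ (dem-tele Φ' (primitive²-spec φ) a b) (dem-tele Ψ' (primitive²-spec ψ) a b))))
  where
  Φ' = primitive² φ
  Ψ' = primitive² ψ
  lem : ∀ a b c d → (a - b) + (c - d) ≡ (a + c) - (b + d)
  lem = solve-∀

dem-neg : ∀ φ a b → dem (λ x y → - φ x y) a b ≡ - dem φ a b
dem-neg φ a b = trans
  (dem-tele (λ x y → - Φ' x y) (λ x y → trans (cong -_ (primitive²-spec φ x y)) (lem (Φ' (sc x) y) (Φ' x (sc y)))) a b)
  (trans (sym (lem (Φ' (sc a) b) _)) (sym (cong -_ (dem-tele Φ' (primitive²-spec φ) a b))))
  where
  Φ' = primitive² φ
  lem : ∀ a b → - (a - b) ≡ - a - - b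
  lem = solve-∀

dem-- : ∀ φ ψ a b → dem (λ x y → φ x y - ψ x y) a b ≡ dem φ a b - dem ψ a b
dem-- φ ψ a b = trans (dem-+ φ (λ x y → - ψ x y) a b) (addˡ (dem φ a b) (dem-neg ψ a b))

-- Dual to s_i π_i = π_i. If ψ(x, y) is a primitive of φ, then - ψ(y, x) is one of the reflected
-- function, and the two telescoped values trade places.
dem-reflect : ∀ φ a b → dem (λ x y → φ y x) a b ≡ dem φ a b
dem-reflect φ a b = trans
  (dem-tele (λ x y → - ψ y x) (λ x y → trans (primitive²-spec φ y x) (lem (ψ (sc y) x) (ψ y (sc x)))) a b)
  (trans (sym (lem (ψ (sc a) b) (ψ b (sc a)))) (sym (dem-tele ψ (primitive²-spec φ) a b)))
  where
  ψ = primitive² φ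
  lem : ∀ u v → u - v ≡ - v - - u
  lem = solve-∀

-- Under the outer `dem` the subtracted term ψ(y, x + 1) of the telescoped `dem φ` may be reflected;
-- the difference that remains is φ itself.
dem-idem : ∀ φ a b → dem (dem φ) a b ≡ dem φ a b
dem-idem φ a b = begin
  dem (dem φ) a b                                         ≡⟨ dem-ext (dem-tele ψ (primitive²-spec φ)) a b ⟩
  dem (λ x y → ψ (sc x) y - ψ y (sc x)) a b               ≡⟨ dem-- (λ x y → ψ (sc x) y) (λ x y → ψ y (sc x)) a b ⟩
  dem (λ x y → ψ (sc x) y) a b - dem (λ x y → ψ y (sc x)) a b
    ≡⟨ subˡ (dem (λ x y → ψ (sc x) y) a b) (dem-reflect (λ x y → ψ x (sc y)) a b) ⟩
  dem (λ x y → ψ (sc x) y) a b - dem (λ x y → ψ x (sc y)) a b ≡⟨ sym (dem-- (λ x y → ψ (sc x) y) (λ x y → ψ x (sc y)) a b) ⟩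
  dem (λ x y → ψ (sc x) y - ψ x (sc y)) a b               ≡⟨ dem-ext (λ x y → sym (primitive²-spec φ x y)) a b ⟩
  dem φ a b ∎
  where
  open ≡-Reasoning
  ψ = primitive² φ

half : ∀ x → x ≡ - x → x ≡ + 0
half (+ zero) h = refl
half (+ suc n) ()
half -[1+ n ] ()

-- For antisymmetric η: π-invariance of x_i η and vanishing on η.
dem-anti : ∀ η → (∀ x y → η x y ≡ - η y x) → ∀ a b → dem η a b ≡ + 0
dem-anti η h a b = half (dem η a b) (trans (dem-ext h a b) (trans (dem-neg (λ x y → η y x) a b) (cong -_ (dem-reflect η a b))))

dem-anti-sc : ∀ η → (∀ x y → η x y ≡ - η y x) → ∀ a b → dem (λ x y → η (sc x) y) a b ≡ η (sc a) b
dem-anti-sc η h a b = ℤP.i-j≡0⇒i≡j _ _ (half _ (flip (dem (λ x y → η (sc x) y) a b) (η (sc a) b) both))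
  where
  open ≡-Reasoning
  flip : ∀ u v → u + u ≡ v + v → u - v ≡ - (u - v)
  flip u v e = trans (lem u v) (trans (cong (λ z → z - (u + v)) e) (lem' u v))
    where
    lem : ∀ u v → u - v ≡ (u + u) - (u + v)
    lem = solve-∀
    lem' : ∀ u v → (v + v) - (u + v) ≡ - (u - v)
    lem' = solve-∀
  D = dem (λ x y → η (sc x) y) a b
  D≡ : dem (λ x y → η x (sc y)) a b ≡ - D
  D≡ = trans (dem-ext (λ x y → h x (sc y)) a b)
       (trans (dem-neg (λ x y → η (sc y) x) a b) (cong -_ (dem-reflect (λ x y → η (sc x) y) a b)))
  -- Telescoping gives `dem` of the difference η(x + 1, y) - η(x, y + 1); antisymmetry makes each of
  -- its two halves equal to `D`, so only 2 remains to be cancelled.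
  both : D + D ≡ η (sc a) b + η (sc a) b
  both = begin
    D + D                                   ≡⟨ addˡ D (sym (ℤP.neg-involutive D)) ⟩
    D - - D                                 ≡⟨ subˡ D (sym D≡) ⟩
    D - dem (λ x y → η x (sc y)) a b        ≡⟨ sym (dem-- (λ x y → η (sc x) y) (λ x y → η x (sc y)) a b) ⟩
    dem (λ x y → η (sc x) y - η x (sc y)) a b ≡⟨ dem-tele η (λ x y → refl) a b ⟩
    η (sc a) b - η b (sc a)                 ≡⟨ subˡ (η (sc a) b) (h b (sc a)) ⟩
    η (sc a) b - - η (sc a) b               ≡⟨ addˡ (η (sc a) b) (ℤP.neg-involutive (η (sc a) b)) ⟩
    η (sc a) b + η (sc a) b ∎

-- With a primitive in x, y the inner operator becomes a difference of two values, and the outer one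
-- passes through it by linearity.
dem-fubini : ∀ (ψ : ℤ → ℤ → Fn²) a b c d →
  dem (λ u v → dem (λ x y → ψ x y u v) a b) c d ≡ dem (λ x y → dem (ψ x y) c d) a b
dem-fubini ψ a b c d = begin
  dem (λ u v → dem (λ x y → ψ x y u v) a b) c d
    ≡⟨ dem-ext (λ u v → dem-tele (λ x y → χ x y u v) (spec u v) a b) c d ⟩
  dem (λ u v → χ (sc a) b u v - χ b (sc a) u v) c d
    ≡⟨ dem-- (χ (sc a) b) (χ b (sc a)) c d ⟩
  dem (χ (sc a) b) c d - dem (χ b (sc a)) c d
    ≡⟨ sym (dem-tele (λ x y → dem (χ x y) c d)
         (λ x y → trans (dem-ext (λ u v → spec u v x y) c d) (dem-- (χ (sc x) y) (χ x (sc y)) c d)) a b) ⟩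
  dem (λ x y → dem (ψ x y) c d) a b ∎
  where
  open ≡-Reasoning
  χ : ℤ → ℤ → Fn²
  χ x y u v = primitive² (λ x y → ψ x y u v) x y
  spec : ∀ u v x y → ψ x y u v ≡ χ (sc x) y u v - χ x (sc y) u v
  spec u v = primitive²-spec (λ x y → ψ x y u v)

Fn³ : Set
Fn³ = ℤ → ℤ → ℤ → ℤ

dem₁₂ dem₂₃ : Fn³ → Fn³
dem₁₂ φ a b c = dem (λ x y → φ x y c) a b
dem₂₃ φ a b c = dem (φ a) b c

-- Both sides of the braid relation, evaluated on functions of the form
-- (x₁-x₂)(x₁-x₃)(x₂-x₃)·ψ, give the alternating sum of ψ over S₃.
module _ (φ ψ : Fn³) where
  private
    ρ ρ' ψ₁ ψ₂ ω ω' η η' ζ κ κ' : Fn³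
    ρ a b c = (ψ (sc a) (sc b) c - ψ (sc a) b (sc c)) - (ψ a (sc b) (sc c) - ψ a b (sc (sc c)))
    ψ₁ a b c = ψ a b c - ψ b a c
    ω a b c = ψ₁ (sc (sc a)) b c - ψ₁ (sc a) b (sc c)
    η a b c = ψ₁ (sc a) (sc b) c
    κ a b c = ψ₁ (sc a) c (sc b)
    ρ' a b c = (ψ (sc (sc a)) b c - ψ (sc a) b (sc c)) - (ψ (sc a) (sc b) c - ψ a (sc b) (sc c))
    ψ₂ a b c = ψ a b c - ψ a c b
    ω' a b c = ψ₂ (sc a) (sc b) c - ψ₂ a (sc b) (sc c)
    η' a b c = ψ₂ (sc (sc a)) b c
    ζ a b c = ψ₂ (sc a) (sc b) (sc c)
    κ' a b c = ψ₂ b (sc (sc a)) c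

    anti : ∀ u v → u - v ≡ - (v - u)
    anti = solve-∀

    drop-mid : ∀ u v w → u - v - w ≡ u - w - v
    drop-mid = solve-∀

  module _ (h : ∀ a b c → φ a b c ≡ ρ (sc a) b c - ρ a (sc b) c) where
    private
      step₁ : ∀ a b c → dem₁₂ φ a b c ≡ ω a (sc b) c - ω a b (sc c)
      step₁ a b c = trans (dem-tele (λ x y → ρ x y c) (λ x y → h x y c) a b)
        (lem (ψ (sc (sc a)) (sc b) c) (ψ (sc (sc a)) b (sc c)) (ψ (sc a) (sc b) (sc c)) (ψ (sc a) b (sc (sc c)))
             (ψ (sc b) (sc (sc a)) c) (ψ (sc b) (sc a) (sc c)) (ψ b (sc (sc a)) (sc c)) (ψ b (sc a) (sc (sc c))))
        where
        lem : ∀ p q r s t u v w → ((p - q) - (r - s)) - ((t - u) - (v - w)) ≡ ((p - t) - (r - u)) - ((q - v) - (s - w))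
        lem = solve-∀

    braid-left : ∀ a b c → dem₁₂ (dem₂₃ (dem₁₂ φ)) a b c ≡ η (sc a) b c - (κ (sc a) b c - κ b (sc a) c)
    braid-left a b c = begin
      dem₁₂ (dem₂₃ (dem₁₂ φ)) a b c
        ≡⟨ dem-ext (λ x y → trans (dem-ext (λ y z → step₁ x y z) y c) (dem-tele (ω x) (λ y z → refl) y c)) a b ⟩
      dem (λ x y → (η (sc x) y c - η x y (sc c)) - (κ (sc x) y c - κ x (sc y) c)) a b
        ≡⟨ dem-- (λ x y → η (sc x) y c - η x y (sc c)) (λ x y → κ (sc x) y c - κ x (sc y) c) a b ⟩
      dem (λ x y → η (sc x) y c - η x y (sc c)) a b - dem (λ x y → κ (sc x) y c - κ x (sc y) c) a b
        ≡⟨ cong₂ _-_ (dem-- (λ x y → η (sc x) y c) (λ x y → η x y (sc c)) a b) (dem-tele (λ x y → κ x y c) (λ x y → refl) a b) ⟩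
      (dem (λ x y → η (sc x) y c) a b - dem (λ x y → η x y (sc c)) a b) - (κ (sc a) b c - κ b (sc a) c)
        ≡⟨ cong (λ z → z - (κ (sc a) b c - κ b (sc a) c))
             (trans (cong₂ _-_ (dem-anti-sc (λ x y → η x y c) (λ x y → anti (ψ (sc x) (sc y) c) (ψ (sc y) (sc x) c)) a b)
                               (dem-anti (λ x y → η x y (sc c)) (λ x y → anti (ψ (sc x) (sc y) (sc c)) (ψ (sc y) (sc x) (sc c))) a b))
                    (ℤP.+-identityʳ (η (sc a) b c))) ⟩
      η (sc a) b c - (κ (sc a) b c - κ b (sc a) c) ∎
      where open ≡-Reasoning

    private
      -- The same threefold difference of ψ, regrouped with the factor of positions 2 and 3
      -- outermost, so that `dem₂₃` telescopes first.
      h' : ∀ a b c → φ a b c ≡ ρ' a (sc b) c - ρ' a b (sc c)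
      h' a b c = trans (h a b c)
        (lem (ψ (sc (sc a)) (sc b) c) (ψ (sc (sc a)) b (sc c)) (ψ (sc a) (sc b) (sc c)) (ψ (sc a) b (sc (sc c)))
             (ψ (sc a) (sc (sc b)) c) (ψ a (sc (sc b)) (sc c)) (ψ a (sc b) (sc (sc c))))
        where
        lem : ∀ p q r s t u v → ((p - q) - (r - s)) - ((t - r) - (u - v)) ≡ ((p - r) - (t - u)) - ((q - s) - (r - v))
        lem = solve-∀

      step₁' : ∀ a b c → dem₂₃ φ a b c ≡ ω' (sc a) b c - ω' a (sc b) c
      step₁' a b c = trans (dem-tele (ρ' a) (λ y z → h' a y z) b c)
        (lem (ψ (sc (sc a)) (sc b) c) (ψ (sc a) (sc b) (sc c)) (ψ (sc a) (sc (sc b)) c) (ψ a (sc (sc b)) (sc c))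
             (ψ (sc (sc a)) c (sc b)) (ψ (sc a) c (sc (sc b))) (ψ (sc a) (sc c) (sc b)) (ψ a (sc c) (sc (sc b))))
        where
        lem : ∀ p q r s t u v w → ((p - q) - (r - s)) - ((t - u) - (v - w)) ≡ ((p - t) - (q - v)) - ((r - u) - (s - w))
        lem = solve-∀

    braid-right : ∀ a b c → dem₂₃ (dem₁₂ (dem₂₃ φ)) a b c ≡ η' a (sc b) c - (κ' a (sc b) c - κ' a c (sc b))
    braid-right a b c = begin
      dem₂₃ (dem₁₂ (dem₂₃ φ)) a b c
        ≡⟨ dem-ext (λ y z → trans (dem-ext (λ x y → step₁' x y z) a y) (dem-tele (λ x y → ω' x y z) (λ x y → refl) a y)) b c ⟩
      dem (λ y z → (η' a (sc y) z - ζ a y z) - (κ' a (sc y) z - κ' a y (sc z))) b c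
        ≡⟨ dem-- (λ y z → η' a (sc y) z - ζ a y z) (λ y z → κ' a (sc y) z - κ' a y (sc z)) b c ⟩
      dem (λ y z → η' a (sc y) z - ζ a y z) b c - dem (λ y z → κ' a (sc y) z - κ' a y (sc z)) b c
        ≡⟨ cong₂ _-_ (dem-- (λ y z → η' a (sc y) z) (ζ a) b c) (dem-tele (κ' a) (λ y z → refl) b c) ⟩
      (dem (λ y z → η' a (sc y) z) b c - dem (ζ a) b c) - (κ' a (sc b) c - κ' a c (sc b))
        ≡⟨ cong (λ z → z - (κ' a (sc b) c - κ' a c (sc b)))
             (trans (cong₂ _-_ (dem-anti-sc (η' a) (λ y z → anti (ψ (sc (sc a)) y z) (ψ (sc (sc a)) z y)) b c)
                               (dem-anti (ζ a) (λ y z → anti (ψ (sc a) (sc y) (sc z)) (ψ (sc a) (sc z) (sc y))) b c))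
                    (ℤP.+-identityʳ (η' a (sc b) c))) ⟩
      η' a (sc b) c - (κ' a (sc b) c - κ' a c (sc b)) ∎
      where open ≡-Reasoning

    braid-both : ∀ a b c → dem₁₂ (dem₂₃ (dem₁₂ φ)) a b c ≡ dem₂₃ (dem₁₂ (dem₂₃ φ)) a b c
    braid-both a b c = trans (braid-left a b c) (trans
      (lem (ψ (sc (sc a)) (sc b) c) (ψ (sc b) (sc (sc a)) c) (ψ (sc (sc a)) c (sc b))
           (ψ c (sc (sc a)) (sc b)) (ψ (sc b) c (sc (sc a))) (ψ c (sc b) (sc (sc a))))
      (sym (braid-right a b c)))
      where
      lem : ∀ p q r s t u → (p - q) - ((r - s) - (t - u)) ≡ (p - r) - ((q - t) - (s - u))
      lem = solve-∀

-- Three successive primitives, for the pairs of positions (1,2), (1,3) and (2,3), put an arbitrary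
-- function into the form that `braid-both` requires.
dem-braid : ∀ φ a b c → dem₁₂ (dem₂₃ (dem₁₂ φ)) a b c ≡ dem₂₃ (dem₁₂ (dem₂₃ φ)) a b c
dem-braid φ = braid-both φ ψ λ a b c → trans (primitive²-spec (λ x y → φ x y c) a b) (cong₂ _-_ (fac (sc a) b c) (fac a (sc b) c))
  where
  σ ρ ψ : Fn³
  ρ a b c = primitive² (λ x y → φ x y c) a b
  σ a b c = primitive² (λ x z → ρ x b z) a c
  ψ a b c = primitive² (λ y z → σ a y z) b c
  fac : ∀ a b c → ρ a b c ≡ (ψ (sc a) (sc b) c - ψ (sc a) b (sc c)) - (ψ a (sc b) (sc c) - ψ a b (sc (sc c)))
  fac a b c = trans (primitive²-spec (λ x z → ρ x b z) a c)
    (cong₂ _-_ (primitive²-spec (σ (sc a)) b c) (primitive²-spec (σ a) b (sc c)))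

-- The transpose of π_i on functions of n exponents.
Π : ∀ {n} → ℕ → Fn n → Fn n
Π zero φ (a ∷ b ∷ e) = dem (λ x y → φ (x ∷ y ∷ e)) a b
Π zero φ e = φ e
Π (suc i) φ [] = φ []
Π (suc i) φ (x ∷ e) = Π i (λ e → φ (x ∷ e)) e

Π-ext : ∀ {n} i {φ ψ : Fn n} → (∀ e → φ e ≡ ψ e) → ∀ e → Π i φ e ≡ Π i ψ e
Π-ext zero h [] = h _
Π-ext zero h (a ∷ []) = h _
Π-ext zero h (a ∷ b ∷ e) = dem-ext (λ x y → h (x ∷ y ∷ e)) a b
Π-ext (suc i) h [] = h _
Π-ext (suc i) h (x ∷ e) = Π-ext i (λ e → h (x ∷ e)) e

Π-- : ∀ {n} i (φ ψ : Fn n) e → Π i (λ e → φ e - ψ e) e ≡ Π i φ e - Π i ψ e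
Π-- zero φ ψ [] = refl
Π-- zero φ ψ (a ∷ []) = refl
Π-- zero φ ψ (a ∷ b ∷ e) = dem-- (λ x y → φ (x ∷ y ∷ e)) (λ x y → ψ (x ∷ y ∷ e)) a b
Π-- (suc i) φ ψ [] = refl
Π-- (suc i) φ ψ (x ∷ e) = Π-- i (λ e → φ (x ∷ e)) (λ e → ψ (x ∷ e)) e

Π-+ : ∀ {n} i (φ ψ : Fn n) e → Π i (λ e → φ e + ψ e) e ≡ Π i φ e + Π i ψ e
Π-+ zero φ ψ [] = refl
Π-+ zero φ ψ (a ∷ []) = refl
Π-+ zero φ ψ (a ∷ b ∷ e) = dem-+ (λ x y → φ (x ∷ y ∷ e)) (λ x y → ψ (x ∷ y ∷ e)) a b
Π-+ (suc i) φ ψ [] = refl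
Π-+ (suc i) φ ψ (x ∷ e) = Π-+ i (λ e → φ (x ∷ e)) (λ e → ψ (x ∷ e)) e

Π-idem : ∀ {n} i (φ : Fn n) e → Π i (Π i φ) e ≡ Π i φ e
Π-idem zero φ [] = refl
Π-idem zero φ (a ∷ []) = refl
Π-idem zero φ (a ∷ b ∷ e) = dem-idem (λ x y → φ (x ∷ y ∷ e)) a b
Π-idem (suc i) φ [] = refl
Π-idem (suc i) φ (x ∷ e) = Π-idem i (λ e → φ (x ∷ e)) e

Π-dem : ∀ {n} j (ψ : ℤ → ℤ → Fn n) a b e →
  Π j (λ e → dem (λ x y → ψ x y e) a b) e ≡ dem (λ x y → Π j (ψ x y) e) a b
Π-dem zero ψ a b [] = refl
Π-dem zero ψ a b (u ∷ []) = refl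
Π-dem zero ψ a b (u ∷ v ∷ e) = dem-fubini (λ x y u v → ψ x y (u ∷ v ∷ e)) a b u v
Π-dem (suc j) ψ a b [] = refl
Π-dem (suc j) ψ a b (u ∷ e) = Π-dem j (λ x y e → ψ x y (u ∷ e)) a b e

Π-comm : ∀ {n} i t (φ : Fn n) e → Π i (Π (suc (suc (i ℕ.+ t))) φ) e ≡ Π (suc (suc (i ℕ.+ t))) (Π i φ) e
Π-comm zero t φ [] = refl
Π-comm zero t φ (a ∷ []) = refl
Π-comm zero t φ (a ∷ b ∷ e) = sym (Π-dem t (λ x y e → φ (x ∷ y ∷ e)) a b e)
Π-comm (suc i) t φ [] = refl
Π-comm (suc i) t φ (x ∷ e) = Π-comm i t (λ e → φ (x ∷ e)) e

Π-braid : ∀ {n} i (φ : Fn n) e → Π i (Π (suc i) (Π i φ)) e ≡ Π (suc i) (Π i (Π (suc i) φ)) e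
Π-braid zero φ [] = refl
Π-braid zero φ (a ∷ []) = refl
-- On two positions the second letter is out of range and acts as the identity, so the braid
-- relation degenerates to idempotence.
Π-braid zero φ (a ∷ b ∷ []) = dem-idem (λ x y → φ (x ∷ y ∷ [])) a b
Π-braid zero φ (a ∷ b ∷ c ∷ e) = dem-braid (λ x y z → φ (x ∷ y ∷ z ∷ e)) a b c
Π-braid (suc i) φ [] = refl
Π-braid (suc i) φ (x ∷ e) = Π-braid i (λ e → φ (x ∷ e)) e

-- The operators π_i on polynomials and their relations

range-pair : ∀ {n} c d (S : ℤ → Vec ℤ n) (φ : ℤ → Fn n) (g : ℕ → ℤ) → (∀ t → g (suc t) ≡ sc (g t)) → ∀ M →
  ⟪ map (λ k → (c , d , S k)) (applyUpTo g M) , φ ⟫ ≡ c * (∫ (λ k → φ d (S k)) (g M) - ∫ (λ k → φ d (S k)) (g 0))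
range-pair c d S φ g h zero = sym (trans (cong (c *_) (ℤP.+-inverseʳ (∫ (λ k → φ d (S k)) (g 0)))) (ℤP.*-zeroʳ c))
range-pair c d S φ g h (suc M) = trans
  (addˡ (c * F (g 0)) (range-pair c d S φ (g ∘ suc) (h ∘ suc) M))
  (trans (addˡ (c * F (g 0)) (cong (λ z → c * (∫ F (g (suc M)) - z)) (trans (cong (∫ F) (h 0)) (∫-sc F (g 0)))))
    (lem c (F (g 0)) (∫ F (g (suc M))) (∫ F (g 0))))
  where
  F : ℤ → ℤ
  F k = φ d (S k)
  lem : ∀ c x y z → c * x + c * (y - (z + x)) ≡ c * (y - z)
  lem = solve-∀

sc-+ : ∀ lo t → lo + + suc t ≡ sc (lo + + t)
sc-+ lo t = lem lo (+ t)
  where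
  lem : ∀ x y → x + (+ 1 + y) ≡ + 1 + (x + y)
  lem = solve-∀

range-end : ∀ {lo hi} → lo ℤ.≤ hi → lo + + suc ∣ hi - lo ∣ ≡ sc hi
range-end {lo} {hi} h = trans (sc-+ lo ∣ hi - lo ∣)
  (trans (cong (λ z → sc (lo + z)) (ℤP.0≤i⇒+∣i∣≡i (ℤP.i≤j⇒0≤j-i h))) (cong sc (lem lo hi)))
  where
  lem : ∀ x y → x + (y - x) ≡ y
  lem = solve-∀

range-pair-≤ : ∀ {n} c d (S : ℤ → Vec ℤ n) (φ : ℤ → Fn n) {lo hi} → lo ℤ.≤ hi →
  ⟪ map (λ k → (c , d , S k)) (applyUpTo (λ t → lo + + t) (suc ∣ hi - lo ∣)) , φ ⟫ ≡
  c * (∫ (λ k → φ d (S k)) (sc hi) - ∫ (λ k → φ d (S k)) lo)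
range-pair-≤ c d S φ {lo} {hi} h = trans (range-pair c d S φ (λ t → lo + + t) (sc-+ lo) (suc ∣ hi - lo ∣))
  (cong₂ (λ u v → c * (∫ F u - ∫ F v)) (range-end h) (ℤP.+-identityʳ lo))
  where
  F : ℤ → ℤ
  F k = φ d (S k)

+1≡sc : ∀ a → a + + 1 ≡ sc a
+1≡sc a = ℤP.+-comm a (+ 1)

sc-pred : ∀ b → sc (b - + 1) ≡ b
sc-pred = lem
  where
  lem : ∀ b → + 1 + (b - + 1) ≡ b
  lem = solve-∀

-- One signed integral from b to a + 1 covers all cases of the definition: for b ≥ a + 2 its
-- reversed ends supply the minus sign of the second branch, and for b = a + 1, where both ranges
-- are empty, its ends coincide.
pair-piTerm₀ : ∀ {n} c d a b (e : Vec ℤ n) φ → ⟪ piTerm 0 (c , d , a ∷ b ∷ e) , φ ⟫ ≡ c * Π 0 (φ d) (a ∷ b ∷ e)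
pair-piTerm₀ c d a b e φ with b ℤ.≤? a
... | yes p = range-pair-≤ c d (λ k → k ∷ (a + b - k) ∷ e) φ p
... | no ¬p with (a + + 1) ℤ.≤? (b - + 1)
...   | yes q = trans (range-pair-≤ (- c) d (λ k → k ∷ (a + b - k) ∷ e) φ q)
          (trans (cong₂ (λ u v → - c * (∫ F u - ∫ F v)) (sc-pred b) (+1≡sc a)) (lem c (∫ F b) (∫ F (sc a))))
  where
  F : ℤ → ℤ
  F k = φ d (k ∷ (a + b - k) ∷ e)
  lem : ∀ c x y → - c * (x - y) ≡ c * (y - x)
  lem = solve-∀
...   | no ¬q = sym (trans (cong (λ z → c * (∫ F z - ∫ F b)) sca≡b)
          (trans (cong (c *_) (ℤP.+-inverseʳ (∫ F b))) (ℤP.*-zeroʳ c)))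
  where
  F : ℤ → ℤ
  F k = φ d (k ∷ (a + b - k) ∷ e)
  sca≤b : sc a ℤ.≤ b
  sca≤b = ℤP.i<j⇒suc[i]≤j (ℤP.≰⇒> ¬p)
  b≤sca : b ℤ.≤ sc a
  b≤sca = subst (ℤ._≤ sc a) (sc-pred b) (ℤP.i<j⇒suc[i]≤j (subst (b - + 1 ℤ.<_) (+1≡sc a) (ℤP.≰⇒> ¬q)))
  sca≡b : sc a ≡ b
  sca≡b = ℤP.≤-antisym sca≤b b≤sca

pair-map-∷ : ∀ {n} x c d (S : ℤ → Vec ℤ n) (φ : ℤ → Fn (suc n)) l →
  ⟪ map (λ k → (c , d , x ∷ S k)) l , φ ⟫ ≡ ⟪ map (λ k → (c , d , S k)) l , (λ d e → φ d (x ∷ e)) ⟫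
pair-map-∷ x c d S φ [] = refl
pair-map-∷ x c d S φ (k ∷ l) = addˡ (c * φ d (x ∷ S k)) (pair-map-∷ x c d S φ l)

pair-piTerm : ∀ {n} i → suc i ℕ.< n → ∀ c d (e : Vec ℤ n) φ → ⟪ piTerm i (c , d , e) , φ ⟫ ≡ c * Π i (φ d) e
pair-piTerm zero v c d (a ∷ b ∷ e) φ = pair-piTerm₀ c d a b e φ
pair-piTerm zero (s≤s ()) c d (a ∷ []) φ
pair-piTerm (suc i) (s≤s v) c d (x ∷ e) φ = trans shift (pair-piTerm i v c d e (λ d e → φ d (x ∷ e)))
  where
  a = getAt i e
  b = getAt (suc i) e
  shift : ⟪ piTerm (suc i) (c , d , x ∷ e) , φ ⟫ ≡ ⟪ piTerm i (c , d , e) , (λ d e → φ d (x ∷ e)) ⟫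
  shift with b ℤ.≤? a
  ... | yes p = pair-map-∷ x c d (λ k → setPair i k (a + b - k) e) φ (applyUpTo (λ t → b + + t) (suc ∣ a - b ∣))
  ... | no p = pair-map-∷ x (- c) d (λ k → setPair i k (a + b - k) e) φ (intRange (a + + 1) (b - + 1))

pair-piOp : ∀ {n} i → suc i ℕ.< n → ∀ (f : Poly n) φ → ⟪ piOp i f , φ ⟫ ≡ ⟪ f , (λ d → Π i (φ d)) ⟫
pair-piOp i v f φ = pair-concatMap (piTerm i) (λ φ d → Π i (φ d)) φ (λ c d e → pair-piTerm i v c d e φ) f

piOp-cong : ∀ {n} i → suc i ℕ.< n → {f g : Poly n} → f ≋ g → piOp i f ≋ piOp i g
piOp-cong i v {f} {g} p = eqP λ φ → trans (pair-piOp i v f φ) (trans (pair p _) (sym (pair-piOp i v g φ)))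

pair-piOp² : ∀ {n} i j → suc i ℕ.< n → suc j ℕ.< n → ∀ (f : Poly n) φ →
  ⟪ piOp i (piOp j f) , φ ⟫ ≡ ⟪ f , (λ d → Π j (Π i (φ d))) ⟫
pair-piOp² i j v v' f φ = trans (pair-piOp i v (piOp j f) φ) (pair-piOp j v' f _)

piOp-idem : ∀ {n} i → suc i ℕ.< n → (f : Poly n) → piOp i (piOp i f) ≋ piOp i f
piOp-idem i v f = eqP λ φ → trans (pair-piOp² i i v v f φ)
  (trans (pair-ext f (λ d → Π-idem i (φ d))) (sym (pair-piOp i v f φ)))

far : ∀ {i j} → suc (suc i) ℕ.≤ j → ∃ λ t → j ≡ suc (suc (i ℕ.+ t))
far {i} h with ℕP.m≤n⇒∃[o]m+o≡n h
... | t , eq = t , sym eq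

piOp-comm : ∀ {n} i j → suc (suc i) ℕ.≤ j → suc j ℕ.< n → (f : Poly n) → piOp i (piOp j f) ≋ piOp j (piOp i f)
piOp-comm {n} i j h v f with far h
... | t , refl = eqP λ φ → trans (pair-piOp² i j v' v f φ)
    (trans (pair-ext f (λ d e → sym (Π-comm i t (φ d) e))) (sym (pair-piOp² j i v v' f φ)))
  where
  v' : suc i ℕ.< n
  v' = ℕP.≤-trans (s≤s (ℕP.≤-trans (ℕP.n≤1+n _) h)) (ℕP.<⇒≤ v)

piOp-braid : ∀ {n} i → suc (suc i) ℕ.< n → (f : Poly n) →
  piOp i (piOp (suc i) (piOp i f)) ≋ piOp (suc i) (piOp i (piOp (suc i) f))
piOp-braid {n} i v f = eqP λ φ → trans (trans (pair-piOp i v' (piOp (suc i) (piOp i f)) φ) (pair-piOp² (suc i) i v v' f _))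
  (trans (pair-ext f (λ d → Π-braid i (φ d))) (sym (trans (pair-piOp (suc i) v (piOp i (piOp (suc i) f)) φ) (pair-piOp² i (suc i) v' v f _))))
  where
  v' : suc i ℕ.< n
  v' = ℕP.<⇒≤ v

-- The affine rotation ρ = x₁Φ

ρ : ∀ {k} → Poly (suc k) → Poly (suc k)
ρ f = x₁· (Φ f)

ρ* : ∀ {k} → (ℤ → Fn (suc k)) → ℤ → Fn (suc k)
ρ* φ d e = φ (d + last e) ((last e + + 1) ∷ init e)

pair-ρ : ∀ {k} (f : Poly (suc k)) φ → ⟪ ρ f , φ ⟫ ≡ ⟪ f , ρ* φ ⟫
pair-ρ [] φ = refl
pair-ρ ((c , d , e) ∷ f) φ = addˡ (c * ρ* φ d e) (pair-ρ f φ)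

ρ-cong : ∀ {k} {f g : Poly (suc k)} → f ≋ g → ρ f ≋ ρ g
ρ-cong {f = f} {g} p = eqP λ φ → trans (pair-ρ f φ) (trans (pair p _) (sym (pair-ρ g φ)))

ρ*-∷ʳ : ∀ {k} (φ : ℤ → Fn (suc k)) d (e : Vec ℤ k) x → ρ* φ d (e ∷ʳ x) ≡ φ (d + x) ((x + + 1) ∷ e)
ρ*-∷ʳ φ d e x rewrite VecP.last-∷ʳ x e | VecP.init-∷ʳ x e = refl

Π-∷ʳ : ∀ {n} i → suc i ℕ.< n → ∀ (φ : Fn (suc n)) (e : Vec ℤ n) x → Π i φ (e ∷ʳ x) ≡ Π i (λ e → φ (e ∷ʳ x)) e
Π-∷ʳ zero v φ (a ∷ b ∷ e) x = refl
Π-∷ʳ zero (s≤s ()) φ (a ∷ []) x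
Π-∷ʳ (suc i) (s≤s v) φ (a ∷ e) x = Π-∷ʳ i v (λ e → φ (a ∷ e)) e x

Π-last : ∀ {n} (φ : Fn (suc (suc n))) (e : Vec ℤ n) x y → Π n φ (e ∷ʳ x ∷ʳ y) ≡ dem (λ x y → φ (e ∷ʳ x ∷ʳ y)) x y
Π-last φ [] x y = refl
Π-last φ (a ∷ e) x y = Π-last (λ e → φ (a ∷ e)) e x y

snoc-elim : ∀ {n} (P : Vec ℤ (suc n) → Set) → (∀ e x → P (e ∷ʳ x)) → ∀ e → P e
snoc-elim P h e with Vec.initLast e
... | e' , x , refl = h e' x

ρ-piOp : ∀ {k} i → suc (suc i) ℕ.< suc k → (f : Poly (suc k)) → ρ (piOp i f) ≋ piOp (suc i) (ρ f)
ρ-piOp {k} i v@(s≤s v') f = eqP λ φ → trans (trans (pair-ρ (piOp i f) φ) (pair-piOp i (ℕP.<⇒≤ v) f _))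
  (trans (pair-ext f (λ d → snoc-elim _ (dual φ d))) (sym (trans (pair-piOp (suc i) v (ρ f) φ) (pair-ρ f _))))
  where
  dual : ∀ (φ : ℤ → Fn (suc k)) d e x → Π i (ρ* φ d) (e ∷ʳ x) ≡ ρ* (λ d → Π (suc i) (φ d)) d (e ∷ʳ x)
  dual φ d e x = trans (Π-∷ʳ i v' (ρ* φ d) e x)
    (trans (Π-ext i (λ e → ρ*-∷ʳ φ d e x) e) (sym (ρ*-∷ʳ (λ d → Π (suc i) (φ d)) d e x)))

dem-ext-line : ∀ {φ ψ : Fn²} a b → (∀ k → φ k (a + b - k) ≡ ψ k (a + b - k)) → dem φ a b ≡ dem ψ a b
dem-ext-line a b h = cong₂ _-_ (∫-ext h (sc a)) (∫-ext h b)

dem-shift : ∀ φ a b → dem (λ x y → φ (sc x) (sc y)) a b ≡ dem φ (sc a) (sc b)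
dem-shift φ a b = trans
  (dem-tele (λ x y → ψ (sc x) (sc y)) (λ x y → primitive²-spec φ (sc x) (sc y)) a b)
  (sym (dem-tele ψ (primitive²-spec φ) (sc a) (sc b)))
  where
  ψ = primitive² φ

-- Two rotations bring the last two exponents x, y to the front, each raised by 1, at the cost of
-- q^(x+y). As `dem` runs over pairs of constant sum, this power of q is constant along its line and
-- the operator is carried from the last two positions to the first two.
ρ²-piOp : ∀ {k} (f : Poly (suc (suc k))) → ρ (ρ (piOp k f)) ≋ piOp 0 (ρ (ρ f))
ρ²-piOp {k} f = eqP λ φ →
  trans (trans (pair-ρ (ρ (piOp k f)) φ) (trans (pair-ρ (piOp k f) _) (pair-piOp k (ℕP.n<1+n _) f _)))
  (trans (pair-ext f (λ d → snoc-elim _ (λ e y → snoc-elim (λ e → lhs φ d (e ∷ʳ y) ≡ rhs φ d (e ∷ʳ y)) (λ e x → dual φ d e x y) e)))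
  (sym (trans (pair-piOp 0 (s≤s (s≤s z≤n)) (ρ (ρ f)) φ) (trans (pair-ρ (ρ f) _) (pair-ρ f _)))))
  where
  lhs rhs : (ℤ → Fn (suc (suc k))) → ℤ → Fn (suc (suc k))
  lhs φ d = Π k (ρ* (ρ* φ) d)
  rhs φ = ρ* (ρ* (λ d → Π 0 (φ d)))

  twice : ∀ (φ : ℤ → Fn (suc (suc k))) d (e : Vec ℤ k) x y →
    ρ* (ρ* φ) d (e ∷ʳ x ∷ʳ y) ≡ φ (d + y + x) ((x + + 1) ∷ (y + + 1) ∷ e)
  twice φ d e x y = trans (ρ*-∷ʳ (ρ* φ) d (e ∷ʳ x) y) (ρ*-∷ʳ φ (d + y) ((y + + 1) ∷ e) x)

  assoc : ∀ d x y k → d + (x + y - k) + k ≡ d + y + x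
  assoc = solve-∀

  dual : ∀ φ d e x y → lhs φ d (e ∷ʳ x ∷ʳ y) ≡ rhs φ d (e ∷ʳ x ∷ʳ y)
  dual φ d e x y = begin
    Π k (ρ* (ρ* φ) d) (e ∷ʳ x ∷ʳ y)
      ≡⟨ Π-last (ρ* (ρ* φ) d) e x y ⟩
    dem (λ x y → ρ* (ρ* φ) d (e ∷ʳ x ∷ʳ y)) x y
      ≡⟨ dem-ext (twice φ d e) x y ⟩
    dem (λ x y → φ (d + y + x) ((x + + 1) ∷ (y + + 1) ∷ e)) x y
      ≡⟨ dem-ext-line {λ x y → φ (d + y + x) ((x + + 1) ∷ (y + + 1) ∷ e)} {λ u v → φ (d + y + x) (sc u ∷ sc v ∷ e)} x y (λ k → cong₂ φ (assoc d x y k)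
           (cong₂ (λ u v → u ∷ v ∷ e) (+1≡sc k) (+1≡sc (x + y - k)))) ⟩
    dem (λ u v → φ (d + y + x) (sc u ∷ sc v ∷ e)) x y
      ≡⟨ dem-shift (λ u v → φ (d + y + x) (u ∷ v ∷ e)) x y ⟩
    dem (λ u v → φ (d + y + x) (u ∷ v ∷ e)) (sc x) (sc y)
      ≡⟨ cong₂ (dem (λ u v → φ (d + y + x) (u ∷ v ∷ e))) (sym (+1≡sc x)) (sym (+1≡sc y)) ⟩
    dem (λ u v → φ (d + y + x) (u ∷ v ∷ e)) (x + + 1) (y + + 1)
      ≡⟨ sym (twice (λ d → Π 0 (φ d)) d e x y) ⟩
    rhs φ d (e ∷ʳ x ∷ʳ y) ∎
    where open ≡-Reasoning

-- Positions of a vector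

module _ {n : ℕ} where
  infix 4 _⊏_
  _⊏_ : ℕ → Vec ℤ n → Set
  i ⊏ v = getAt i v ℤ.< getAt (suc i) v

get-swap₀ : ∀ {n} i → suc i ℕ.< n → (v : Vec ℤ n) → getAt i (swapAt i v) ≡ getAt (suc i) v
get-swap₀ zero h (a ∷ b ∷ v) = refl
get-swap₀ zero (s≤s ()) (a ∷ [])
get-swap₀ (suc i) (s≤s h) (x ∷ v) = get-swap₀ i h v

get-swap₁ : ∀ {n} i → suc i ℕ.< n → (v : Vec ℤ n) → getAt (suc i) (swapAt i v) ≡ getAt i v
get-swap₁ zero h (a ∷ b ∷ v) = refl
get-swap₁ zero (s≤s ()) (a ∷ [])
get-swap₁ (suc i) (s≤s h) (x ∷ v) = get-swap₁ i h v

get-swap-> : ∀ {n} i j → suc i ℕ.< j → (v : Vec ℤ n) → getAt j (swapAt i v) ≡ getAt j v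
get-swap-> zero (suc (suc j)) h [] = refl
get-swap-> zero (suc (suc j)) h (a ∷ []) = refl
get-swap-> zero (suc (suc j)) h (a ∷ b ∷ v) = refl
get-swap-> zero (suc zero) (s≤s ()) v
get-swap-> (suc i) (suc j) h [] = refl
get-swap-> (suc i) (suc j) (s≤s h) (x ∷ v) = get-swap-> i j h v

get-swap-< : ∀ {n} i j → j ℕ.< i → (v : Vec ℤ n) → getAt j (swapAt i v) ≡ getAt j v
get-swap-< (suc i) j h [] = refl
get-swap-< (suc i) zero h (x ∷ v) = refl
get-swap-< (suc i) (suc j) (s≤s h) (x ∷ v) = get-swap-< i j h v

swap-invol : ∀ {n} i (v : Vec ℤ n) → swapAt i (swapAt i v) ≡ v
swap-invol zero [] = refl
swap-invol zero (a ∷ []) = refl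
swap-invol zero (a ∷ b ∷ v) = refl
swap-invol (suc i) [] = refl
swap-invol (suc i) (x ∷ v) = cong (x ∷_) (swap-invol i v)

swap-comm : ∀ {n} i j → suc (suc i) ℕ.≤ j → (v : Vec ℤ n) → swapAt i (swapAt j v) ≡ swapAt j (swapAt i v)
swap-comm zero (suc (suc j)) h [] = refl
swap-comm zero (suc (suc j)) h (a ∷ []) = refl
swap-comm zero (suc (suc j)) h (a ∷ b ∷ v) = refl
swap-comm zero (suc zero) (s≤s ()) v
swap-comm (suc i) (suc j) h [] = refl
swap-comm (suc i) (suc j) (s≤s h) (x ∷ v) = cong (x ∷_) (swap-comm i j h v)

swap-braid : ∀ {n} i → suc (suc i) ℕ.< n → (v : Vec ℤ n) →
  swapAt i (swapAt (suc i) (swapAt i v)) ≡ swapAt (suc i) (swapAt i (swapAt (suc i) v))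
swap-braid zero h (a ∷ b ∷ c ∷ v) = refl
swap-braid zero (s≤s (s≤s ())) (a ∷ b ∷ [])
swap-braid zero (s≤s ()) (a ∷ [])
swap-braid (suc i) (s≤s h) (x ∷ v) = cong (x ∷_) (swap-braid i h v)

swap-eq : ∀ {n} i → suc i ℕ.< n → (v : Vec ℤ n) → getAt i v ≡ getAt (suc i) v → swapAt i v ≡ v
swap-eq zero h (a ∷ b ∷ v) refl = refl
swap-eq zero (s≤s ()) (a ∷ [])
swap-eq (suc i) (s≤s h) (x ∷ v) e = cong (x ∷_) (swap-eq i h v e)

hstep-swap : ∀ {n} i → suc i ℕ.< n → (v : Vec ℤ n) → getAt (suc i) v ℤ.≤ getAt i v → hstep i v ≡ swapAt i v
hstep-swap zero h (a ∷ b ∷ v) p rewrite dec-true (b ℤ.≤? a) p = refl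
hstep-swap zero (s≤s ()) (a ∷ [])
hstep-swap (suc i) (s≤s h) (x ∷ v) p = cong (x ∷_) (hstep-swap i h v p)

hstep-id : ∀ {n} i → suc i ℕ.< n → (v : Vec ℤ n) → i ⊏ v → hstep i v ≡ v
hstep-id zero h (a ∷ b ∷ v) p rewrite dec-false (b ℤ.≤? a) (ℤP.<⇒≱ p) = refl
hstep-id zero (s≤s ()) (a ∷ [])
hstep-id (suc i) (s≤s h) (x ∷ v) p = cong (x ∷_) (hstep-id i h v p)

hstep-unswap : ∀ {n} i → suc i ℕ.< n → (v : Vec ℤ n) → getAt i v ℤ.≤ getAt (suc i) v → hstep i (swapAt i v) ≡ v
hstep-unswap i h v p = trans
  (hstep-swap i h (swapAt i v) (subst₂ ℤ._≤_ (sym (get-swap₁ i h v)) (sym (get-swap₀ i h v)) p)) (swap-invol i v)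

ascent? : ∀ {n} (v : Vec ℤ n) → (∃ λ i → suc i ℕ.< n × i ⊏ v) ⊎ (∀ i → suc i ℕ.< n → getAt (suc i) v ℤ.≤ getAt i v)
ascent? [] = inj₂ λ i ()
ascent? (x ∷ []) = inj₂ λ { zero (s≤s ()) ; (suc i) (s≤s ()) }
ascent? (x ∷ y ∷ v) = cons (x ℤ.<? y) (ascent? (y ∷ v))
  where
  cons : Dec (x ℤ.< y) →
    (∃ λ i → suc i ℕ.< _ × i ⊏ (y ∷ v)) ⊎ (∀ i → suc i ℕ.< _ → getAt (suc i) (y ∷ v) ℤ.≤ getAt i (y ∷ v)) →
    (∃ λ i → suc i ℕ.< _ × i ⊏ (x ∷ y ∷ v)) ⊎ (∀ i → suc i ℕ.< _ → getAt (suc i) (x ∷ y ∷ v) ℤ.≤ getAt i (x ∷ y ∷ v))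
  cons (yes p) _ = inj₁ (0 , s≤s (s≤s z≤n) , p)
  cons (no p) (inj₁ (i , h , q)) = inj₁ (suc i , s≤s h , q)
  cons (no p) (inj₂ q) = inj₂ λ { zero h → ℤP.≮⇒≥ p ; (suc i) (s≤s h) → q i h }


count< : ∀ a (xs : List ℤ) → ℕ
count< a xs = length (filterᵇ (λ b → not (a ≤ℤ b)) xs)

bit : Bool → ℕ
bit b = if b then 0 else 1

count<-∷ : ∀ a x xs → count< a (x ∷ xs) ≡ bit (a ≤ℤ x) ℕ.+ count< a xs
count<-∷ a x xs with a ≤ℤ x
... | true = refl
... | false = refl

swap+ : ∀ x y z → x ℕ.+ (y ℕ.+ z) ≡ y ℕ.+ (x ℕ.+ z)
swap+ x y z = trans (sym (ℕP.+-assoc x y z)) (trans (cong (ℕ._+ z) (ℕP.+-comm x y)) (ℕP.+-assoc y x z))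

count<-swap : ∀ a {n} i (v : Vec ℤ n) → count< a (toList (swapAt i v)) ≡ count< a (toList v)
count<-swap a zero [] = refl
count<-swap a zero (x ∷ []) = refl
count<-swap a zero (x ∷ y ∷ v) rewrite count<-∷ a y (x ∷ toList v) | count<-∷ a x (toList v)
  | count<-∷ a x (y ∷ toList v) | count<-∷ a y (toList v) = swap+ (bit (a ≤ℤ y)) (bit (a ≤ℤ x)) _
count<-swap a (suc i) [] = refl
count<-swap a (suc i) (x ∷ v) rewrite count<-∷ a x (toList (swapAt i v)) | count<-∷ a x (toList v) =
  cong (bit (a ≤ℤ x) ℕ.+_) (count<-swap a i v)

inversions-swap : ∀ {n} i → suc i ℕ.< n → (v : Vec ℤ n) → i ⊏ v →
  inversions (toList (swapAt i v)) ≡ suc (inversions (toList v))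
inversions-swap zero h (a ∷ b ∷ v) p
  rewrite dec-false (b ℤ.≤? a) (ℤP.<⇒≱ p) | dec-true (a ℤ.≤? b) (ℤP.<⇒≤ p) = cong suc (swap+ (count< b (toList v)) (count< a (toList v)) (inversions (toList v)))
inversions-swap zero (s≤s ()) (a ∷ [])
inversions-swap (suc i) (s≤s h) (x ∷ v) p =
  trans (cong₂ ℕ._+_ (count<-swap x i v) (inversions-swap i h v p)) (ℕP.+-suc (count< x (toList v)) _)

inversions-swap-≤ : ∀ {n} i → suc i ℕ.< n → (v : Vec ℤ n) → getAt (suc i) v ℤ.≤ getAt i v →
  inversions (toList (swapAt i v)) ℕ.≤ inversions (toList v)
inversions-swap-≤ i h v p with getAt (suc i) v ℤ.≟ getAt i v
... | yes e = ℕP.≤-reflexive (cong (inversions ∘ toList) (swap-eq i h v (sym e)))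
... | no ne = ℕP.≤-trans (ℕP.n≤1+n _) (ℕP.≤-reflexive (sym (trans
      (cong (inversions ∘ toList) (sym (swap-invol i v)))
      (inversions-swap i h (swapAt i v) (subst₂ ℤ._<_ (sym (get-swap₀ i h v)) (sym (get-swap₁ i h v)) (ℤP.≤∧≢⇒< p ne))))))

get-map : ∀ {n} (f : ℤ → ℤ) i → i ℕ.< n → (v : Vec ℤ n) → getAt i (Vec.map f v) ≡ f (getAt i v)
get-map f zero h (x ∷ v) = refl
get-map f (suc i) (s≤s h) (x ∷ v) = get-map f i h v

swap-map : ∀ {n} (f : ℤ → ℤ) i (v : Vec ℤ n) → swapAt i (Vec.map f v) ≡ Vec.map f (swapAt i v)
swap-map f zero [] = refl
swap-map f zero (x ∷ []) = refl
swap-map f zero (x ∷ y ∷ v) = refl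
swap-map f (suc i) [] = refl
swap-map f (suc i) (x ∷ v) = cong (f x ∷_) (swap-map f i v)

-- The measure that decreases along backward steps

neg : ℤ → ℤ
neg x = - x

-- The number of pairs of positions in strictly increasing order; reusing `inversions` makes
-- `inversions-swap` available for it.
ascents : ∀ {n} → Vec ℤ n → ℕ
ascents v = inversions (toList (Vec.map neg v))

ascents-swap : ∀ {n} i → suc i ℕ.< n → (v : Vec ℤ n) → i ⊏ v → ascents (swapAt i v) ℕ.< ascents v
ascents-swap i h v p = ℕP.≤-reflexive (sym (trans
  (cong (inversions ∘ toList) (trans (cong (Vec.map neg) (sym (swap-invol i v))) (sym (swap-map neg i (swapAt i v)))))
  (inversions-swap i h (Vec.map neg (swapAt i v)) asc)))
  where
  asc : i ⊏ Vec.map neg (swapAt i v)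
  asc = subst₂ ℤ._<_ (sym (trans (get-map neg i (ℕP.<⇒≤ h) (swapAt i v)) (cong neg (get-swap₀ i h v))))
                     (sym (trans (get-map neg (suc i) h (swapAt i v)) (cong neg (get-swap₁ i h v))))
                     (ℤP.neg-mono-< p)

size : ∀ {n} → Vec ℤ n → ℕ
size [] = 0
size (x ∷ v) = ∣ x ∣ ℕ.+ size v

size-swap : ∀ {n} i (v : Vec ℤ n) → size (swapAt i v) ≡ size v
size-swap zero [] = refl
size-swap zero (x ∷ []) = refl
size-swap zero (x ∷ y ∷ v) = trans (sym (ℕP.+-assoc ∣ y ∣ _ _)) (trans (cong (ℕ._+ size v) (ℕP.+-comm ∣ y ∣ ∣ x ∣)) (ℕP.+-assoc ∣ x ∣ _ _))
size-swap (suc i) [] = refl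
size-swap (suc i) (x ∷ v) = cong (∣ x ∣ ℕ.+_) (size-swap i v)

size-∷ʳ : ∀ {n} (v : Vec ℤ n) x → size (v ∷ʳ x) ≡ ∣ x ∣ ℕ.+ size v
size-∷ʳ [] x = refl
size-∷ʳ (y ∷ v) x = trans (cong (∣ y ∣ ℕ.+_) (size-∷ʳ v x))
  (trans (sym (ℕP.+-assoc ∣ y ∣ _ _)) (trans (cong (ℕ._+ size v) (ℕP.+-comm ∣ y ∣ ∣ x ∣)) (ℕP.+-assoc ∣ x ∣ _ _)))

unrot : ∀ {k} → Vec ℤ (suc k) → Vec ℤ (suc k)
unrot (x ∷ v) = v ∷ʳ (x - + 1)

head : ∀ {k} → Vec ℤ (suc k) → ℤ
head (x ∷ v) = x

rot-∷ʳ : ∀ {k} (v : Vec ℤ k) x → rot (v ∷ʳ x) ≡ (x + + 1) ∷ v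
rot-∷ʳ v x = cong₂ (λ y w → (y + + 1) ∷ w) (VecP.last-∷ʳ x v) (VecP.init-∷ʳ x v)

-1+1 : ∀ x → x - + 1 + + 1 ≡ x
-1+1 = solve-∀

+1-1 : ∀ x → x + + 1 - + 1 ≡ x
+1-1 = solve-∀

rot-unrot : ∀ {k} (v : Vec ℤ (suc k)) → rot (unrot v) ≡ v
rot-unrot (x ∷ v) = trans (rot-∷ʳ v (x - + 1)) (cong (_∷ v) (-1+1 x))

unrot-rot : ∀ {k} (v : Vec ℤ (suc k)) → unrot (rot v) ≡ v
unrot-rot = snoc-elim _ λ v x → trans (cong unrot (rot-∷ʳ v x)) (cong (v ∷ʳ_) (+1-1 x))

size-unrot : ∀ {k} (v : Vec ℤ (suc k)) → + 0 ℤ.< head v → size (unrot v) ℕ.< size v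
size-unrot (+ suc x ∷ v) p = ℕP.≤-reflexive (cong suc (size-∷ʳ v (+ suc x - + 1)))
size-unrot (+ zero ∷ v) (ℤ.+<+ ())

swap-∷ʳ : ∀ {n} i → suc i ℕ.< n → (v : Vec ℤ n) → ∀ x → swapAt i (v ∷ʳ x) ≡ swapAt i v ∷ʳ x
swap-∷ʳ zero h (a ∷ b ∷ v) x = refl
swap-∷ʳ zero (s≤s ()) (a ∷ []) x
swap-∷ʳ (suc i) (s≤s h) (a ∷ v) x = cong (a ∷_) (swap-∷ʳ i h v x)

get-∷ʳ : ∀ {n} i → i ℕ.< n → (v : Vec ℤ n) → ∀ x → getAt i (v ∷ʳ x) ≡ getAt i v
get-∷ʳ zero h (a ∷ v) x = refl
get-∷ʳ (suc i) (s≤s h) (a ∷ v) x = get-∷ʳ i h v x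

swap-last : ∀ {n} (v : Vec ℤ n) x y → swapAt n (v ∷ʳ x ∷ʳ y) ≡ v ∷ʳ y ∷ʳ x
swap-last [] x y = refl
swap-last (a ∷ v) x y = cong (a ∷_) (swap-last v x y)

get-last : ∀ {n} (v : Vec ℤ n) x → getAt n (v ∷ʳ x) ≡ x
get-last [] x = refl
get-last (a ∷ v) x = get-last v x

get-last₂ : ∀ {n} (v : Vec ℤ n) x y → getAt n (v ∷ʳ x ∷ʳ y) ≡ x
get-last₂ [] x y = refl
get-last₂ (a ∷ v) x y = get-last₂ v x y

-- With cyc these are the derivations of Ẽ; without it, of the polynomials π_w g.
data Der {k} (cyc : Bool) (b : Vec ℤ (suc k)) (g : Poly (suc k)) : Vec ℤ (suc k) → Poly (suc k) → Set where
  base : Der cyc b g b g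
  hecke : ∀ {β f} i → suc i ℕ.< suc k → Der cyc b g β f → Der cyc b g (hstep i β) (piOp i f)
  cyclic : ∀ {β f} → cyc ≡ true → Der cyc b g β f → Der cyc b g (rot β) (ρ f)

module _ where
  private
    shape : ∀ {k} → 1 ℕ.< suc k → ∃ λ k' → k ≡ suc k'
    shape (s≤s {n = suc k'} _) = k' , refl

  ρ²-lastLetter : ∀ {k} → 1 ℕ.< suc k → (f : Poly (suc k)) → ρ (ρ (piOp (ℕ.pred k) f)) ≋ piOp 0 (ρ (ρ f))
  ρ²-lastLetter h f with shape h
  ... | k' , refl = ρ²-piOp f

  last-valid : ∀ {k} → 1 ℕ.< suc k → suc (ℕ.pred k) ℕ.< suc k
  last-valid h with shape h
  ... | k' , refl = ℕP.≤-refl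

  unrot²-swap : ∀ {k} → 1 ℕ.< suc k → (β : Vec ℤ (suc k)) → unrot (unrot (swapAt 0 β)) ≡ swapAt (ℕ.pred k) (unrot (unrot β))
  unrot²-swap h β with shape h
  unrot²-swap h (x ∷ y ∷ e) | k' , refl = sym (swap-last e (x - + 1) (y - + 1))

  get-unrot²₀ : ∀ {k} → 1 ℕ.< suc k → (β : Vec ℤ (suc k)) → getAt (ℕ.pred k) (unrot (unrot β)) ≡ getAt 0 β - + 1
  get-unrot²₀ h β with shape h
  get-unrot²₀ h (x ∷ y ∷ e) | k' , refl = get-last₂ e (x - + 1) (y - + 1)

  get-unrot²₁ : ∀ {k} → 1 ℕ.< suc k → (β : Vec ℤ (suc k)) → getAt (suc (ℕ.pred k)) (unrot (unrot β)) ≡ getAt 1 β - + 1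
  get-unrot²₁ h β with shape h
  get-unrot²₁ h (x ∷ y ∷ e) | k' , refl = get-last (e ∷ʳ (x - + 1)) (y - + 1)

  head-unrot : ∀ {k} → 1 ℕ.< suc k → (β : Vec ℤ (suc k)) → head (unrot β) ≡ getAt 1 β
  head-unrot h β with shape h
  head-unrot h (x ∷ y ∷ e) | k' , refl = refl

  head-get : ∀ {k} (β : Vec ℤ (suc k)) → head β ≡ getAt 0 β
  head-get (x ∷ e) = refl

  get-unrot : ∀ {k} i → suc i ℕ.< suc k → (β : Vec ℤ (suc k)) → getAt i (unrot β) ≡ getAt (suc i) β
  get-unrot i (s≤s h) (x ∷ e) = get-∷ʳ i h e _

  unrot-swap : ∀ {k} i → suc (suc i) ℕ.< suc k → (β : Vec ℤ (suc k)) → unrot (swapAt (suc i) β) ≡ swapAt i (unrot β)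
  unrot-swap i (s≤s h) (x ∷ e) = sym (swap-∷ʳ i h e _)

  head-swap-suc : ∀ {k} i (β : Vec ℤ (suc k)) → head (swapAt (suc i) β) ≡ head β
  head-swap-suc i (x ∷ e) = refl

-- Every vector has at most one polynomial derivable from the base (b , g₀): the
-- backward steps (undoing an ascent, or a rotation when the head is positive)
-- terminate and are locally confluent because of the relations between the π_i and ρ.
module Unique {k : ℕ} (cyc : Bool) (b : Vec ℤ (suc k)) (g₀ : Poly (suc k)) (Inv : Vec ℤ (suc k) → Set)
  (inv-swap : ∀ {β} i → suc i ℕ.< suc k → Inv β → Inv (swapAt i β))
  (inv-unrot : ∀ {β} → cyc ≡ true → Inv β → + 0 ℤ.< head β → Inv (unrot β))
  (inv-der : ∀ {β f} → Der cyc b g₀ β f → Inv β)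
  (inv-last : ∀ {β} → cyc ≡ true → Inv β → + 0 ℤ.≤ last β)
  (terminal : ∀ {β} → Inv β → (∀ i → suc i ℕ.< suc k → getAt (suc i) β ℤ.≤ getAt i β) →
    (cyc ≡ true → ¬ (+ 0 ℤ.< head β)) → β ≡ b)
  (b-desc : ∀ i → suc i ℕ.< suc k → getAt (suc i) b ℤ.≤ getAt i b)
  (b-head : cyc ≡ true → ¬ (+ 0 ℤ.< head b))
  (b-fix : ∀ i → suc i ℕ.< suc k → getAt i b ≡ getAt (suc i) b → piOp i g₀ ≋ g₀)
  where

  private
    n = suc k
    V = Vec ℤ n
    D = Der cyc b g₀

  -- A forward letter leaves β in place when β_i ≤ β_(i+1); derivations containing such steps agree
  -- only if π_i fixes the polynomial. Hence `fix` has to be proved in the same induction as `uniq`.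
  record Good (β : V) : Set where
    field
      poly : Poly n
      der : D β poly
      uniq : ∀ {f} → D β f → f ≋ poly
      fix : ∀ i → suc i ℕ.< n → getAt i β ℤ.≤ getAt (suc i) β → piOp i poly ≋ poly
  open Good

  -- Lexicographic in (`size`, `ascents`): undoing a rotation at a positive head lowers the first
  -- entry, undoing an ascent keeps it and lowers the second.
  data _≺_ (β' β : V) : Set where
    smaller : size β' ℕ.< size β → β' ≺ β
    flatter : size β' ≡ size β → ascents β' ℕ.< ascents β → β' ≺ β

  swap-≺ : ∀ {β} i → suc i ℕ.< n → i ⊏ β → swapAt i β ≺ β
  swap-≺ {β} i h p = flatter (size-swap i β) (ascents-swap i h β p)

  unrot-≺ : ∀ {β} → + 0 ℤ.< head β → unrot β ≺ β
  unrot-≺ {β} p = smaller (size-unrot β p)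

  ≺-trans : ∀ {α β γ} → α ≺ β → β ≺ γ → α ≺ γ
  ≺-trans (smaller p) (smaller q) = smaller (ℕP.<-trans p q)
  ≺-trans {α} (smaller p) (flatter e q) = smaller (subst (size α ℕ.<_) e p)
  ≺-trans {γ = γ} (flatter e p) (smaller q) = smaller (subst (ℕ._< size γ) (sym e) q)
  ≺-trans (flatter e p) (flatter e' q) = flatter (trans e e') (ℕP.<-trans p q)

  unswap : ∀ {β f} i → suc i ℕ.< n → getAt i β ℤ.≤ getAt (suc i) β → D (swapAt i β) f → D β (piOp i f)
  unswap {β} {f} i h p d = subst (λ β → D β (piOp i f)) (hstep-unswap i h β p) (hecke i h d)

  unrotate : ∀ {β f} → cyc ≡ true → D (unrot β) f → D β (ρ f)
  unrotate {β} {f} c d = subst (λ β → D β (ρ f)) (rot-unrot β) (cyclic c d)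

  module Step (β : V) (inv : Inv β) (IH : ∀ {β'} → β' ≺ β → Inv β' → Good β') where

    Asc : ℕ → Set
    Asc i = suc i ℕ.< n × i ⊏ β

    Rot : Set
    Rot = cyc ≡ true × + 0 ℤ.< head β

    G : ∀ i → Asc i → Good (swapAt i β)
    G i (h , p) = IH (swap-≺ i h p) (inv-swap i h inv)

    F : ∀ i → Asc i → Poly n
    F i a = poly (G i a)

    GR : Rot → Good (unrot β)
    GR (c , p) = IH (unrot-≺ p) (inv-unrot c inv p)

    FR : Rot → Poly n
    FR r = poly (GR r)

    confl-far : ∀ i j (a : Asc i) (a' : Asc j) → suc (suc i) ℕ.≤ j → piOp i (F i a) ≋ piOp j (F j a')
    confl-far i j a@(h , p) a'@(h' , p') far = ≋-trans (piOp-cong i h (≋-sym (uniq (G i a) di)))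
      (≋-trans (piOp-comm i j far h' (poly G₂)) (piOp-cong j h' (uniq (G j a') dj)))
      where
      p₂ : j ⊏ swapAt i β
      p₂ = subst₂ ℤ._<_ (sym (get-swap-> i j far β)) (sym (get-swap-> i (suc j) (ℕP.m≤n⇒m≤1+n far) β)) p'
      p₁ : i ⊏ swapAt j β
      p₁ = subst₂ ℤ._<_ (sym (get-swap-< j i (ℕP.<⇒≤ far) β)) (sym (get-swap-< j (suc i) far β)) p
      G₂ = IH (≺-trans (swap-≺ j h' p₂) (swap-≺ i h p)) (inv-swap j h' (inv-swap i h inv))
      di : D (swapAt i β) (piOp j (poly G₂))
      di = unswap j h' (ℤP.<⇒≤ p₂) (der G₂)
      dj : D (swapAt j β) (piOp i (poly G₂))
      dj = unswap i h (ℤP.<⇒≤ p₁) (subst (λ v → D v (poly G₂)) (sym (swap-comm i j far β)) (der G₂))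

    confl-near : ∀ i (a : Asc i) (a' : Asc (suc i)) → piOp i (F i a) ≋ piOp (suc i) (F (suc i) a')
    confl-near i a@(h , p) a'@(h' , p') = ≋-trans (piOp-cong i h (≋-sym (uniq (G i a) di)))
      (≋-trans (piOp-braid i h' f₃) (piOp-cong j h' (uniq (G j a') dj)))
      where
      j = suc i
      -- a b c ↦ b a c ↦ b c a ↦ c b a and a b c ↦ a c b ↦ c a b ↦ c b a
      s₁ = swapAt i β
      s₂ = swapAt j s₁
      s₃ = swapAt i s₂
      t₁ = swapAt j β
      t₂ = swapAt i t₁
      t₃ = swapAt j t₂
      x = getAt i β
      y = getAt j β
      z = getAt (suc j) β
      s₁j : getAt j s₁ ≡ x
      s₁j = get-swap₁ i h β
      s₁k : getAt (suc j) s₁ ≡ z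
      s₁k = get-swap-> i (suc j) ℕP.≤-refl β
      s₁i : getAt i s₁ ≡ y
      s₁i = get-swap₀ i h β
      s₂i : getAt i s₂ ≡ y
      s₂i = trans (get-swap-< j i ℕP.≤-refl s₁) s₁i
      s₂j : getAt j s₂ ≡ z
      s₂j = trans (get-swap₀ j h' s₁) s₁k
      t₁i : getAt i t₁ ≡ x
      t₁i = get-swap-< j i ℕP.≤-refl β
      t₁j : getAt j t₁ ≡ z
      t₁j = get-swap₀ j h' β
      t₁k : getAt (suc j) t₁ ≡ y
      t₁k = get-swap₁ j h' β
      t₂j : getAt j t₂ ≡ x
      t₂j = trans (get-swap₁ i h t₁) t₁i
      t₂k : getAt (suc j) t₂ ≡ y
      t₂k = trans (get-swap-> i (suc j) ℕP.≤-refl t₁) t₁k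
      q₁ : j ⊏ s₁
      q₁ = subst₂ ℤ._<_ (sym s₁j) (sym s₁k) (ℤP.<-trans p p')
      q₂ : i ⊏ s₂
      q₂ = subst₂ ℤ._<_ (sym s₂i) (sym s₂j) p'
      r₁ : i ⊏ t₁
      r₁ = subst₂ ℤ._<_ (sym t₁i) (sym t₁j) (ℤP.<-trans p p')
      r₂ : j ⊏ t₂
      r₂ = subst₂ ℤ._<_ (sym t₂j) (sym t₂k) p
      G₃ = IH (≺-trans (swap-≺ i h q₂) (≺-trans (swap-≺ j h' q₁) (swap-≺ i h p)))
              (inv-swap i h (inv-swap j h' (inv-swap i h inv)))
      f₃ = poly G₃
      di : D s₁ (piOp j (piOp i f₃))
      di = unswap j h' (ℤP.<⇒≤ q₁) (unswap i h (ℤP.<⇒≤ q₂) (der G₃))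
      dj : D t₁ (piOp i (piOp j f₃))
      dj = unswap i h (ℤP.<⇒≤ r₁) (unswap j h' (ℤP.<⇒≤ r₂) (subst (λ v → D v f₃) (swap-braid i h' β) (der G₃)))

    ascents-agree : ∀ i j (a : Asc i) (a' : Asc j) → piOp i (F i a) ≋ piOp j (F j a')
    ascents-agree i j a a' with ℕP.<-cmp i j
    ... | tri≈ _ refl _ = piOp-cong i (proj₁ a) (uniq (G i a') (der (G i a)))
    ... | tri< i<j _ _ with ℕP.m≤n⇒m<n∨m≡n i<j
    ...   | inj₁ far = confl-far i j a a' far
    ...   | inj₂ refl = confl-near i a a'
    ascents-agree i j a a' | tri> _ _ j<i with ℕP.m≤n⇒m<n∨m≡n j<i
    ...   | inj₁ far = ≋-sym (confl-far j i a' a far)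
    ...   | inj₂ refl = ≋-sym (confl-near j a' a)

    confl-rot-suc : ∀ i (a : Asc (suc i)) (r : Rot) → piOp (suc i) (F (suc i) a) ≋ ρ (FR r)
    confl-rot-suc i a@(h , p) r@(c , q) = ≋-trans (piOp-cong (suc i) h (≋-sym (uniq (G (suc i) a) di)))
      (≋-trans (≋-sym (ρ-piOp i h (poly G₂))) (ρ-cong (uniq (GR r) dr)))
      where
      q' : + 0 ℤ.< head (swapAt (suc i) β)
      q' = subst (+ 0 ℤ.<_) (sym (head-swap-suc i β)) q
      G₂ = IH (≺-trans (unrot-≺ q') (swap-≺ (suc i) h p)) (inv-unrot c (inv-swap (suc i) h inv) q')
      di : D (swapAt (suc i) β) (ρ (poly G₂))
      di = unrotate c (der G₂)
      dr : D (unrot β) (piOp i (poly G₂))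
      dr = unswap i (ℕP.<⇒≤ h)
        (subst₂ ℤ._≤_ (sym (get-unrot i (ℕP.<⇒≤ h) β)) (sym (get-unrot (suc i) h β)) (ℤP.<⇒≤ p))
        (subst (λ v → D v (poly G₂)) (unrot-swap i h β) (der G₂))

    -- Both entries of an ascent at the front are positive when the head is. So two rotations can be
    -- undone on either side, after which the ascent occupies the last two positions, and ρ² π_last
    -- = π_0 ρ² closes the diamond.
    confl-rot-zero : (a : Asc 0) (r : Rot) → piOp 0 (F 0 a) ≋ ρ (FR r)
    confl-rot-zero a@(h , p) r@(c , q) = ≋-trans (piOp-cong 0 h (≋-sym (uniq (G 0 a) di)))
      (≋-trans (≋-sym (ρ²-lastLetter h (poly G₂))) (ρ-cong (uniq (GR r) dr)))
      where
      0<0 : + 0 ℤ.< getAt 0 β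
      0<0 = subst (+ 0 ℤ.<_) (head-get β) q
      q₁ : + 0 ℤ.< head (swapAt 0 β)
      q₁ = subst (+ 0 ℤ.<_) (sym (trans (head-get (swapAt 0 β)) (get-swap₀ 0 h β))) (ℤP.<-trans 0<0 p)
      q₂ : + 0 ℤ.< head (unrot (swapAt 0 β))
      q₂ = subst (+ 0 ℤ.<_) (sym (trans (head-unrot h (swapAt 0 β)) (get-swap₁ 0 h β))) 0<0
      G₂ = IH (≺-trans (unrot-≺ q₂) (≺-trans (unrot-≺ q₁) (swap-≺ 0 h p)))
              (inv-unrot c (inv-unrot c (inv-swap 0 h inv) q₁) q₂)
      di : D (swapAt 0 β) (ρ (ρ (poly G₂)))
      di = unrotate c (unrotate c (der G₂))
      dr : D (unrot β) (ρ (piOp (ℕ.pred k) (poly G₂)))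
      dr = unrotate c (unswap (ℕ.pred k) (last-valid h)
        (subst₂ ℤ._≤_ (sym (get-unrot²₀ h β)) (sym (get-unrot²₁ h β)) (ℤP.+-monoˡ-≤ (- (+ 1)) (ℤP.<⇒≤ p)))
        (subst (λ v → D v (poly G₂)) (unrot²-swap h β) (der G₂)))

    ascent-rot-agree : ∀ i (a : Asc i) (r : Rot) → piOp i (F i a) ≋ ρ (FR r)
    ascent-rot-agree zero = confl-rot-zero
    ascent-rot-agree (suc i) = confl-rot-suc i


    fix-asc-far : ∀ i j (a : Asc j) → suc i ℕ.< n → getAt i β ≡ getAt (suc i) β →
      suc (suc i) ℕ.≤ j ⊎ suc (suc j) ℕ.≤ i → piOp i (piOp j (F j a)) ≋ piOp j (F j a)
    fix-asc-far i j a@(h' , p) h e (inj₁ far) = ≋-trans (piOp-comm i j far h' (F j a))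
      (piOp-cong j h' (fix (G j a) i h (ℤP.≤-reflexive
        (trans (get-swap-< j i (ℕP.<⇒≤ far) β) (trans e (sym (get-swap-< j (suc i) far β)))))))
    fix-asc-far i j a@(h' , p) h e (inj₂ far) = ≋-trans (≋-sym (piOp-comm j i far h (F j a)))
      (piOp-cong j h' (fix (G j a) i h (ℤP.≤-reflexive
        (trans (get-swap-> j i far β) (trans e (sym (get-swap-> j (suc i) (ℕP.m≤n⇒m≤1+n far) β)))))))

    -- For entries x x y with x < y, undoing two ascents leads over x y x to y x x. There the
    -- polynomial is fixed by the neighbouring letter, and the braid relation transports this back
    -- to x x y.
    fix-asc-right : ∀ i (a : Asc (suc i)) → suc i ℕ.< n → getAt i β ≡ getAt (suc i) β →
      piOp i (piOp (suc i) (F (suc i) a)) ≋ piOp (suc i) (F (suc i) a)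
    fix-asc-right i a@(h' , p) h e = ≋-trans (piOp-cong i h (piOp-cong j h' (≋-sym F≋)))
      (≋-trans (piOp-braid i h' f₂) (≋-trans (piOp-cong j h' (piOp-cong i h fix₂)) (piOp-cong j h' F≋)))
      where
      j = suc i
      s₁ = swapAt j β
      s₁i : getAt i s₁ ≡ getAt i β
      s₁i = get-swap-< j i ℕP.≤-refl β
      s₁j : getAt j s₁ ≡ getAt (suc j) β
      s₁j = get-swap₀ j h' β
      q : i ⊏ s₁
      q = subst₂ ℤ._<_ (sym (trans s₁i e)) (sym s₁j) p
      G₂ = IH (≺-trans (swap-≺ i h q) (swap-≺ j h' p)) (inv-swap i h (inv-swap j h' inv))
      f₂ = poly G₂
      F≋ : piOp i f₂ ≋ F j a
      F≋ = uniq (G j a) (unswap i h (ℤP.<⇒≤ q) (der G₂))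
      fix₂ : piOp j f₂ ≋ f₂
      fix₂ = fix G₂ j h' (ℤP.≤-reflexive (trans (get-swap₁ i h s₁) (trans s₁i
        (trans e (sym (trans (get-swap-> i (suc j) ℕP.≤-refl s₁) (get-swap₁ j h' β)))))))

    fix-asc-left : ∀ j (a : Asc j) → suc (suc j) ℕ.< n → getAt (suc j) β ≡ getAt (suc (suc j)) β →
      piOp (suc j) (piOp j (F j a)) ≋ piOp j (F j a)
    fix-asc-left j a@(h' , p) h e = ≋-trans (piOp-cong i h (piOp-cong j h' (≋-sym F≋)))
      (≋-trans (≋-sym (piOp-braid j h f₂)) (≋-trans (piOp-cong j h' (piOp-cong i h fix₂)) (piOp-cong j h' F≋)))
      where
      i = suc j
      s₁ = swapAt j β
      s₁i : getAt i s₁ ≡ getAt j β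
      s₁i = get-swap₁ j h' β
      s₁k : getAt (suc i) s₁ ≡ getAt (suc i) β
      s₁k = get-swap-> j (suc i) ℕP.≤-refl β
      q : i ⊏ s₁
      q = subst₂ ℤ._<_ (sym s₁i) (sym (trans s₁k (sym e))) p
      G₂ = IH (≺-trans (swap-≺ i h q) (swap-≺ j h' p)) (inv-swap i h (inv-swap j h' inv))
      f₂ = poly G₂
      F≋ : piOp i f₂ ≋ F j a
      F≋ = uniq (G j a) (unswap i h (ℤP.<⇒≤ q) (der G₂))
      fix₂ : piOp j f₂ ≋ f₂
      fix₂ = fix G₂ j h' (ℤP.≤-reflexive (trans (get-swap-< i j ℕP.≤-refl s₁)
        (trans (get-swap₀ j h' β) (trans e (sym (trans (get-swap₀ i h s₁) s₁k))))))

    fix-asc : ∀ i j (a : Asc j) → suc i ℕ.< n → getAt i β ≡ getAt (suc i) β →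
      piOp i (piOp j (F j a)) ≋ piOp j (F j a)
    fix-asc i j a h e with ℕP.<-cmp i j
    ... | tri≈ _ refl _ = piOp-idem i h (F i a)
    ... | tri< i<j _ _ with ℕP.m≤n⇒m<n∨m≡n i<j
    ...   | inj₁ far = fix-asc-far i j a h e (inj₁ far)
    ...   | inj₂ refl = fix-asc-right i a h e
    fix-asc i j a h e | tri> _ _ j<i with ℕP.m≤n⇒m<n∨m≡n j<i
    ...   | inj₁ far = fix-asc-far i j a h e (inj₂ far)
    ...   | inj₂ refl = fix-asc-left j a h e

    fix-rot : ∀ i (r : Rot) → suc i ℕ.< n → getAt i β ≡ getAt (suc i) β → piOp i (ρ (FR r)) ≋ ρ (FR r)
    fix-rot (suc i) r h e = ≋-trans (≋-sym (ρ-piOp i h (FR r))) (ρ-cong (fix (GR r) i (ℕP.<⇒≤ h)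
      (ℤP.≤-reflexive (trans (get-unrot i (ℕP.<⇒≤ h) β) (trans e (sym (get-unrot (suc i) h β)))))))
    fix-rot zero r@(c , q) h e = ≋-trans (piOp-cong 0 h (ρ-cong (≋-sym F≋)))
      (≋-trans (≋-sym (ρ²-lastLetter h (poly G₂))) (≋-trans (ρ-cong (ρ-cong fix₂)) (ρ-cong F≋)))
      where
      q₂ : + 0 ℤ.< head (unrot β)
      q₂ = subst (+ 0 ℤ.<_) (trans (head-get β) (trans e (sym (head-unrot h β)))) q
      G₂ = IH (≺-trans (unrot-≺ q₂) (unrot-≺ q)) (inv-unrot c (inv-unrot c inv q) q₂)
      F≋ : ρ (poly G₂) ≋ FR r
      F≋ = uniq (GR r) (unrotate c (der G₂))
      fix₂ : piOp (ℕ.pred k) (poly G₂) ≋ poly G₂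
      fix₂ = fix G₂ (ℕ.pred k) (last-valid h) (ℤP.≤-reflexive
        (trans (get-unrot²₀ h β) (trans (cong (λ z → z - + 1) e) (sym (get-unrot²₁ h β)))))

    module Result (g : Poly n) (dg : D β g)
      (asc≋ : ∀ i (a : Asc i) → piOp i (F i a) ≋ g) (rot≋ : ∀ (r : Rot) → ρ (FR r) ≋ g)
      (base≋ : β ≡ b → g₀ ≋ g)
      (fix≋ : ∀ i → suc i ℕ.< n → getAt i β ≡ getAt (suc i) β → piOp i g ≋ g) where

      fix-g : ∀ i → suc i ℕ.< n → getAt i β ℤ.≤ getAt (suc i) β → piOp i g ≋ g
      fix-g i h p with getAt i β ℤ.≟ getAt (suc i) β
      ... | yes e = fix≋ i h e
      ... | no ne = ≋-trans (piOp-cong i h (≋-sym (asc≋ i a))) (≋-trans (piOp-idem i h (F i a)) (asc≋ i a))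
        where
        a : Asc i
        a = h , ℤP.≤∧≢⇒< p ne

      -- Only a last step that leaves β in place recurses on the derivation, and `fix-g` absorbs it.
      -- Every other last step starts from a vector `≺ β`, whose polynomial is already unique; the
      -- confluence hypotheses then apply.
      uniq-g : ∀ {β' f} → D β' f → β' ≡ β → f ≋ g
      uniq-g base e = base≋ (sym e)
      uniq-g (hecke {β₁} {f} i h d) e with ℤP.<-cmp (getAt i β₁) (getAt (suc i) β₁)
      ... | tri< p _ _ = ≋-trans (piOp-cong i h (uniq-g d β₁≡)) (fix-g i h (subst (λ v → getAt i v ℤ.≤ getAt (suc i) v) β₁≡ (ℤP.<⇒≤ p)))
        where
        β₁≡ : β₁ ≡ β
        β₁≡ = trans (sym (hstep-id i h β₁ p)) e
      ... | tri≈ _ p _ = ≋-trans (piOp-cong i h (uniq-g d β₁≡)) (fix-g i h (subst (λ v → getAt i v ℤ.≤ getAt (suc i) v) β₁≡ (ℤP.≤-reflexive p)))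
        where
        β₁≡ : β₁ ≡ β
        β₁≡ = trans (sym (trans (hstep-swap i h β₁ (ℤP.≤-reflexive (sym p))) (swap-eq i h β₁ p))) e
      ... | tri> _ _ p = ≋-trans (piOp-cong i h (uniq (G i a) (subst (λ v → D v f) β₁≡ d))) (asc≋ i a)
        where
        eq : swapAt i β₁ ≡ β
        eq = trans (sym (hstep-swap i h β₁ (ℤP.<⇒≤ p))) e
        β₁≡ : β₁ ≡ swapAt i β
        β₁≡ = trans (sym (swap-invol i β₁)) (cong (swapAt i) eq)
        a : Asc i
        a = h , subst (λ v → i ⊏ v) eq (subst₂ ℤ._<_ (sym (get-swap₀ i h β₁)) (sym (get-swap₁ i h β₁)) p)
      uniq-g (cyclic {β₁} {f} c d) e = ≋-trans (ρ-cong (uniq (GR r) (subst (λ v → D v f) β₁≡ d))) (rot≋ r)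
        where
        β₁≡ : β₁ ≡ unrot β
        β₁≡ = trans (sym (unrot-rot β₁)) (cong unrot e)
        r : Rot
        r = c , subst (λ v → + 0 ℤ.< head v) e
          (ℤP.<-≤-trans (ℤ.+<+ (s≤s z≤n)) (ℤP.+-monoˡ-≤ (+ 1) (inv-last c (inv-der d))))

      good : Good β
      good = record { poly = g ; der = dg ; uniq = λ d → uniq-g d refl ; fix = fix-g }

    -- Any available backward step may define the polynomial, since `ascents-agree` and
    -- `ascent-rot-agree` identify the candidates. With no step left, β is the base vector.
    goodStep : (∀ i → ¬ (Asc i)) ⊎ ∃ Asc → Dec Rot → Good β
    goodStep (inj₂ (j , a)) _ = Result.good (piOp j (F j a))
      (unswap j (proj₁ a) (ℤP.<⇒≤ (proj₂ a)) (der (G j a)))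
      (λ i a' → ascents-agree i j a' a) (λ r → ≋-sym (ascent-rot-agree j a r))
      (λ { refl → ⊥-elim (ℤP.<⇒≱ (proj₂ a) (b-desc j (proj₁ a))) })
      (λ i → fix-asc i j a)
    goodStep (inj₁ na) (yes r) = Result.good (ρ (FR r))
      (unrotate (proj₁ r) (der (GR r)))
      (λ i a → ⊥-elim (na i a)) (λ r' → ρ-cong (uniq (GR r) (der (GR r'))))
      (λ { refl → ⊥-elim (b-head (proj₁ r) (proj₂ r)) })
      (λ i → fix-rot i r)
    goodStep (inj₁ na) (no nr) = Result.good g₀
      (subst (λ v → D v g₀) (sym β≡b) base)
      (λ i a → ⊥-elim (na i a)) (λ r → ⊥-elim (nr r)) (λ _ → ≋-refl)
      (λ i h e → b-fix i h (subst (λ v → getAt i v ≡ getAt (suc i) v) β≡b e))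
      where
      β≡b : β ≡ b
      β≡b = terminal inv (λ i h → ℤP.≮⇒≥ λ p → na i (h , p)) (λ c p → nr (c , p))

  private
    rot? : ∀ (β : V) → Dec (cyc ≡ true × + 0 ℤ.< head β)
    rot? β with cyc 𝔹.≟ true | + 0 ℤ.<? head β
    ... | yes c | yes p = yes (c , p)
    ... | yes c | no p = no (p ∘ proj₂)
    ... | no c | _ = no (c ∘ proj₁)

    asc? : ∀ (β : V) → (∀ i → ¬ (suc i ℕ.< n × i ⊏ β)) ⊎ ∃ λ i → suc i ℕ.< n × i ⊏ β
    asc? β with ascent? β
    ... | inj₁ a = inj₂ a
    ... | inj₂ na = inj₁ λ { i (h , p) → ℤP.<⇒≱ p (na i h) }

    inner : ∀ s → (∀ β → size β ℕ.< s → Inv β → Good β) → ∀ t β → size β ≡ s → ascents β ℕ.< t → Inv β → Good β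
    inner s small (suc t) β e (s≤s q) inv = Step.goodStep β inv IH (asc? β) (rot? β)
      where
      IH : ∀ {β'} → β' ≺ β → Inv β' → Good β'
      IH {β'} (smaller p) inv' = small β' (subst (size β' ℕ.<_) e p) inv'
      IH {β'} (flatter e' q') inv' = inner s small t β' (trans e' e) (ℕP.<-≤-trans q' q) inv'

    allGood : ∀ s β → size β ℕ.< s → Inv β → Good β
    allGood (suc s) β (s≤s p) inv =
      inner (size β) (λ β' p' → allGood s β' (ℕP.<-≤-trans p' p)) _ β refl ℕP.≤-refl inv

  unique : ∀ {β f f'} → D β f → D β f' → f ≋ f'
  unique {β} d d' = ≋-trans (uniq g d) (≋-sym (uniq g d'))
    where
    g = allGood _ β ℕP.≤-refl (inv-der d)

-- Nonnegative vectors and uniqueness of Ẽ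

NN : ∀ {n} → Vec ℤ n → Set
NN [] = ⊤
NN (x ∷ v) = + 0 ℤ.≤ x × NN v

NN-swap : ∀ {n} i (v : Vec ℤ n) → NN v → NN (swapAt i v)
NN-swap zero [] h = h
NN-swap zero (x ∷ []) h = h
NN-swap zero (x ∷ y ∷ v) (p , q , h) = q , p , h
NN-swap (suc i) [] h = h
NN-swap (suc i) (x ∷ v) (p , h) = p , NN-swap i v h

NN-∷ʳ : ∀ {n} (v : Vec ℤ n) x → NN v → + 0 ℤ.≤ x → NN (v ∷ʳ x)
NN-∷ʳ [] x h p = p , tt
NN-∷ʳ (y ∷ v) x (q , h) p = q , NN-∷ʳ v x h p

NN-∷ʳ⁻ : ∀ {n} (v : Vec ℤ n) x → NN (v ∷ʳ x) → NN v × + 0 ℤ.≤ x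
NN-∷ʳ⁻ [] x (p , _) = tt , p
NN-∷ʳ⁻ (y ∷ v) x (q , h) with NN-∷ʳ⁻ v x h
... | h' , p = (q , h') , p

NN-unrot : ∀ {k} (v : Vec ℤ (suc k)) → NN v → + 0 ℤ.< head v → NN (unrot v)
NN-unrot (+ suc x ∷ v) (p , h) q = NN-∷ʳ v (+ x) h (ℤ.+≤+ z≤n)
NN-unrot (+ zero ∷ v) (p , h) (ℤ.+<+ ())

NN-rot : ∀ {k} (v : Vec ℤ (suc k)) → NN v → NN (rot v)
NN-rot = snoc-elim _ λ v x h → subst NN (sym (rot-∷ʳ v x))
  (ℤP.≤-trans (proj₂ (NN-∷ʳ⁻ v x h)) (ℤP.i≤i+j x (+ 1)) , proj₁ (NN-∷ʳ⁻ v x h))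

NN-last : ∀ {k} (v : Vec ℤ (suc k)) → NN v → + 0 ℤ.≤ last v
NN-last = snoc-elim _ λ v x h → subst (+ 0 ℤ.≤_) (sym (VecP.last-∷ʳ x v)) (proj₂ (NN-∷ʳ⁻ v x h))

NN-zeroV : ∀ n → NN (zeroV n)
NN-zeroV zero = tt
NN-zeroV (suc n) = ℤ.+≤+ z≤n , NN-zeroV n

hstep-cases : ∀ {n} i (v : Vec ℤ n) → hstep i v ≡ swapAt i v ⊎ hstep i v ≡ v
hstep-cases zero [] = inj₁ refl
hstep-cases zero (x ∷ []) = inj₁ refl
hstep-cases zero (x ∷ y ∷ v) with y ≤ℤ x
... | true = inj₁ refl
... | false = inj₂ refl
hstep-cases (suc i) [] = inj₁ refl
hstep-cases (suc i) (x ∷ v) with hstep-cases i v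
... | inj₁ e = inj₁ (cong (x ∷_) e)
... | inj₂ e = inj₂ (cong (x ∷_) e)

NN-hstep : ∀ {n} i (v : Vec ℤ n) → NN v → NN (hstep i v)
NN-hstep i v h with hstep-cases i v
... | inj₁ e = subst NN (sym e) (NN-swap i v h)
... | inj₂ e = subst NN (sym e) h

Desc : ∀ {n} → Vec ℤ n → Set
Desc {n} v = ∀ i → suc i ℕ.< n → getAt (suc i) v ℤ.≤ getAt i v

desc-tail : ∀ {n} {x} {v : Vec ℤ n} → Desc (x ∷ v) → Desc v
desc-tail d i h = d (suc i) (s≤s h)

zero-from-head : ∀ {n} (v : Vec ℤ n) x → Desc (x ∷ v) → x ≡ + 0 → NN v → v ≡ zeroV n
zero-from-head [] x d e h = refl
zero-from-head (y ∷ v) x d e (p , h) = cong₂ _∷_ y≡0 (zero-from-head v y (desc-tail d) y≡0 h)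
  where
  y≡0 = ℤP.≤-antisym (subst (y ℤ.≤_) e (d 0 (s≤s (s≤s z≤n)))) p

get-zeroV : ∀ n i → getAt i (zeroV n) ≡ + 0
get-zeroV zero i = refl
get-zeroV (suc n) zero = refl
get-zeroV (suc n) (suc i) = get-zeroV n i

dem-diag : ∀ φ a → dem φ a a ≡ φ a a
dem-diag φ a = trans (cong (λ z → z - ∫ F a) (∫-sc F a)) (trans (lem (∫ F a) (F a)) (cong (φ a) (lem' a)))
  where
  F = line φ (a + a)
  lem : ∀ x y → x + y - x ≡ y
  lem = solve-∀
  lem' : ∀ x → x + x - x ≡ x
  lem' = solve-∀

Π-equal : ∀ {n} i → suc i ℕ.< n → ∀ (φ : Fn n) e → getAt i e ≡ getAt (suc i) e → Π i φ e ≡ φ e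
Π-equal zero h φ (a ∷ b ∷ e) refl = dem-diag (λ x y → φ (x ∷ y ∷ e)) a
Π-equal zero (s≤s ()) φ (a ∷ [])
Π-equal (suc i) (s≤s h) φ (x ∷ e) p = Π-equal i h (λ e → φ (x ∷ e)) e p

piOp-one : ∀ {n} i → suc i ℕ.< n → piOp i (onePoly n) ≋ onePoly n
piOp-one {n} i h = eqP λ φ → trans (pair-piOp i h (onePoly n) φ)
  (cong (λ z → + 1 * z + + 0) (Π-equal i h (φ (+ 0)) (zeroV n) (trans (get-zeroV n i) (sym (get-zeroV n (suc i))))))

module _ {k : ℕ} where
  private
    n = suc k

    der-NN : ∀ {β f} → Der true (zeroV n) (onePoly n) β f → NN β
    der-NN base = NN-zeroV n
    der-NN (hecke i h d) = NN-hstep i _ (der-NN d)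
    der-NN (cyclic c d) = NN-rot _ (der-NN d)

    fromE : ∀ {β f} → IsE k β f → Der true (zeroV n) (onePoly n) β f
    fromE base = base
    fromE (hecke i h d) = hecke i h (fromE d)
    fromE (cyclic d) = cyclic refl (fromE d)

    terminal-zero : ∀ {β : Vec ℤ n} → NN β → Desc β → (true ≡ true → ¬ (+ 0 ℤ.< head β)) → β ≡ zeroV n
    terminal-zero {x ∷ v} (p , h) d nh = cong₂ _∷_ x≡0 (zero-from-head v x d x≡0 h)
      where
      x≡0 : x ≡ + 0
      x≡0 = ℤP.≤-antisym (ℤP.≮⇒≥ (nh refl)) p

    head-zero : true ≡ true → ¬ (+ 0 ℤ.< head (zeroV n))
    head-zero _ (ℤ.+<+ ())

    open Unique true (zeroV n) (onePoly n) NN (λ i _ → NN-swap i _) (λ {β} _ → NN-unrot β) der-NN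
      (λ {β} _ → NN-last β)
      terminal-zero
      (λ i _ → ℤP.≤-reflexive (trans (get-zeroV n (suc i)) (sym (get-zeroV n i))))
      head-zero
      (λ i h _ → piOp-one i h)

  IsE-unique : ∀ {β f f'} → IsE k β f → IsE k β f' → f ≋ f'
  IsE-unique d d' = unique (fromE d) (fromE d')

  IsE-NN : ∀ {β f} → IsE k β f → NN β
  IsE-NN d = der-NN (fromE d)

-- Sorting

ins-≤ : ∀ {n} {x y} {v : Vec ℤ n} → x ℤ.≤ y → insertDesc x (y ∷ v) ≡ y ∷ insertDesc x v
ins-≤ {x = x} {y} p rewrite dec-true (x ℤ.≤? y) p = refl

ins-≰ : ∀ {n} {x y} {v : Vec ℤ n} → ¬ (x ℤ.≤ y) → insertDesc x (y ∷ v) ≡ x ∷ y ∷ v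
ins-≰ {x = x} {y} p rewrite dec-false (x ℤ.≤? y) p = refl

ins-front : ∀ {n} a b (v : Vec ℤ n) → insertDesc a v ≡ a ∷ v → insertDesc b v ≡ b ∷ v →
  insertDesc a (b ∷ v) ≡ insertDesc b (a ∷ v)
ins-front a b v ea eb = go (a ℤ.≤? b) (b ℤ.≤? a)
  where
  go : Dec (a ℤ.≤ b) → Dec (b ℤ.≤ a) → insertDesc a (b ∷ v) ≡ insertDesc b (a ∷ v)
  go (yes p) (yes q) with ℤP.≤-antisym p q
  ... | refl = refl
  go (yes p) (no q) = trans (ins-≤ p) (trans (cong (b ∷_) ea) (sym (ins-≰ q)))
  go (no p) (yes q) = trans (ins-≰ p) (sym (trans (ins-≤ q) (cong (a ∷_) eb)))
  go (no p) (no q) = ⊥-elim (p (ℤP.<⇒≤ (ℤP.≰⇒> q)))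

ins-comm : ∀ {n} a b (v : Vec ℤ n) → insertDesc a (insertDesc b v) ≡ insertDesc b (insertDesc a v)
ins-comm a b [] = ins-front a b [] refl refl
ins-comm a b (y ∷ v) = go (a ℤ.≤? y) (b ℤ.≤? y)
  where
  go : Dec (a ℤ.≤ y) → Dec (b ℤ.≤ y) → insertDesc a (insertDesc b (y ∷ v)) ≡ insertDesc b (insertDesc a (y ∷ v))
  go (yes p) (yes q) rewrite ins-≤ {v = v} p | ins-≤ {v = v} q | ins-≤ {v = insertDesc b v} p | ins-≤ {v = insertDesc a v} q =
    cong (y ∷_) (ins-comm a b v)
  go (yes p) (no q) rewrite ins-≤ {v = v} p | ins-≰ {v = v} q | ins-≰ {v = insertDesc a v} q
    | ins-≤ {v = y ∷ v} (ℤP.≤-trans p (ℤP.<⇒≤ (ℤP.≰⇒> q))) | ins-≤ {v = v} p = refl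
  go (no p) (yes q) rewrite ins-≤ {v = v} q | ins-≰ {v = v} p | ins-≰ {v = insertDesc b v} p
    | ins-≤ {v = y ∷ v} (ℤP.≤-trans q (ℤP.<⇒≤ (ℤP.≰⇒> p))) | ins-≤ {v = v} q = refl
  go (no p) (no q) = trans (cong (insertDesc a) (ins-≰ q))
    (trans (ins-front a b (y ∷ v) (ins-≰ p) (ins-≰ q)) (cong (insertDesc b) (sym (ins-≰ p))))

sortDesc-swap : ∀ {n} i (v : Vec ℤ n) → sortDesc (swapAt i v) ≡ sortDesc v
sortDesc-swap zero [] = refl
sortDesc-swap zero (x ∷ []) = refl
sortDesc-swap zero (x ∷ y ∷ v) = ins-comm y x (sortDesc v)
sortDesc-swap (suc i) [] = refl
sortDesc-swap (suc i) (x ∷ v) = cong (insertDesc x) (sortDesc-swap i v)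

sortDesc-hstep : ∀ {n} i (v : Vec ℤ n) → sortDesc (hstep i v) ≡ sortDesc v
sortDesc-hstep i v with hstep-cases i v
... | inj₁ e = trans (cong sortDesc e) (sortDesc-swap i v)
... | inj₂ e = cong sortDesc e

ins-desc : ∀ {n} x (v : Vec ℤ n) → Desc (x ∷ v) → insertDesc x v ≡ x ∷ v
ins-desc x [] d = refl
ins-desc x (y ∷ v) d with x ℤ.≤? y
... | no p = refl
... | yes p with ℤP.≤-antisym p (d 0 (s≤s (s≤s z≤n)))
...   | refl = cong (x ∷_) (ins-desc x v (desc-tail d))

sortDesc-desc : ∀ {n} (v : Vec ℤ n) → Desc v → sortDesc v ≡ v
sortDesc-desc [] d = refl
sortDesc-desc (x ∷ v) d = trans (cong (insertDesc x) (sortDesc-desc v (desc-tail d))) (ins-desc x v d)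

-- Operators indexed by reduced words agree when the words act in the same way
-- on a strictly decreasing vector.
module _ {k : ℕ} (δ : Vec ℤ (suc k)) (strict : ∀ i → suc i ℕ.< suc k → getAt (suc i) δ ℤ.< getAt i δ)
  (g : Poly (suc k)) where
  private
    D = Der false δ g

    desc : Desc δ
    desc i h = ℤP.<⇒≤ (strict i h)

    der-sort : ∀ {β f} → D β f → sortDesc β ≡ δ
    der-sort base = sortDesc-desc δ desc
    der-sort (hecke i h d) = trans (sortDesc-hstep i _) (der-sort d)
    der-sort (cyclic () d)

    open Unique false δ g (λ β → sortDesc β ≡ δ) (λ {β} i _ e → trans (sortDesc-swap i β) e) (λ ()) der-sort (λ ())
      (λ {β} e d _ → trans (sym (sortDesc-desc β d)) e) desc (λ ())
      (λ i h e → ⊥-elim (ℤP.<-irrefl (sym e) (strict i h)))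

    word-der : ∀ w → Valid (suc k) w → D (act w δ) (piWord w g)
    word-der [] _ = base
    word-der (i ∷ w) (h ∷ v) = hecke i h (word-der w v)

  piWord-determined : ∀ {w w'} → Valid (suc k) w → Valid (suc k) w' → act w δ ≡ act w' δ → piWord w g ≋ piWord w' g
  piWord-determined {w} {w'} v v' e = unique (subst (λ β → D β (piWord w g)) e (word-der w v)) (word-der w' v')

-- The kernel ∏_(i<j) (1 - x_i/x_j), self-adjointness, and the annihilator of K

δ₀ : ℤ → ℤ
δ₀ (+ zero) = + 1
δ₀ (+ suc n) = + 0
δ₀ -[1+ n ] = + 0

-- J e is the coefficient of x^{-e} in ∏_{i<j} (1 - x_i/x_j); multiplication by
-- ∏_{j>1} (1 - x_1/x_j) is performed by R, whose argument a is the exponent of x_1.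
R : ∀ {n} → Fn n → ℤ → Fn n
R φ a [] = δ₀ a * φ []
R φ a (b ∷ e) = R (λ e → φ (b ∷ e)) a e - R (λ e → φ ((b - + 1) ∷ e)) (sc a) e

J : ∀ {n} → Fn n
J [] = + 1
J (a ∷ e) = R J a e

R-ext : ∀ {n} {φ ψ : Fn n} → (∀ e → φ e ≡ ψ e) → ∀ a e → R φ a e ≡ R ψ a e
R-ext h a [] = cong (δ₀ a *_) (h [])
R-ext h a (b ∷ e) = cong₂ _-_ (R-ext (λ e → h (b ∷ e)) a e) (R-ext (λ e → h ((b - + 1) ∷ e)) (sc a) e)

R-- : ∀ {n} (φ ψ : Fn n) a e → R (λ e → φ e - ψ e) a e ≡ R φ a e - R ψ a e
R-- φ ψ a [] = lem (δ₀ a) (φ []) (ψ [])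
  where
  lem : ∀ x y z → x * (y - z) ≡ x * y - x * z
  lem = solve-∀
R-- φ ψ a (b ∷ e) = trans (cong₂ _-_ (R-- (λ e → φ (b ∷ e)) (λ e → ψ (b ∷ e)) a e)
    (R-- (λ e → φ ((b - + 1) ∷ e)) (λ e → ψ ((b - + 1) ∷ e)) (sc a) e))
  (lem (R (λ e → φ (b ∷ e)) a e) (R (λ e → ψ (b ∷ e)) a e) _ _)
  where
  lem : ∀ x y z w → (x - y) - (z - w) ≡ (x - z) - (y - w)
  lem = solve-∀

-- `R` only ever raises its exponent, so a positive one never returns to 0, where `δ₀` is supported.
R-pos : ∀ {n} (φ : Fn n) a e → R φ (+ suc a) e ≡ + 0
R-pos φ a [] = ℤP.*-zeroˡ (φ [])
R-pos φ a (b ∷ e) = cong₂ _-_ (R-pos (λ e → φ (b ∷ e)) a e) (R-pos (λ e → φ ((b - + 1) ∷ e)) (suc a) e)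

R-zero : ∀ {n} (φ : Fn n) e → R φ (+ 0) e ≡ φ e
R-zero φ [] = ℤP.*-identityˡ (φ [])
R-zero φ (b ∷ e) = trans (cong₂ _-_ (R-zero (λ e → φ (b ∷ e)) e) (R-pos (λ e → φ ((b - + 1) ∷ e)) 0 e)) (ℤP.+-identityʳ (φ (b ∷ e)))

-- In the kernel x_n occurs only in denominators; with the sign convention of `J` its support lies
-- where the last exponent is nonnegative.
VL : ∀ {n} → Fn (suc n) → Set
VL φ = ∀ e x → x ℤ.< + 0 → φ (e ∷ʳ x) ≡ + 0

pred<0 : ∀ {x} → x ℤ.< + 0 → x - + 1 ℤ.< + 0
pred<0 {x} p = ℤP.≤-<-trans (subst (x - + 1 ℤ.≤_) (ℤP.+-identityʳ x) (ℤP.+-monoʳ-≤ x (ℤ.-≤+ {0} {0}))) p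

R-VL : ∀ {n} {φ : Fn (suc n)} → VL φ → ∀ a → VL (R φ a)
R-VL v a [] x p = cong₂ _-_ (trans (cong (δ₀ a *_) (v [] x p)) (ℤP.*-zeroʳ (δ₀ a)))
  (trans (cong (δ₀ (sc a) *_) (v [] (x - + 1) (pred<0 p))) (ℤP.*-zeroʳ (δ₀ (sc a))))
R-VL v a (b ∷ e) x p = cong₂ _-_ (R-VL (λ e x p → v (b ∷ e) x p) a e x p) (R-VL (λ e x p → v ((b - + 1) ∷ e) x p) (sc a) e x p)

J-VL : ∀ {n} → VL (J {suc n})
J-VL [] -[1+ x ] p = refl
J-VL [] (+ x) (ℤ.+<+ ())
J-VL (a ∷ e) x p = R-VL J-VL a e x p

R-snoc : ∀ {n} {φ : Fn (suc n)} → VL φ → ∀ a e → R φ a (e ∷ʳ + 0) ≡ R (λ e → φ (e ∷ʳ + 0)) a e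
R-snoc {φ = φ} v a [] = trans (cong (λ z → δ₀ a * φ (+ 0 ∷ []) - δ₀ (sc a) * z) (v [] (-[1+ 0 ]) ℤ.-<+))
  (trans (cong (λ z → δ₀ a * φ (+ 0 ∷ []) - z) (ℤP.*-zeroʳ (δ₀ (sc a)))) (ℤP.+-identityʳ _))
R-snoc v a (b ∷ e) = cong₂ _-_ (R-snoc (λ e x p → v (b ∷ e) x p) a e) (R-snoc (λ e x p → v ((b - + 1) ∷ e) x p) (sc a) e)

J-snoc : ∀ {n} (e : Vec ℤ n) → J (e ∷ʳ + 0) ≡ J e
J-snoc [] = refl
J-snoc (a ∷ e) = trans (R-snoc J-VL a e) (R-ext J-snoc a e)

-- ∏_{i<j} (1 - x_i/x_j) is (1 - x_i/x_{i+1}) times a function symmetric in x_i, x_{i+1}.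

shiftAt : ∀ {n} → ℕ → Vec ℤ n → Vec ℤ n
shiftAt zero (a ∷ b ∷ e) = sc a ∷ (b - + 1) ∷ e
shiftAt zero e = e
shiftAt (suc i) [] = []
shiftAt (suc i) (x ∷ e) = x ∷ shiftAt i e

R-swap : ∀ {n} i (φ : Fn n) a e → R (λ e → φ (swapAt i e)) a e ≡ R φ a (swapAt i e)
R-swap zero φ a [] = refl
R-swap zero φ a (b ∷ []) = refl
R-swap zero φ a (b ∷ c ∷ e) = lem (R (λ e → φ (c ∷ b ∷ e)) a e) _ _ _
  where
  lem : ∀ x y z w → (x - y) - (z - w) ≡ (x - z) - (y - w)
  lem = solve-∀
R-swap (suc i) φ a [] = refl
R-swap (suc i) φ a (b ∷ e) = cong₂ _-_ (R-swap i (λ e → φ (b ∷ e)) a e) (R-swap i (λ e → φ ((b - + 1) ∷ e)) (sc a) e)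

R-shift : ∀ {n} i (φ : Fn n) a e → R (λ e → φ (shiftAt i e)) a e ≡ R φ a (shiftAt i e)
R-shift zero φ a [] = refl
R-shift zero φ a (b ∷ []) = refl
R-shift zero φ a (b ∷ c ∷ e) = addˡ X
  (cong (λ z → - (R (λ e → φ (z ∷ (c - + 1) ∷ e)) (sc a) e - R (λ e → φ (z ∷ (c - + 1 - + 1) ∷ e)) (sc (sc a)) e)) (lem b))
  where
  X = R (λ e → φ (sc b ∷ (c - + 1) ∷ e)) a e - R (λ e → φ (sc b ∷ (c - + 1 - + 1) ∷ e)) (sc a) e
  lem : ∀ b → + 1 + (b - + 1) ≡ (+ 1 + b) - + 1
  lem = solve-∀
R-shift (suc i) φ a [] = refl
R-shift (suc i) φ a (b ∷ e) = cong₂ _-_ (R-shift i (λ e → φ (b ∷ e)) a e) (R-shift i (λ e → φ ((b - + 1) ∷ e)) (sc a) e)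

R-R : ∀ {n} (φ : Fn n) a b e → R (R φ a) b e ≡ R (R φ b) a e
R-R φ a b [] = lem (δ₀ b) (δ₀ a) (φ [])
  where
  lem : ∀ x y z → x * (y * z) ≡ y * (x * z)
  lem = solve-∀
R-R φ a b (c ∷ e) = trans (cong₂ _-_ (R-- (R φ₀ a) (R φ₁ (sc a)) b e) (R-- (R φ₁ a) (R φ₂ (sc a)) (sc b) e))
  (trans (cong₂ _-_ (cong₂ _-_ (R-R φ₀ a b e) (R-R φ₁ (sc a) b e)) (cong₂ _-_ (R-R φ₁ a (sc b) e) (R-R φ₂ (sc a) (sc b) e)))
  (trans (lem (R (R φ₀ b) a e) _ _ _)
  (sym (cong₂ _-_ (R-- (R φ₀ b) (R φ₁ (sc b)) a e) (R-- (R φ₁ b) (R φ₂ (sc b)) (sc a) e)))))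
  where
  φ₀ φ₁ φ₂ : Fn _
  φ₀ e = φ (c ∷ e)
  φ₁ e = φ ((c - + 1) ∷ e)
  φ₂ e = φ ((c - + 1 - + 1) ∷ e)
  lem : ∀ x y z w → (x - y) - (z - w) ≡ (x - z) - (y - w)
  lem = solve-∀

record Split {n} (i : ℕ) (φ : Fn n) : Set where
  field
    symPart : Fn n
    dec : ∀ e → φ e ≡ symPart e - symPart (shiftAt i e)
    symm : ∀ e → symPart (swapAt i e) ≡ symPart e
open Split

J-split : ∀ {n} i → suc i ℕ.< n → Split i (J {n})
J-split {suc (suc n)} zero h = record { symPart = P ; dec = D ; symm = S }
  where
  -- The factor 1 - x_1/x_2 is left out; in the remaining product x_1 and x_2 enter alike, and `R-R`
  -- is this symmetry.
  P : Fn (suc (suc n))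
  P (a ∷ b ∷ e) = R (R J b) a e
  D : ∀ e → J e ≡ P e - P (shiftAt 0 e)
  D (a ∷ b ∷ e) = refl
  S : ∀ e → P (swapAt 0 e) ≡ P e
  S (a ∷ b ∷ e) = R-R J a b e
J-split {suc zero} zero (s≤s ())
J-split {suc n} (suc i) (s≤s h) = record { symPart = P ; dec = D ; symm = S }
  where
  s = J-split i h
  P : Fn (suc n)
  P (a ∷ e) = R (symPart s) a e
  D : ∀ e → J e ≡ P e - P (shiftAt (suc i) e)
  D (a ∷ e) = trans (R-ext (dec s) a e) (trans (R-- (symPart s) _ a e) (subˡ (R (symPart s) a e) (R-shift i (symPart s) a e)))
  S : ∀ e → P (swapAt (suc i) e) ≡ P e
  S (a ∷ e) = trans (sym (R-swap i (symPart s) a e)) (R-ext (symm s) a e)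

infixl 6 _⊖_
_⊖_ : ∀ {n} → Vec ℤ n → Vec ℤ n → Vec ℤ n
_⊖_ = zipWith _-_

-- Self-adjointness of π_i for the form (h , f) ↦ constant term of h f ∏_{i<j} (1 - x_i/x_j).
Π-adjoint : ∀ {n} i → suc i ℕ.< n → (φ : Fn n) → Split i φ → ∀ γ e →
  Π i (λ e → φ (e ⊖ γ)) e ≡ Π i (λ γ → φ (e ⊖ γ)) (swapAt i γ)
-- The test monomial is x^(-γ). Negating exponents reverses their order, so π_i of this monomial is
-- the signed sum `dem` at the exchanged entries of γ, which explains `swapAt`.
Π-adjoint zero h φ s (g ∷ g' ∷ γ) (a ∷ b ∷ e) = trans
  (dem-tele (λ x y → - Q (x - g) (y - + 1 - g'))
    (λ x y → trans (dec s _) (trans (cong₂ (λ u v → Q (x - g) u - Q v (y - g' - + 1)) (l₁ y g') (l₂ x g))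
       (trans (lem (Q (x - g) (sc y - + 1 - g')) _) (cong (λ u → - Q (sc x - g) u - - Q (x - g) (sc y - + 1 - g')) (l₃ y g'))))) a b)
  (trans (trans (lem' (Q (sc a - g) (b - + 1 - g')) _)
      (cong₂ (λ u v → u - Q v (b - + 1 - g'))
        (trans (symm s ((sc a - + 1 - g') ∷ (b - g) ∷ (e ⊖ γ))) (cong (λ u → Q u (b - g)) (l₄ a g')))
        refl))
  (trans (cong (λ u → Q (sc a - sc g') (b - g) - Q (sc a - g) u) (l₆ b g'))
  (sym (dem-tele (λ x y → Q (sc a - x) (b - y))
    (λ x y → trans (dec s _) (cong₂ (λ u v → Q u (b - y) - v) (l₇ a x) (cong₂ Q (l₈ a x) (l₉ b y)))) g' g))))
  where
  Q : Fn²
  Q x y = symPart s (x ∷ y ∷ (e ⊖ γ))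
  lem : ∀ u v → u - v ≡ - v - - u
  lem = solve-∀
  lem' : ∀ u v → - u - - v ≡ v - u
  lem' = solve-∀
  l₁ : ∀ y g → y - g ≡ (+ 1 + y) - + 1 - g
  l₁ = solve-∀
  l₂ : ∀ x g → + 1 + (x - g) ≡ (+ 1 + x) - g
  l₂ = solve-∀
  l₃ : ∀ y g → y - g - + 1 ≡ y - + 1 - g
  l₃ = solve-∀
  l₄ : ∀ a g → (+ 1 + a) - + 1 - g ≡ (+ 1 + a) - (+ 1 + g)
  l₄ = solve-∀
  l₆ : ∀ b g → b - + 1 - g ≡ b - (+ 1 + g)
  l₆ = solve-∀
  l₇ : ∀ a x → a - x ≡ (+ 1 + a) - (+ 1 + x)
  l₇ = solve-∀
  l₈ : ∀ a x → + 1 + (a - x) ≡ (+ 1 + a) - x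
  l₈ = solve-∀
  l₉ : ∀ b y → (b - y) - + 1 ≡ b - (+ 1 + y)
  l₉ = solve-∀
Π-adjoint zero (s≤s ()) φ s (g ∷ []) e
Π-adjoint (suc i) (s≤s h) φ s (g ∷ γ) (x ∷ e) = Π-adjoint i h (λ e → φ ((x - g) ∷ e))
  (record { symPart = λ e → symPart s ((x - g) ∷ e) ; dec = λ e → dec s ((x - g) ∷ e) ; symm = λ e → symm s ((x - g) ∷ e) }) γ e

-- `J (e ⊖ γ)` is the constant term of x^(-γ) x^e ∏_(i<j) (1 - x_i/x_j): the generators are the
-- pairings with monomials in the inverse variables. Closure under pointwise equality is a
-- constructor because functions are compared only pointwise.
data Span {n} : Fn n → Set where
  gen : ∀ γ → NN γ → Span (λ e → J (e ⊖ γ))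
  null : Span (λ _ → + 0)
  add : ∀ {τ τ'} → Span τ → Span τ' → Span (λ e → τ e + τ' e)
  sub : ∀ {τ τ'} → Span τ → Span τ' → Span (λ e → τ e - τ' e)
  ext : ∀ {τ τ'} → (∀ e → τ e ≡ τ' e) → Span τ → Span τ'

-- f ∼ g holds when f - g lies in the span of the key polynomials κ_β with β ≱ 0:
-- this subspace is the annihilator of Span.
infix 4 _∼_
record _∼_ {n} (f g : Poly n) : Set where
  constructor eqK
  field test : ∀ (χ : ℤ → ℤ) {τ : Fn n} → Span τ → ⟪ f , (λ d e → χ d * τ e) ⟫ ≡ ⟪ g , (λ d e → χ d * τ e) ⟫
open _∼_ public

∼-refl : ∀ {n} {f : Poly n} → f ∼ f
∼-refl = eqK λ _ _ → refl

∼-sym : ∀ {n} {f g : Poly n} → f ∼ g → g ∼ f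
∼-sym p = eqK λ χ s → sym (test p χ s)

∼-trans : ∀ {n} {f g h : Poly n} → f ∼ g → g ∼ h → f ∼ h
∼-trans p q = eqK λ χ s → trans (test p χ s) (test q χ s)

≋⇒∼ : ∀ {n} {f g : Poly n} → f ≋ g → f ∼ g
≋⇒∼ p = eqK λ χ s → pair p _

∼-++ : ∀ {n} {f f' g g' : Poly n} → f ∼ f' → g ∼ g' → f ++ g ∼ f' ++ g'
∼-++ {f = f} {f'} {g} {g'} p q = eqK λ χ s →
  trans (pair-++ f g _) (trans (cong₂ _+_ (test p χ s) (test q χ s)) (sym (pair-++ f' g' _)))

∼-scale : ∀ {n} c {f g : Poly n} → f ∼ g → scale c f ∼ scale c g
∼-scale c {f} {g} p = eqK λ χ s → trans (pair-scale c f _) (trans (cong (c *_) (test p χ s)) (sym (pair-scale c g _)))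

-- R in the variables γ, where decreasing an exponent e - γ means increasing γ
R↑ : ∀ {m} → Fn m → ℤ → Fn m
R↑ φ a [] = δ₀ a * φ []
R↑ φ a (b ∷ γ) = R↑ (λ γ → φ (b ∷ γ)) a γ - R↑ (λ γ → φ ((b + + 1) ∷ γ)) (sc a) γ

R↑-ext : ∀ {m} {φ ψ : Fn m} → (∀ γ → φ γ ≡ ψ γ) → ∀ a γ → R↑ φ a γ ≡ R↑ ψ a γ
R↑-ext h a [] = cong (δ₀ a *_) (h [])
R↑-ext h a (b ∷ γ) = cong₂ _-_ (R↑-ext (λ γ → h (b ∷ γ)) a γ) (R↑-ext (λ γ → h ((b + + 1) ∷ γ)) (sc a) γ)

R-R↑ : ∀ {m} (φ : Fn m) a (e γ : Vec ℤ m) → R φ a (e ⊖ γ) ≡ R↑ (λ γ → φ (e ⊖ γ)) a γ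
R-R↑ φ a [] [] = refl
R-R↑ φ a (x ∷ e) (g ∷ γ) = cong₂ _-_ (R-R↑ (λ e → φ ((x - g) ∷ e)) a e γ)
  (trans (R-R↑ (λ e → φ ((x - g - + 1) ∷ e)) (sc a) e γ)
    (R↑-ext (λ γ → cong (λ z → φ (z ∷ (e ⊖ γ))) (lem x g)) (sc a) γ))
  where
  lem : ∀ x g → x - g - + 1 ≡ x - (g + + 1)
  lem = solve-∀

-- Closure of Span under the transposed operators. A family of functions indexed by
-- exponents γ is closed under the operators acting on γ, as these only use γ ≥ 0.

module _ {n} (P : Fn n → Set) (P-null : P (λ _ → + 0)) (P-add : ∀ {τ τ'} → P τ → P τ' → P (λ e → τ e + τ' e))
  (P-sub : ∀ {τ τ'} → P τ → P τ' → P (λ e → τ e - τ' e)) (P-ext : ∀ {τ τ'} → (∀ e → τ e ≡ τ' e) → P τ → P τ') where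

  ∫-closed : ∀ (F : ℤ → Fn n) m → (∀ t → t ℕ.< m → P (F (+ t))) → P (λ e → ∫ (λ k → F k e) (+ m))
  ∫-closed F zero h = P-null
  ∫-closed F (suc m) h = P-add (∫-closed F m (λ t p → h t (ℕP.m≤n⇒m≤1+n p))) (h m ℕP.≤-refl)

  Π-closed : ∀ {m} i (H : Vec ℤ m → Fn n) → (∀ γ → NN γ → P (H γ)) → ∀ γ → NN γ → P (λ e → Π i (λ γ → H γ e) γ)
  Π-closed zero H h [] p = h [] p
  Π-closed zero H h (a ∷ []) p = h (a ∷ []) p
  Π-closed zero H h (+ a ∷ + b ∷ γ) (_ , _ , p) =
    P-sub (∫-closed F (suc a) (λ t q → hF t (ℕP.≤-trans (ℕ.s≤s⁻¹ q) (ℕP.m≤m+n a b))))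
          (∫-closed F b (λ t q → hF t (ℕP.≤-trans (ℕP.<⇒≤ q) (ℕP.m≤n+m b a))))
    where
    F : ℤ → Fn n
    F k = H (k ∷ (+ a + + b - k) ∷ γ)
    hF : ∀ t → t ℕ.≤ a ℕ.+ b → P (F (+ t))
    hF t q = h _ (ℤ.+≤+ z≤n , ℤP.i≤j⇒0≤j-i (ℤ.+≤+ q) , p)
  Π-closed zero H h (-[1+ a ] ∷ b ∷ γ) (() , _)
  Π-closed zero H h (+ a ∷ -[1+ b ] ∷ γ) (_ , () , _)
  Π-closed (suc i) H h [] p = h [] p
  Π-closed (suc i) H h (x ∷ γ) (q , p) = Π-closed i (λ γ → H (x ∷ γ)) (λ γ p → h (x ∷ γ) (q , p)) γ p

  R↑-closed : ∀ {m} (H : Vec ℤ m → Fn n) → (∀ γ → NN γ → P (H γ)) → ∀ a γ → NN γ → P (λ e → R↑ (λ γ → H γ e) a γ)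
  R↑-closed H h (+ zero) [] p = P-ext (λ e → sym (ℤP.*-identityˡ (H [] e))) (h [] tt)
  R↑-closed H h (+ suc a) [] p = P-ext (λ e → sym (ℤP.*-zeroˡ (H [] e))) P-null
  R↑-closed H h -[1+ a ] [] p = P-ext (λ e → sym (ℤP.*-zeroˡ (H [] e))) P-null
  R↑-closed H h a (b ∷ γ) (q , p) = P-sub
    (R↑-closed (λ γ → H (b ∷ γ)) (λ γ p → h (b ∷ γ) (q , p)) a γ p)
    (R↑-closed (λ γ → H ((b + + 1) ∷ γ)) (λ γ p → h ((b + + 1) ∷ γ) (ℤP.≤-trans q (ℤP.i≤i+j b (+ 1)) , p)) (sc a) γ p)

Span-Π : ∀ {n} i → suc i ℕ.< n → {τ : Fn n} → Span τ → Span (Π i τ)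
Span-Π i h (gen γ p) = ext (λ e → sym (Π-adjoint i h J (J-split i h) γ e))
  (Π-closed Span null add sub ext i (λ γ e → J (e ⊖ γ)) gen (swapAt i γ) (NN-swap i γ p))
Span-Π i h null = ext (λ e → sym (Π-0 e)) null
  where
  Π-0 : ∀ e → Π i (λ _ → + 0) e ≡ + 0
  Π-0 e = trans (Π-- i (λ _ → + 0) (λ _ → + 0) e) (ℤP.+-inverseʳ (Π i (λ _ → + 0) e))
Span-Π i h (add s s') = ext (λ e → sym (Π-+ i _ _ e)) (add (Span-Π i h s) (Span-Π i h s'))
Span-Π i h (sub s s') = ext (λ e → sym (Π-- i _ _ e)) (sub (Span-Π i h s) (Span-Π i h s'))
Span-Π i h (ext q s) = ext (Π-ext i q) (Span-Π i h s)

Span-VL : ∀ {n} {τ : Fn (suc n)} → Span τ → VL τ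
Span-VL (gen γ p) e x q = go γ p
  where
  snoc-⊖ : ∀ {n} (e γ : Vec ℤ n) x g → (e ∷ʳ x) ⊖ (γ ∷ʳ g) ≡ (e ⊖ γ) ∷ʳ (x - g)
  snoc-⊖ [] [] x g = refl
  snoc-⊖ (y ∷ e) (h ∷ γ) x g = cong ((y - h) ∷_) (snoc-⊖ e γ x g)
  go : ∀ γ → NN γ → J ((e ∷ʳ x) ⊖ γ) ≡ + 0
  go = snoc-elim _ λ γ g p → trans (cong J (snoc-⊖ e γ x g)) (J-VL (e ⊖ γ) (x - g)
    (ℤP.≤-<-trans (subst (x - g ℤ.≤_) (ℤP.+-identityʳ x) (ℤP.+-monoʳ-≤ x (ℤP.neg-mono-≤ (proj₂ (NN-∷ʳ⁻ γ g p))))) q))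
Span-VL null e x q = refl
Span-VL (add s s') e x q = cong₂ _+_ (Span-VL s e x q) (Span-VL s' e x q)
Span-VL (sub s s') e x q = cong₂ _-_ (Span-VL s e x q) (Span-VL s' e x q)
Span-VL (ext h s) e x q = trans (sym (h _)) (Span-VL s e x q)

-- With the first exponent fixed, the kernel is `R J` in the other variables. Lowering e - γ there
-- is the same as raising γ, which stays nonnegative, so only generators occur.
Span-cons : ∀ {n} {τ : Fn (suc n)} a → Span τ → Span (λ e → τ (a ∷ e))
Span-cons a (gen (g ∷ γ) (_ , p)) = ext (λ e → sym (R-R↑ J (a - g) e γ))
  (R↑-closed Span null add sub ext (λ γ e → J (e ⊖ γ)) gen (a - g) γ p)
Span-cons a null = null
Span-cons a (add s s') = add (Span-cons a s) (Span-cons a s')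
Span-cons a (sub s s') = sub (Span-cons a s) (Span-cons a s')
Span-cons a (ext h s) = ext (λ e → h (a ∷ e)) (Span-cons a s)

Span-R : ∀ {n} a γ → NN γ → Span {n} (λ e → R J a (e ⊖ γ))
Span-R a γ p = ext (λ e → cong (λ z → R J z (e ⊖ γ)) (ℤP.+-identityʳ a)) (Span-cons a (gen (+ 0 ∷ γ) (ℤ.+≤+ z≤n , p)))

-- An appended 0 meets either a last entry 0 of γ, where `J-snoc` forgets the variable, or a
-- positive one, where `J-VL` gives 0.
Span-snoc : ∀ {n} {τ : Fn (suc n)} → Span τ → Span (λ e → τ (e ∷ʳ + 0))
Span-snoc (gen γ p) = go γ p
  where
  snoc-⊖ : ∀ {n} (e γ : Vec ℤ n) x g → (e ∷ʳ x) ⊖ (γ ∷ʳ g) ≡ (e ⊖ γ) ∷ʳ (x - g)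
  snoc-⊖ [] [] x g = refl
  snoc-⊖ (y ∷ e) (h ∷ γ) x g = cong ((y - h) ∷_) (snoc-⊖ e γ x g)
  go : ∀ γ → NN γ → Span (λ e → J ((e ∷ʳ + 0) ⊖ γ))
  go = snoc-elim _ λ { γ (+ zero) p → ext (λ e → sym (trans (cong J (snoc-⊖ e γ (+ 0) (+ 0))) (J-snoc (e ⊖ γ)))) (gen γ (proj₁ (NN-∷ʳ⁻ γ _ p)))
                     ; γ (+ suc g) p → ext (λ e → sym (trans (cong J (snoc-⊖ e γ (+ 0) (+ suc g))) (J-VL (e ⊖ γ) -[1+ g ] ℤ.-<+))) null
                     ; γ -[1+ g ] p → ⊥-elim (absurd (proj₂ (NN-∷ʳ⁻ γ _ p))) }
    where
    absurd : ∀ {g} → ¬ (+ 0 ℤ.≤ -[1+ g ])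
    absurd ()
Span-snoc null = null
Span-snoc (add s s') = add (Span-snoc s) (Span-snoc s')
Span-snoc (sub s s') = sub (Span-snoc s) (Span-snoc s')
Span-snoc (ext h s) = ext (λ e → h (e ∷ʳ + 0)) (Span-snoc s)

dn : ∀ {n} → ℕ → Vec ℤ n → Vec ℤ n
dn j [] = []
dn zero (x ∷ e) = (x - + 1) ∷ e
dn (suc j) (x ∷ e) = x ∷ dn j e

up : ∀ {n} → ℕ → Vec ℤ n → Vec ℤ n
up j [] = []
up zero (x ∷ e) = (x + + 1) ∷ e
up (suc j) (x ∷ e) = x ∷ up j e

Span-dn : ∀ {n} j {τ : Fn n} → Span τ → Span (λ e → τ (dn j e))
Span-dn j (gen γ p) = ext (λ e → cong J (dn-up j e γ)) (gen (up j γ) (NN-up j γ p))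
  where
  dn-up : ∀ {n} j (e γ : Vec ℤ n) → e ⊖ up j γ ≡ dn j e ⊖ γ
  dn-up j [] [] = refl
  dn-up zero (x ∷ e) (g ∷ γ) = cong (_∷ (e ⊖ γ)) (lem x g)
    where
    lem : ∀ x g → x - (g + + 1) ≡ x - + 1 - g
    lem = solve-∀
  dn-up (suc j) (x ∷ e) (g ∷ γ) = cong ((x - g) ∷_) (dn-up j e γ)
  NN-up : ∀ {n} j (γ : Vec ℤ n) → NN γ → NN (up j γ)
  NN-up j [] p = p
  NN-up zero (g ∷ γ) (q , p) = ℤP.≤-trans q (ℤP.i≤i+j g (+ 1)) , p
  NN-up (suc j) (g ∷ γ) (q , p) = q , NN-up j γ p
Span-dn j null = null
Span-dn j (add s s') = add (Span-dn j s) (Span-dn j s')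
Span-dn j (sub s s') = sub (Span-dn j s) (Span-dn j s')
Span-dn j (ext h s) = ext (λ e → h (dn j e)) (Span-dn j s)

∼-piOp : ∀ {n} i → suc i ℕ.< n → {f g : Poly n} → f ∼ g → piOp i f ∼ piOp i g
∼-piOp i h {f} {g} p = eqK λ χ {τ} s → trans (move χ τ f) (trans (test p χ (Span-Π i h s)) (sym (move χ τ g)))
  where
  Π-* : ∀ {n} i c (τ : Fn n) e → Π i (λ e → c * τ e) e ≡ c * Π i τ e
  Π-* zero c τ [] = refl
  Π-* zero c τ (a ∷ []) = refl
  Π-* zero c τ (a ∷ b ∷ e) = trans (dem-tele (λ x y → c * ψ x y) (λ x y → trans (cong (c *_) (primitive²-spec τ' x y)) (lem c _ _)) a b)
    (trans (sym (lem c _ _)) (cong (c *_) (sym (dem-tele ψ (primitive²-spec τ') a b))))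
    where
    τ' : Fn²
    τ' x y = τ (x ∷ y ∷ e)
    ψ = primitive² τ'
    lem : ∀ c x y → c * (x - y) ≡ c * x - c * y
    lem = solve-∀
  Π-* (suc i) c τ [] = refl
  Π-* (suc i) c τ (x ∷ e) = Π-* i c (λ e → τ (x ∷ e)) e
  move : ∀ χ τ f → ⟪ piOp i f , (λ d e → χ d * τ e) ⟫ ≡ ⟪ f , (λ d e → χ d * Π i τ e) ⟫
  move χ τ f = trans (pair-piOp i h f _) (pair-ext f (λ d e → Π-* i (χ d) τ e))

∼-piWord : ∀ {n} w → Valid n w → {f g : Poly n} → f ∼ g → piWord w f ∼ piWord w g
∼-piWord [] _ p = p
∼-piWord (i ∷ w) (h ∷ v) p = ∼-piOp i h (∼-piWord w v p)

cons : ∀ {n} → ℤ → Poly n → Poly (suc n)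
cons a = map (λ { (c , d , e) → (c , d , a ∷ e) })

snoc₀ : ∀ {n} → Poly n → Poly (suc n)
snoc₀ = map (λ { (c , d , e) → (c , d , e ∷ʳ + 0) })

X⁻ : ∀ {n} → ℕ → Poly n → Poly n
X⁻ j = map (λ { (c , d , e) → (c , d , dn j e) })

pair-cons : ∀ {n} a (f : Poly n) φ → ⟪ cons a f , φ ⟫ ≡ ⟪ f , (λ d e → φ d (a ∷ e)) ⟫
pair-cons a f φ = pair-map (λ d _ → d) (λ _ e → a ∷ e) _ (λ _ _ _ → refl) f φ

pair-snoc₀ : ∀ {n} (f : Poly n) φ → ⟪ snoc₀ f , φ ⟫ ≡ ⟪ f , (λ d e → φ d (e ∷ʳ + 0)) ⟫
pair-snoc₀ f φ = pair-map (λ d _ → d) (λ _ e → e ∷ʳ + 0) _ (λ _ _ _ → refl) f φ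

pair-X⁻ : ∀ {n} j (f : Poly n) φ → ⟪ X⁻ j f , φ ⟫ ≡ ⟪ f , (λ d e → φ d (dn j e)) ⟫
pair-X⁻ j f φ = pair-map (λ d _ → d) (λ _ e → dn j e) _ (λ _ _ _ → refl) f φ

∼-cons : ∀ {n} a {f g : Poly n} → f ∼ g → cons a f ∼ cons a g
∼-cons a {f} {g} p = eqK λ χ s → trans (pair-cons a f _) (trans (test p χ (Span-cons a s)) (sym (pair-cons a g _)))

∼-snoc₀ : ∀ {n} {f g : Poly n} → f ∼ g → snoc₀ f ∼ snoc₀ g
∼-snoc₀ {f = f} {g} p = eqK λ χ s → trans (pair-snoc₀ f _) (trans (test p χ (Span-snoc s)) (sym (pair-snoc₀ g _)))

∼-X⁻ : ∀ {n} j {f g : Poly n} → f ∼ g → X⁻ j f ∼ X⁻ j g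
∼-X⁻ j {f} {g} p = eqK λ χ s → trans (pair-X⁻ j f _) (trans (test p χ (Span-dn j s)) (sym (pair-X⁻ j g _)))

-- equality modulo monomials with negative last exponent
infix 4 _≃_
record _≃_ {n} (f g : Poly (suc n)) : Set where
  constructor eqL
  field pairL : ∀ φ → (∀ d → VL (φ d)) → ⟪ f , φ ⟫ ≡ ⟪ g , φ ⟫
open _≃_ public

≃⇒∼ : ∀ {n} {f g : Poly (suc n)} → f ≃ g → f ∼ g
≃⇒∼ p = eqK λ χ s → pairL p _ λ d e x q → trans (cong (χ d *_) (Span-VL s e x q)) (ℤP.*-zeroʳ (χ d))

-- Nonnegative polynomials are separated modulo K

NNT : ∀ {n} → Term n → Set
NNT (c , d , e) = NN e

AllNN : ∀ {n} → Poly n → Set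
AllNN = All NNT

slice : ∀ {n} → ℤ → Poly (suc n) → Poly n
slice a [] = []
slice a ((c , d , x ∷ e) ∷ h) = if x ==ℤ a then (c , d , e) ∷ slice a h else slice a h

AllNN-slice : ∀ {n} a {h : Poly (suc n)} → AllNN h → AllNN (slice a h)
AllNN-slice a [] = []
AllNN-slice a {(c , d , x ∷ e) ∷ h} ((_ , p) ∷ ps) with x ==ℤ a
... | true = p ∷ AllNN-slice a ps
... | false = AllNN-slice a ps

infixl 6 _∖_
_∖_ : ∀ {n} → (ℤ → Fn (suc n)) → ℤ → ℤ → Fn (suc n)
(φ ∖ a) d (x ∷ e) = if x ==ℤ a then + 0 else φ d (x ∷ e)

slice-split : ∀ {n} a (h : Poly (suc n)) φ → ⟪ h , φ ⟫ ≡ ⟪ slice a h , (λ d e → φ d (a ∷ e)) ⟫ + ⟪ h , φ ∖ a ⟫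
slice-split a [] φ = refl
slice-split a ((c , d , x ∷ e) ∷ h) φ with x ℤ.≟ a
... | yes refl = trans (addˡ (c * φ d (x ∷ e)) (slice-split a h φ)) (lem c (φ d (x ∷ e)) _ _)
  where
  lem : ∀ c x y z → c * x + (y + z) ≡ (c * x + y) + (c * + 0 + z)
  lem = solve-∀
... | no _ = trans (addˡ (c * φ d (x ∷ e)) (slice-split a h φ))
  (lem c (φ d (x ∷ e)) ⟪ slice a h , (λ d e → φ d (a ∷ e)) ⟫ ⟪ h , φ ∖ a ⟫)
  where
  lem : ∀ c x y z → c * x + (y + z) ≡ y + (c * x + z)
  lem = solve-∀

∖-≢ : ∀ {n} (φ : ℤ → Fn (suc n)) a x d e → x ≢ a → (φ ∖ a) d (x ∷ e) ≡ φ d (x ∷ e)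
∖-≢ φ a x d e ne rewrite dec-false (x ℤ.≟ a) ne = refl

∖-≡ : ∀ {n} (φ : ℤ → Fn (suc n)) a d e → (φ ∖ a) d (a ∷ e) ≡ + 0
∖-≡ φ a d e rewrite dec-true (a ℤ.≟ a) refl = refl

+-inj : ∀ {a b} → + a ≡ + b → a ≡ b
+-inj refl = refl

-- The list has only finitely many first exponents, and the slices are discarded from the largest
-- downwards. The alternative `φ d e ≡ + 0` allows a treated slice to be masked in φ by `_∖_`
-- instead of being removed from h.
slices-null : ∀ {n} B (h : Poly (suc n)) φ → AllNN h →
  All (λ { (c , d , e) → head e ℤ.< + B ⊎ φ d e ≡ + 0 }) h →
  (∀ a → a ℕ.< B → ⟪ slice (+ a) h , (λ d e → φ d (+ a ∷ e)) ⟫ ≡ + 0) → ⟪ h , φ ⟫ ≡ + 0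
slices-null zero h φ p q s = trans (pair-extAll {ψ = λ _ _ → + 0} (All.zip (p , q)) van) (pair-0 h (λ _ _ → refl))
  where
  van : ∀ c d e → NN e × (head e ℤ.< + 0 ⊎ φ d e ≡ + 0) → φ d e ≡ + 0
  van c d (x ∷ e) ((n , _) , inj₁ l) = ⊥-elim (ℤP.<⇒≱ l n)
  van c d e (_ , inj₂ z) = z
slices-null (suc B) h φ p q s = trans (slice-split (+ B) h φ)
  (cong₂ _+_ (s B ℕP.≤-refl) (slices-null B h (φ ∖ + B) p (All.map (λ { {c , d , e} → below d e }) q)
    (λ a l → trans (pair-ext (slice (+ a) h) (λ d e → ∖-≢ φ (+ B) (+ a) d e (λ eq → ℕP.<⇒≢ l (+-inj eq)))) (s a (ℕP.m≤n⇒m≤1+n l)))))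
  where
  below : ∀ d e → head e ℤ.< + suc B ⊎ φ d e ≡ + 0 → head e ℤ.< + B ⊎ (φ ∖ + B) d e ≡ + 0
  below d (x ∷ e) r with x ℤ.≟ + B
  ... | yes refl = inj₂ refl
  below d (x ∷ e) (inj₂ z) | no ne = inj₂ z
  below d (x ∷ e) (inj₁ l) | no ne = inj₁ (ℤP.≤∧≢⇒< (ℤP.i<j⇒i≤pred[j] l) ne)

bounded : ∀ {n} (h : Poly (suc n)) → ∃ λ B → All (λ { (c , d , e) → head e ℤ.< + B }) h
bounded [] = 0 , []
bounded ((c , d , x ∷ e) ∷ h) with bounded h
... | B , p = suc ∣ x ∣ ℕ.+ B , below x B ∷ All.map (λ { {c , d , e} l → ℤP.<-≤-trans l (ℤ.+≤+ (ℕP.m≤n+m B (suc ∣ x ∣))) }) p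
  where
  below : ∀ x B → x ℤ.< + (suc ∣ x ∣ ℕ.+ B)
  below (+ x) B = ℤ.+<+ (s≤s (ℕP.m≤m+n x B))
  below -[1+ x ] B = ℤ.-<+

fromGens : ∀ {n} (f : Poly n) → (∀ χ γ → NN γ → ⟪ f , (λ d e → χ d * J (e ⊖ γ)) ⟫ ≡ + 0) → f ∼ []
fromGens f h = eqK go
  where
  go : ∀ χ {τ} → Span τ → ⟪ f , (λ d e → χ d * τ e) ⟫ ≡ + 0
  go χ (gen γ p) = h χ γ p
  go χ null = pair-0 f (λ d e → ℤP.*-zeroʳ (χ d))
  go χ (add s s') = trans (pair-ext f (λ d e → ℤP.*-distribˡ-+ (χ d) _ _)) (trans (pair-+ f _ _) (cong₂ _+_ (go χ s) (go χ s')))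
  go χ (sub {τ} {τ'} s s') = trans (pair-ext f (λ d e → lem (χ d) (τ e) (τ' e))) (trans (pair-- f _ _) (cong₂ _-_ (go χ s) (go χ s')))
    where
    lem : ∀ c x y → c * (x - y) ≡ c * x - c * y
    lem = solve-∀
  go χ (ext q s) = trans (pair-ext f (λ d e → cong (χ d *_) (sym (q e)))) (go χ s)

-- Triangularity in the first exponent x. Tested against g ∷ γ, the terms with x > g vanish by
-- `R-pos`, those with x = g give the generator γ in the remaining variables, and those with x < g
-- vanish by induction on g, the tests on them lying in `Span` by `Span-R`. So every slice is
-- congruent to 0 in one variable fewer.
nn-null : ∀ n (h : Poly n) → AllNN h → h ∼ [] → ∀ φ → ⟪ h , φ ⟫ ≡ + 0
nn-null zero h p t φ = trans (pair-ext h (λ { d [] → sym (ℤP.*-identityʳ (φ d [])) })) (test t (λ d → φ d []) (gen [] tt))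
nn-null (suc n) h p t φ = slices-null (proj₁ (bounded h)) h φ p (All.map (λ { {c , d , e} → inj₁ }) (proj₂ (bounded h)))
  (λ a _ → nn-null n (slice (+ a) h) (AllNN-slice (+ a) p) (slice∼ (suc a) a ℕP.≤-refl) _)
  where
  slice∼ : ∀ G g → g ℕ.< G → slice (+ g) h ∼ []
  slice∼ (suc G) g (s≤s l) = fromGens (slice (+ g) h) main
    where
    main : ∀ χ γ → NN γ → ⟪ slice (+ g) h , (λ d e → χ d * J (e ⊖ γ)) ⟫ ≡ + 0
    main χ γ pγ = begin
      ⟪ slice (+ g) h , (λ d e → χ d * J (e ⊖ γ)) ⟫
        ≡⟨ pair-ext (slice (+ g) h) (λ d e → cong (χ d *_)
             (sym (trans (cong (λ z → R J z (e ⊖ γ)) (ℤP.+-inverseʳ (+ g))) (R-zero J (e ⊖ γ))))) ⟩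
      ⟪ slice (+ g) h , (λ d e → ψ d (+ g ∷ e)) ⟫
        ≡⟨ sym (ℤP.+-identityʳ _) ⟩
      ⟪ slice (+ g) h , (λ d e → ψ d (+ g ∷ e)) ⟫ + + 0
        ≡⟨ addˡ ⟪ slice (+ g) h , (λ d e → ψ d (+ g ∷ e)) ⟫ (sym (slices-null g h (ψ ∖ + g) p (All.map (λ { {c , d , e} q → above d e q }) p) smaller)) ⟩
      ⟪ slice (+ g) h , (λ d e → ψ d (+ g ∷ e)) ⟫ + ⟪ h , ψ ∖ + g ⟫
        ≡⟨ sym (slice-split (+ g) h ψ) ⟩
      ⟪ h , ψ ⟫
        ≡⟨ test t χ (gen (+ g ∷ γ) (ℤ.+≤+ z≤n , pγ)) ⟩
      + 0 ∎
      where
      open ≡-Reasoning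
      ψ : ℤ → Fn (suc n)
      ψ d e = χ d * J (e ⊖ (+ g ∷ γ))
      above : ∀ d e → NN e → head e ℤ.< + g ⊎ (ψ ∖ + g) d e ≡ + 0
      above d (+ x ∷ e) _ with ℕP.<-cmp x g
      ... | tri< x<g _ _ = inj₁ (ℤ.+<+ x<g)
      ... | tri≈ _ refl _ = inj₂ (∖-≡ ψ (+ g) d e)
      ... | tri> _ ne g<x = inj₂ (trans (∖-≢ ψ (+ g) (+ x) d e (λ eq → ne (+-inj eq)))
            (trans (cong (χ d *_) (pos g<x)) (ℤP.*-zeroʳ (χ d))))
        where
        pos : ∀ {x} → g ℕ.< x → R J (+ x - + g) (e ⊖ γ) ≡ + 0
        pos g<x with ℕP.m≤n⇒∃[o]m+o≡n g<x
        ... | o , refl = trans (cong (λ z → R J z (e ⊖ γ)) (lem (+ g) (+ o))) (R-pos J o (e ⊖ γ))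
          where
          lem : ∀ g o → + 1 + (g + o) - g ≡ + 1 + o
          lem = solve-∀
      smaller : ∀ a → a ℕ.< g → ⟪ slice (+ a) h , (λ d e → (ψ ∖ + g) d (+ a ∷ e)) ⟫ ≡ + 0
      smaller a a<g = trans (pair-ext (slice (+ a) h) (λ d e → ∖-≢ ψ (+ g) (+ a) d e (λ eq → ℕP.<⇒≢ a<g (+-inj eq))))
        (test (slice∼ G a (ℕP.<-≤-trans a<g l)) χ (Span-R (+ a - + g) γ pγ))

NNT-scale : ∀ {n} c {f : Poly n} → AllNN f → AllNN (scale c f)
NNT-scale c [] = []
NNT-scale c (p ∷ ps) = p ∷ NNT-scale c ps

nonneg-separated : ∀ {n} {f g : Poly n} → AllNN f → AllNN g → f ∼ g → f ≋ g
nonneg-separated {n} {f} {g} pf pg h = eqP λ φ → -≡0 _ _ (trans (addˡ ⟪ f , φ ⟫ (sym (pair-scale (- (+ 1)) g φ)))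
  (trans (sym (pair-++ f (negP g) φ)) (nn-null n (f ++ negP g) (AllP.++⁺ pf (NNT-scale (- (+ 1)) pg)) null∼ φ)))
  where
  null∼ : f ++ negP g ∼ []
  null∼ = eqK λ χ {τ} s → trans (pair-++ f (negP g) _)
    (trans (cong₂ _+_ (test h χ s) (pair-scale (- (+ 1)) g _)) (lem ⟪ g , (λ d e → χ d * τ e) ⟫))
    where
    lem : ∀ x → x + - (+ 1) * x ≡ + 0
    lem = solve-∀

intRange-bounds : ∀ lo hi → All (λ k → lo ℤ.≤ k × k ℤ.≤ hi) (intRange lo hi)
intRange-bounds lo hi with lo ℤ.≤? hi
... | no _ = []
... | yes p = AllP.applyUpTo⁺₁ (λ t → lo + + t) (suc ∣ hi - lo ∣) λ {t} l →
  ℤP.i≤i+j lo (+ t) , subst (lo + + t ℤ.≤_) (trans (addˡ lo (ℤP.0≤i⇒+∣i∣≡i (ℤP.i≤j⇒0≤j-i p))) (lem lo hi))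
    (ℤP.+-monoʳ-≤ lo (ℤ.+≤+ (ℕ.s≤s⁻¹ l)))
  where
  lem : ∀ x y → x + (y - x) ≡ y
  lem = solve-∀

NN-get : ∀ {n} i (e : Vec ℤ n) → NN e → + 0 ℤ.≤ getAt i e
NN-get i [] p = ℤ.+≤+ z≤n
NN-get zero (x ∷ e) (p , _) = p
NN-get (suc i) (x ∷ e) (_ , p) = NN-get i e p

NN-setPair : ∀ {n} i a b (e : Vec ℤ n) → + 0 ℤ.≤ a → + 0 ℤ.≤ b → NN e → NN (setPair i a b e)
NN-setPair zero a b [] p q r = r
NN-setPair zero a b (x ∷ []) p q r = r
NN-setPair zero a b (x ∷ y ∷ e) p q (_ , _ , r) = p , q , r
NN-setPair (suc i) a b [] p q r = r
NN-setPair (suc i) a b (x ∷ e) p q (s , r) = s , NN-setPair i a b e p q r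

AllNN-piTerm : ∀ {n} i (t : Term n) → NNT t → AllNN (piTerm i t)
AllNN-piTerm i (c , d , e) p with getAt (suc i) e ℤ.≤? getAt i e in eq
... | yes b≤a = AllP.map⁺ (All.map (λ { {k} (l , u) → NN-setPair i k (a + b - k) e (ℤP.≤-trans pb l) (nn l u) p }) range)
  where
  a = getAt i e
  b = getAt (suc i) e
  pb = NN-get (suc i) e p
  range : All (λ k → b ℤ.≤ k × k ℤ.≤ a) (applyUpTo (λ t → b + + t) (suc ∣ a - b ∣))
  range = subst (λ z → All (λ k → b ℤ.≤ k × k ℤ.≤ a) (if z then applyUpTo (λ t → b + + t) (suc ∣ a - b ∣) else [])) (cong does eq) (intRange-bounds b a)
  nn : ∀ {k} → b ℤ.≤ k → k ℤ.≤ a → + 0 ℤ.≤ a + b - k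
  nn {k} l u = subst (+ 0 ℤ.≤_) (lem a b k) (ℤP.+-mono-≤ {+ 0} {b} {+ 0} {a - k} pb (ℤP.i≤j⇒0≤j-i u))
    where
    lem : ∀ a b k → b + (a - k) ≡ a + b - k
    lem = solve-∀
... | no _ = AllP.map⁺ (All.map (λ { {k} (l , u) → NN-setPair i k (a + b - k) e (ℤP.≤-trans (ℤP.≤-trans pa (ℤP.i≤i+j a (+ 1))) l) (nn u) p })
    (intRange-bounds (a + + 1) (b - + 1)))
  where
  a = getAt i e
  b = getAt (suc i) e
  pa = NN-get i e p
  nn : ∀ {k} → k ℤ.≤ b - + 1 → + 0 ℤ.≤ a + b - k
  nn {k} u = subst (+ 0 ℤ.≤_) (lem a b k) (ℤP.+-mono-≤ {+ 0} {a + + 1} {+ 0} {b - + 1 - k} (ℤP.≤-trans pa (ℤP.i≤i+j a (+ 1))) (ℤP.i≤j⇒0≤j-i u))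
    where
    lem : ∀ a b k → a + + 1 + (b - + 1 - k) ≡ a + b - k
    lem = solve-∀

AllNN-piOp : ∀ {n} i (f : Poly n) → AllNN f → AllNN (piOp i f)
AllNN-piOp i [] [] = []
AllNN-piOp i (t ∷ f) (p ∷ ps) = AllP.++⁺ (AllNN-piTerm i t p) (AllNN-piOp i f ps)

AllNN-piWord : ∀ {n} w (f : Poly n) → AllNN f → AllNN (piWord w f)
AllNN-piWord [] f p = p
AllNN-piWord (i ∷ w) f p = AllNN-piOp i (piWord w f) (AllNN-piWord w f p)


-- Every Laurent polynomial is congruent to a polynomial

HasPoly : ∀ {n} → Poly n → Set
HasPoly f = ∃ λ p → AllNN p × f ∼ p

has-++ : ∀ {n} {f g : Poly n} → HasPoly f → HasPoly g → HasPoly (f ++ g)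
has-++ (p , a , s) (q , b , t) = p ++ q , AllP.++⁺ a b , ∼-++ s t

has-∼ : ∀ {n} {f g : Poly n} → f ∼ g → HasPoly g → HasPoly f
has-∼ h (p , a , s) = p , a , ∼-trans h s

has-neg : ∀ {n} {f : Poly n} → HasPoly f → HasPoly (negP f)
has-neg (p , a , s) = negP p , NNT-scale (- (+ 1)) a , ∼-scale (- (+ 1)) s

AllNN-cons : ∀ {n} a {f : Poly n} → + 0 ℤ.≤ a → AllNN f → AllNN (cons a f)
AllNN-cons a h [] = []
AllNN-cons a h (p ∷ ps) = (h , p) ∷ AllNN-cons a h ps

has-cons : ∀ {n} a {f : Poly n} → + 0 ℤ.≤ a → HasPoly f → HasPoly (cons a f)
has-cons a h (p , q , s) = cons a p , AllNN-cons a h q , ∼-cons a s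

has-piOp : ∀ {n} i → suc i ℕ.< n → {f : Poly n} → HasPoly f → HasPoly (piOp i f)
has-piOp i h (p , q , s) = piOp i p , AllNN-piOp i p q , ∼-piOp i h s

VL-null : ∀ {n} c d (e : Vec ℤ n) x → x ℤ.< + 0 → (c , d , e ∷ʳ x) ∷ [] ≃ []
VL-null c d e x p = eqL λ φ v → trans (ℤP.+-identityʳ _) (trans (cong (c *_) (v d e x p)) (ℤP.*-zeroʳ c))

-- x_j^{-1} x_{j+1}^b is expressed by π_j(x_j^b x_{j+1}^{-1}).
has-dn₀ : ∀ {n} c d b (e : Vec ℤ n) → NN e →
  HasPoly ((c , d , + b ∷ -[1+ 0 ] ∷ e) ∷ []) → HasPoly ((c , d , -[1+ 0 ] ∷ + b ∷ e) ∷ [])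
has-dn₀ {n} c d b e r hasM =
  has-∼ (≋⇒∼ formula) (has-++ (has-piOp 0 (s≤s (s≤s z≤n)) hasM) (has-neg (has-++ hasM (_ , AllP.map⁺ range , ∼-refl))))
  where
  M : Poly (suc (suc n))
  M = (c , d , + b ∷ -[1+ 0 ] ∷ e) ∷ []
  L : Poly (suc (suc n))
  L = map (λ k → (c , d , k ∷ (+ b - + 1 - k) ∷ e)) (applyUpTo (λ t → + t) b)
  range : All (λ k → NN (k ∷ (+ b - + 1 - k) ∷ e)) (applyUpTo (λ t → + t) b)
  range = AllP.applyUpTo⁺₁ (λ t → + t) b λ {t} l → ℤ.+≤+ z≤n ,
    subst (+ 0 ℤ.≤_) (lem (+ b) (+ t)) (ℤP.i≤j⇒0≤j-i (ℤ.+≤+ l)) , r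
    where
    lem : ∀ b t → b - (+ 1 + t) ≡ b - + 1 - t
    lem = solve-∀
  formula : (c , d , -[1+ 0 ] ∷ + b ∷ e) ∷ [] ≋ piOp 0 M ++ negP (M ++ L)
  formula = eqP λ φ → let F = λ k → φ d (k ∷ (+ b - + 1 - k) ∷ e) in sym (begin
    ⟪ piOp 0 M ++ negP (M ++ L) , φ ⟫
      ≡⟨ pair-++ (piOp 0 M) (negP (M ++ L)) φ ⟩
    ⟪ piOp 0 M , φ ⟫ + ⟪ negP (M ++ L) , φ ⟫
      ≡⟨ cong₂ _+_ (trans (pair-piOp 0 (s≤s (s≤s z≤n)) M φ) (ℤP.+-identityʳ (c * (∫ F (sc (+ b)) - ∫ F -[1+ 0 ]))))
           (trans (pair-scale (- (+ 1)) (M ++ L) φ) (cong (- (+ 1) *_)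
             (trans (pair-++ M L φ) (cong₂ _+_ (ℤP.+-identityʳ (c * φ d (+ b ∷ -[1+ 0 ] ∷ e))) (range-pair c d (λ k → k ∷ (+ b - + 1 - k) ∷ e) φ (λ t → + t) (λ t → refl) b))))) ⟩
    c * (∫ F (sc (+ b)) - ∫ F -[1+ 0 ]) + - (+ 1) * (c * φ d (+ b ∷ -[1+ 0 ] ∷ e) + c * (∫ F (+ b) - ∫ F (+ 0)))
      ≡⟨ cong₂ (λ u v → c * (u - ∫ F -[1+ 0 ]) + - (+ 1) * (c * v + c * (∫ F (+ b) - ∫ F (+ 0))))
           (∫-sc F (+ b)) (cong (λ z → φ d (+ b ∷ z ∷ e)) (sym (lem₁ (+ b)))) ⟩
    c * (∫ F (+ b) + F (+ b) - - F -[1+ 0 ]) + - (+ 1) * (c * F (+ b) + c * (∫ F (+ b) - + 0))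
      ≡⟨ lem₂ c (∫ F (+ b)) (F (+ b)) (F -[1+ 0 ]) ⟩
    c * F -[1+ 0 ] + + 0
      ≡⟨ cong (λ z → c * φ d (-[1+ 0 ] ∷ z ∷ e) + + 0) (lem₃ (+ b)) ⟩
    c * φ d (-[1+ 0 ] ∷ + b ∷ e) + + 0 ∎)
    where
    open ≡-Reasoning
    lem₁ : ∀ b → b - + 1 - b ≡ - (+ 1)
    lem₁ = solve-∀
    lem₂ : ∀ c x y z → c * (x + y - - z) + - (+ 1) * (c * y + c * (x - + 0)) ≡ c * z + + 0
    lem₂ = solve-∀
    lem₃ : ∀ b → b - + 1 - - (+ 1) ≡ b
    lem₃ = solve-∀

-- `has-dn₀` moves an exponent -1 one place to the right, at the price of terms that are already
-- nonnegative. In the last place the monomial is congruent to 0.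
has-dn : ∀ n j c d (e : Vec ℤ n) → j ℕ.< n → NN e → HasPoly ((c , d , dn j e) ∷ [])
has-dn (suc n) (suc j) c d (x ∷ e) (s≤s h) (p , q) = has-cons x p (has-dn n j c d e h q)
has-dn (suc n) zero c d (+ suc x ∷ e) h (p , q) = _ , (ℤ.+≤+ z≤n , q) ∷ [] , ∼-refl
has-dn (suc zero) zero c d (+ zero ∷ []) h (p , q) = [] , [] , ≃⇒∼ (VL-null c d [] -[1+ 0 ] ℤ.-<+)
has-dn (suc (suc n)) zero c d (+ zero ∷ + b ∷ e) h (p , q , r) = has-dn₀ c d b e r
  (has-cons (+ b) (ℤ.+≤+ z≤n) (has-dn (suc n) 0 c d (+ 0 ∷ e) (s≤s z≤n) (ℤ.+≤+ z≤n , r)))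
has-dn (suc (suc n)) zero c d (+ zero ∷ -[1+ b ] ∷ e) h (p , () , r)
has-dn (suc n) zero c d (-[1+ x ] ∷ e) h (() , q)

has-X⁻ : ∀ {n} j → j ℕ.< n → {f : Poly n} → HasPoly f → HasPoly (X⁻ j f)
has-X⁻ {n} j h (p , q , s) = has-∼ (∼-X⁻ j s) (go p q)
  where
  go : ∀ p → AllNN p → HasPoly (X⁻ j p)
  go [] [] = [] , [] , ∼-refl
  go ((c , d , e) ∷ p) (q ∷ qs) = has-++ {f = (c , d , dn j e) ∷ []} (has-dn n j c d e h q) (go p qs)

has-mono : ∀ {n} c d (e : Vec ℤ n) → HasPoly ((c , d , e) ∷ [])
has-mono c d [] = _ , tt ∷ [] , ∼-refl
has-mono c d (+ x ∷ e) = has-cons (+ x) (ℤ.+≤+ z≤n) (has-mono c d e)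
has-mono {suc n} c d (-[1+ x ] ∷ e) = go x
  where
  go : ∀ x → HasPoly ((c , d , -[1+ x ] ∷ e) ∷ [])
  go zero = has-X⁻ 0 (s≤s z≤n) {(c , d , + 0 ∷ e) ∷ []} (has-cons (+ 0) (ℤ.+≤+ z≤n) (has-mono c d e))
  go (suc x) = subst (λ z → HasPoly ((c , d , z ∷ e) ∷ [])) (cong (λ z → -[1+ suc z ]) (ℕP.+-identityʳ x))
    (has-X⁻ 0 (s≤s z≤n) {(c , d , -[1+ x ] ∷ e) ∷ []} (go x))

hasPoly : ∀ {n} (f : Poly n) → HasPoly f
hasPoly [] = [] , [] , ∼-refl
hasPoly ((c , d , e) ∷ f) = has-++ {f = (c , d , e) ∷ []} (has-mono c d e) (hasPoly f)

-- Words modulo the relations of the 0-Hecke monoid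

infix 4 _~_
data _~_ : Word → Word → Set where
  ~refl : ∀ {a} → a ~ a
  ~sym : ∀ {a b} → a ~ b → b ~ a
  ~trans : ∀ {a b c} → a ~ b → b ~ c → a ~ c
  ~app : ∀ {a b c d} → a ~ b → c ~ d → a ++ c ~ b ++ d
  ~idem : ∀ i → i ∷ i ∷ [] ~ i ∷ []
  ~comm : ∀ i j → suc (suc i) ℕ.≤ j → i ∷ j ∷ [] ~ j ∷ i ∷ []
  ~braid : ∀ i → i ∷ suc i ∷ i ∷ [] ~ suc i ∷ i ∷ suc i ∷ []

~valid : ∀ {n a b} → a ~ b → (Valid n a → Valid n b) × (Valid n b → Valid n a)
~valid ~refl = id , id
~valid (~sym p) = proj₂ (~valid p) , proj₁ (~valid p)
~valid (~trans p q) = proj₁ (~valid q) ∘ proj₁ (~valid p) , proj₂ (~valid p) ∘ proj₂ (~valid q)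
~valid (~app {a} {b} p q) =
  (λ v → AllP.++⁺ (proj₁ (~valid p) (AllP.++⁻ˡ a v)) (proj₁ (~valid q) (AllP.++⁻ʳ a v))) ,
  (λ v → AllP.++⁺ (proj₂ (~valid p) (AllP.++⁻ˡ b v)) (proj₂ (~valid q) (AllP.++⁻ʳ b v)))
~valid (~idem i) = (λ { (x ∷ _) → x ∷ [] }) , (λ { (x ∷ _) → x ∷ x ∷ [] })
~valid (~comm i j _) = (λ { (x ∷ y ∷ []) → y ∷ x ∷ [] }) , (λ { (x ∷ y ∷ []) → y ∷ x ∷ [] })
~valid (~braid i) = (λ { (x ∷ y ∷ _) → y ∷ x ∷ y ∷ [] }) , (λ { (x ∷ y ∷ _) → y ∷ x ∷ y ∷ [] })

piWord-++ : ∀ {n} a b (f : Poly n) → piWord (a ++ b) f ≡ piWord a (piWord b f)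
piWord-++ [] b f = refl
piWord-++ (i ∷ a) b f = cong (piOp i) (piWord-++ a b f)

piWord-cong : ∀ {n} a → Valid n a → {f g : Poly n} → f ≋ g → piWord a f ≋ piWord a g
piWord-cong [] v p = p
piWord-cong (i ∷ a) (h ∷ v) p = piOp-cong i h (piWord-cong a v p)

~sound : ∀ {n a b} → a ~ b → Valid n a → (f : Poly n) → piWord a f ≋ piWord b f
~sound ~refl v f = ≋-refl
~sound (~sym p) v f = ≋-sym (~sound p (proj₂ (~valid p) v) f)
~sound (~trans p q) v f = ≋-trans (~sound p v f) (~sound q (proj₁ (~valid p) v) f)
~sound (~app {a} {b} {c} {d} p q) v f = ≋-trans (≡⇒≋ (piWord-++ a c f))
  (≋-trans (piWord-cong a (AllP.++⁻ˡ a v) (~sound q (AllP.++⁻ʳ a v) f))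
  (≋-trans (~sound p (AllP.++⁻ˡ a v) (piWord d f)) (≡⇒≋ (sym (piWord-++ b d f)))))
~sound (~idem i) (h ∷ _) f = piOp-idem i h f
~sound (~comm i j far) (_ ∷ h ∷ []) f = piOp-comm i j far h f
~sound (~braid i) (_ ∷ h ∷ _) f = piOp-braid i h f

~rev : ∀ {a b} → a ~ b → List.reverse a ~ List.reverse b
~rev ~refl = ~refl
~rev (~sym p) = ~sym (~rev p)
~rev (~trans p q) = ~trans (~rev p) (~rev q)
~rev (~app {a} {b} {c} {d} p q) =
  subst₂ _~_ (sym (LP.reverse-++ a c)) (sym (LP.reverse-++ b d)) (~app (~rev q) (~rev p))
~rev (~idem i) = ~idem i
~rev (~comm i j far) = ~sym (~comm i j far)
~rev (~braid i) = ~braid i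

~cons : ∀ i {a b} → a ~ b → i ∷ a ~ i ∷ b
~cons i p = ~app (~refl {i ∷ []}) p

≡⇒~ : ∀ {a b} → a ≡ b → a ~ b
≡⇒~ refl = ~refl

down : ℕ → ℕ → Word
down s zero = s ∷ []
down s (suc c) = suc (c ℕ.+ s) ∷ down s c

-- a word for the longest element of the parabolic on the letters s, …, s+c-1
U : ℕ → ℕ → Word
U s zero = []
U s (suc c) = U s c ++ down s c

far-letters : ∀ t w → All (λ i → suc (suc i) ℕ.≤ t) w → t ∷ w ~ w ++ t ∷ []
far-letters t [] [] = ~refl
far-letters t (i ∷ w) (h ∷ hs) = ~trans (~app (~sym (~comm i t h)) (~refl {w})) (~cons i (far-letters t w hs))

down-≤ : ∀ s c {t} → c ℕ.+ s ℕ.< t → All (ℕ._< t) (down s c)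
down-≤ s zero h = h ∷ []
down-≤ s (suc c) h = h ∷ down-≤ s c (ℕP.<⇒≤ h)

U-< : ∀ s c {t} → c ℕ.+ s ℕ.≤ t → All (ℕ._< t) (U s c)
U-< s zero h = []
U-< s (suc c) h = AllP.++⁺ (U-< s c (ℕP.<⇒≤ h)) (down-≤ s c h)

-- A descending word is a cycle and carries the letter i + 1 to i: one braid move where the two
-- meet, commutations elsewhere.
down-slide : ∀ s c i → i ℕ.< c → down s c ++ suc (i ℕ.+ s) ∷ [] ~ (i ℕ.+ s) ∷ down s c
down-slide s (suc c) i (s≤s h) with ℕP.m≤n⇒m<n∨m≡n h
... | inj₁ i<c = ~trans (~cons (suc (c ℕ.+ s)) (down-slide s c i i<c))
  (~sym (~app (~comm (i ℕ.+ s) (suc (c ℕ.+ s)) (s≤s (ℕP.+-monoˡ-≤ s i<c))) (~refl {down s c})))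
down-slide s (suc zero) zero (s≤s h) | inj₂ refl = ~sym (~braid s)
down-slide s (suc (suc c)) (suc c) (s≤s h) | inj₂ refl =
  ~trans (~cons t (~cons (suc (c ℕ.+ s)) (~sym (far-letters t (down s c) (All.map s≤s (down-≤ s c ℕP.≤-refl))))))
    (~sym (~app (~braid (suc (c ℕ.+ s))) (~refl {down s c})))
  where
  t = suc (suc (c ℕ.+ s))

down-snoc : ∀ s c → down s (suc c) ≡ map suc (down s c) ++ s ∷ []
down-snoc s zero = refl
down-snoc s (suc c) = cong (suc (suc (c ℕ.+ s)) ∷_) (down-snoc s c)

down-slides : ∀ s c i → i ℕ.< c → down s c ++ map suc (down s i) ~ down s i ++ down s c
down-slides s c zero h = down-slide s c 0 h
down-slides s c (suc i) h =
  ~trans (≡⇒~ (sym (LP.++-assoc (down s c) _ (map suc (down s i)))))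
  (~trans (~app (down-slide s c (suc i) h) (~refl {map suc (down s i)})) (~cons (suc i ℕ.+ s) (down-slides s c i (ℕP.<⇒≤ h))))

down-end : ∀ s c → down s c ++ s ∷ [] ~ down s c
down-end s zero = ~idem s
down-end s (suc c) = ~cons _ (down-end s c)

down-down : ∀ s c → down s (suc c) ++ down s (suc c) ~ down s c ++ down s (suc c)
down-down s c = ~trans (≡⇒~ (trans (cong (down s (suc c) ++_) (down-snoc s c)) (sym (LP.++-assoc (down s (suc c)) _ (s ∷ [])))))
  (~trans (~app (down-slides s (suc c) c ℕP.≤-refl) (~refl {s ∷ []}))
  (~trans (≡⇒~ (LP.++-assoc (down s c) _ (s ∷ []))) (~app (~refl {down s c}) (down-end s (suc c)))))

-- Smaller letters are absorbed by the inner `U`. The top letter commutes past the part of `U`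
-- without its neighbour, completes `down s c` to a second copy of `D`, and `down-down` removes what
-- it added.
U-absorbs : ∀ s c j → j ℕ.< c → (j ℕ.+ s) ∷ U s c ~ U s c
U-absorbs s (suc c) j (s≤s h) with ℕP.m≤n⇒m<n∨m≡n h
... | inj₁ j<c = ~app (U-absorbs s c j j<c) (~refl {down s c})
U-absorbs s (suc zero) zero (s≤s h) | inj₂ refl = ~idem s
U-absorbs s (suc (suc c)) (suc c) (s≤s h) | inj₂ refl =
  ~trans (≡⇒~ (cong (t ∷_) (LP.++-assoc (U s c) (down s c) D)))
  (~trans (~app (far-letters t (U s c) (All.map s≤s (U-< s c ℕP.≤-refl))) (~refl {down s c ++ D}))
  (~trans (≡⇒~ (LP.++-assoc (U s c) (t ∷ []) (down s c ++ D)))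
  (~trans (~app (~refl {U s c}) (down-down s c)) (≡⇒~ (sym (LP.++-assoc (U s c) (down s c) D))))))
  where
  t = suc (c ℕ.+ s)
  D = down s (suc c)

upw : ℕ → ℕ → Word
upw s zero = s ∷ []
upw s (suc c) = s ∷ upw (suc s) c

-- `U` read backwards. This form begins with the ascending cycle π_s ⋯ π_(s+c-1), which is the
-- factor that meets the new variable in the rotation step, followed by symmetrisation in one
-- variable fewer.
V : ℕ → ℕ → Word
V s zero = []
V s (suc c) = upw s c ++ V s c

upw-snoc : ∀ s c → upw s (suc c) ≡ upw s c ++ suc (c ℕ.+ s) ∷ []
upw-snoc s zero = refl
upw-snoc s (suc c) = cong (s ∷_) (trans (upw-snoc (suc s) c) (cong (λ z → upw (suc s) c ++ suc z ∷ []) (ℕP.+-suc c s)))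

reverse-down : ∀ s c → List.reverse (down s c) ≡ upw s c
reverse-down s zero = refl
reverse-down s (suc c) = trans (LP.unfold-reverse _ (down s c)) (trans (cong (List._∷ʳ suc (c ℕ.+ s)) (reverse-down s c)) (sym (upw-snoc s c)))

reverse-U : ∀ s c → List.reverse (U s c) ≡ V s c
reverse-U s zero = refl
reverse-U s (suc c) = trans (LP.reverse-++ (U s c) (down s c)) (cong₂ _++_ (reverse-down s c) (reverse-U s c))

InRange : ℕ → ℕ → ℕ → Set
InRange s c i = ∃ λ j → j ℕ.< c × j ℕ.+ s ≡ i

upw-range : ∀ s c c' → c ℕ.< c' → All (InRange s c') (upw s c)
upw-range s zero c' h = (0 , h , refl) ∷ []
upw-range s (suc c) (suc c') (s≤s h) = (0 , s≤s z≤n , refl) ∷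
  All.map (λ { (j , l , e) → suc j , s≤s l , trans (sym (ℕP.+-suc j s)) e }) (upw-range (suc s) c c' h)

V-range : ∀ s c c' → c ℕ.≤ c' → All (InRange s c') (V s c)
V-range s zero c' h = []
V-range s (suc c) c' h = AllP.++⁺ (upw-range s c c' h) (V-range s c c' (ℕP.<⇒≤ h))

U-absorbs-word : ∀ s c w → All (InRange s c) w → w ++ U s c ~ U s c
U-absorbs-word s c [] [] = ~refl
U-absorbs-word s c (i ∷ w) ((j , h , refl) ∷ hs) = ~trans (~cons i (U-absorbs-word s c w hs)) (U-absorbs s c j h)

-- A left absorbing and a right absorbing element coincide.
V~U : ∀ s c → V s c ~ U s c
V~U s c = ~trans (~sym (subst₂ _~_ (trans (LP.reverse-++ (List.reverse (U s c)) (U s c)) (cong₂ _++_ (reverse-U s c) (LP.reverse-involutive (U s c))))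
    (reverse-U s c) (~rev (U-absorbs-word s c (List.reverse (U s c)) (rangeʳ s c)))))
  (U-absorbs-word s c (V s c) (subst (All (InRange s c)) (reverse-U s c) (rangeʳ s c)))
  where
  rangeʳ : ∀ s c → All (InRange s c) (List.reverse (U s c))
  rangeʳ s c = subst (All (InRange s c)) (sym (reverse-U s c)) (V-range s c c ℕP.≤-refl)

V-absorbsˡ : ∀ s c j → j ℕ.< c → (j ℕ.+ s) ∷ V s c ~ V s c
V-absorbsˡ s c j h = ~trans (~cons _ (V~U s c)) (~trans (U-absorbs s c j h) (~sym (V~U s c)))

V-absorbsʳ : ∀ s c j → j ℕ.< c → V s c ++ (j ℕ.+ s) ∷ [] ~ V s c
V-absorbsʳ s c j h = subst₂ _~_ (trans (LP.unfold-reverse (j ℕ.+ s) (U s c)) (cong (List._∷ʳ (j ℕ.+ s)) (reverse-U s c)))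
  (reverse-U s c) (~rev (U-absorbs s c j h))

V-valid : ∀ s c {n} → c ℕ.+ s ℕ.< n → Valid n (V s c)
V-valid s c {n} h = proj₂ (~valid (V~U s c)) (All.map (λ l → ℕP.≤-<-trans l h) (U-< s c ℕP.≤-refl))

X⁻-cong : ∀ {n} j {f g : Poly n} → f ≋ g → X⁻ j f ≋ X⁻ j g
X⁻-cong j {f} {g} p = eqP λ φ → trans (pair-X⁻ j f φ) (trans (pair p _) (sym (pair-X⁻ j g φ)))

X⁻-++ : ∀ {n} j (f g : Poly n) → X⁻ j (f ++ g) ≋ X⁻ j f ++ X⁻ j g
X⁻-++ j f g = ≡⇒≋ (LP.map-++ _ f g)

piOp-++ : ∀ {n} i (f g : Poly n) → piOp i (f ++ g) ≋ piOp i f ++ piOp i g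
piOp-++ i f g = ≡⇒≋ (LP.concatMap-++ (piTerm i) f g)

-- Transposes of π_i and x_j^{-1}

dn-comm : ∀ {n} i j (e : Vec ℤ n) → dn i (dn j e) ≡ dn j (dn i e)
dn-comm i j [] = refl
dn-comm zero zero (x ∷ e) = refl
dn-comm zero (suc j) (x ∷ e) = refl
dn-comm (suc i) zero (x ∷ e) = refl
dn-comm (suc i) (suc j) (x ∷ e) = cong (x ∷_) (dn-comm i j e)

Π-dn-below : ∀ {n} i j → j ℕ.< i → (φ : Fn n) → ∀ e → Π i (λ e → φ (dn j e)) e ≡ Π i φ (dn j e)
Π-dn-below (suc i) j h φ [] = refl
Π-dn-below (suc i) zero h φ (x ∷ e) = refl
Π-dn-below (suc i) (suc j) (s≤s h) φ (x ∷ e) = Π-dn-below i j h (λ e → φ (x ∷ e)) e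

Π-dn-above : ∀ {n} i j → suc i ℕ.< j → (φ : Fn n) → ∀ e → Π i (λ e → φ (dn j e)) e ≡ Π i φ (dn j e)
Π-dn-above zero j h φ [] = refl
Π-dn-above zero (suc (suc j)) h φ (x ∷ []) = refl
Π-dn-above zero (suc (suc j)) h φ (x ∷ y ∷ e) = refl
Π-dn-above zero (suc zero) (s≤s ()) φ (x ∷ e)
Π-dn-above (suc i) (suc j) h φ [] = refl
Π-dn-above (suc i) (suc j) (s≤s h) φ (x ∷ e) = Π-dn-above i j h (λ e → φ (x ∷ e)) e

dem-dn₁ : ∀ φ a b → dem φ a (b - + 1) ≡ dem (λ x y → φ (x - + 1) y) a b + φ a (b - + 1)
dem-dn₁ φ a b = trans (dem-tele ψ (primitive²-spec φ) a (b - + 1))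
  (trans (lem (ψ (sc a) (b - + 1)) (ψ (b - + 1) (sc a)) (ψ a (sc (b - + 1))))
    (cong₂ _+_ (trans (cong₂ (λ u v → ψ a u - ψ (b - + 1) v) (l₁ b) refl) (trans (cong (λ z → ψ z b - ψ (b - + 1) (sc a)) (sym (l₂ a)))
        (sym (dem-tele (λ x y → ψ (x - + 1) y) (λ x y → trans (primitive²-spec φ (x - + 1) y) (cong (λ z → ψ z y - ψ (x - + 1) (sc y)) (l₃ x))) a b))))
      (sym (primitive²-spec φ a (b - + 1)))))
  where
  ψ = primitive² φ
  lem : ∀ x y z → x - y ≡ (z - y) + (x - z)
  lem = solve-∀
  l₁ : ∀ b → + 1 + (b - + 1) ≡ b
  l₁ = solve-∀
  l₂ : ∀ a → (+ 1 + a) - + 1 ≡ a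
  l₂ = solve-∀
  l₃ : ∀ x → + 1 + (x - + 1) ≡ (+ 1 + x) - + 1
  l₃ = solve-∀

dem-dn₀ : ∀ φ a b → dem φ (a - + 1) b + φ a (b - + 1) ≡ dem (λ x y → φ x (y - + 1)) a b
dem-dn₀ φ a b = trans (cong₂ _+_ (dem-tele ψ (primitive²-spec φ) (a - + 1) b) (primitive²-spec φ a (b - + 1)))
  (trans (cong₂ (λ u v → (ψ u b - ψ b u) + (ψ (sc a) (b - + 1) - ψ a v)) (l₁ a) (l₁ b))
  (trans (lem (ψ a b) (ψ b a) (ψ (sc a) (b - + 1)))
  (trans (cong (λ z → ψ (sc a) (b - + 1) - ψ b z) (sym (l₂ a)))
  (sym (dem-tele (λ x y → ψ x (y - + 1)) (λ x y → trans (primitive²-spec φ x (y - + 1)) (cong (λ z → ψ (sc x) (y - + 1) - ψ x z) (l₃ y))) a b)))))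
  where
  ψ = primitive² φ
  lem : ∀ x y z → (x - y) + (z - x) ≡ z - y
  lem = solve-∀
  l₁ : ∀ b → + 1 + (b - + 1) ≡ b
  l₁ = solve-∀
  l₂ : ∀ a → (+ 1 + a) - + 1 ≡ a
  l₂ = solve-∀
  l₃ : ∀ x → + 1 + (x - + 1) ≡ (+ 1 + x) - + 1
  l₃ = solve-∀

Π-dn-suc : ∀ {n} i → suc i ℕ.< n → (φ : Fn n) → ∀ e →
  Π i φ (dn (suc i) e) ≡ Π i (λ e → φ (dn i e)) e + φ (dn (suc i) e)
Π-dn-suc zero h φ (a ∷ b ∷ e) = dem-dn₁ (λ x y → φ (x ∷ y ∷ e)) a b
Π-dn-suc zero (s≤s ()) φ (a ∷ [])
Π-dn-suc (suc i) (s≤s h) φ (x ∷ e) = Π-dn-suc i h (λ e → φ (x ∷ e)) e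

Π-dn : ∀ {n} i → suc i ℕ.< n → (φ : Fn n) → ∀ e →
  Π i φ (dn i e) + φ (dn (suc i) e) ≡ Π i (λ e → φ (dn (suc i) e)) e
Π-dn zero h φ (a ∷ b ∷ e) = dem-dn₀ (λ x y → φ (x ∷ y ∷ e)) a b
Π-dn zero (s≤s ()) φ (a ∷ [])
Π-dn (suc i) (s≤s h) φ (x ∷ e) = Π-dn i h (λ e → φ (x ∷ e)) e

pair-πX : ∀ {n} i j → suc i ℕ.< n → ∀ (f : Poly n) φ → ⟪ piOp i (X⁻ j f) , φ ⟫ ≡ ⟪ f , (λ d e → Π i (φ d) (dn j e)) ⟫
pair-πX i j h f φ = trans (pair-piOp i h (X⁻ j f) φ) (pair-X⁻ j f _)

pair-Xπ : ∀ {n} i j → suc i ℕ.< n → ∀ (f : Poly n) φ → ⟪ X⁻ j (piOp i f) , φ ⟫ ≡ ⟪ f , (λ d e → Π i (λ e → φ d (dn j e)) e) ⟫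
pair-Xπ i j h f φ = trans (pair-X⁻ j (piOp i f) φ) (pair-piOp i h f _)

π-X⁻-below : ∀ {n} i j → suc i ℕ.< n → j ℕ.< i → (f : Poly n) → piOp i (X⁻ j f) ≋ X⁻ j (piOp i f)
π-X⁻-below i j h l f = eqP λ φ → trans (pair-πX i j h f φ)
  (trans (pair-ext f (λ d e → sym (Π-dn-below i j l (φ d) e))) (sym (pair-Xπ i j h f φ)))

π-X⁻-above : ∀ {n} i j → suc i ℕ.< n → suc i ℕ.< j → (f : Poly n) → piOp i (X⁻ j f) ≋ X⁻ j (piOp i f)
π-X⁻-above i j h l f = eqP λ φ → trans (pair-πX i j h f φ)
  (trans (pair-ext f (λ d e → sym (Π-dn-above i j l (φ d) e))) (sym (pair-Xπ i j h f φ)))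

π-X⁻-suc : ∀ {n} i → suc i ℕ.< n → (f : Poly n) → piOp i (X⁻ (suc i) f) ≋ X⁻ i (piOp i f) ++ X⁻ (suc i) f
π-X⁻-suc i h f = eqP λ φ → trans (pair-πX i (suc i) h f φ)
  (trans (pair-ext f (λ d e → Π-dn-suc i h (φ d) e))
  (trans (pair-+ f _ _)
  (sym (trans (pair-++ (X⁻ i (piOp i f)) _ φ) (cong₂ _+_ (pair-Xπ i i h f φ) (pair-X⁻ (suc i) f φ))))))

π-X⁻ : ∀ {n} i → suc i ℕ.< n → (f : Poly n) → piOp i (X⁻ i f) ++ X⁻ (suc i) f ≋ X⁻ (suc i) (piOp i f)
π-X⁻ i h f = eqP λ φ → trans (pair-++ (piOp i (X⁻ i f)) _ φ)
  (trans (cong₂ _+_ (pair-πX i i h f φ) (pair-X⁻ (suc i) f φ))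
  (trans (sym (pair-+ f _ _))
  (trans (pair-ext f (λ d e → Π-dn i h (φ d) e)) (sym (pair-Xπ i (suc i) h f φ)))))

X⁻-comm : ∀ {n} i j (f : Poly n) → X⁻ i (X⁻ j f) ≋ X⁻ j (X⁻ i f)
X⁻-comm i j f = eqP λ φ → trans (trans (pair-X⁻ i (X⁻ j f) φ) (pair-X⁻ j f _))
  (trans (pair-ext f (λ d e → cong (φ d) (dn-comm i j e))) (sym (trans (pair-X⁻ j (X⁻ i f) φ) (pair-X⁻ i f _))))

++-cancel : ∀ {n} (f g h : Poly n) → f ++ h ≋ g ++ h → f ≋ g
++-cancel f g h p = eqP λ φ → trans (lem ⟪ f , φ ⟫ ⟪ h , φ ⟫)
  (trans (cong (λ z → z - ⟪ h , φ ⟫) (trans (sym (pair-++ f h φ)) (trans (pair p φ) (pair-++ g h φ)))) (sym (lem ⟪ g , φ ⟫ ⟪ h , φ ⟫)))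
  where
  lem : ∀ x y → x ≡ x + y - y
  lem = solve-∀


-- Neither `π-X⁻-suc` nor `π-X⁻` is a commutation, but the defect of both is x_(i+1)⁻¹ f, on
-- opposite sides; it cancels in their sum.
π-e₁ : ∀ {n} i → suc i ℕ.< n → (f : Poly n) → piOp i (X⁻ i f ++ X⁻ (suc i) f) ≋ X⁻ i (piOp i f) ++ X⁻ (suc i) (piOp i f)
π-e₁ i h f = ++-cancel _ _ (X⁻ (suc i) f) (eqP λ φ → begin
  ⟪ piOp i (X⁻ i f ++ X⁻ (suc i) f) ++ X⁻ (suc i) f , φ ⟫
    ≡⟨ trans (pair-++ (piOp i (X⁻ i f ++ X⁻ (suc i) f)) _ φ) (cong (λ z → z + ⟪ X⁻ (suc i) f , φ ⟫)
         (trans (pair (piOp-++ i (X⁻ i f) (X⁻ (suc i) f)) φ) (pair-++ (piOp i (X⁻ i f)) _ φ))) ⟩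
  ⟪ piOp i (X⁻ i f) , φ ⟫ + ⟪ piOp i (X⁻ (suc i) f) , φ ⟫ + ⟪ X⁻ (suc i) f , φ ⟫
    ≡⟨ cong (λ z → ⟪ piOp i (X⁻ i f) , φ ⟫ + z + ⟪ X⁻ (suc i) f , φ ⟫)
         (trans (pair (π-X⁻-suc i h f) φ) (pair-++ (X⁻ i (piOp i f)) _ φ)) ⟩
  ⟪ piOp i (X⁻ i f) , φ ⟫ + (⟪ X⁻ i (piOp i f) , φ ⟫ + ⟪ X⁻ (suc i) f , φ ⟫) + ⟪ X⁻ (suc i) f , φ ⟫
    ≡⟨ lem ⟪ piOp i (X⁻ i f) , φ ⟫ ⟪ X⁻ i (piOp i f) , φ ⟫ ⟪ X⁻ (suc i) f , φ ⟫ ⟩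
  ⟪ X⁻ i (piOp i f) , φ ⟫ + (⟪ piOp i (X⁻ i f) , φ ⟫ + ⟪ X⁻ (suc i) f , φ ⟫) + ⟪ X⁻ (suc i) f , φ ⟫
    ≡⟨ cong (λ z → ⟪ X⁻ i (piOp i f) , φ ⟫ + z + ⟪ X⁻ (suc i) f , φ ⟫)
         (trans (sym (pair-++ (piOp i (X⁻ i f)) _ φ)) (pair (π-X⁻ i h f) φ)) ⟩
  ⟪ X⁻ i (piOp i f) , φ ⟫ + ⟪ X⁻ (suc i) (piOp i f) , φ ⟫ + ⟪ X⁻ (suc i) f , φ ⟫
    ≡⟨ sym (trans (pair-++ (X⁻ i (piOp i f) ++ X⁻ (suc i) (piOp i f)) _ φ)
         (cong (λ z → z + ⟪ X⁻ (suc i) f , φ ⟫) (pair-++ (X⁻ i (piOp i f)) _ φ))) ⟩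
  ⟪ (X⁻ i (piOp i f) ++ X⁻ (suc i) (piOp i f)) ++ X⁻ (suc i) f , φ ⟫ ∎)
  where
  open ≡-Reasoning
  lem : ∀ x y z → x + (y + z) + z ≡ y + (x + z) + z
  lem = solve-∀

π-e₂ : ∀ {n} i → suc i ℕ.< n → (f : Poly n) → piOp i (X⁻ i (X⁻ (suc i) f)) ≋ X⁻ i (X⁻ (suc i) (piOp i f))
π-e₂ i h f = ++-cancel _ _ (X⁻ (suc i) (X⁻ (suc i) f)) (≋-trans (π-X⁻ i h (X⁻ (suc i) f))
  (≋-trans (X⁻-cong (suc i) (π-X⁻-suc i h f)) (≋-trans (X⁻-++ (suc i) (X⁻ i (piOp i f)) _)
  (++-cong (X⁻-comm (suc i) i (piOp i f)) ≋-refl))))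

-- Multiplication by the complete homogeneous polynomial of degree k in
-- x_s^{-1}, …, x_{s+c-1}^{-1}.
H : ∀ {n} → ℕ → ℕ → ℕ → Poly n → Poly n
H s zero zero f = f
H s zero (suc k) f = []
H s (suc c) zero f = H (suc s) c zero f
H s (suc c) (suc k) f = H (suc s) c (suc k) f ++ X⁻ s (H s (suc c) k f)

H-cong : ∀ {n} s c k {f g : Poly n} → f ≋ g → H s c k f ≋ H s c k g
H-cong s zero zero p = p
H-cong s zero (suc k) p = ≋-refl
H-cong s (suc c) zero p = H-cong (suc s) c zero p
H-cong s (suc c) (suc k) p = ++-cong (H-cong (suc s) c (suc k) p) (X⁻-cong s (H-cong s (suc c) k p))

H-∼ : ∀ {n} s c k {f g : Poly n} → f ∼ g → H s c k f ∼ H s c k g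
H-∼ s zero zero p = p
H-∼ s zero (suc k) p = ∼-refl
H-∼ s (suc c) zero p = H-∼ (suc s) c zero p
H-∼ s (suc c) (suc k) p = ∼-++ (H-∼ (suc s) c (suc k) p) (∼-X⁻ s (H-∼ s (suc c) k p))

H-zero : ∀ {n} s c (f : Poly n) → H s c 0 f ≡ f
H-zero s zero f = refl
H-zero s (suc c) f = H-zero (suc s) c f

-- The generating series of the h_k, multiplied by (1 - y₁t)(1 - y₂t) with y₁ = x_s⁻¹ and y₂ =
-- x_(s+1)⁻¹, loses its first two variables. Only y₁ + y₂ and y₁y₂ enter, with which π_s commutes by
-- `π-e₁` and `π-e₂`.
H-two : ∀ {n} s c k (f : Poly n) → H s (2 ℕ.+ c) (2 ℕ.+ k) f ++ X⁻ s (X⁻ (suc s) (H s (2 ℕ.+ c) k f)) ≋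
  H (2 ℕ.+ s) c (2 ℕ.+ k) f ++ (X⁻ s (H s (2 ℕ.+ c) (suc k) f) ++ X⁻ (suc s) (H s (2 ℕ.+ c) (suc k) f))
H-two s c k f = eqP λ φ → begin
  ⟪ ((G ++ X⁻ (suc s) H') ++ X⁻ s H₁) ++ X⁻ s (X⁻ (suc s) H₀) , φ ⟫
    ≡⟨ trans (pair-++ ((G ++ X⁻ (suc s) H') ++ X⁻ s H₁) _ φ)
         (cong (λ z → z + ⟪ X⁻ s (X⁻ (suc s) H₀) , φ ⟫) (trans (pair-++ (G ++ X⁻ (suc s) H') _ φ)
           (cong (λ z → z + ⟪ X⁻ s H₁ , φ ⟫) (pair-++ G _ φ)))) ⟩
  ⟪ G , φ ⟫ + ⟪ X⁻ (suc s) H' , φ ⟫ + ⟪ X⁻ s H₁ , φ ⟫ + ⟪ X⁻ s (X⁻ (suc s) H₀) , φ ⟫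
    ≡⟨ lem ⟪ G , φ ⟫ ⟪ X⁻ (suc s) H' , φ ⟫ ⟪ X⁻ s H₁ , φ ⟫ ⟪ X⁻ s (X⁻ (suc s) H₀) , φ ⟫ ⟩
  ⟪ G , φ ⟫ + (⟪ X⁻ s H₁ , φ ⟫ + (⟪ X⁻ (suc s) H' , φ ⟫ + ⟪ X⁻ s (X⁻ (suc s) H₀) , φ ⟫))
    ≡⟨ cong (λ z → ⟪ G , φ ⟫ + (⟪ X⁻ s H₁ , φ ⟫ + z)) (sym
         (trans (pair (X⁻-++ (suc s) H' (X⁻ s H₀)) φ) (trans (pair-++ (X⁻ (suc s) H') _ φ)
           (addˡ ⟪ X⁻ (suc s) H' , φ ⟫ (pair (X⁻-comm (suc s) s H₀) φ))))) ⟩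
  ⟪ G , φ ⟫ + (⟪ X⁻ s H₁ , φ ⟫ + ⟪ X⁻ (suc s) H₁ , φ ⟫)
    ≡⟨ sym (trans (pair-++ G _ φ) (addˡ ⟪ G , φ ⟫ (pair-++ (X⁻ s H₁) _ φ))) ⟩
  ⟪ G ++ (X⁻ s H₁ ++ X⁻ (suc s) H₁) , φ ⟫ ∎
  where
  open ≡-Reasoning
  G = H (2 ℕ.+ s) c (2 ℕ.+ k) f
  H' = H (suc s) (suc c) (suc k) f
  H₀ = H s (2 ℕ.+ c) k f
  H₁ = H s (2 ℕ.+ c) (suc k) f
  lem : ∀ a b c d → a + b + c + d ≡ a + (c + (b + d))
  lem = solve-∀

H-one : ∀ {n} s c (f : Poly n) → H s (2 ℕ.+ c) 1 f ≋ H (2 ℕ.+ s) c 1 f ++ (X⁻ s f ++ X⁻ (suc s) f)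
H-one s c f rewrite H-zero (2 ℕ.+ s) c f = eqP λ φ →
  trans (pair-++ (H (2 ℕ.+ s) c 1 f ++ X⁻ (suc s) f) _ φ) (trans (cong (λ z → z + ⟪ X⁻ s f , φ ⟫) (pair-++ (H (2 ℕ.+ s) c 1 f) _ φ))
  (trans (lem ⟪ H (2 ℕ.+ s) c 1 f , φ ⟫ ⟪ X⁻ (suc s) f , φ ⟫ ⟪ X⁻ s f , φ ⟫)
  (sym (trans (pair-++ (H (2 ℕ.+ s) c 1 f) _ φ) (addˡ ⟪ H (2 ℕ.+ s) c 1 f , φ ⟫ (pair-++ (X⁻ s f) _ φ))))))
  where
  lem : ∀ a b c → a + b + c ≡ a + (c + b)
  lem = solve-∀

π-H-below : ∀ {n} i s c k → suc i ℕ.< n → suc i ℕ.< s → (f : Poly n) → piOp i (H s c k f) ≋ H s c k (piOp i f)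
π-H-below i s zero zero h l f = ≋-refl
π-H-below i s zero (suc k) h l f = ≋-refl
π-H-below i s (suc c) zero h l f = π-H-below i (suc s) c zero h (ℕP.m≤n⇒m≤1+n l) f
π-H-below i s (suc c) (suc k) h l f = ≋-trans (piOp-++ i (H (suc s) c (suc k) f) _)
  (++-cong (π-H-below i (suc s) c (suc k) h (ℕP.m≤n⇒m≤1+n l) f)
    (≋-trans (π-X⁻-above i s h l (H s (suc c) k f)) (X⁻-cong s (π-H-below i s (suc c) k h l f))))

π-H-first : ∀ {n} s c k → suc s ℕ.< n → (f : Poly n) → piOp s (H s (2 ℕ.+ c) k f) ≋ H s (2 ℕ.+ c) k (piOp s f)
π-H-first s c zero h f = π-H-below s (2 ℕ.+ s) c 0 h ℕP.≤-refl f
π-H-first s c (suc zero) h f = ≋-trans (piOp-cong s h (H-one s c f))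
  (≋-trans (piOp-++ s (H (2 ℕ.+ s) c 1 f) _)
  (≋-trans (++-cong (π-H-below s (2 ℕ.+ s) c 1 h ℕP.≤-refl f) (π-e₁ s h f)) (≋-sym (H-one s c (piOp s f)))))
π-H-first s c (suc (suc k)) h f = ++-cancel _ _ (X⁻ s (X⁻ (suc s) (H s (2 ℕ.+ c) k (piOp s f))))
  (≋-trans (++-cong ≋-refl (≋-sym (≋-trans (π-e₂ s h (H s (2 ℕ.+ c) k f)) (X⁻-cong s (X⁻-cong (suc s) (π-H-first s c k h f))))))
  (≋-trans (≋-sym (piOp-++ s (H s (2 ℕ.+ c) (2 ℕ.+ k) f) _))
  (≋-trans (piOp-cong s h (H-two s c k f))
  (≋-trans (piOp-++ s (H (2 ℕ.+ s) c (2 ℕ.+ k) f) _)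
  (≋-trans (++-cong (π-H-below s (2 ℕ.+ s) c (2 ℕ.+ k) h ℕP.≤-refl f)
    (≋-trans (π-e₁ s h (H s (2 ℕ.+ c) (suc k) f))
      (++-cong (X⁻-cong s (π-H-first s c (suc k) h f)) (X⁻-cong (suc s) (π-H-first s c (suc k) h f)))))
  (≋-sym (H-two s c k (piOp s f))))))))

π-H : ∀ {n} i s c k → suc i ℕ.< n → s ℕ.≤ i → suc i ℕ.< c ℕ.+ s → (f : Poly n) → piOp i (H s c k f) ≋ H s c k (piOp i f)
π-H i s zero k h l u f = ⊥-elim (ℕP.<⇒≱ u (ℕP.m≤n⇒m≤1+n l))
π-H i s (suc c) zero h l u f rewrite H-zero (suc s) c f | H-zero (suc s) c (piOp i f) = ≋-refl
π-H i s (suc c) (suc k) h l u f with ℕP.m≤n⇒m<n∨m≡n l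
... | inj₁ s<i = ≋-trans (piOp-++ i (H (suc s) c (suc k) f) _)
  (++-cong (π-H i (suc s) c (suc k) h s<i (subst (suc i ℕ.<_) (sym (ℕP.+-suc c s)) u) f)
    (≋-trans (π-X⁻-below i s h s<i (H s (suc c) k f)) (X⁻-cong s (π-H i s (suc c) k h l u f))))
π-H i s (suc zero) (suc k) h l u f | inj₂ refl = ⊥-elim (ℕP.<-irrefl refl u)
π-H i s (suc (suc c)) (suc k) h l u f | inj₂ refl = π-H-first s c (suc k) h f

-- In degree k + 1 the summand free of x_(s+1) is fixed, and `π-X⁻-suc` turns the other one into
-- itself plus x_s⁻¹ times the case of degree k: the recursion defining h on one more variable.
π-H-extend : ∀ {n} s c k → suc s ℕ.< n → (f : Poly n) → piOp s f ≋ f → piOp s (H (suc s) (suc c) k f) ≋ H s (2 ℕ.+ c) k f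
π-H-extend s c zero h f fix rewrite H-zero (2 ℕ.+ s) c f = fix
π-H-extend s c (suc k) h f fix =
  ≋-trans (piOp-++ s (H (2 ℕ.+ s) c (suc k) f) _)
  (≋-trans (++-cong (≋-trans (π-H-below s (2 ℕ.+ s) c (suc k) h ℕP.≤-refl f) (H-cong (2 ℕ.+ s) c (suc k) fix))
    (≋-trans (π-X⁻-suc s h (H (suc s) (suc c) k f))
      (++-cong (X⁻-cong s (π-H-extend s c k h f fix)) (≋-refl {f = X⁻ (suc s) (H (suc s) (suc c) k f)}))))
  (eqP λ φ → trans (pair-++ G _ φ) (trans (addˡ ⟪ G , φ ⟫ (pair-++ (X⁻ s H₁) _ φ))
    (trans (lem ⟪ G , φ ⟫ ⟪ X⁻ s H₁ , φ ⟫ ⟪ X⁻ (suc s) H' , φ ⟫)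
    (sym (trans (pair-++ (G ++ X⁻ (suc s) H') _ φ) (cong (λ z → z + ⟪ X⁻ s H₁ , φ ⟫) (pair-++ G _ φ))))))))
  where
  G = H (2 ℕ.+ s) c (suc k) f
  H' = H (suc s) (suc c) k f
  H₁ = H s (2 ℕ.+ c) k f
  lem : ∀ a b c → a + (b + c) ≡ a + c + b
  lem = solve-∀

-- Extraction of the coefficient of x_n^k

σ : ∀ {n} → ℤ → Poly (suc n) → Poly n
σ k [] = []
σ k ((c , d , e) ∷ f) = if last e ==ℤ k then (c , d , init e) ∷ σ k f else σ k f

σ* : ∀ {n} → ℤ → (ℤ → Fn n) → ℤ → Fn (suc n)
σ* k φ d e = if last e ==ℤ k then φ d (init e) else + 0

pair-σ : ∀ {n} k (f : Poly (suc n)) φ → ⟪ σ k f , φ ⟫ ≡ ⟪ f , σ* k φ ⟫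
pair-σ k [] φ = refl
pair-σ k ((c , d , e) ∷ f) φ with last e ==ℤ k
... | true = addˡ (c * φ d (init e)) (pair-σ k f φ)
... | false = trans (pair-σ k f φ) (lem c ⟪ f , σ* k φ ⟫)
  where
  lem : ∀ c x → x ≡ c * + 0 + x
  lem = solve-∀

σ*-∷ʳ : ∀ {n} k (φ : ℤ → Fn n) d e x → σ* k φ d (e ∷ʳ x) ≡ (if x ==ℤ k then φ d e else + 0)
σ*-∷ʳ k φ d e x rewrite VecP.last-∷ʳ x e | VecP.init-∷ʳ x e = refl

σ-cong : ∀ {n} k {f g : Poly (suc n)} → f ≋ g → σ k f ≋ σ k g
σ-cong k {f} {g} p = eqP λ φ → trans (pair-σ k f φ) (trans (pair p _) (sym (pair-σ k g φ)))

Π-if : ∀ {n} i b (φ : Fn n) e → Π i (λ e → if b then φ e else + 0) e ≡ (if b then Π i φ e else + 0)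
Π-if i true φ e = refl
Π-if i false φ e = trans (Π-- i (λ _ → + 0) (λ _ → + 0) e) (ℤP.+-inverseʳ (Π i (λ _ → + 0) e))

σ-piOp : ∀ {n} k i → suc i ℕ.< n → (f : Poly (suc n)) → σ k (piOp i f) ≋ piOp i (σ k f)
σ-piOp k i h f = eqP λ φ → trans (trans (pair-σ k (piOp i f) φ) (pair-piOp i (ℕP.m≤n⇒m≤1+n h) f _))
  (trans (pair-ext f (λ d → snoc-elim _ λ e x → trans (Π-∷ʳ i h (σ* k φ d) e x)
    (trans (Π-ext i (λ e → σ*-∷ʳ k φ d e x) e) (trans (Π-if i (x ==ℤ k) (φ d) e) (sym (σ*-∷ʳ k (λ d → Π i (φ d)) d e x))))))
  (sym (trans (pair-piOp i h (σ k f) φ) (pair-σ k f _))))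

snoc₀-piWord : ∀ {n} w → Valid n w → (f : Poly n) → piWord w (snoc₀ f) ≋ snoc₀ (piWord w f)
snoc₀-piWord [] _ f = ≋-refl
snoc₀-piWord {n} (i ∷ w) (h ∷ v) f = ≋-trans (piOp-cong i h' (snoc₀-piWord w v f)) (one (piWord w f))
  where
  h' = ℕP.m≤n⇒m≤1+n h
  one : ∀ (f : Poly n) → piOp i (snoc₀ f) ≋ snoc₀ (piOp i f)
  one f = eqP λ φ → trans (trans (pair-piOp i h' (snoc₀ f) φ) (pair-snoc₀ f _))
    (trans (pair-ext f (λ d e → Π-∷ʳ i h (φ d) e (+ 0))) (sym (trans (pair-snoc₀ (piOp i f) φ) (pair-piOp i h f _))))

cons-piWord : ∀ {n} a w → Valid n w → (f : Poly n) → piWord (map suc w) (cons a f) ≋ cons a (piWord w f)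
cons-piWord a [] _ f = ≋-refl
cons-piWord {n} a (i ∷ w) (h ∷ v) f = ≋-trans (piOp-cong (suc i) (s≤s h) (cons-piWord a w v f)) (one (piWord w f))
  where
  one : ∀ (f : Poly n) → piOp (suc i) (cons a f) ≋ cons a (piOp i f)
  one f = eqP λ φ → trans (trans (pair-piOp (suc i) (s≤s h) (cons a f) φ) (pair-cons a f _))
    (sym (trans (pair-cons a (piOp i f) φ) (pair-piOp i h f _)))

∫-zero : ∀ (F : ℤ → ℤ) m → (∀ t → t ℕ.< m → F (+ t) ≡ + 0) → ∫ F (+ m) ≡ + 0
∫-zero F zero h = refl
∫-zero F (suc m) h = cong₂ _+_ (∫-zero F m (λ t l → h t (ℕP.m≤n⇒m≤1+n l))) (h m ℕP.≤-refl)

∫-single : ∀ (F : ℤ → ℤ) m p → p ℕ.< m → (∀ t → t ≢ p → F (+ t) ≡ + 0) → ∫ F (+ m) ≡ F (+ p)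
∫-single F (suc m) p (s≤s l) h with ℕP.m≤n⇒m<n∨m≡n l
... | inj₁ p<m = trans (cong₂ _+_ (∫-single F m p p<m h) (h m (λ e → ℕP.<⇒≢ p<m (sym e)))) (ℤP.+-identityʳ (F (+ p)))
... | inj₂ refl = trans (cong (λ z → z + F (+ m)) (∫-zero F m (λ t l → h t (ℕP.<⇒≢ l)))) (ℤP.+-identityˡ (F (+ p)))

dn-last : ∀ {n} (e : Vec ℤ n) x → dn n (e ∷ʳ x) ≡ e ∷ʳ (x - + 1)
dn-last [] x = refl
dn-last (y ∷ e) x = cong (y ∷_) (dn-last e x)

dual-H-last : ∀ {n} k (f : Poly (suc n)) φ → ⟪ H n 1 k f , φ ⟫ ≡ ⟪ f , (λ d e → φ d (init e ∷ʳ (last e - + k))) ⟫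
dual-H-last zero f φ = pair-ext f (λ d → snoc-elim _ λ e x → cong (φ d)
  (sym (cong₂ _∷ʳ_ (VecP.init-∷ʳ x e) (trans (ℤP.+-identityʳ _) (VecP.last-∷ʳ x e)))))
dual-H-last {n} (suc k) f φ = trans (pair-X⁻ n (H n 1 k f) φ) (trans (dual-H-last k f _)
  (pair-ext f (λ d e → cong (φ d) (trans (dn-last (init e) (last e - + k)) (cong (init e ∷ʳ_) (lem (last e) (+ k)))))))
  where
  lem : ∀ x k → x - k - + 1 ≡ x - (+ 1 + k)
  lem = solve-∀

==-false : ∀ {x y} → x ≢ y → (x ==ℤ y) ≡ false
==-false {x} {y} = dec-false (x ℤ.≟ y)

==-true : ∀ {x y} → x ≡ y → (x ==ℤ y) ≡ true
==-true {x} {y} = dec-true (x ℤ.≟ y)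

-- A term with last exponent a ≥ 0 becomes the sum of all x^(a-j) y^j with 0 ≤ j ≤ a, whose
-- y^k-coefficient is x^(a-k) or, for k > a, zero. In the latter case x^(a-k) has negative last
-- exponent, which is invisible to `≃`.
σ-last : ∀ {n} k (p : Poly (suc n)) → AllNN p → σ (+ k) (piOp n (snoc₀ p)) ≃ H n 1 k p
σ-last {n} k p nn = eqL λ φ v → trans (trans (pair-σ (+ k) (piOp n (snoc₀ p)) φ)
    (trans (pair-piOp n ℕP.≤-refl (snoc₀ p) (σ* (+ k) φ)) (pair-snoc₀ p _)))
  (trans (pair-extAll nn (λ c d e q → go φ v d e q)) (sym (dual-H-last k p φ)))
  where
  go : ∀ φ → (∀ d → VL (φ d)) → ∀ d e → NN e → Π n (σ* (+ k) φ d) (e ∷ʳ + 0) ≡ φ d (init e ∷ʳ (last e - + k))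
  go φ v d = snoc-elim _ λ e x q → trans (trans (Π-last (σ* (+ k) φ d) e x (+ 0))
      (dem-ext (λ x y → σ*-∷ʳ (+ k) φ d (e ∷ʳ x) y) x (+ 0)))
    (trans (calc e x (proj₂ (NN-∷ʳ⁻ e x q))) (cong (φ d) (sym (cong₂ _∷ʳ_ (VecP.init-∷ʳ x e) (cong (λ z → z - + k) (VecP.last-∷ʳ x e))))))
    where
    calc : ∀ e x → + 0 ℤ.≤ x → dem (λ x y → if y ==ℤ + k then φ d (e ∷ʳ x) else + 0) x (+ 0) ≡ φ d (e ∷ʳ (x - + k))
    calc e (+ x) _ with k ℕ.≤? x
    ... | yes k≤x with ℕP.m≤n⇒∃[o]m+o≡n k≤x
    ...   | o , refl = trans (ℤP.+-identityʳ _) (trans (∫-single F (suc (k ℕ.+ o)) o (s≤s (ℕP.m≤n+m o k)) off)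
              (trans (cong (λ b → if b then φ d (e ∷ʳ + o) else + 0) (==-true (lem₁ (+ k) (+ o)))) (cong (λ z → φ d (e ∷ʳ z)) (lem₂ (+ k) (+ o)))))
      where
      F : ℤ → ℤ
      F j = if (+ (k ℕ.+ o) + + 0 - j) ==ℤ + k then φ d (e ∷ʳ j) else + 0
      lem₁ : ∀ k o → k + o + + 0 - o ≡ k
      lem₁ = solve-∀
      lem₂ : ∀ k o → o ≡ k + o - k
      lem₂ = solve-∀
      lem₃ : ∀ k o t → k + o + + 0 - t ≡ k → t ≡ o
      lem₃ k o t h = trans (lem₄ k o t) (trans (cong (λ z → k + o - z) h) (lem₅ k o))
        where
        lem₄ : ∀ k o t → t ≡ k + o - (k + o + + 0 - t)
        lem₄ = solve-∀
        lem₅ : ∀ k o → k + o - k ≡ o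
        lem₅ = solve-∀
      off : ∀ t → t ≢ o → F (+ t) ≡ + 0
      off t ne = cong (λ b → if b then φ d (e ∷ʳ + t) else + 0) (==-false λ h → ne (ℤP.+-injective (lem₃ (+ k) (+ o) (+ t) h)))
    calc e (+ x) _ | no k≰x = trans (ℤP.+-identityʳ _) (trans (∫-zero F (suc x) off) (sym (v d e (+ x - + k) (neg< x<k))))
      where
      x<k = ℕP.≰⇒> k≰x
      F : ℤ → ℤ
      F j = if (+ x + + 0 - j) ==ℤ + k then φ d (e ∷ʳ j) else + 0
      neg< : x ℕ.< k → + x - + k ℤ.< + 0
      neg< l = subst (+ x - + k ℤ.<_) (ℤP.+-inverseʳ (+ k)) (ℤP.+-monoˡ-< (- (+ k)) (ℤ.+<+ l))
      lem₃ : ∀ x t k → x + + 0 - t ≡ k → x ≡ k + t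
      lem₃ x t k refl = lem₄ x t
        where
        lem₄ : ∀ x t → x ≡ (x + + 0 - t) + t
        lem₄ = solve-∀
      off : ∀ t → t ℕ.< suc x → F (+ t) ≡ + 0
      off t _ = cong (λ b → if b then φ d (e ∷ʳ + t) else + 0)
        (==-false λ h → ℕP.<⇒≱ x<k (ℕP.≤-trans (ℕP.m≤m+n k t) (ℕP.≤-reflexive (sym (ℤP.+-injective (lem₃ (+ x) (+ t) (+ k) h))))))

σ-snoc₀ : ∀ {n} k (f : Poly n) → σ (+ k) (snoc₀ f) ≋ H 0 0 k f
σ-snoc₀ zero f = eqP λ φ → trans (trans (pair-σ (+ 0) (snoc₀ f) φ) (pair-snoc₀ f _)) (pair-ext f (λ d e → σ*-∷ʳ (+ 0) φ d e (+ 0)))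
σ-snoc₀ (suc k) f = eqP λ φ → trans (trans (pair-σ (+ suc k) (snoc₀ f) φ) (pair-snoc₀ f _)) (pair-0 f (λ d e → σ*-∷ʳ (+ suc k) φ d e (+ 0)))

H-empty : ∀ {n} s s' k (f : Poly n) → H s 0 k f ≡ H s' 0 k f
H-empty s s' zero f = refl
H-empty s s' (suc k) f = refl

cyc : ℕ → ℕ → Word
cyc s zero = []
cyc s (suc c) = upw s c

-- The coefficients of powers of x_{N+1} in π_s ⋯ π_N p, where p is symmetric in x_s, …, x_N.
σ-cyc : ∀ {n} s c k (p p' : Poly n) → c ℕ.+ s ≡ n → AllNN p → p ∼ p' →
  (∀ i → s ℕ.≤ i → suc i ℕ.< n → piOp i p' ≋ p') → σ (+ k) (piWord (cyc s c) (snoc₀ p)) ∼ H s c k p'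
σ-cyc s zero k p p' e nn h fix = ∼-trans (≋⇒∼ (σ-snoc₀ k p)) (∼-trans (≋⇒∼ (≡⇒≋ (H-empty 0 s k p))) (H-∼ s 0 k h))
σ-cyc s (suc zero) k p p' refl nn h fix = ∼-trans (≃⇒∼ (σ-last k p nn)) (H-∼ s 1 k h)
σ-cyc {n} s (suc (suc c)) k p p' e nn h fix =
  ∼-trans (≋⇒∼ (σ-piOp (+ k) s s<n (piWord (cyc (suc s) (suc c)) (snoc₀ p))))
  (∼-trans (∼-piOp s s<n (σ-cyc (suc s) (suc c) k p p' (trans (cong suc (ℕP.+-suc c s)) e) nn h (λ i l → fix i (ℕP.<⇒≤ l))))
  (≋⇒∼ (π-H-extend s c k s<n p' (fix s ℕP.≤-refl s<n))))
  where
  s<n : suc s ℕ.< n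
  s<n = subst (suc s ℕ.<_) e (s≤s (s≤s (ℕP.m≤n+m s c)))


-- Coefficients of powers of q

sumP : ∀ {n} → (ℕ → Poly n) → ℕ → Poly n
sumP F zero = F 0
sumP F (suc d) = sumP F d ++ F (suc d)

sumℤ : (ℕ → ℤ) → ℕ → ℤ
sumℤ F zero = F 0
sumℤ F (suc d) = sumℤ F d + F (suc d)

pair-sumP : ∀ {n} (F : ℕ → Poly n) d φ → ⟪ sumP F d , φ ⟫ ≡ sumℤ (λ k → ⟪ F k , φ ⟫) d
pair-sumP F zero φ = refl
pair-sumP F (suc d) φ = trans (pair-++ (sumP F d) (F (suc d)) φ) (cong (λ z → z + ⟪ F (suc d) , φ ⟫) (pair-sumP F d φ))

sumℤ-ext : ∀ {F G : ℕ → ℤ} d → (∀ k → k ℕ.≤ d → F k ≡ G k) → sumℤ F d ≡ sumℤ G d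
sumℤ-ext zero h = h 0 z≤n
sumℤ-ext (suc d) h = cong₂ _+_ (sumℤ-ext d (λ k l → h k (ℕP.m≤n⇒m≤1+n l))) (h (suc d) ℕP.≤-refl)

sumℤ-pair : ∀ {n} (f : Poly n) (φ : ℕ → ℤ → Fn n) d →
  sumℤ (λ k → ⟪ f , φ k ⟫) d ≡ ⟪ f , (λ d' e → sumℤ (λ k → φ k d' e) d) ⟫
sumℤ-pair f φ zero = refl
sumℤ-pair f φ (suc d) = trans (cong (λ z → z + ⟪ f , φ (suc d) ⟫) (sumℤ-pair f φ d)) (sym (pair-+ f _ _))

sumℤ-zero : ∀ (F : ℕ → ℤ) d → (∀ k → k ℕ.≤ d → F k ≡ + 0) → sumℤ F d ≡ + 0
sumℤ-zero F zero h = h 0 z≤n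
sumℤ-zero F (suc d) h = cong₂ _+_ (sumℤ-zero F d (λ k l → h k (ℕP.m≤n⇒m≤1+n l))) (h (suc d) ℕP.≤-refl)

sumℤ-single : ∀ (F : ℕ → ℤ) d b → b ℕ.≤ d → (∀ k → k ≢ b → F k ≡ + 0) → sumℤ F d ≡ F b
sumℤ-single F zero zero l h = refl
sumℤ-single F (suc d) b l h with ℕP.m≤n⇒m<n∨m≡n l
... | inj₁ (s≤s b≤d) = trans (cong₂ _+_ (sumℤ-single F d b b≤d h) (h (suc d) (λ { refl → ℕP.<-irrefl refl b≤d }))) (ℤP.+-identityʳ (F b))
... | inj₂ refl = trans (cong (λ z → z + F (suc d)) (sumℤ-zero F d (λ k k≤d → h k (λ { refl → ℕP.<-irrefl refl k≤d })))) (ℤP.+-identityˡ (F (suc d)))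

sumP-≋ : ∀ {n} {F G : ℕ → Poly n} d → (∀ k → F k ≋ G k) → sumP F d ≋ sumP G d
sumP-≋ zero h = h 0
sumP-≋ (suc d) h = ++-cong (sumP-≋ d h) (h (suc d))

sumP-∼ : ∀ {n} {F G : ℕ → Poly n} d → (∀ k → F k ∼ G k) → sumP F d ∼ sumP G d
sumP-∼ zero h = h 0
sumP-∼ (suc d) h = ∼-++ (sumP-∼ d h) (h (suc d))


pair-qPart : ∀ {n} (f : Poly n) d φ → ⟪ qPart f d , φ ⟫ ≡ ⟪ f , (λ d' e → if d ==ℤ d' then φ (+ 0) e else + 0) ⟫
pair-qPart [] d φ = refl
pair-qPart ((c , d' , e) ∷ f) d φ with d ==ℤ d'
... | true = addˡ (c * φ (+ 0) e) (pair-qPart f d φ)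
... | false = trans (pair-qPart f d φ) (lem c _)
  where
  lem : ∀ c x → x ≡ c * + 0 + x
  lem = solve-∀

qPart-cong : ∀ {n} {f g : Poly n} → f ≋ g → ∀ d → qPart f d ≋ qPart g d
qPart-cong {f = f} {g} p d = eqP λ φ → trans (pair-qPart f d φ) (trans (pair p _) (sym (pair-qPart g d φ)))

qPart-piOp : ∀ {n} i → suc i ℕ.< n → (f : Poly n) → ∀ d → qPart (piOp i f) d ≋ piOp i (qPart f d)
qPart-piOp i h f d = eqP λ φ → trans (trans (pair-qPart (piOp i f) d φ) (pair-piOp i h f _))
  (trans (pair-ext f (λ d' e → Π-if i (d ==ℤ d') (φ (+ 0)) e)) (sym (trans (pair-piOp i h (qPart f d) φ) (pair-qPart f d _))))

qPart-piWord : ∀ {n} w → Valid n w → (f : Poly n) → ∀ d → qPart (piWord w f) d ≋ piWord w (qPart f d)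
qPart-piWord [] _ f d = ≋-refl
qPart-piWord (i ∷ w) (h ∷ v) f d = ≋-trans (qPart-piOp i h (piWord w f) d) (piOp-cong i h (qPart-piWord w v f d))

NNQ : ∀ {n} → Term n → Set
NNQ (c , d , e) = + 0 ℤ.≤ d × NN e

AllNN-qPart : ∀ {n} {f : Poly n} d → All NNQ f → AllNN (qPart f d)
AllNN-qPart d [] = []
AllNN-qPart {f = (c , d' , e) ∷ f} d ((_ , p) ∷ ps) with d ==ℤ d'
... | true = p ∷ AllNN-qPart d ps
... | false = AllNN-qPart d ps

-- A last exponent k is traded for q^k x₁^(k+1), so q^d collects the terms of q-degree d - k.
-- Nonnegative exponents and q-degrees confine k to 0, ..., d.
ρ-parts : ∀ {N} (f : Poly (suc N)) → All NNQ f → ∀ d →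
  qPart (ρ f) (+ d) ≋ sumP (λ k → cons (+ suc k) (σ (+ k) (qPart f (+ (d ℕ.∸ k))))) d
ρ-parts {N} f nn d = eqP λ φ → trans (trans (pair-qPart (ρ f) (+ d) φ) (pair-ρ f _))
  (trans (pair-extAll nn (λ c d' e p → termwise φ d' e p))
  (trans (sym (sumℤ-pair f (term φ) d))
  (sym (trans (pair-sumP _ d φ) (sumℤ-ext d λ k _ → trans (pair-cons (+ suc k) (σ (+ k) (qPart f (+ (d ℕ.∸ k)))) φ)
    (trans (pair-σ (+ k) (qPart f (+ (d ℕ.∸ k))) _) (pair-qPart f (+ (d ℕ.∸ k)) _)))))))
  where
  term : (ℤ → Fn (suc N)) → ℕ → ℤ → Fn (suc N)
  term φ k d' e = if + (d ℕ.∸ k) ==ℤ d' then σ* (+ k) (λ d e → φ d (+ suc k ∷ e)) (+ 0) e else + 0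

  termwise : ∀ φ d' e → + 0 ℤ.≤ d' × NN e → ρ* (λ d' e → if + d ==ℤ d' then φ (+ 0) e else + 0) d' e ≡ sumℤ (λ k → term φ k d' e) d
  termwise φ (+ a) = snoc-elim _ λ e x p → trans (ρ*-∷ʳ (λ d' e → if + d ==ℤ d' then φ (+ 0) e else + 0) (+ a) e x) (calc e x (proj₂ (NN-∷ʳ⁻ e x (proj₂ p))))
    where
    value : ∀ e b k → term φ k (+ a) (e ∷ʳ + b) ≡
      (if + (d ℕ.∸ k) ==ℤ + a then (if + b ==ℤ + k then φ (+ 0) (+ suc k ∷ e) else + 0) else + 0)
    value e b k = cong (λ z → if + (d ℕ.∸ k) ==ℤ + a then z else + 0) (σ*-∷ʳ (+ k) (λ d e → φ d (+ suc k ∷ e)) (+ 0) e (+ b))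

    off : ∀ e b k → k ≢ b → term φ k (+ a) (e ∷ʳ + b) ≡ + 0
    off e b k ne rewrite value e b k | ==-false {+ b} {+ k} (λ h → ne (sym (ℤP.+-injective h))) with + (d ℕ.∸ k) ==ℤ + a
    ... | true = refl
    ... | false = refl

    hit : ∀ e b → term φ b (+ a) (e ∷ʳ + b) ≡ (if + (d ℕ.∸ b) ==ℤ + a then φ (+ 0) (+ suc b ∷ e) else + 0)
    hit e b rewrite value e b b | ==-true {+ b} {+ b} refl = refl

    calc : ∀ e x → + 0 ℤ.≤ x → (if + d ==ℤ + a + x then φ (+ 0) ((x + + 1) ∷ e) else + 0) ≡ sumℤ (λ k → term φ k (+ a) (e ∷ʳ x)) d
    calc e (+ b) _ with b ℕ.≤? d
    ... | yes b≤d = sym (trans (sumℤ-single _ d b b≤d (off e b)) (trans (hit e b)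
          (cong₂ (λ t z → if t then φ (+ 0) (z ∷ e) else + 0) same (cong +_ (sym (ℕP.+-comm b 1))))))
      where
      same : (+ (d ℕ.∸ b) ==ℤ + a) ≡ (+ d ==ℤ + a + + b)
      same with d ℕ.∸ b ℕ.≟ a
      ... | yes refl = trans (==-true {+ (d ℕ.∸ b)} refl) (sym (==-true {+ d} (cong +_ (sym (ℕP.m∸n+n≡m b≤d)))))
      ... | no ne = trans (==-false {+ (d ℕ.∸ b)} (ne ∘ ℤP.+-injective))
                      (sym (==-false {+ d} λ h → ne (trans (cong (ℕ._∸ b) (ℤP.+-injective h)) (ℕP.m+n∸n≡m a b))))
    ... | no b≰d = trans (cong (λ t → if t then φ (+ 0) ((+ b + + 1) ∷ e) else + 0)
          (==-false {+ d} λ h → b≰d (ℕP.≤-trans (ℕP.m≤n+m b a) (ℕP.≤-reflexive (sym (ℤP.+-injective h))))))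
          (sym (sumℤ-zero _ d λ k k≤d → off e b k λ { refl → b≰d k≤d }))
  termwise φ -[1+ a ] e (() , _)

-- The coefficient of q^d in x^γ ∏_{(i,j) ∈ Ψ} (1 - q x_i/x_j)^{-1}, where the i-th row of Ψ
-- consists of the roots (i,j) with j ≥ i + r_i and γ = 1^{|r|} 0^{n-|r|}.

conv : ∀ {N} → ℕ → ℕ → ℕ → (ℕ → Poly N) → ℕ → Poly (suc N)
conv z s c g d = sumP (λ k → cons (+ (z ℕ.+ k)) (H s c k (g (d ℕ.∸ k)))) d

G : ∀ n → List ℕ → ℕ → Poly n
G zero r zero = onePoly 0
G zero r (suc d) = []
G (suc N) [] = conv 0 0 N (G N [])
-- In 1-based terms the row consists of the roots (1, j) with j ≥ 1 + a. Removing x_1 and counting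
-- from 0 sends j to j - 2, so the row starts at position a - 1.
G (suc N) (a ∷ r) = conv 1 (ℕ.pred a) (N ℕ.∸ ℕ.pred a) (G N r)

≃-refl : ∀ {n} {f : Poly (suc n)} → f ≃ f
≃-refl = eqL λ _ _ → refl

≃-trans : ∀ {n} {f g h : Poly (suc n)} → f ≃ g → g ≃ h → f ≃ h
≃-trans p q = eqL λ φ v → trans (pairL p φ v) (pairL q φ v)

≋⇒≃ : ∀ {n} {f g : Poly (suc n)} → f ≋ g → f ≃ g
≋⇒≃ p = eqL λ φ _ → pair p φ

≃-++ : ∀ {n} {f f' g g' : Poly (suc n)} → f ≃ f' → g ≃ g' → f ++ g ≃ f' ++ g'
≃-++ {f = f} {f'} {g} {g'} p q = eqL λ φ v →
  trans (pair-++ f g φ) (trans (cong₂ _+_ (pairL p φ v) (pairL q φ v)) (sym (pair-++ f' g' φ)))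

≃-cons : ∀ {n} a {f g : Poly (suc n)} → f ≃ g → cons a f ≃ cons a g
≃-cons a {f} {g} p = eqL λ φ v → trans (pair-cons a f φ) (trans (pairL p _ (λ d e x → v d (a ∷ e) x)) (sym (pair-cons a g φ)))

dn-VL : ∀ {n} s {φ : Fn (suc n)} → VL φ → VL (λ e → φ (dn s e))
dn-VL s {φ} v e x p with go s e
  where
  go : ∀ {n} s (e : Vec ℤ n) → ∃ λ e' → (dn s (e ∷ʳ x) ≡ e' ∷ʳ x) ⊎ (dn s (e ∷ʳ x) ≡ e' ∷ʳ (x - + 1))
  go zero [] = [] , inj₂ refl
  go (suc s) [] = [] , inj₁ refl
  go zero (y ∷ e) = (y - + 1) ∷ e , inj₁ refl
  go (suc s) (y ∷ e) with go s e
  ... | e' , inj₁ q = y ∷ e' , inj₁ (cong (y ∷_) q)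
  ... | e' , inj₂ q = y ∷ e' , inj₂ (cong (y ∷_) q)
... | e' , inj₁ q = trans (cong φ q) (v e' x p)
... | e' , inj₂ q = trans (cong φ q) (v e' (x - + 1) (ℤP.≤-<-trans
        (subst (x - + 1 ℤ.≤_) (ℤP.+-identityʳ x) (ℤP.+-monoʳ-≤ x (ℤ.-≤+ {0} {0}))) p))

≃-X⁻ : ∀ {n} s {f g : Poly (suc n)} → f ≃ g → X⁻ s f ≃ X⁻ s g
≃-X⁻ s {f} {g} p = eqL λ φ v → trans (pair-X⁻ s f φ) (trans (pairL p _ (λ d → dn-VL s {φ d} (v d))) (sym (pair-X⁻ s g φ)))

dn-∷ʳ : ∀ {n} s → s ℕ.< n → (e : Vec ℤ n) → ∀ x → dn s (e ∷ʳ x) ≡ dn s e ∷ʳ x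
dn-∷ʳ zero h (y ∷ e) x = refl
dn-∷ʳ (suc s) (s≤s h) (y ∷ e) x = cong (y ∷_) (dn-∷ʳ s h e x)

X⁻-snoc₀ : ∀ {n} s → s ℕ.< n → (g : Poly n) → X⁻ s (snoc₀ g) ≋ snoc₀ (X⁻ s g)
X⁻-snoc₀ s h g = eqP λ φ → trans (trans (pair-X⁻ s (snoc₀ g) φ) (pair-snoc₀ g _))
  (trans (pair-ext g (λ d e → cong (φ d) (dn-∷ʳ s h e (+ 0)))) (sym (trans (pair-snoc₀ (X⁻ s g) φ) (pair-X⁻ s g _))))

X⁻-snoc₀-last : ∀ {n} (g : Poly n) → X⁻ n (snoc₀ g) ≃ []
X⁻-snoc₀-last {n} g = eqL λ φ v → trans (trans (pair-X⁻ n (snoc₀ g) φ) (pair-snoc₀ g _))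
  (pair-0 g (λ d e → trans (cong (φ d) (dn-last e (+ 0))) (v d e -[1+ 0 ] ℤ.-<+)))

H-snoc₀-last : ∀ {n} k {f : Poly (suc n)} {g : Poly n} → f ≃ snoc₀ g → H n 1 k f ≃ snoc₀ (H n 0 k g)
H-snoc₀-last zero p = p
H-snoc₀-last {n} (suc k) {g = g} p = ≃-trans (≃-X⁻ n (H-snoc₀-last k p)) (X⁻-snoc₀-last (H n 0 k g))

H-snoc₀-empty : ∀ {n} s k {f : Poly (suc n)} {g : Poly n} → f ≃ snoc₀ g → H s 0 k f ≃ snoc₀ (H s 0 k g)
H-snoc₀-empty s zero p = p
H-snoc₀-empty s (suc k) p = ≃-refl

H-snoc₀ : ∀ {n} s c k {f : Poly (suc n)} {g : Poly n} → c ℕ.+ s ≡ n → f ≃ snoc₀ g → H s (suc c) k f ≃ snoc₀ (H s c k g)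
H-snoc₀ s zero k refl p = H-snoc₀-last k p
H-snoc₀ s (suc c) zero e p = H-snoc₀ (suc s) c 0 (trans (ℕP.+-suc c s) e) p
H-snoc₀ s (suc c) (suc k) {f} {g} e p = ≃-trans
  (≃-++ (H-snoc₀ (suc s) c (suc k) (trans (ℕP.+-suc c s) e) p)
    (≃-trans (≃-X⁻ s (H-snoc₀ s (suc c) k e p)) (≋⇒≃ (X⁻-snoc₀ s (subst (s ℕ.<_) e (s≤s (ℕP.m≤n+m s c))) (H s (suc c) k g)))))
  (≋⇒≃ (≡⇒≋ (sym (LP.map-++ _ (H (suc s) c (suc k) g) (X⁻ s (H s (suc c) k g))))))

cons-snoc₀ : ∀ {n} a (f : Poly n) → cons a (snoc₀ f) ≋ snoc₀ (cons a f)
cons-snoc₀ a f = eqP λ φ → trans (trans (pair-cons a (snoc₀ f) φ) (pair-snoc₀ f _))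
  (sym (trans (pair-snoc₀ (cons a f) φ) (pair-cons a f _)))

sumP-snoc₀ : ∀ {n} (F : ℕ → Poly (suc n)) (F' : ℕ → Poly n) d → (∀ k → F k ≃ snoc₀ (F' k)) → sumP F d ≃ snoc₀ (sumP F' d)
sumP-snoc₀ F F' zero h = h 0
sumP-snoc₀ F F' (suc d) h = ≃-trans (≃-++ (sumP-snoc₀ F F' d h) (h (suc d))) (≋⇒≃ (≡⇒≋ (sym (LP.map-++ _ (sumP F' d) (F' (suc d))))))

conv-snoc₀ : ∀ {N} z s (g : ℕ → Poly (suc N)) (g' : ℕ → Poly N) → (∀ d → g d ≃ snoc₀ (g' d)) → ∀ d →
  conv z s (suc N ℕ.∸ s) g d ≃ snoc₀ (conv z s (N ℕ.∸ s) g' d)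
conv-snoc₀ {N} z s g g' h d = sumP-snoc₀ _ _ d λ k →
  ≃-trans (≃-cons (+ (z ℕ.+ k)) (column k)) (≋⇒≃ (cons-snoc₀ (+ (z ℕ.+ k)) (H s (N ℕ.∸ s) k (g' (d ℕ.∸ k)))))
  where
  column : ∀ k → H s (suc N ℕ.∸ s) k (g (d ℕ.∸ k)) ≃ snoc₀ (H s (N ℕ.∸ s) k (g' (d ℕ.∸ k)))
  column k with s ℕ.≤? N
  ... | yes s≤N rewrite ℕP.+-∸-assoc 1 s≤N = H-snoc₀ s (N ℕ.∸ s) k (ℕP.m∸n+n≡m s≤N) (h (d ℕ.∸ k))
  ... | no s≰N rewrite ℕP.m≤n⇒m∸n≡0 (ℕP.≰⇒> s≰N) | ℕP.m≤n⇒m∸n≡0 (ℕP.<⇒≤ (ℕP.≰⇒> s≰N)) = H-snoc₀-empty s k (h (d ℕ.∸ k))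

-- As `length r ≤ N`, the last variable has exponent 0 in the monomial, and every root containing it
-- divides by it. Modulo negative last exponents only the terms avoiding these roots remain.
G-snoc₀ : ∀ N r → length r ℕ.≤ N → ∀ d → G (suc N) r d ≃ snoc₀ (G N r d)
G-snoc₀ zero [] _ d = ≋⇒≃ (initial d)
  where
  vanish : ∀ d → sumP {1} (λ k → cons (+ k) (H 0 0 k (G 0 [] (suc d ℕ.∸ k)))) d ≋ []
  vanish d = go d d ℕP.≤-refl
    where
    go : ∀ d d' → d' ℕ.≤ d → sumP {1} (λ k → cons (+ k) (H 0 0 k (G 0 [] (suc d ℕ.∸ k)))) d' ≋ []
    go d zero l = ≋-refl
    go d (suc d') l = ++-cong (go d d' (ℕP.<⇒≤ l)) (≋-refl {f = []})
  initial : ∀ d → G 1 [] d ≋ snoc₀ (G 0 [] d)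
  initial zero = ≋-refl
  initial (suc d) = ++-cong (vanish d) (≋-refl {f = []})
G-snoc₀ (suc N) [] _ d = conv-snoc₀ 0 0 (G (suc N) []) (G N []) (G-snoc₀ N [] z≤n) d
G-snoc₀ (suc N) (a ∷ r) (s≤s l) d = conv-snoc₀ 1 (ℕ.pred a) (G (suc N) r) (G N r) (G-snoc₀ N r l) d

G-nil : ∀ n d → G n [] d ∼ qPart (onePoly n) (+ d)
G-nil zero zero = ∼-refl
G-nil zero (suc d) = ∼-refl
G-nil (suc n) d = ∼-trans (≃⇒∼ (G-snoc₀ n [] z≤n d)) (∼-trans (∼-snoc₀ (G-nil n d)) (≋⇒∼ (one d)))
  where
  zero-snoc : ∀ n → zeroV n ∷ʳ + 0 ≡ zeroV (suc n)
  zero-snoc zero = refl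
  zero-snoc (suc n) = cong (+ 0 ∷_) (zero-snoc n)
  one : ∀ d → snoc₀ (qPart (onePoly n) (+ d)) ≋ qPart (onePoly (suc n)) (+ d)
  one zero = ≡⇒≋ (cong (λ e → (+ 1 , + 0 , e) ∷ []) (zero-snoc n))
  one (suc d) = ≋-refl

cons-cong : ∀ {n} a {f g : Poly n} → f ≋ g → cons a f ≋ cons a g
cons-cong a {f} {g} p = eqP λ φ → trans (pair-cons a f φ) (trans (pair p _) (sym (pair-cons a g φ)))

piWord-++P : ∀ {n} w (f g : Poly n) → piWord w (f ++ g) ≡ piWord w f ++ piWord w g
piWord-++P [] f g = refl
piWord-++P (i ∷ w) f g = trans (cong (piOp i) (piWord-++P w f g)) (LP.concatMap-++ (piTerm i) (piWord w f) (piWord w g))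

piWord-sumP : ∀ {n} w (F : ℕ → Poly n) d → piWord w (sumP F d) ≡ sumP (λ k → piWord w (F k)) d
piWord-sumP w F zero = refl
piWord-sumP w F (suc d) = trans (piWord-++P w (sumP F d) (F (suc d))) (cong (_++ piWord w (F (suc d))) (piWord-sumP w F d))

H-piWord : ∀ {n} s c k w → All (λ i → s ℕ.≤ i × suc i ℕ.< c ℕ.+ s) w → Valid n w → (f : Poly n) → piWord w (H s c k f) ≋ H s c k (piWord w f)
H-piWord s c k [] _ _ f = ≋-refl
H-piWord s c k (i ∷ w) ((l , u) ∷ b) (h ∷ v) f = ≋-trans (piOp-cong i h (H-piWord s c k w b v f)) (π-H i s c k h l u (piWord w f))

Absorbs : ℕ → ℕ → Word → Set
Absorbs n a w = ∀ i → a ℕ.≤ i → suc i ℕ.< n → ∀ (f : Poly n) → piWord w (piOp i f) ≋ piWord w f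

absorb-word : ∀ {n a w} → Absorbs n a w → Valid n w → ∀ u → All (a ℕ.≤_) u → Valid n u → ∀ (f : Poly n) → piWord w (piWord u f) ≋ piWord w f
absorb-word ab vw [] _ _ f = ≋-refl
absorb-word ab vw (i ∷ u) (l ∷ ls) (h ∷ v) f = ≋-trans (ab i l h (piWord u f)) (absorb-word ab vw u ls v f)

V-bounds : ∀ s c → All (λ i → s ℕ.≤ i × suc i ℕ.≤ c ℕ.+ s) (V s c)
V-bounds s c = All.zip (lower , V-valid' s c)
  where
  lower : All (s ℕ.≤_) (V s c)
  lower = go s c
    where
    up≥ : ∀ s c t → t ℕ.≤ s → All (t ℕ.≤_) (upw s c)
    up≥ s zero t l = l ∷ []
    up≥ s (suc c) t l = l ∷ up≥ (suc s) c t (ℕP.m≤n⇒m≤1+n l)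
    go : ∀ s c → All (s ℕ.≤_) (V s c)
    go s zero = []
    go s (suc c) = AllP.++⁺ (up≥ s c s ℕP.≤-refl) (go s c)
  V-valid' : ∀ s c → All (λ i → suc i ℕ.≤ c ℕ.+ s) (V s c)
  V-valid' s c = All.map ℕ.s≤s⁻¹ (V-valid s c ℕP.≤-refl)

-- One factor of the rotation formula: multiplication by the row ∏_{j>s} (1 - q x_1/x_j)^{-1}
-- amounts to the affine rotation ρ applied after symmetrisation in x_{s+1}, …, x_n.
rotation-step : ∀ N s r (Y : Poly (suc N)) → s ℕ.≤ N → length r ℕ.≤ N → All NNQ Y →
  (∀ e → piWord (V s (N ℕ.∸ s)) (G (suc N) r e) ∼ qPart Y (+ e)) →
  ∀ w → Valid (suc N) w → Absorbs (suc N) (suc s) w →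
  ∀ d → piWord w (G (suc N) (suc s ∷ r) d) ∼ piWord w (qPart (ρ Y) (+ d))
rotation-step N s r Y s≤N len nn hyp w vw ab d =
  -- `w` absorbs `map suc u`; inserting this word symmetrises the row in precisely the variables by
  -- which it divides.
  ∼-trans (≋⇒∼ (≋-sym (absorb-word ab vw (map suc u) u-letters u-valid (G (suc N) (suc s ∷ r) d))))
    (∼-piWord w vw (∼-trans (≋⇒∼ left) (∼-trans (sumP-∼ d λ k → ∼-cons (+ suc k) (∼-sym (right k (d ℕ.∸ k)))) (≋⇒∼ (≋-sym (ρ-parts Y nn d))))))
  where
  c = N ℕ.∸ s
  c+s : c ℕ.+ s ≡ N
  c+s = ℕP.m∸n+n≡m s≤N
  Q = G N r
  u = V s (ℕ.pred c)

  u-bounds : All (λ i → s ℕ.≤ i × suc i ℕ.< c ℕ.+ s) u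
  u-bounds = go c
    where
    go : ∀ c → All (λ i → s ℕ.≤ i × suc i ℕ.< c ℕ.+ s) (V s (ℕ.pred c))
    go zero = []
    go (suc c) = All.map (λ { (l , h) → l , s≤s h }) (V-bounds s c)

  vu : Valid N u
  vu = All.map (λ { (_ , h) → subst (_ ℕ.<_) c+s h }) u-bounds

  u-letters : All (suc s ℕ.≤_) (map suc u)
  u-letters = AllP.map⁺ (All.map (λ { (l , _) → s≤s l }) u-bounds)

  u-valid : Valid (suc N) (map suc u)
  u-valid = AllP.map⁺ (All.map s≤s vu)

  V-cyc : ∀ c → V s c ≡ cyc s c ++ V s (ℕ.pred c)
  V-cyc zero = refl
  V-cyc (suc c) = refl

  v-cyc : Valid (suc N) (cyc s c)
  v-cyc = AllP.++⁻ˡ (cyc s c) (subst (Valid (suc N)) (V-cyc c) (V-valid s c (s≤s (ℕP.≤-reflexive c+s))))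

  p' : ℕ → Poly N
  p' e = piWord u (Q e)

  -- A polynomial representative of `p' e`: the coefficient extraction in `σ-cyc` is valid for
  -- nonnegative exponents.
  p : ℕ → Poly N
  p e = proj₁ (hasPoly (p' e))

  p'-fixed : ∀ e i → s ℕ.≤ i → suc i ℕ.< N → piOp i (p' e) ≋ p' e
  p'-fixed e i l h = subst (λ i → piOp i (p' e) ≋ p' e) (ℕP.m∸n+n≡m l)
    (~sound (V-absorbsˡ s (ℕ.pred c) (i ℕ.∸ s) small) (subst (λ i → suc i ℕ.< N) (sym (ℕP.m∸n+n≡m l)) h ∷ vu) (Q e))
    where
    small : i ℕ.∸ s ℕ.< ℕ.pred c
    small = ℕP.<⇒≤pred (ℕP.+-cancelʳ-< s (suc (i ℕ.∸ s)) c
      (subst₂ ℕ._<_ (cong suc (sym (ℕP.m∸n+n≡m l))) (sym c+s) h))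

  -- The congruence is sharpened to an equality, both sides being nonnegative, before `σ` is
  -- applied: `σ-cong` transports `≋`, not `∼`.
  Y≋ : ∀ e → qPart Y (+ e) ≋ piWord (cyc s c) (snoc₀ (p e))
  Y≋ e = nonneg-separated (AllNN-qPart (+ e) nn)
    (AllNN-piWord (cyc s c) _ (AllP.map⁺ (All.map (λ { {c , d , e} q → NN-∷ʳ e (+ 0) q (ℤ.+≤+ z≤n) }) (proj₁ (proj₂ (hasPoly (p' e)))))))
    (∼-trans (∼-sym (hyp e)) (∼-trans (∼-piWord (V s c) vV (≃⇒∼ (G-snoc₀ N r len e)))
    (∼-trans (≋⇒∼ (≡⇒≋ (trans (cong (λ w → piWord w (snoc₀ (Q e))) (V-cyc c)) (piWord-++ (cyc s c) u (snoc₀ (Q e))))))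
    (∼-piWord (cyc s c) v-cyc (∼-trans (≋⇒∼ (snoc₀-piWord u vu (Q e))) (∼-snoc₀ (proj₂ (proj₂ (hasPoly (p' e))))))))))
    where
    vV : Valid (suc N) (V s c)
    vV = V-valid s c (s≤s (ℕP.≤-reflexive c+s))

  right : ∀ k e → σ (+ k) (qPart Y (+ e)) ∼ H s c k (p' e)
  right k e = ∼-trans (≋⇒∼ (σ-cong (+ k) (Y≋ e)))
    (σ-cyc s c k (p e) (p' e) c+s (proj₁ (proj₂ (hasPoly (p' e)))) (∼-sym (proj₂ (proj₂ (hasPoly (p' e))))) (p'-fixed e))

  left : piWord (map suc u) (G (suc N) (suc s ∷ r) d) ≋ sumP (λ k → cons (+ suc k) (H s c k (p' (d ℕ.∸ k)))) d
  left = ≋-trans (≡⇒≋ (piWord-sumP (map suc u) _ d)) (sumP-≋ d λ k →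
    ≋-trans (cons-piWord (+ suc k) u vu (H s c k (Q (d ℕ.∸ k))))
      (cons-cong (+ suc k) (H-piWord s c k u u-bounds vu (Q (d ℕ.∸ k)))))

-- Vectors reached by alternating the rotation with the longest words

padℕ : ∀ n → List ℕ → Vec ℤ n
padℕ n l = pad n (map +_ l)

takePad : ℕ → List ℕ → List ℕ
takePad zero l = []
takePad (suc s) [] = 0 ∷ takePad s []
takePad (suc s) (x ∷ l) = x ∷ takePad s l

stepRow : ℕ → List ℕ → List ℕ
stepRow s l = suc (nthℕ s l) ∷ takePad s l

run : List ℕ → List ℕ
run [] = []
run (a ∷ r) = stepRow (ℕ.pred a) (run r)

pad-[] : ∀ n → pad n [] ≡ zeroV n
pad-[] zero = refl
pad-[] (suc n) = cong (+ 0 ∷_) (pad-[] n)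

zeroV-∷ʳ : ∀ n → zeroV n ∷ʳ + 0 ≡ zeroV (suc n)
zeroV-∷ʳ zero = refl
zeroV-∷ʳ (suc n) = cong (+ 0 ∷_) (zeroV-∷ʳ n)

hstep-∷ʳ : ∀ {n} i → suc i ℕ.< n → (v : Vec ℤ n) → ∀ x → hstep i (v ∷ʳ x) ≡ hstep i v ∷ʳ x
hstep-∷ʳ zero h (a ∷ b ∷ v) x with b ≤ℤ a
... | true = refl
... | false = refl
hstep-∷ʳ zero (s≤s ()) (a ∷ []) x
hstep-∷ʳ (suc i) (s≤s h) (a ∷ v) x = cong (a ∷_) (hstep-∷ʳ i h v x)

act-∷ʳ : ∀ {n} w → Valid n w → (v : Vec ℤ n) → ∀ x → act w (v ∷ʳ x) ≡ act w v ∷ʳ x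
act-∷ʳ [] _ v x = refl
act-∷ʳ (i ∷ w) (h ∷ vw) v x = trans (cong (hstep i) (act-∷ʳ w vw v x)) (hstep-∷ʳ i h (act w v) x)

act-++ : ∀ {n} a b (v : Vec ℤ n) → act (a ++ b) v ≡ act a (act b v)
act-++ [] b v = refl
act-++ (i ∷ a) b v = cong (hstep i) (act-++ a b v)

act-zeroV : ∀ {n} w → Valid n w → act w (zeroV n) ≡ zeroV n
act-zeroV [] _ = refl
act-zeroV {n} (i ∷ w) (h ∷ v) = trans (cong (hstep i) (act-zeroV w v))
  (trans (hstep-swap i h (zeroV n) (ℤP.≤-reflexive (sym eq))) (swap-eq i h (zeroV n) eq))
  where
  eq : getAt i (zeroV n) ≡ getAt (suc i) (zeroV n)
  eq = trans (get-zeroV n i) (sym (get-zeroV n (suc i)))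

act-map-suc : ∀ {n} w y (v : Vec ℤ n) → act (map suc w) (y ∷ v) ≡ y ∷ act w v
act-map-suc [] y v = refl
act-map-suc (i ∷ w) y v = cong (hstep (suc i)) (act-map-suc w y v)

upw-suc : ∀ s c → upw (suc s) c ≡ map suc (upw s c)
upw-suc s zero = refl
upw-suc s (suc c) = cong (suc s ∷_) (upw-suc (suc s) c)

V-suc : ∀ s c → V (suc s) c ≡ map suc (V s c)
V-suc s zero = refl
V-suc s (suc c) = trans (cong₂ _++_ (upw-suc s c) (V-suc s c)) (sym (LP.map-++ suc (upw s c) (V s c)))

upw-top : ∀ c → ∃ λ w → upw 0 c ≡ w ++ c ∷ [] × Valid (suc c) w
upw-top zero = [] , refl , []
upw-top (suc c) = upw 0 c , trans (upw-snoc 0 c) (cong (λ z → upw 0 c ++ suc z ∷ []) (ℕP.+-identityʳ c)) ,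
  upw-valid 0 c (s≤s (s≤s (ℕP.≤-reflexive (ℕP.+-identityʳ c))))
  where
  upw-valid : ∀ s c {n} → suc (c ℕ.+ s) ℕ.< n → Valid n (upw s c)
  upw-valid s zero h = h ∷ []
  upw-valid s (suc c) {n} h = ℕP.≤-<-trans (s≤s (ℕP.m≤n⇒m≤1+n (ℕP.m≤n+m s c))) h ∷ upw-valid (suc s) c (subst (λ z → suc z ℕ.< n) (sym (ℕP.+-suc c s)) h)

act-V₀ : ∀ c x → act (V 0 c) (+ x ∷ zeroV c) ≡ zeroV c ∷ʳ + x
act-V₀ zero x = refl
act-V₀ (suc c) x with upw-top c
... | w , eq , vw = begin
  act (upw 0 c ++ V 0 c) (+ x ∷ zeroV (suc c))
    ≡⟨ act-++ (upw 0 c) (V 0 c) _ ⟩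
  act (upw 0 c) (act (V 0 c) (+ x ∷ zeroV (suc c)))
    ≡⟨ cong (λ v → act (upw 0 c) (act (V 0 c) (+ x ∷ v))) (sym (zeroV-∷ʳ c)) ⟩
  act (upw 0 c) (act (V 0 c) ((+ x ∷ zeroV c) ∷ʳ + 0))
    ≡⟨ cong (act (upw 0 c)) (trans (act-∷ʳ (V 0 c) (V-valid 0 c (s≤s (ℕP.≤-reflexive (ℕP.+-identityʳ c)))) (+ x ∷ zeroV c) (+ 0))
         (cong (_∷ʳ + 0) (act-V₀ c x))) ⟩
  act (upw 0 c) (zeroV c ∷ʳ + x ∷ʳ + 0)
    ≡⟨ trans (cong (λ u → act u (zeroV c ∷ʳ + x ∷ʳ + 0)) eq) (act-++ w (c ∷ []) _) ⟩
  act w (hstep c (zeroV c ∷ʳ + x ∷ʳ + 0))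
    ≡⟨ cong (act w) (trans (hstep-swap c ℕP.≤-refl (zeroV c ∷ʳ + x ∷ʳ + 0)
         (subst₂ ℤ._≤_ (sym (get-last (zeroV c ∷ʳ + x) (+ 0))) (sym (get-last₂ (zeroV c) (+ x) (+ 0))) (ℤ.+≤+ z≤n)))
         (swap-last (zeroV c) (+ x) (+ 0))) ⟩
  act w (zeroV c ∷ʳ + 0 ∷ʳ + x)
    ≡⟨ cong (λ v → act w (v ∷ʳ + x)) (zeroV-∷ʳ c) ⟩
  act w (zeroV (suc c) ∷ʳ + x)
    ≡⟨ trans (act-∷ʳ w vw (zeroV (suc c)) (+ x)) (cong (_∷ʳ + x) (act-zeroV w vw)) ⟩
  zeroV (suc c) ∷ʳ + x ∎
  where open ≡-Reasoning

-- All entries after position s are 0, so the longest word on the positions from s on merely carries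
-- the entry at s to the end.
act-V-pad : ∀ s c l → length l ℕ.≤ suc s → act (V s c) (padℕ (suc (s ℕ.+ c)) l) ≡ padℕ (s ℕ.+ c) (takePad s l) ∷ʳ + nthℕ s l
act-V-pad zero c [] h = trans (cong (λ v → act (V 0 c) (+ 0 ∷ v)) (pad-[] c)) (trans (act-V₀ c 0) (cong (_∷ʳ + 0) (sym (pad-[] c))))
act-V-pad zero c (x ∷ []) h = trans (cong (λ v → act (V 0 c) (+ x ∷ v)) (pad-[] c)) (trans (act-V₀ c x) (cong (_∷ʳ + x) (sym (pad-[] c))))
act-V-pad zero c (x ∷ y ∷ l) (s≤s ())
act-V-pad (suc s) c [] h = trans (cong (λ w → act w (padℕ (suc (suc s ℕ.+ c)) [])) (V-suc s c))
  (trans (act-map-suc (V s c) (+ 0) _) (cong (+ 0 ∷_) (act-V-pad s c [] z≤n)))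
act-V-pad (suc s) c (x ∷ l) (s≤s h) = trans (cong (λ w → act w (padℕ (suc (suc s ℕ.+ c)) (x ∷ l))) (V-suc s c))
  (trans (act-map-suc (V s c) (+ x) _) (cong (+ x ∷_) (act-V-pad s c l h)))

rot-act-V : ∀ N s l → s ℕ.≤ N → length l ℕ.≤ suc s → rot (act (V s (N ℕ.∸ s)) (padℕ (suc N) l)) ≡ padℕ (suc N) (stepRow s l)
rot-act-V N s l s≤N h = subst (λ M → rot (act (V s (N ℕ.∸ s)) (padℕ (suc M) l)) ≡ padℕ (suc M) (stepRow s l)) (ℕP.m+[n∸m]≡n s≤N)
  (trans (cong rot (act-V-pad s (N ℕ.∸ s) l h)) (trans (rot-∷ʳ _ (+ nthℕ s l)) (cong (λ z → + z ∷ padℕ (s ℕ.+ (N ℕ.∸ s)) (takePad s l)) (ℕP.+-comm (nthℕ s l) 1))))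

hdOK : ℕ → List ℕ → Set
hdOK s [] = ⊤
hdOK s (a ∷ _) = s ℕ.≤ a

-- The conditions under which rows can be peeled: `length (run r) ≤ suc s` ensures that only zeros
-- follow position s, as `rot-act-V` requires, and `hdOK` that the word symmetrising from s on
-- absorbs the letters demanded by the next row.
data Rows (N : ℕ) : List ℕ → Set where
  [] : Rows N []
  row : ∀ {s r} → s ℕ.≤ N → length (run r) ℕ.≤ suc s → hdOK s r → Rows N r → Rows N (suc s ∷ r)

AbsorbsFrom : ℕ → List ℕ → Word → Set
AbsorbsFrom n [] w = ⊤
AbsorbsFrom n (a ∷ _) w = Absorbs n a w

AllQ-piOp : ∀ {n} i (f : Poly n) → All (λ t → + 0 ℤ.≤ proj₁ (proj₂ t)) f → All (λ t → + 0 ℤ.≤ proj₁ (proj₂ t)) (piOp i f)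
AllQ-piOp i [] [] = []
AllQ-piOp i ((c , d , e) ∷ f) (p ∷ ps) = AllP.++⁺ term (AllQ-piOp i f ps)
  where
  term : All (λ t → + 0 ℤ.≤ proj₁ (proj₂ t)) (piTerm i (c , d , e))
  term with getAt (suc i) e ≤ℤ getAt i e
  ... | true = AllP.map⁺ (All.universal (λ _ → p) _)
  ... | false = AllP.map⁺ (All.universal (λ _ → p) _)

AllNNQ-piOp : ∀ {n} i (f : Poly n) → All NNQ f → All NNQ (piOp i f)
AllNNQ-piOp i f h = All.zip (AllQ-piOp i f (All.map proj₁ h) , AllNN-piOp i f (All.map proj₂ h))

IsE-NNQ : ∀ {k β f} → IsE k β f → All NNQ f
IsE-NNQ {k} base = (ℤ.+≤+ z≤n , NN-zeroV (suc k)) ∷ []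
IsE-NNQ (hecke i h d) = AllNNQ-piOp i _ (IsE-NNQ d)
IsE-NNQ (cyclic {f = f} d) = go f (IsE-NNQ d)
  where
  go : ∀ f → All NNQ f → All NNQ (ρ f)
  go [] [] = []
  go ((c , d , e) ∷ f) ((p , q) ∷ ps) = (ℤP.+-mono-≤ p (NN-last e q) , NN-rot e q) ∷ go f ps

IsE-word : ∀ {k β f} w → Valid (suc k) w → IsE k β f → IsE k (act w β) (piWord w f)
IsE-word [] _ d = d
IsE-word (i ∷ w) (h ∷ v) d = hecke i h (IsE-word w v d)

-- The outer word is universally quantified because it changes at each row: the remaining rows are
-- treated with `V s (N ∸ s)` in its place, which satisfies their absorption condition by
-- `V-absorbsʳ`.
rotation : ∀ N r → Rows N r → length r ℕ.≤ suc N → ∃ λ Y → IsE N (padℕ (suc N) (run r)) Y ×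
  (∀ w → Valid (suc N) w → AbsorbsFrom (suc N) r w → ∀ d → piWord w (G (suc N) r d) ∼ piWord w (qPart Y (+ d)))
rotation N [] [] _ = onePoly (suc N) , subst (λ v → IsE N v (onePoly (suc N))) (sym (pad-[] (suc N))) base ,
  λ w vw _ d → ∼-piWord w vw (G-nil (suc N) d)
rotation N (suc s ∷ r) (row s≤N lr hd rows) (s≤s len) with rotation N r rows (ℕP.m≤n⇒m≤1+n len)
... | Y , dY , hyp = ρ (piWord v Y) ,
    subst (λ β → IsE N β (ρ (piWord v Y))) (rot-act-V N s (run r) s≤N lr) (cyclic dv) ,
    rotation-step N s r (piWord v Y) s≤N len (IsE-NNQ dv)
      (λ e → ∼-trans (hyp v vv (absorb r hd) e) (≋⇒∼ (≋-sym (qPart-piWord v vv Y (+ e)))))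
  where
  v = V s (N ℕ.∸ s)
  vv : Valid (suc N) v
  vv = V-valid s (N ℕ.∸ s) (s≤s (ℕP.≤-reflexive (ℕP.m∸n+n≡m s≤N)))
  dv : IsE N (act v (padℕ (suc N) (run r))) (piWord v Y)
  dv = IsE-word v vv dY
  absorb : ∀ r → hdOK s r → AbsorbsFrom (suc N) r v
  absorb [] _ = tt
  absorb (a ∷ _) s≤a i a≤i h f = ≋-trans (≡⇒≋ (sym (piWord-++ v (i ∷ []) f)))
    (subst (λ z → piWord (v ++ z ∷ []) f ≋ piWord v f) (ℕP.m∸n+n≡m s≤i)
      (~sound (V-absorbsʳ s (N ℕ.∸ s) (i ℕ.∸ s) (ℕP.∸-monoˡ-< (ℕ.s≤s⁻¹ h) s≤i))
        (AllP.++⁺ vv (subst (λ z → suc z ℕ.< suc N) (sym (ℕP.m∸n+n≡m s≤i)) h ∷ [])) f))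
    where
    s≤i = ℕP.≤-trans s≤a a≤i

-- The rows of Δ'(η), including the trivial last one

hd : List ℕ → ℕ
hd [] = 0
hd (a ∷ _) = a

full : List ℕ → List ℕ
full [] = []
full (a ∷ η) = List.replicate (hd η) a ++ descList a (hd η) ++ full η

-- The conjugate partition, built column by column: a first part a adds 1 to each of the first a
-- entries.
lam : List ℕ → List ℕ
lam [] = []
lam (a ∷ η) = map suc (lam η ++ List.replicate (a ℕ.∸ hd η) 0)

data Partition : List ℕ → Set where
  [] : Partition []
  part : ∀ {a η} → 1 ℕ.≤ a → hd η ℕ.≤ a → Partition η → Partition (a ∷ η)

length-lam : ∀ {η} → Partition η → length (lam η) ≡ hd η
length-lam [] = refl
length-lam {a ∷ η} (part _ h p) = trans (LP.length-map suc (lam η ++ List.replicate (a ℕ.∸ hd η) 0)) (trans (LP.length-++ (lam η))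
  (trans (cong₂ ℕ._+_ (length-lam p) (LP.length-replicate (a ℕ.∸ hd η) {0})) (ℕP.m+[n∸m]≡n h)))

dl : ℕ → ℕ → List ℕ
dl b zero = []
dl b (suc t) = suc (t ℕ.+ b) ∷ dl b t

descList-dl : ∀ b t → descList (t ℕ.+ b) b ≡ dl b t
descList-dl b t = trans (cong (applyUpTo (λ i → t ℕ.+ b ℕ.∸ i)) (ℕP.m+n∸n≡m t b)) (go t)
  where
  go : ∀ t → applyUpTo (λ i → t ℕ.+ b ℕ.∸ i) t ≡ dl b t
  go zero = refl
  go (suc t) = cong (suc (t ℕ.+ b) ∷_) (go t)

takePad-all : ∀ l → takePad (length l) l ≡ l
takePad-all [] = refl
takePad-all (x ∷ l) = cong (x ∷_) (takePad-all l)

nth-all : ∀ l → nthℕ (length l) l ≡ 0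
nth-all [] = refl
nth-all (x ∷ l) = nth-all l

stepRow-all : ∀ {s} l → length l ≡ s → stepRow s l ≡ 1 ∷ l
stepRow-all l refl = cong₂ (λ x m → suc x ∷ m) (nth-all l) (takePad-all l)

stepRow-last : ∀ {s} l y → length l ≡ s → stepRow s (l ++ y ∷ []) ≡ suc y ∷ l
stepRow-last l y refl = cong₂ (λ x m → suc x ∷ m) (nth l) (take l)
  where
  nth : ∀ l → nthℕ (length l) (l ++ y ∷ []) ≡ y
  nth [] = refl
  nth (x ∷ l) = nth l
  take : ∀ l → takePad (length l) (l ++ y ∷ []) ≡ l
  take [] = refl
  take (x ∷ l) = cong (x ∷_) (take l)

run-dl : ∀ b t r l → run r ≡ l → length l ≡ b → run (dl b t ++ r) ≡ List.replicate t 1 ++ l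
run-dl b zero r l e h = e
run-dl b (suc t) r l e h = trans (cong (stepRow (t ℕ.+ b)) (run-dl b t r l e h))
  (stepRow-all (List.replicate t 1 ++ l) (trans (LP.length-++ (List.replicate t 1)) (cong₂ ℕ._+_ (LP.length-replicate t) h)))

-- Each row `suc a` takes the last of the `suc a` entries, raises it and puts it in front. After as
-- many rows as `K` has entries, `K` has been raised and stands before `M` in its original order.
run-replicate : ∀ a r M K → run r ≡ M ++ K → length (M ++ K) ≡ suc a → run (List.replicate (length K) (suc a) ++ r) ≡ map suc K ++ M
run-replicate a r M [] e h = trans e (LP.++-identityʳ M)
run-replicate a r M (y ∷ K) e h = trans
  (cong (stepRow a) (trans (run-replicate a r (M ++ y ∷ []) K (trans e e') (trans (cong length (sym e')) h)) (sym (LP.++-assoc (map suc K) M (y ∷ [])))))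
  (stepRow-last (map suc K ++ M) y (ℕP.suc-injective (trans len h)))
  where
  e' : M ++ y ∷ K ≡ (M ++ y ∷ []) ++ K
  e' = sym (LP.++-assoc M (y ∷ []) K)
  len : suc (length (map suc K ++ M)) ≡ length (M ++ y ∷ K)
  len = trans (cong suc (trans (LP.length-++ (map suc K)) (trans (cong (ℕ._+ length M) (LP.length-map suc K)) (ℕP.+-comm (length K) (length M)))))
    (trans (sym (ℕP.+-suc (length M) (length K))) (sym (LP.length-++ M)))

map-suc-zeros : ∀ t → map suc (List.replicate t 0) ≡ List.replicate t 1
map-suc-zeros zero = refl
map-suc-zeros (suc t) = cong (1 ∷_) (map-suc-zeros t)

full-dl : ∀ a η → hd η ℕ.≤ a → full (a ∷ η) ≡ List.replicate (hd η) a ++ dl (hd η) (a ℕ.∸ hd η) ++ full η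
full-dl a η h = cong (λ l → List.replicate (hd η) a ++ l ++ full η)
  (trans (cong (λ z → descList z (hd η)) (sym (ℕP.m∸n+n≡m h))) (descList-dl (hd η) (a ℕ.∸ hd η)))

-- Rows act from the end of the list. In the block of a part a, the descending rows each bring in a
-- new 1 in front of `lam η`; the repeated rows then raise the entries of `lam η` and move them
-- before these ones. This adds one column of height a.
run-full : ∀ {η} → Partition η → run (full η) ≡ lam η
run-full [] = refl
run-full {suc a ∷ η} (part _ h p) = trans (cong run (full-dl (suc a) η h))
  (trans (cong (λ k → run (List.replicate k (suc a) ++ dl (hd η) t ++ full η)) (sym (length-lam p)))
  (trans (run-replicate a _ (List.replicate t 1) (lam η) (run-dl (hd η) t (full η) (lam η) (run-full p) (length-lam p)) len)
  (sym (trans (LP.map-++ suc (lam η) (List.replicate t 0)) (cong (map suc (lam η) ++_) (map-suc-zeros t))))))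
  where
  t = suc a ℕ.∸ hd η
  len : length (List.replicate t 1 ++ lam η) ≡ suc a
  len = trans (LP.length-++ (List.replicate t 1)) (trans (cong₂ ℕ._+_ (LP.length-replicate t) (length-lam p)) (ℕP.m∸n+n≡m h))

sumL : List ℕ → ℕ
sumL = foldr ℕ._+_ 0

sumL-++ : ∀ a b → sumL (a ++ b) ≡ sumL a ℕ.+ sumL b
sumL-++ [] b = refl
sumL-++ (x ∷ a) b = trans (cong (x ℕ.+_) (sumL-++ a b)) (sym (ℕP.+-assoc x (sumL a) (sumL b)))

sum-lam : ∀ {η} → Partition η → sumL (lam η) ≡ sumL η
sum-lam [] = refl
sum-lam {a ∷ η} (part x h p) = trans (sum-suc (lam η ++ zs)) (cong₂ ℕ._+_ len
  (trans (sumL-++ (lam η) zs) (trans (cong₂ ℕ._+_ (sum-lam p) (sum-0 (a ℕ.∸ hd η))) (ℕP.+-identityʳ (sumL η)))))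
  where
  zs = List.replicate (a ℕ.∸ hd η) 0
  len : length (lam η ++ zs) ≡ a
  len = trans (sym (LP.length-map suc (lam η ++ zs))) (length-lam (part x h p))
  sum-suc : ∀ l → sumL (map suc l) ≡ length l ℕ.+ sumL l
  sum-suc [] = refl
  sum-suc (x ∷ l) = cong suc (trans (cong (x ℕ.+_) (sum-suc l)) (trans (sym (ℕP.+-assoc x (length l) (sumL l)))
    (trans (cong (ℕ._+ sumL l) (ℕP.+-comm x (length l))) (ℕP.+-assoc (length l) x (sumL l)))))
  sum-0 : ∀ t → sumL (List.replicate t 0) ≡ 0
  sum-0 zero = refl
  sum-0 (suc t) = sum-0 t

length-dl : ∀ b t → length (dl b t) ≡ t
length-dl b zero = refl
length-dl b (suc t) = cong suc (length-dl b t)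

length-full : ∀ {η} → Partition η → length (full η) ≡ sumL η
length-full [] = refl
length-full {a ∷ η} (part _ h p) = trans (cong length (full-dl a η h)) (trans (LP.length-++ (List.replicate (hd η) a))
  (trans (cong₂ ℕ._+_ (LP.length-replicate (hd η)) (trans (LP.length-++ (dl (hd η) (a ℕ.∸ hd η))) (cong₂ ℕ._+_ (length-dl (hd η) (a ℕ.∸ hd η)) (length-full p))))
  (trans (sym (ℕP.+-assoc (hd η) (a ℕ.∸ hd η) (sumL η))) (cong (ℕ._+ sumL η) (ℕP.m+[n∸m]≡n h)))))

full-head : ∀ {a η} → Partition (a ∷ η) → ∃ λ r → full (a ∷ η) ≡ a ∷ r
full-head {a} {η} (part pos h p) with hd η | full-dl a η h
... | suc b | eq = _ , eq
full-head {suc a} {η} (part pos h p) | zero | eq = _ , trans eq (cong (λ z → suc z ∷ dl 0 a ++ full η) (ℕP.+-identityʳ a))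

hdOK-full : ∀ {η} s → Partition η → s ℕ.≤ hd η → hdOK s (full η)
hdOK-full s [] h = tt
hdOK-full s p@(part _ _ _) h with full-head p
... | r , eq = subst (hdOK s) (sym eq) h

hdOK-mono : ∀ {s s'} r → s ℕ.≤ s' → hdOK s' r → hdOK s r
hdOK-mono [] l h = tt
hdOK-mono (a ∷ r) l h = ℕP.≤-trans l h

rows-full : ∀ N {η} → Partition η → hd η ℕ.≤ suc N → Rows N (full η)
rows-full N [] _ = []
rows-full N {suc a ∷ η} (part pos h p) (s≤s a≤N) =
  subst (Rows N) (sym (full-dl (suc a) η h)) (replicated (hd η))
  where
  b = hd η
  t = suc a ℕ.∸ b
  t+b : t ℕ.+ b ≡ suc a
  t+b = ℕP.m∸n+n≡m h
  ones : ℕ → List ℕ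
  ones t = List.replicate t 1
  R₀ = dl b t ++ full η

  run-R₀ : ∀ t → run (dl b t ++ full η) ≡ ones t ++ lam η
  run-R₀ t = run-dl b t (full η) (lam η) (run-full p) (length-lam p)

  len-R₀ : ∀ t → length (run (dl b t ++ full η)) ≡ t ℕ.+ b
  len-R₀ t = trans (cong length (run-R₀ t)) (trans (LP.length-++ (ones t)) (cong₂ ℕ._+_ (LP.length-replicate t) (length-lam p)))

  hd-dl : ∀ t → hdOK (t ℕ.+ b) (dl b t ++ full η)
  hd-dl zero = hdOK-full b p ℕP.≤-refl
  hd-dl (suc t) = ℕP.≤-refl

  descending : ∀ t → t ℕ.+ b ℕ.≤ suc N → Rows N (dl b t ++ full η)
  descending zero l = rows-full N p l
  descending (suc t) (s≤s l) = row l (ℕP.m≤n⇒m≤1+n (ℕP.≤-reflexive (len-R₀ t))) (hd-dl t) (descending t (ℕP.m≤n⇒m≤1+n l))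

  hd-rep : ∀ k → hdOK a (List.replicate k (suc a) ++ R₀)
  hd-rep zero = hdOK-mono R₀ (ℕP.n≤1+n a) (subst (λ z → hdOK z R₀) t+b (hd-dl t))
  hd-rep (suc k) = ℕP.n≤1+n a

  length-takePad : ∀ s l → length (takePad s l) ≡ s
  length-takePad zero l = refl
  length-takePad (suc s) [] = cong suc (length-takePad s [])
  length-takePad (suc s) (x ∷ l) = cong suc (length-takePad s l)

  replicated : ∀ k → Rows N (List.replicate k (suc a) ++ R₀)
  replicated zero = descending t (subst (ℕ._≤ suc N) (sym t+b) (s≤s a≤N))
  replicated (suc k) = row a≤N (ℕP.≤-reflexive (len k)) (hd-rep k) (replicated k)
    where
    len : ∀ k → length (run (List.replicate k (suc a) ++ R₀)) ≡ suc a
    len zero = trans (len-R₀ t) t+b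
    len (suc k) = cong suc (length-takePad a _)

-- Expansion of the product over a root ideal, row by row

pair-·P : ∀ {n} (f g : Poly n) φ → ⟪ f ·P g , φ ⟫ ≡ ⟪ f , (λ d e → ⟪ g , (λ d' e' → φ (d + d') (zipWith _+_ e e')) ⟫) ⟫
pair-·P f g φ = pair-concatMap _ (λ φ d e → ⟪ g , (λ d' e' → φ (d + d') (zipWith _+_ e e')) ⟫) φ (λ c d e → term c d e g) f
  where
  term : ∀ c d e g → ⟪ map (λ { (c' , d' , e') → (c * c' , d + d' , zipWith _+_ e e') }) g , φ ⟫ ≡
    c * ⟪ g , (λ d' e' → φ (d + d') (zipWith _+_ e e')) ⟫
  term c d e [] = sym (ℤP.*-zeroʳ c)
  term c d e ((c' , d' , e') ∷ g) = trans (addˡ (c * c' * φ (d + d') (zipWith _+_ e e')) (term c d e g))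
    (lem c c' (φ (d + d') (zipWith _+_ e e')) _)
    where
    lem : ∀ c c' x y → c * c' * x + c * y ≡ c * (c' * x + y)
    lem = solve-∀

pair-mono· : ∀ {n} (v : Vec ℤ n) (g : Poly n) φ → ⟪ mono v ·P g , φ ⟫ ≡ ⟪ g , (λ d e → φ d (zipWith _+_ v e)) ⟫
pair-mono· v g φ = trans (pair-·P (mono v) g φ) (trans (lem ⟪ g , (λ d' e' → φ (+ 0 + d') (zipWith _+_ v e')) ⟫)
  (pair-ext g (λ d e → cong (λ z → φ z (zipWith _+_ v e)) (ℤP.+-identityˡ d))))
  where
  lem : ∀ x → + 1 * x + + 0 ≡ x
  lem = solve-∀

pair-·mono : ∀ {n} (v : Vec ℤ n) (g : Poly n) φ → ⟪ g ·P mono v , φ ⟫ ≡ ⟪ g , (λ d e → φ d (zipWith _+_ e v)) ⟫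
pair-·mono v g φ = trans (pair-·P g (mono v) φ) (pair-ext g λ d e → trans (lem (φ (d + + 0) (zipWith _+_ e v)))
  (cong (λ z → φ z (zipWith _+_ e v)) (ℤP.+-identityʳ d)))
  where
  lem : ∀ x → + 1 * x + + 0 ≡ x
  lem = solve-∀


unit⁻ : ∀ N → ℕ → ℕ → Vec ℤ N
unit⁻ N s k = tabulate (λ p → if Fin.toℕ p ℕ.≡ᵇ s then - (+ k) else + 0)

zeros-+ : ∀ {N} (e : Vec ℤ N) → zipWith _+_ (tabulate {n = N} (λ _ → + 0)) e ≡ e
zeros-+ [] = refl
zeros-+ (x ∷ e) = cong₂ _∷_ (ℤP.+-identityˡ x) (zeros-+ e)

unit⁻-zero : ∀ {N} s (e : Vec ℤ N) → zipWith _+_ (unit⁻ N s 0) e ≡ e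
unit⁻-zero s [] = refl
unit⁻-zero zero (x ∷ e) = cong₂ _∷_ (ℤP.+-identityˡ x) (zeros-+ e)
unit⁻-zero (suc s) (x ∷ e) = cong₂ _∷_ (ℤP.+-identityˡ x) (unit⁻-zero s e)

unit⁻-suc : ∀ {N} s k (e : Vec ℤ N) → zipWith _+_ (unit⁻ N s (suc k)) e ≡ dn s (zipWith _+_ (unit⁻ N s k) e)
unit⁻-suc s k [] = refl
unit⁻-suc zero k (x ∷ e) = cong (_∷ zipWith _+_ (tabulate (λ _ → + 0)) e) (lem (+ k) x)
  where
  lem : ∀ k x → - (+ 1 + k) + x ≡ - k + x - + 1
  lem = solve-∀
unit⁻-suc (suc s) k (x ∷ e) = cong (_ ∷_) (unit⁻-suc s k e)

·P-congʳ : ∀ {n} (v : Vec ℤ n) {f g : Poly n} → f ≋ g → mono v ·P f ≋ mono v ·P g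
·P-congʳ v {f} {g} p = eqP λ φ → trans (pair-mono· v f φ) (trans (pair p _) (sym (pair-mono· v g φ)))

up-root : ℕ × ℕ → ℕ × ℕ
up-root (i , j) = suc i , suc j

geo-up : ∀ N Ψ d → geoCoeff (suc N) (map up-root Ψ) d ≋ cons (+ 0) (geoCoeff N Ψ d)
geo-up N [] zero = ≋-refl
geo-up N [] (suc d) = ≋-refl
geo-up N ((i , j) ∷ Ψ) d = go (List.upTo (suc d))
  where
  go : ∀ L → concatMap (λ k → mono (rootExp (suc N) (suc i) (suc j) k) ·P geoCoeff (suc N) (map up-root Ψ) (d ℕ.∸ k)) L ≋
    cons (+ 0) (concatMap (λ k → mono (rootExp N i j k) ·P geoCoeff N Ψ (d ℕ.∸ k)) L)
  go [] = ≋-refl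
  go (k ∷ L) = ≋-trans (++-cong one (go L)) (≡⇒≋ (sym (LP.map-++ _ (mono (rootExp N i j k) ·P geoCoeff N Ψ (d ℕ.∸ k)) _)))
    where
    one : mono (rootExp (suc N) (suc i) (suc j) k) ·P geoCoeff (suc N) (map up-root Ψ) (d ℕ.∸ k) ≋
      cons (+ 0) (mono (rootExp N i j k) ·P geoCoeff N Ψ (d ℕ.∸ k))
    one = ≋-trans (·P-congʳ _ (geo-up N Ψ (d ℕ.∸ k))) (eqP λ φ →
      trans (pair-mono· (rootExp (suc N) (suc i) (suc j) k) (cons (+ 0) (geoCoeff N Ψ (d ℕ.∸ k))) φ)
      (trans (pair-cons (+ 0) (geoCoeff N Ψ (d ℕ.∸ k)) _)
      (sym (trans (pair-cons (+ 0) (mono (rootExp N i j k) ·P geoCoeff N Ψ (d ℕ.∸ k)) φ) (pair-mono· (rootExp N i j k) (geoCoeff N Ψ (d ℕ.∸ k)) _)))))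

-- multiplication by x_1/x_{s+2}
M : ∀ {N} → ℕ → Poly (suc N) → Poly (suc N)
M s = map (λ { (c , d , x ∷ e) → (c , d , sc x ∷ dn s e) })

M* : ∀ {N} → ℕ → (ℤ → Fn (suc N)) → ℤ → Fn (suc N)
M* s φ d (x ∷ e) = φ d (sc x ∷ dn s e)

pair-M : ∀ {N} s (f : Poly (suc N)) φ → ⟪ M s f , φ ⟫ ≡ ⟪ f , M* s φ ⟫
pair-M s [] φ = refl
pair-M s ((c , d , x ∷ e) ∷ f) φ = addˡ (c * φ d (sc x ∷ dn s e)) (pair-M s f φ)

M-cong : ∀ {N} s {f g : Poly (suc N)} → f ≋ g → M s f ≋ M s g
M-cong s {f} {g} p = eqP λ φ → trans (pair-M s f φ) (trans (pair p _) (sym (pair-M s g φ)))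

M-++ : ∀ {N} s (f g : Poly (suc N)) → M s (f ++ g) ≋ M s f ++ M s g
M-++ s f g = ≡⇒≋ (LP.map-++ _ f g)

M-cons : ∀ {N} s k (f : Poly N) → M s (cons (+ k) f) ≋ cons (+ suc k) (X⁻ s f)
M-cons s k f = eqP λ φ → trans (trans (pair-M s (cons (+ k) f) φ) (pair-cons (+ k) f _))
  (sym (trans (pair-cons (+ suc k) (X⁻ s f) φ) (pair-X⁻ s f _)))

-- Coefficient of q^(d+1) in P = Q + q (x_1/x_(s+2)) P, where P is the full product and Q lacks its
-- first factor.
geo-first : ∀ N s Ψ d → geoCoeff (suc N) ((0 , suc s) ∷ Ψ) (suc d) ≋ geoCoeff (suc N) Ψ (suc d) ++ M s (geoCoeff (suc N) ((0 , suc s) ∷ Ψ) d)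
geo-first N s Ψ d = ++-cong first (go (suc d) suc id (λ k → shift k))
  where
  F : ℕ → ℕ → Poly (suc N)
  F d k = mono (rootExp (suc N) 0 (suc s) k) ·P geoCoeff (suc N) Ψ (d ℕ.∸ k)
  first : F (suc d) 0 ≋ geoCoeff (suc N) Ψ (suc d)
  first = eqP λ φ → trans (pair-mono· (rootExp (suc N) 0 (suc s) 0) (geoCoeff (suc N) Ψ (suc d)) φ)
    (pair-ext (geoCoeff (suc N) Ψ (suc d)) {ψ = φ} (λ { d (x ∷ e) → cong (φ d) (cong₂ _∷_ (ℤP.+-identityˡ x) (unit⁻-zero s e)) }))
  shift : ∀ k → F (suc d) (suc k) ≋ M s (F d k)
  shift k = eqP λ φ → trans (pair-mono· (rootExp (suc N) 0 (suc s) (suc k)) g φ)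
    (trans (pair-ext g (λ { d (x ∷ e) → cong (φ d) (cong₂ _∷_ (ℤP.+-assoc (+ 1) (+ k) x) (unit⁻-suc s k e)) }))
    (sym (trans (pair-M s (F d k) φ) (pair-mono· (rootExp (suc N) 0 (suc s) k) g (M* s φ)))))
    where
    g = geoCoeff (suc N) Ψ (d ℕ.∸ k)
  go : ∀ m (g h : ℕ → ℕ) → (∀ k → F (suc d) (g k) ≋ M s (F d (h k))) →
    concatMap (F (suc d)) (applyUpTo g m) ≋ M s (concatMap (F d) (applyUpTo h m))
  go zero g h eq = ≋-refl
  go (suc m) g h eq = ≋-trans (++-cong (eq 0) (go m (g ∘ suc) (h ∘ suc) (eq ∘ suc))) (≋-sym (M-++ s (F d (h 0)) _))

geo-zero : ∀ N s Ψ → geoCoeff (suc N) ((0 , suc s) ∷ Ψ) 0 ≋ geoCoeff (suc N) Ψ 0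
geo-zero N s Ψ = ≋-trans (≡⇒≋ (LP.++-identityʳ (mono (rootExp (suc N) 0 (suc s) 0) ·P geoCoeff (suc N) Ψ 0))) (eqP λ φ →
  trans (pair-mono· (rootExp (suc N) 0 (suc s) 0) (geoCoeff (suc N) Ψ 0) φ)
    (pair-ext (geoCoeff (suc N) Ψ 0) {ψ = φ} (λ { d (x ∷ e) → cong (φ d) (cong₂ _∷_ (ℤP.+-identityˡ x) (unit⁻-zero s e)) })))

sumP-suc : ∀ {n} (F : ℕ → Poly n) d → sumP F (suc d) ≋ F 0 ++ sumP (F ∘ suc) d
sumP-suc F zero = ≋-refl
sumP-suc F (suc d) = ≋-trans (++-cong (sumP-suc F d) ≋-refl) (≡⇒≋ (LP.++-assoc (F 0) (sumP (F ∘ suc) d) (F (suc (suc d)))))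

sumP-++ : ∀ {n} (F F' : ℕ → Poly n) d → sumP (λ k → F k ++ F' k) d ≋ sumP F d ++ sumP F' d
sumP-++ F F' d = eqP λ φ → trans (pair-sumP _ d φ) (trans (sumℤ-ext d (λ k _ → pair-++ (F k) (F' k) φ)) (trans (go φ d)
  (sym (trans (pair-++ (sumP F d) _ φ) (cong₂ _+_ (pair-sumP F d φ) (pair-sumP F' d φ))))))
  where
  go : ∀ φ d → sumℤ (λ k → ⟪ F k , φ ⟫ + ⟪ F' k , φ ⟫) d ≡ sumℤ (λ k → ⟪ F k , φ ⟫) d + sumℤ (λ k → ⟪ F' k , φ ⟫) d
  go φ zero = refl
  go φ (suc d) = trans (cong (λ z → z + (⟪ F (suc d) , φ ⟫ + ⟪ F' (suc d) , φ ⟫)) (go φ d)) (lem (sumℤ (λ k → ⟪ F k , φ ⟫) d) (sumℤ (λ k → ⟪ F' k , φ ⟫) d) ⟪ F (suc d) , φ ⟫ ⟪ F' (suc d) , φ ⟫)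
    where
    lem : ∀ a b c d → a + b + (c + d) ≡ a + c + (b + d)
    lem = solve-∀

sumP-M : ∀ {N} s (F : ℕ → Poly (suc N)) d → M s (sumP F d) ≋ sumP (λ k → M s (F k)) d
sumP-M s F zero = ≋-refl
sumP-M s F (suc d) = ≋-trans (M-++ s (sumP F d) (F (suc d))) (++-cong (sumP-M s F d) ≋-refl)

conv-first : ∀ {N} s c (g : ℕ → Poly N) d → conv 0 s (suc c) g (suc d) ≋ conv 0 (suc s) c g (suc d) ++ M s (conv 0 s (suc c) g d)
conv-first {N} s c g d = ≋-trans (sumP-suc F d)
  (≋-trans (++-cong (≋-refl {f = F 0}) (≋-trans (sumP-≋ d λ k → ≋-trans (≡⇒≋ (LP.map-++ _ (H (suc s) c (suc k) (g (d ℕ.∸ k))) _))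
      (++-cong (≋-refl {f = F' (suc k)}) (≋-sym (M-cons s k (H s (suc c) k (g (d ℕ.∸ k)))))))
    (≋-trans (sumP-++ (F' ∘ suc) (λ k → M s (F″ k)) d) (++-cong (≋-refl {f = sumP (F' ∘ suc) d}) (≋-sym (sumP-M s F″ d))))))
  (≋-trans (≡⇒≋ (sym (LP.++-assoc (F 0) (sumP (F' ∘ suc) d) _))) (++-cong (≋-sym (sumP-suc F' d)) (≋-refl {f = M s (sumP F″ d)}))))
  where
  F F' F″ : ℕ → Poly (suc N)
  F k = cons (+ k) (H s (suc c) k (g (suc d ℕ.∸ k)))
  F' k = cons (+ k) (H (suc s) c k (g (suc d ℕ.∸ k)))
  F″ k = cons (+ k) (H s (suc c) k (g (d ℕ.∸ k)))

interval : ℕ → ℕ → List ℕ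
interval s zero = []
interval s (suc c) = s ∷ interval (suc s) c

-- Both sides obey the same recurrence in the number c of roots and the degree d, by `geo-first` and
-- `conv-first`, with the same values at c = 0.
geo-row : ∀ N s c Ψ d → geoCoeff (suc N) (map (λ t → (0 , suc t)) (interval s c) ++ map up-root Ψ) d ≋ conv 0 s c (geoCoeff N Ψ) d
geo-row N s zero Ψ d = ≋-trans (geo-up N Ψ d) (≋-sym (only d))
  where
  only : ∀ d → conv 0 s 0 (geoCoeff N Ψ) d ≋ cons (+ 0) (geoCoeff N Ψ d)
  only zero = ≋-refl
  only (suc d) = ≋-trans (sumP-suc _ d) (eqP λ φ → trans (pair-++ (cons (+ 0) (geoCoeff N Ψ (suc d))) _ φ)
    (trans (addˡ ⟪ cons (+ 0) (geoCoeff N Ψ (suc d)) , φ ⟫ (trans (pair-sumP _ d φ) (sumℤ-zero _ d (λ _ _ → refl)))) (ℤP.+-identityʳ _)))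
geo-row N s (suc c) Ψ zero = ≋-trans (geo-zero N s (map (λ t → (0 , suc t)) (interval (suc s) c) ++ map up-root Ψ)) (geo-row N (suc s) c Ψ 0)
geo-row N s (suc c) Ψ (suc d) = ≋-trans (geo-first N s (map (λ t → (0 , suc t)) (interval (suc s) c) ++ map up-root Ψ) d)
  (≋-trans (++-cong (geo-row N (suc s) c Ψ (suc d)) (M-cong s (geo-row N s (suc c) Ψ d))) (≋-sym (conv-first s c (geoCoeff N Ψ) d)))

roots : (n : ℕ) → List ℕ → List (ℕ × ℕ)
roots zero r = []
roots (suc N) [] = map (λ t → (0 , suc t)) (interval 0 N) ++ map up-root (roots N [])
roots (suc N) (a ∷ r) = map (λ t → (0 , suc t)) (interval (ℕ.pred a) (N ℕ.∸ ℕ.pred a)) ++ map up-root (roots N r)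

H-·mono : ∀ {n} s c k (v : Vec ℤ n) (f : Poly n) → H s c k f ·P mono v ≋ H s c k (f ·P mono v)
H-·mono s zero zero v f = ≋-refl
H-·mono s zero (suc k) v f = ≋-refl
H-·mono s (suc c) zero v f = H-·mono (suc s) c 0 v f
H-·mono s (suc c) (suc k) v f = ≋-trans (eqP λ φ → trans (pair-·mono v (H (suc s) c (suc k) f ++ X⁻ s (H s (suc c) k f)) φ)
    (trans (pair-++ (H (suc s) c (suc k) f) _ _) (sym (trans (pair-++ (H (suc s) c (suc k) f ·P mono v) _ φ)
      (cong₂ _+_ (pair-·mono v (H (suc s) c (suc k) f) φ) (swap φ))))))
  (++-cong (H-·mono (suc s) c (suc k) v f) (X⁻-cong s (H-·mono s (suc c) k v f)))
  where
  dn-+ : ∀ {n} s (e v : Vec ℤ n) → zipWith _+_ (dn s e) v ≡ dn s (zipWith _+_ e v)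
  dn-+ s [] [] = refl
  dn-+ zero (x ∷ e) (y ∷ v) = cong (_∷ zipWith _+_ e v) (lem x y)
    where
    lem : ∀ x y → x - + 1 + y ≡ x + y - + 1
    lem = solve-∀
  dn-+ (suc s) (x ∷ e) (y ∷ v) = cong ((x + y) ∷_) (dn-+ s e v)
  swap : ∀ φ → ⟪ X⁻ s (H s (suc c) k f ·P mono v) , φ ⟫ ≡ ⟪ X⁻ s (H s (suc c) k f) , (λ d e → φ d (zipWith _+_ e v)) ⟫
  swap φ = trans (trans (pair-X⁻ s (H s (suc c) k f ·P mono v) φ) (pair-·mono v (H s (suc c) k f) _))
    (trans (pair-ext (H s (suc c) k f) (λ d e → cong (φ d) (sym (dn-+ s e v)))) (sym (pair-X⁻ s (H s (suc c) k f) _)))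

conv-·mono : ∀ {N} z s c (g g' : ℕ → Poly N) v d → (∀ d → g d ·P mono v ≋ g' d) → conv 0 s c g d ·P mono (+ z ∷ v) ≋ conv z s c g' d
conv-·mono {N} z s c g g' v d h = ≋-trans (dist d) (sumP-≋ d λ k → ≋-trans (one k (H s c k (g (d ℕ.∸ k))))
    (cons-cong (+ (z ℕ.+ k)) (≋-trans (H-·mono s c k v (g (d ℕ.∸ k))) (H-cong s c k (h (d ℕ.∸ k))))))
  where
  F : ℕ → Poly (suc N)
  F k = cons (+ k) (H s c k (g (d ℕ.∸ k)))
  dist : ∀ d' → sumP F d' ·P mono (+ z ∷ v) ≋ sumP (λ k → F k ·P mono (+ z ∷ v)) d'
  dist zero = ≋-refl
  dist (suc d') = ≋-trans (≡⇒≋ (LP.concatMap-++ _ (sumP F d') (F (suc d')))) (++-cong (dist d') ≋-refl)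
  one : ∀ k f → cons (+ k) f ·P mono (+ z ∷ v) ≋ cons (+ (z ℕ.+ k)) (f ·P mono v)
  one k f = eqP λ φ → trans (trans (pair-·mono (+ z ∷ v) (cons (+ k) f) φ) (pair-cons (+ k) f _))
    (trans (pair-ext f (λ d e → cong (λ x → φ d (x ∷ zipWith _+_ e v)) (cong +_ (ℕP.+-comm k z))))
    (sym (trans (pair-cons (+ (z ℕ.+ k)) (f ·P mono v) φ) (pair-·mono v f _))))

·mono-cong : ∀ {n} (v : Vec ℤ n) {f g : Poly n} → f ≋ g → f ·P mono v ≋ g ·P mono v
·mono-cong v {f} {g} p = eqP λ φ → trans (pair-·mono v f φ) (trans (pair p _) (sym (pair-·mono v g φ)))

product-G : ∀ n r → length r ℕ.≤ n → ∀ d → productCoeff n (roots n r) (onesThenZeros n (length r)) (+ d) ≋ G n r d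
product-G zero [] _ zero = ≋-refl
product-G zero [] _ (suc d) = ≋-refl
product-G (suc N) [] _ d = ≋-trans (·mono-cong (onesThenZeros (suc N) 0) (geo-row N 0 N (roots N []) d))
  (conv-·mono 0 0 N (geoCoeff N (roots N [])) (G N []) (onesThenZeros N 0) d (product-G N [] z≤n))
product-G (suc N) (a ∷ r) (s≤s h) d = ≋-trans (·mono-cong (onesThenZeros (suc N) (suc (length r))) (geo-row N (ℕ.pred a) (N ℕ.∸ ℕ.pred a) (roots N r) d))
  (conv-·mono 1 (ℕ.pred a) (N ℕ.∸ ℕ.pred a) (geoCoeff N (roots N r)) (G N r) (onesThenZeros N (length r)) d (product-G N r h))

-- The list Δ'_ℓ(η) is the list of roots with rows full η

filterᵇ-∷ : {A : Set} (p : A → Bool) (x : A) (xs : List A) → filterᵇ p (x ∷ xs) ≡ (if p x then x ∷ filterᵇ p xs else filterᵇ p xs)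
filterᵇ-∷ p x xs with p x
... | true = refl
... | false = refl

filterᵇ-++ : {A : Set} (p : A → Bool) (xs ys : List A) → filterᵇ p (xs ++ ys) ≡ filterᵇ p xs ++ filterᵇ p ys
filterᵇ-++ p xs ys = LP.filter-++ (𝔹.T? ∘ p) xs ys

filterᵇ-cong : {A : Set} {p q : A → Bool} → (∀ x → p x ≡ q x) → ∀ xs → filterᵇ p xs ≡ filterᵇ q xs
filterᵇ-cong h [] = refl
filterᵇ-cong {p = p} {q} h (x ∷ xs) rewrite filterᵇ-∷ p x xs | filterᵇ-∷ q x xs | h x | filterᵇ-cong {p = p} {q} h xs = refl

≤ᵇ-true : ∀ {m n} → m ℕ.≤ n → (m ℕ.≤ᵇ n) ≡ true
≤ᵇ-true {m} {n} h = dec-true (m ℕ.≤? n) h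

≤ᵇ-false : ∀ {m n} → ¬ (m ℕ.≤ n) → (m ℕ.≤ᵇ n) ≡ false
≤ᵇ-false {m} {n} h = dec-false (m ℕ.≤? n) h

<ᵇ-suc : ∀ m n → (m ℕ.<ᵇ suc n) ≡ (m ℕ.≤ᵇ n)
<ᵇ-suc zero n = refl
<ᵇ-suc (suc m) n = refl

rootᵇ : List ℕ → ℕ × ℕ → Bool
rootᵇ r (i , j) = (i ℕ.<ᵇ j) ∧ (i ℕ.+ nthℕ i r ℕ.≤ᵇ j)

grid : List ℕ → List ℕ → List (ℕ × ℕ)
grid K L = concatMap (λ i → map (λ j → (i , j)) L) K

tailL : List ℕ → List ℕ
tailL [] = []
tailL (_ ∷ r) = r

rootᵇ-suc : ∀ r i j → rootᵇ r (suc i , suc j) ≡ rootᵇ (tailL r) (i , j)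
rootᵇ-suc [] i j = cong ((i ℕ.<ᵇ j) ∧_) (<ᵇ-suc (i ℕ.+ 0) j)
rootᵇ-suc (a ∷ r) i j = cong ((i ℕ.<ᵇ j) ∧_) (<ᵇ-suc (i ℕ.+ nthℕ i r) j)

row-suc : ∀ r i L → filterᵇ (rootᵇ r) (map (λ j → (suc i , j)) (map suc L)) ≡ map up-root (filterᵇ (rootᵇ (tailL r)) (map (λ j → (i , j)) L))
row-suc r i [] = refl
row-suc r i (j ∷ L) rewrite filterᵇ-∷ (rootᵇ r) (suc i , suc j) (map (λ j → (suc i , j)) (map suc L))
  | filterᵇ-∷ (rootᵇ (tailL r)) (i , j) (map (λ j → (i , j)) L) | rootᵇ-suc r i j with rootᵇ (tailL r) (i , j)
... | true = cong (_ ∷_) (row-suc r i L)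
... | false = row-suc r i L

grid-suc : ∀ r K L → filterᵇ (rootᵇ r) (grid (map suc K) (0 ∷ map suc L)) ≡ map up-root (filterᵇ (rootᵇ (tailL r)) (grid K L))
grid-suc r [] L = refl
grid-suc r (i ∷ K) L = trans (filterᵇ-++ (rootᵇ r) (map (λ j → (suc i , j)) (map suc L)) (grid (map suc K) (0 ∷ map suc L)))
  (trans (cong₂ _++_ (row-suc r i L) (grid-suc r K L))
  (trans (sym (LP.map-++ up-root (filterᵇ (rootᵇ (tailL r)) (map (λ j → (i , j)) L)) _))
  (cong (map up-root) (sym (filterᵇ-++ (rootᵇ (tailL r)) (map (λ j → (i , j)) L) (grid K L))))))

≤suc-pred : ∀ a → a ℕ.≤ suc (ℕ.pred a)
≤suc-pred zero = z≤n
≤suc-pred (suc a) = ℕP.≤-refl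

shift : ∀ n u (f : ℕ → ℕ) → applyUpTo (λ t → suc (u ℕ.+ suc (f t))) n ≡ applyUpTo (λ t → suc (suc u ℕ.+ f t)) n
shift zero u f = refl
shift (suc n) u f = cong₂ _∷_ (cong suc (ℕP.+-suc u (f 0))) (shift n u (f ∘ suc))

first-row-all : ∀ r n u → ℕ.pred (nthℕ 0 r) ℕ.≤ u → filterᵇ (rootᵇ r) (map (λ j → (0 , j)) (applyUpTo (λ t → suc (u ℕ.+ t)) n)) ≡
  map (λ t → (0 , suc t)) (interval u n)
first-row-all r zero u h = refl
first-row-all r (suc n) u h rewrite filterᵇ-∷ (rootᵇ r) (0 , suc (u ℕ.+ 0)) (map (λ j → (0 , j)) (applyUpTo (λ t → suc (u ℕ.+ suc t)) n))
  | ≤ᵇ-true {nthℕ 0 r} {suc (u ℕ.+ 0)} (ℕP.≤-trans (≤suc-pred (nthℕ 0 r)) (s≤s (ℕP.≤-trans h (ℕP.m≤m+n u 0)))) = cong₂ _∷_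
    (cong (λ z → (0 , suc z)) (ℕP.+-identityʳ u))
    (trans (cong (filterᵇ (rootᵇ r) ∘ map (λ j → (0 , j))) (shift n u id)) (first-row-all r n (suc u) (ℕP.m≤n⇒m≤1+n h)))

first-row : ∀ r n u → u ℕ.≤ ℕ.pred (nthℕ 0 r) → filterᵇ (rootᵇ r) (map (λ j → (0 , j)) (applyUpTo (λ t → suc (u ℕ.+ t)) n)) ≡
  map (λ t → (0 , suc t)) (interval (ℕ.pred (nthℕ 0 r)) (n ℕ.+ u ℕ.∸ ℕ.pred (nthℕ 0 r)))
first-row r n u h with ℕP.m≤n⇒m<n∨m≡n h
... | inj₂ refl = trans (first-row-all r n u ℕP.≤-refl) (cong (λ c → map (λ t → (0 , suc t)) (interval u c)) (sym (ℕP.m+n∸n≡m n u)))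
first-row r zero u h | inj₁ lt rewrite ℕP.m≤n⇒m∸n≡0 h = refl
first-row r (suc n) u h | inj₁ lt rewrite filterᵇ-∷ (rootᵇ r) (0 , suc (u ℕ.+ 0)) (map (λ j → (0 , j)) (applyUpTo (λ t → suc (u ℕ.+ suc t)) n))
  | ≤ᵇ-false {nthℕ 0 r} {suc (u ℕ.+ 0)} (λ le → ℕP.<⇒≱ lt (ℕP.≤-trans (ℕP.pred-mono-≤ le) (ℕP.≤-reflexive (ℕP.+-identityʳ u)))) =
    trans (cong (filterᵇ (rootᵇ r) ∘ map (λ j → (0 , j))) (shift n u id))
      (trans (first-row r n (suc u) lt) (cong (λ c → map (λ t → (0 , suc t)) (interval (ℕ.pred (nthℕ 0 r)) (c ℕ.∸ ℕ.pred (nthℕ 0 r)))) (ℕP.+-suc n u)))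

grid-roots : ∀ n r → filterᵇ (rootᵇ r) (grid (List.upTo n) (List.upTo n)) ≡ roots n r
grid-roots zero r = refl
grid-roots (suc N) r = trans (filterᵇ-++ (rootᵇ r) (map (λ j → (0 , j)) (applyUpTo suc N)) (grid (applyUpTo suc N) (0 ∷ applyUpTo suc N)))
  (trans (cong₂ _++_ (trans (first-row r N 0 z≤n) (cong (λ c → map (λ t → (0 , suc t)) (interval (ℕ.pred (nthℕ 0 r)) (c ℕ.∸ ℕ.pred (nthℕ 0 r)))) (ℕP.+-identityʳ N)))
    (trans (cong (λ U → filterᵇ (rootᵇ r) (grid U (0 ∷ U))) (sym (LP.map-upTo suc N)))
      (trans (grid-suc r (List.upTo N) (List.upTo N)) (cong (map up-root) (grid-roots N (tailL r))))))
  (sym (unfold r)))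
  where
  unfold : ∀ r → roots (suc N) r ≡ map (λ t → (0 , suc t)) (interval (ℕ.pred (nthℕ 0 r)) (N ℕ.∸ ℕ.pred (nthℕ 0 r))) ++ map up-root (roots N (tailL r))
  unfold [] = refl
  unfold (a ∷ r) = refl

-- No row reaches beyond the number m of rows: counted from 0, i + r_i ≤ m.
data Bounded : List ℕ → Set where
  [] : Bounded []
  _∷_ : ∀ {a l} → a ℕ.≤ suc (length l) → Bounded l → Bounded (a ∷ l)

nth-bounded : ∀ {l} → Bounded l → ∀ i → i ℕ.< length l → i ℕ.+ nthℕ i l ℕ.≤ length l
nth-bounded (h ∷ b) zero _ = h
nth-bounded (h ∷ b) (suc i) (s≤s l) = s≤s (nth-bounded b i l)

nth-beyond : ∀ l i → length l ℕ.≤ i → nthℕ i l ≡ 0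
nth-beyond [] i h = refl
nth-beyond (x ∷ l) (suc i) (s≤s h) = nth-beyond l i h

full-bounded : ∀ {η} → Partition η → Bounded (full η)
full-bounded [] = []
full-bounded {a ∷ η} (part pos h p) = subst Bounded (sym (full-dl a η h)) (rep (hd η))
  where
  b = hd η
  hd≤ : b ℕ.≤ length (full η)
  hd≤ = ℕP.≤-trans (hd≤sum η) (ℕP.≤-reflexive (sym (length-full p)))
    where
    hd≤sum : ∀ η → hd η ℕ.≤ sumL η
    hd≤sum [] = z≤n
    hd≤sum (a ∷ η) = ℕP.m≤m+n a (sumL η)
  len : ∀ t → t ℕ.+ b ℕ.≤ length (dl b t ++ full η)
  len zero = hd≤
  len (suc t) = s≤s (len t)
  desc : ∀ t → Bounded (dl b t ++ full η)
  desc zero = full-bounded p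
  desc (suc t) = s≤s (len t) ∷ desc t
  a≤ : ∀ k → a ℕ.≤ length (List.replicate k a ++ dl b (a ℕ.∸ b) ++ full η)
  a≤ zero = subst (ℕ._≤ length (dl b (a ℕ.∸ b) ++ full η)) (ℕP.m∸n+n≡m h) (len (a ℕ.∸ b))
  a≤ (suc k) = ℕP.m≤n⇒m≤1+n (a≤ k)
  rep : ∀ k → Bounded (List.replicate k a ++ dl b (a ℕ.∸ b) ++ full η)
  rep zero = desc (a ℕ.∸ b)
  rep (suc k) = ℕP.m≤n⇒m≤1+n (a≤ k) ∷ rep k

nrΔ'-full : ∀ {a η} → Partition (a ∷ η) → nrΔ' (a ∷ η) ++ 1 ∷ [] ≡ full (a ∷ η)
nrΔ'-full {suc a} {[]} (part _ _ _) = trans (cong (λ z → applyUpTo f a ++ z ∷ []) (sym (ℕP.m+n∸n≡m 1 a)))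
  (trans (LP.applyUpTo-∷ʳ f a) (sym (LP.++-identityʳ (applyUpTo f (suc a)))))
  where
  f : ℕ → ℕ
  f t = suc a ℕ.∸ t
nrΔ'-full {a} {b ∷ η} (part _ _ p) = trans (LP.++-assoc (List.replicate b a) (descList a b ++ nrΔ' (b ∷ η)) (1 ∷ []))
  (cong (List.replicate b a ++_) (trans (LP.++-assoc (descList a b) (nrΔ' (b ∷ η)) (1 ∷ [])) (cong (descList a b ++_) (nrΔ'-full p))))

-- Roots with j ≥ m satisfy the row condition anyway, by `nth-bounded`, so the disjunct `m ≤ᵇ j`
-- adds nothing to the rows `full η`. For i < j < m the index i is not the last one, and there
-- `nrΔ' η` agrees with `full η`.
Δ'-roots : ∀ n {η} → Partition η → Δ'ℓ n η (length (full η)) ≡ roots n (full η)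
Δ'-roots n {η} p = trans (filterᵇ-cong (λ { (i , j) → same i j }) (grid (List.upTo n) (List.upTo n))) (grid-roots n (full η))
  where
  m = length (full η)

  below : ∀ {η} → Partition η → ∀ i → suc i ℕ.< length (full η) → nthℕ i (nrΔ' η) ≡ nthℕ i (full η)
  below {a ∷ η} p i h = trans (sym (go (nrΔ' (a ∷ η)) i (ℕP.+-cancelˡ-< 1 _ _ (subst (suc i ℕ.<_) (trans (cong length (sym (nrΔ'-full p)))
      (trans (LP.length-++ (nrΔ' (a ∷ η))) (ℕP.+-comm (length (nrΔ' (a ∷ η))) 1))) h)))) (cong (nthℕ i) (nrΔ'-full p))
    where
    go : ∀ l i → i ℕ.< length l → nthℕ i (l ++ 1 ∷ []) ≡ nthℕ i l
    go (x ∷ l) zero h = refl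
    go (x ∷ l) (suc i) (s≤s h) = go l i h

  beyond : ∀ i → m ℕ.≤ i → nthℕ i (full η) ≡ 0
  beyond i h = nth-beyond (full η) i h

  same : ∀ i j → ((i ℕ.<ᵇ j) ∧ ((m ℕ.≤ᵇ j) ∨ ((i ℕ.+ nthℕ i (nrΔ' η)) ℕ.≤ᵇ j))) ≡ rootᵇ (full η) (i , j)
  same i j with i ℕ.<ᵇ j in eq
  ... | false = refl
  ... | true with m ℕ.≤? j
  ...   | yes m≤j rewrite ≤ᵇ-true m≤j = sym (≤ᵇ-true bound)
    where
    i<j : i ℕ.< j
    i<j = ℕP.<ᵇ⇒< i j (subst T (sym eq) tt)
    bound : i ℕ.+ nthℕ i (full η) ℕ.≤ j
    bound with i ℕ.<? m
    ... | yes i<m = ℕP.≤-trans (nth-bounded (full-bounded p) i i<m) m≤j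
    ... | no i≮m rewrite beyond i (ℕP.≮⇒≥ i≮m) | ℕP.+-identityʳ i = ℕP.<⇒≤ i<j
  ...   | no m≰j rewrite ≤ᵇ-false m≰j = cong (λ z → i ℕ.+ z ℕ.≤ᵇ j) (below p i (ℕP.≤-<-trans i<j (ℕP.≰⇒> m≰j)))
    where
    i<j : i ℕ.< j
    i<j = ℕP.<ᵇ⇒< i j (subst T (sym eq) tt)

-- Conjugation and sorting

count : ℕ → List ℕ → ℕ
count r l = length (filterᵇ (λ a → suc r ℕ.≤ᵇ a) l)

one-if : Bool → ℕ
one-if b = if b then 1 else 0

count-∷ : ∀ r x l → count r (x ∷ l) ≡ one-if (suc r ℕ.≤ᵇ x) ℕ.+ count r l
count-∷ r x l with suc r ℕ.≤ᵇ x
... | true = refl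
... | false = refl

left-comm : ∀ x y z → x ℕ.+ (y ℕ.+ z) ≡ y ℕ.+ (x ℕ.+ z)
left-comm x y z = trans (sym (ℕP.+-assoc x y z)) (trans (cong (ℕ._+ z) (ℕP.+-comm x y)) (ℕP.+-assoc y x z))

insertℕ : ∀ {n} → ℕ → Vec ℕ n → Vec ℕ (suc n)
insertℕ x [] = x ∷ []
insertℕ x (y ∷ v) = if x ℕ.≤ᵇ y then y ∷ insertℕ x v else x ∷ y ∷ v

sortℕ : ∀ {n} → Vec ℕ n → Vec ℕ n
sortℕ [] = []
sortℕ (x ∷ v) = insertℕ x (sortℕ v)

toZ-insert : ∀ {n} x (v : Vec ℕ n) → toZ (insertℕ x v) ≡ insertDesc (+ x) (toZ v)
toZ-insert x [] = refl
toZ-insert x (y ∷ v) with x ℕ.≤? y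
... | yes p rewrite ≤ᵇ-true p = cong (+ y ∷_) (toZ-insert x v)
... | no p rewrite ≤ᵇ-false p = refl

toZ-sort : ∀ {n} (v : Vec ℕ n) → toZ (sortℕ v) ≡ sortDesc (toZ v)
toZ-sort [] = refl
toZ-sort (x ∷ v) = trans (toZ-insert x (sortℕ v)) (cong (insertDesc (+ x)) (toZ-sort v))

count-insert : ∀ {n} r x (v : Vec ℕ n) → count r (toList (insertℕ x v)) ≡ count r (x ∷ toList v)
count-insert r x [] = refl
count-insert r x (y ∷ v) with x ℕ.≤? y
... | no p rewrite ≤ᵇ-false p = refl
... | yes p rewrite ≤ᵇ-true p | count-∷ r y (toList (insertℕ x v)) | count-insert r x v | count-∷ r x (y ∷ toList v)
  | count-∷ r y (toList v) | count-∷ r x (toList v) = left-comm (one-if (suc r ℕ.≤ᵇ y)) (one-if (suc r ℕ.≤ᵇ x)) _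

count-sort : ∀ {n} r (v : Vec ℕ n) → count r (toList (sortℕ v)) ≡ count r (toList v)
count-sort r [] = refl
count-sort r (x ∷ v) rewrite count-insert r x (sortℕ v) | count-∷ r x (toList (sortℕ v)) | count-∷ r x (toList v) | count-sort r v = refl

max-insert : ∀ {n} x (v : Vec ℕ n) → maxℕ (toList (insertℕ x v)) ≡ x ℕ.⊔ maxℕ (toList v)
max-insert x [] = refl
max-insert x (y ∷ v) with x ℕ.≤? y
... | no p rewrite ≤ᵇ-false p = refl
... | yes p rewrite ≤ᵇ-true p = trans (cong (y ℕ.⊔_) (max-insert x v)) (trans (sym (ℕP.⊔-assoc y x _))
  (trans (cong (ℕ._⊔ maxℕ (toList v)) (ℕP.⊔-comm y x)) (ℕP.⊔-assoc x y _)))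

max-sort : ∀ {n} (v : Vec ℕ n) → maxℕ (toList (sortℕ v)) ≡ maxℕ (toList v)
max-sort [] = refl
max-sort (x ∷ v) = trans (max-insert x (sortℕ v)) (cong (x ℕ.⊔_) (max-sort v))

applyUpTo-cong : ∀ {f g : ℕ → ℕ} M → (∀ r → f r ≡ g r) → applyUpTo f M ≡ applyUpTo g M
applyUpTo-cong zero h = refl
applyUpTo-cong (suc M) h = cong₂ _∷_ (h 0) (applyUpTo-cong M (h ∘ suc))

conjugate-sort : ∀ {n} (v : Vec ℕ n) → conjugate (toList (sortℕ v)) ≡ conjugate (toList v)
conjugate-sort v = trans (cong (applyUpTo _) (max-sort v)) (applyUpTo-cong (maxℕ (toList v)) (λ r → count-sort r v))

data Decreasing : ∀ {n} → Vec ℕ n → Set where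
  [] : Decreasing []
  _∷_ : ∀ {n x} {v : Vec ℕ n} → maxℕ (toList v) ℕ.≤ x → Decreasing v → Decreasing (x ∷ v)

sort-decreasing : ∀ {n} (v : Vec ℕ n) → Decreasing (sortℕ v)
sort-decreasing [] = []
sort-decreasing (x ∷ v) = insert (sort-decreasing v)
  where
  insert : ∀ {n} {v : Vec ℕ n} → Decreasing v → Decreasing (insertℕ x v)
  insert [] = z≤n ∷ []
  insert {v = y ∷ v} (h ∷ d) with x ℕ.≤? y
  ... | yes p rewrite ≤ᵇ-true p = subst (ℕ._≤ y) (sym (max-insert x v)) (ℕP.⊔-lub p h) ∷ insert d
  ... | no p rewrite ≤ᵇ-false p = ℕP.⊔-lub (ℕP.<⇒≤ (ℕP.≰⇒> p)) (ℕP.≤-trans h (ℕP.<⇒≤ (ℕP.≰⇒> p))) ∷ (h ∷ d)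

count-antitone : ∀ r l → count (suc r) l ℕ.≤ count r l
count-antitone r [] = z≤n
count-antitone r (x ∷ l) rewrite count-∷ (suc r) x l | count-∷ r x l = ℕP.+-mono-≤ (bits r x) (count-antitone r l)
  where
  bits : ∀ r x → one-if (suc (suc r) ℕ.≤ᵇ x) ℕ.≤ one-if (suc r ℕ.≤ᵇ x)
  bits r x with suc (suc r) ℕ.≤? x
  ... | no p rewrite ≤ᵇ-false p = z≤n
  ... | yes p rewrite ≤ᵇ-true p | ≤ᵇ-true (ℕP.<⇒≤ p) = ℕP.≤-refl

count-positive : ∀ r l → r ℕ.< maxℕ l → 1 ℕ.≤ count r l
count-positive r (x ∷ l) h rewrite count-∷ r x l with suc r ℕ.≤? x
... | yes p rewrite ≤ᵇ-true p = s≤s z≤n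
... | no p = ℕP.≤-trans (count-positive r l (big (ℕP.⊔-sel x (maxℕ l)))) (ℕP.m≤n+m _ (one-if (suc r ℕ.≤ᵇ x)))
  where
  big : x ℕ.⊔ maxℕ l ≡ x ⊎ x ℕ.⊔ maxℕ l ≡ maxℕ l → r ℕ.< maxℕ l
  big (inj₁ e) = ⊥-elim (p (subst (suc r ℕ.≤_) e h))
  big (inj₂ e) = subst (suc r ℕ.≤_) e h

partition-applyUpTo : ∀ (f : ℕ → ℕ) M → (∀ r → r ℕ.< M → 1 ℕ.≤ f r) → (∀ r → f (suc r) ℕ.≤ f r) → Partition (applyUpTo f M)
partition-applyUpTo f zero pos dec = []
partition-applyUpTo f (suc M) pos dec = part (pos 0 (s≤s z≤n)) (hd≤ M) (partition-applyUpTo (f ∘ suc) M (λ r h → pos (suc r) (s≤s h)) (λ r → dec (suc r)))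
  where
  hd≤ : ∀ M → hd (applyUpTo (f ∘ suc) M) ℕ.≤ f 0
  hd≤ zero = z≤n
  hd≤ (suc M) = dec 0

conjugate-partition : ∀ l → Partition (conjugate l)
conjugate-partition l = partition-applyUpTo (λ r → count r l) (maxℕ l) (λ r → count-positive r l) (λ r → count-antitone r l)

count-pred : ∀ r l → count (suc r) l ≡ count r (map ℕ.pred l)
count-pred r [] = refl
count-pred r (x ∷ l) rewrite count-∷ (suc r) x l | count-∷ r (ℕ.pred x) (map ℕ.pred l) = cong₂ ℕ._+_ (bits x) (count-pred r l)
  where
  bits : ∀ x → one-if (suc (suc r) ℕ.≤ᵇ x) ≡ one-if (suc r ℕ.≤ᵇ ℕ.pred x)
  bits zero = refl
  bits (suc x) = refl

max-pred : ∀ l → maxℕ (map ℕ.pred l) ≡ ℕ.pred (maxℕ l)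
max-pred [] = refl
max-pred (x ∷ l) = trans (cong (ℕ.pred x ℕ.⊔_) (max-pred l)) (sym (pred-⊔ x (maxℕ l)))
  where
  pred-⊔ : ∀ x y → ℕ.pred (x ℕ.⊔ y) ≡ ℕ.pred x ℕ.⊔ ℕ.pred y
  pred-⊔ zero y = refl
  pred-⊔ (suc x) zero = sym (ℕP.⊔-identityʳ x)
  pred-⊔ (suc x) (suc y) = refl

toList-map : ∀ {n} (v : Vec ℕ n) → toList (Vec.map ℕ.pred v) ≡ map ℕ.pred (toList v)
toList-map [] = refl
toList-map (x ∷ v) = cong (ℕ.pred x ∷_) (toList-map v)

dec-pred : ∀ {n} {v : Vec ℕ n} → Decreasing v → Decreasing (Vec.map ℕ.pred v)
dec-pred [] = []
dec-pred {v = x ∷ v} (h ∷ d) = subst (ℕ._≤ ℕ.pred x) (sym (trans (cong maxℕ (toList-map v)) (max-pred (toList v)))) (ℕP.pred-mono-≤ h) ∷ dec-pred d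

zeros : ∀ {n} (v : Vec ℕ n) → maxℕ (toList v) ℕ.≤ 0 → toZ v ≡ zeroV n
zeros [] h = refl
zeros (zero ∷ v) h = cong (+ 0 ∷_) (zeros v h)
zeros (suc x ∷ v) h with maxℕ (toList v) | h
... | zero | ()
... | suc _ | ()

count-zeros : ∀ {n} (v : Vec ℕ n) → maxℕ (toList v) ℕ.≤ 0 → count 0 (toList v) ≡ 0
count-zeros [] h = refl
count-zeros (zero ∷ v) h = count-zeros v h
count-zeros (suc x ∷ v) h with maxℕ (toList v) | h
... | zero | ()
... | suc _ | ()

-- The nonzero entries of a decreasing vector stand first. Padding the lowered list with zeros up to
-- their number restores those that had dropped to 0 before all are raised again.
add-column : ∀ {n} (v : Vec ℕ n) l → Decreasing v → padℕ n l ≡ toZ (Vec.map ℕ.pred v) → length l ℕ.≤ count 0 (toList v) →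
  padℕ n (map suc (l ++ List.replicate (count 0 (toList v) ℕ.∸ length l) 0)) ≡ toZ v
add-column [] l d e h = refl
add-column (zero ∷ v) l (h ∷ d) e le rewrite count-zeros v h with l
... | [] = cong (+ 0 ∷_) (trans (pad-[] _) (sym (zeros v h)))
add-column (suc y ∷ v) [] (h ∷ d) e le = cong₂ _∷_ (cong (λ z → + suc z) (ℤP.+-injective (cong head e)))
  (add-column v [] d (cong Vec.tail e) z≤n)
add-column (suc y ∷ v) (z ∷ l) (h ∷ d) e (s≤s le) = cong₂ _∷_ (cong (λ z → + suc z) (ℤP.+-injective (cong head e)))
  (add-column v l d (cong Vec.tail e) le)

-- Lowering all entries by 1 deletes the first part of the conjugate, which counts the nonzero
-- entries; `add-column` puts this column back.
lam-conjugate-dec : ∀ {n} M (v : Vec ℕ n) → Decreasing v → maxℕ (toList v) ≡ M →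
  padℕ n (lam (applyUpTo (λ r → count r (toList v)) M)) ≡ toZ v
lam-conjugate-dec zero v d e = trans (pad-[] _) (sym (zeros v (ℕP.≤-reflexive e)))
lam-conjugate-dec {n} (suc M) v d e = trans (cong (λ c → padℕ n (map suc (lam η ++ List.replicate (count 0 (toList v) ℕ.∸ c) 0))) (sym len))
  (add-column v (lam η) d (trans (cong (λ z → padℕ n (lam z)) η≡)
    (lam-conjugate-dec M (Vec.map ℕ.pred v) (dec-pred d) (trans (cong maxℕ (toList-map v)) (trans (max-pred (toList v)) (cong ℕ.pred e)))))
    (ℕP.≤-trans (ℕP.≤-reflexive len) (hd≤ M)))
  where
  η = applyUpTo (λ r → count (suc r) (toList v)) M
  η≡ : η ≡ applyUpTo (λ r → count r (toList (Vec.map ℕ.pred v))) M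
  η≡ = applyUpTo-cong M (λ r → trans (count-pred r (toList v)) (cong (count r) (sym (toList-map v))))
  η-part : Partition η
  η-part = partition-applyUpTo (λ r → count (suc r) (toList v)) M
    (λ r h → count-positive (suc r) (toList v) (subst (suc r ℕ.<_) (sym e) (s≤s h))) (λ r → count-antitone (suc r) (toList v))
  len : length (lam η) ≡ hd η
  len = length-lam η-part
  hd≤ : ∀ M → hd (applyUpTo (λ r → count (suc r) (toList v)) M) ℕ.≤ count 0 (toList v)
  hd≤ zero = z≤n
  hd≤ (suc M) = count-antitone 0 (toList v)

lam-conjugate : ∀ {n} (α : Vec ℕ n) → padℕ n (lam (conjugate (toList α))) ≡ sortDesc (toZ α)
lam-conjugate {n} α = trans (cong (λ η → padℕ n (lam η)) (sym (conjugate-sort α)))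
  (trans (lam-conjugate-dec _ (sortℕ α) (sort-decreasing α) refl) (toZ-sort α))

hd-conjugate : ∀ {n} (α : Vec ℕ n) → hd (conjugate (toList α)) ℕ.≤ n
hd-conjugate {n} α = go (maxℕ (toList α))
  where
  bound : ∀ {n} (v : Vec ℕ n) → count 0 (toList v) ℕ.≤ n
  bound [] = z≤n
  bound (zero ∷ v) = ℕP.m≤n⇒m≤1+n (bound v)
  bound (suc x ∷ v) = s≤s (bound v)
  go : ∀ M → hd (applyUpTo (λ r → count r (toList α)) M) ℕ.≤ n
  go zero = z≤n
  go (suc M) = bound α

size-sort : ∀ {n} (v : Vec ℤ n) → size (sortDesc v) ≡ size v
size-sort [] = refl
size-sort (x ∷ v) = trans (insert (sortDesc v)) (cong (∣ x ∣ ℕ.+_) (size-sort v))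
  where
  insert : ∀ {n} (v : Vec ℤ n) → size (insertDesc x v) ≡ ∣ x ∣ ℕ.+ size v
  insert [] = refl
  insert (y ∷ v) with x ≤ℤ y
  ... | false = refl
  ... | true = trans (cong (∣ y ∣ ℕ.+_) (insert v)) (left-comm ∣ y ∣ ∣ x ∣ (size v))

size-toZ : ∀ {n} (α : Vec ℕ n) → size (toZ α) ≡ Vec.sum α
size-toZ [] = refl
size-toZ (x ∷ α) = cong (x ℕ.+_) (size-toZ α)

-- `lam` keeps the sum, and applied to the conjugate it returns the sorted α up to zeros.
sum-conjugate : ∀ {n} (α : Vec ℕ n) → length (full (conjugate (toList α))) ≡ Vec.sum α
sum-conjugate {n} α = trans (length-full p) (trans (sym (sum-lam p)) (trans (sym (size-pad n (lam η) (subst (ℕ._≤ n) (sym (length-lam p)) (hd-conjugate α))))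
  (trans (cong size (lam-conjugate α)) (trans (size-sort (toZ α)) (size-toZ α)))))
  where
  η = conjugate (toList α)
  p = conjugate-partition (toList α)
  size-pad : ∀ n l → length l ℕ.≤ n → size (padℕ n l) ≡ sumL l
  size-pad zero [] h = refl
  size-pad (suc n) [] h = size-pad n [] z≤n
  size-pad (suc n) (x ∷ l) (s≤s h) = cong (x ℕ.+_) (size-pad n l h)


-- Absorption of letters by longest words

trans-pos : ℕ → ℕ → ℕ
trans-pos zero zero = 1
trans-pos zero (suc zero) = 0
trans-pos zero (suc (suc x)) = suc (suc x)
trans-pos (suc j) zero = 0
trans-pos (suc j) (suc x) = suc (trans-pos j x)

trans-pos-invol : ∀ j x → trans-pos j (trans-pos j x) ≡ x
trans-pos-invol zero zero = refl
trans-pos-invol zero (suc zero) = refl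
trans-pos-invol zero (suc (suc x)) = refl
trans-pos-invol (suc j) zero = refl
trans-pos-invol (suc j) (suc x) = cong suc (trans-pos-invol j x)

trans-pos-< : ∀ {n} j x → suc j ℕ.< n → x ℕ.< n → trans-pos j x ℕ.< n
trans-pos-< zero zero h l = h
trans-pos-< zero (suc zero) h l = ℕP.<⇒≤ h
trans-pos-< zero (suc (suc x)) h l = l
trans-pos-< (suc j) zero h l = l
trans-pos-< (suc j) (suc x) (s≤s h) (s≤s l) = s≤s (trans-pos-< j x h l)

trans-pos-at : ∀ j → trans-pos j j ≡ suc j
trans-pos-at zero = refl
trans-pos-at (suc j) = cong suc (trans-pos-at j)

trans-pos-at-suc : ∀ j → trans-pos j (suc j) ≡ j
trans-pos-at-suc zero = refl
trans-pos-at-suc (suc j) = cong suc (trans-pos-at-suc j)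

trans-pos-other : ∀ j x → x ≢ j → x ≢ suc j → trans-pos j x ≡ x
trans-pos-other zero zero p q = ⊥-elim (p refl)
trans-pos-other zero (suc zero) p q = ⊥-elim (q refl)
trans-pos-other zero (suc (suc x)) p q = refl
trans-pos-other (suc j) zero p q = refl
trans-pos-other (suc j) (suc x) p q = cong suc (trans-pos-other j x (p ∘ cong suc) (q ∘ cong suc))

get-swap : ∀ {n} j x → suc j ℕ.< n → (v : Vec ℤ n) → getAt x (swapAt j v) ≡ getAt (trans-pos j x) v
get-swap zero zero h (a ∷ b ∷ v) = refl
get-swap zero (suc zero) h (a ∷ b ∷ v) = refl
get-swap zero (suc (suc x)) h (a ∷ b ∷ v) = refl
get-swap zero x (s≤s ()) (a ∷ [])
get-swap (suc j) zero (s≤s h) (a ∷ v) = refl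
get-swap (suc j) (suc x) (s≤s h) (a ∷ v) = get-swap j x h v

vec-ext : ∀ {n} (u v : Vec ℤ n) → (∀ x → x ℕ.< n → getAt x u ≡ getAt x v) → u ≡ v
vec-ext [] [] h = refl
vec-ext (a ∷ u) (b ∷ v) h = cong₂ _∷_ (h 0 (s≤s z≤n)) (vec-ext u v (λ x l → h (suc x) (s≤s l)))

get-tabulate : ∀ n (f : ℕ → ℤ) x → x ℕ.< n → getAt x (tabulate {n = n} (λ p → f (Fin.toℕ p))) ≡ f x
get-tabulate (suc n) f zero h = refl
get-tabulate (suc n) f (suc x) (s≤s h) = get-tabulate n (f ∘ suc) x h

inversions-id : ∀ n → inversions (toList (permOf n [])) ≡ 0
inversions-id n = go n (λ x → + x) (λ x y h → ℤ.+≤+ h)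
  where
  none : ∀ n a (f : ℕ → ℤ) → (∀ x → a ℤ.≤ f x) → count< a (toList (tabulate {n = n} (λ p → f (Fin.toℕ p)))) ≡ 0
  none zero a f h = refl
  none (suc n) a f h rewrite dec-true (a ℤ.≤? f 0) (h 0) = none n a (f ∘ suc) (λ x → h (suc x))
  go : ∀ n (f : ℕ → ℤ) → (∀ x y → x ℕ.≤ y → f x ℤ.≤ f y) → inversions (toList (tabulate {n = n} (λ p → f (Fin.toℕ p)))) ≡ 0
  go zero f h = refl
  go (suc n) f h = cong₂ ℕ._+_ (none n (f 0) (f ∘ suc) (λ x → h 0 (suc x) z≤n)) (go n (f ∘ suc) (λ x y l → h (suc x) (suc y) (s≤s l)))

inversions-≤ : ∀ {n} w → Valid n w → inversions (toList (permOf n w)) ℕ.≤ length w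
inversions-≤ {n} [] _ = ℕP.≤-reflexive (inversions-id n)
inversions-≤ {n} (j ∷ w) (h ∷ v) with getAt j (permOf n w) ℤ.<? getAt (suc j) (permOf n w)
... | yes a = ℕP.≤-trans (ℕP.≤-reflexive (inversions-swap j h (permOf n w) a)) (s≤s (inversions-≤ w v))
... | no a = ℕP.≤-trans (inversions-swap-≤ j h (permOf n w) (ℤP.≮⇒≥ a)) (ℕP.m≤n⇒m≤1+n (inversions-≤ w v))

-- A letter adds at most one inversion, and only at an ascent; a reduced word has no letter to
-- waste.
reduced-tail : ∀ {n} j w → Valid n (j ∷ w) → Reduced n (j ∷ w) → Reduced n w × j ⊏ permOf n w
reduced-tail {n} j w (h ∷ v) r with getAt j (permOf n w) ℤ.<? getAt (suc j) (permOf n w)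
... | yes a = ℕP.suc-injective (trans r (inversions-swap j h (permOf n w) a)) , a
... | no a = ⊥-elim (ℕP.1+n≰n (ℕP.≤-trans (ℕP.≤-reflexive r)
      (ℕP.≤-trans (inversions-swap-≤ j h (permOf n w) (ℤP.≮⇒≥ a)) (inversions-≤ w v))))

reduced-cons : ∀ {n} j w → suc j ℕ.< n → Reduced n w → j ⊏ permOf n w → Reduced n (j ∷ w)
reduced-cons {n} j w h r a = trans (cong suc r) (sym (inversions-swap j h (permOf n w) a))

perm-injective : ∀ {n} w → Valid n w → ∀ x y → x ℕ.< n → y ℕ.< n → getAt x (permOf n w) ≡ getAt y (permOf n w) → x ≡ y
perm-injective {n} [] _ x y p q e = ℤP.+-injective (trans (sym (get-tabulate n (λ z → + z) x p)) (trans e (get-tabulate n (λ z → + z) y q)))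
perm-injective {n} (j ∷ w) (h ∷ v) x y p q e = trans (sym (trans-pos-invol j x)) (trans (cong (trans-pos j)
  (perm-injective w v (trans-pos j x) (trans-pos j y) (trans-pos-< j x h p) (trans-pos-< j y h q)
    (trans (sym (get-swap j x h (permOf n w))) (trans e (get-swap j y h (permOf n w)))))) (trans-pos-invol j y))

-- The tracks of δ = (0,-1,…,-(n-1)) and of s_i δ under a reduced word: they differ by the
-- exchange τ of two adjacent values, until a letter swaps exactly these two.
module Track (n i : ℕ) (hi : suc i ℕ.< n) where

  τ : ℤ → ℤ
  τ x = if x ==ℤ + i then + suc i else if x ==ℤ + suc i then + i else x

  τ-i : τ (+ i) ≡ + suc i
  τ-i rewrite dec-true (+ i ℤ.≟ + i) refl = refl

  i≢si : + suc i ≢ + i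
  i≢si e = ℕP.1+n≢n (ℤP.+-injective e)

  τ-si : τ (+ suc i) ≡ + i
  τ-si rewrite dec-false (+ suc i ℤ.≟ + i) i≢si | dec-true (+ suc i ℤ.≟ + suc i) refl = refl

  τ-other : ∀ x → x ≢ + i → x ≢ + suc i → τ x ≡ x
  τ-other x p q rewrite dec-false (x ℤ.≟ + i) p | dec-false (x ℤ.≟ + suc i) q = refl

  -- No integer lies strictly between i and i + 1, so exchanging these two values reverses the order
  -- of this one pair only.
  τ-mono : ∀ a b → a ℤ.< b → (a ≡ + i × b ≡ + suc i) ⊎ τ a ℤ.< τ b
  τ-mono a b l = go (a ℤ.≟ + i) (a ℤ.≟ + suc i) (b ℤ.≟ + i) (b ℤ.≟ + suc i) l
    where
    go : ∀ {a b} → Dec (a ≡ + i) → Dec (a ≡ + suc i) → Dec (b ≡ + i) → Dec (b ≡ + suc i) → a ℤ.< b →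
      (a ≡ + i × b ≡ + suc i) ⊎ τ a ℤ.< τ b
    go {a} {b} (yes p) _ _ (yes q) l = inj₁ (p , q)
    go {a} {b} (yes refl) _ (yes refl) (no _) l = ⊥-elim (ℤP.<-irrefl refl l)
    go {a} {b} (yes refl) _ (no r) (no s) l = inj₂ (subst₂ ℤ._<_ (sym τ-i) (sym (τ-other b r s)) (ℤP.≤∧≢⇒< (ℤP.i<j⇒suc[i]≤j l) (s ∘ sym)))
    go {a} {b} (no p) (yes refl) (yes refl) _ l = ⊥-elim (ℤP.<⇒≱ l (ℤ.+≤+ (ℕP.n≤1+n i)))
    go {a} {b} (no p) (yes refl) (no r) (yes refl) l = ⊥-elim (ℤP.<-irrefl refl l)
    go {a} {b} (no p) (yes refl) (no r) (no s) l = inj₂ (subst₂ ℤ._<_ (sym τ-si) (sym (τ-other b r s)) (ℤP.<-trans (ℤ.+<+ ℕP.≤-refl) l))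
    go {a} {b} (no p) (no q) (yes refl) _ l = inj₂ (subst₂ ℤ._<_ (sym (τ-other a p q)) (sym τ-i) (ℤP.<-trans l (ℤ.+<+ ℕP.≤-refl)))
    go {a} {b} (no p) (no q) (no r) (yes refl) l = inj₂ (subst₂ ℤ._<_ (sym (τ-other a p q)) (sym τ-si)
        (ℤP.≤∧≢⇒< (ℤP.i<j⇒i≤pred[j] l) p))
    go {a} {b} (no p) (no q) (no r) (no s) l = inj₂ (subst₂ ℤ._<_ (sym (τ-other a p q)) (sym (τ-other b r s)) l)

  δ : Vec ℤ n
  δ = Vec.map neg (permOf n [])

  neg-≤ : ∀ j (v : Vec ℤ n) → suc j ℕ.< n → j ⊏ v → getAt (suc j) (Vec.map neg v) ℤ.≤ getAt j (Vec.map neg v)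
  neg-≤ j v h l = subst₂ ℤ._≤_ (sym (get-map neg (suc j) h v)) (sym (get-map neg j (ℕP.<⇒≤ h) v)) (ℤP.neg-mono-≤ (ℤP.<⇒≤ l))

  hstep-neg : ∀ j (v : Vec ℤ n) → suc j ℕ.< n → j ⊏ v → hstep j (Vec.map neg v) ≡ Vec.map neg (swapAt j v)
  hstep-neg j v h l = trans (hstep-swap j h (Vec.map neg v) (neg-≤ j v h l)) (swap-map neg j v)

  act-δ : ∀ w → Valid n w → Reduced n w → act w δ ≡ Vec.map neg (permOf n w)
  act-δ [] _ _ = refl
  act-δ (j ∷ w) vw@(h ∷ v) r with reduced-tail j w vw r
  ... | r' , a = trans (cong (hstep j) (act-δ w v r')) (hstep-neg j (permOf n w) h a)

  id-get : ∀ x → x ℕ.< n → getAt x (permOf n []) ≡ + x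
  id-get x h = get-tabulate n (λ z → + z) x h

  id-ascent : i ⊏ permOf n []
  id-ascent = subst₂ ℤ._<_ (sym (id-get i (ℕP.<⇒≤ hi))) (sym (id-get (suc i) hi)) (ℤ.+<+ ℕP.≤-refl)

  τ-swap : ∀ j (v : Vec ℤ n) → suc j ℕ.< n → getAt j v ≡ + i → getAt (suc j) v ≡ + suc i →
    (∀ x y → x ℕ.< n → y ℕ.< n → getAt x v ≡ getAt y v → x ≡ y) → Vec.map τ v ≡ swapAt j v
  τ-swap j v h e₀ e₁ inj = vec-ext _ _ λ x l → trans (get-map τ x l v) (trans (at x l) (sym (get-swap j x h v)))
    where
    at : ∀ x → x ℕ.< n → τ (getAt x v) ≡ getAt (trans-pos j x) v
    at x l with x ℕ.≟ j | x ℕ.≟ suc j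
    ... | yes refl | _ rewrite trans-pos-at x | e₀ | e₁ = τ-i
    ... | no _ | yes refl rewrite trans-pos-at-suc j | e₀ | e₁ = τ-si
    ... | no p | no q rewrite trans-pos-other j x p q = τ-other (getAt x v)
          (λ e → p (inj x j l (ℕP.<⇒≤ h) (trans e (sym e₀)))) (λ e → q (inj x (suc j) l h (trans e (sym e₁))))

  Parallel : Word → Set
  Parallel w = permOf n (w ++ i ∷ []) ≡ Vec.map τ (permOf n w) × Reduced n (w ++ i ∷ [])

  tracks : ∀ w → Valid n w → Reduced n w → act (w ++ i ∷ []) δ ≡ act w δ ⊎ Parallel w
  tracks [] _ r = inj₂ (sym (τ-swap i (permOf n []) hi (id-get i (ℕP.<⇒≤ hi)) (id-get (suc i) hi) (perm-injective [] [])) ,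
    reduced-cons i [] hi (sym (inversions-id n)) id-ascent)
  tracks (j ∷ w) vw@(h ∷ v) r with reduced-tail j w vw r
  ... | r' , a with tracks w v r'
  ... | inj₁ e = inj₁ (cong (hstep j) e)
  ... | inj₂ (e , red) with τ-mono _ _ a
  ... | inj₂ l = inj₂ (trans (cong (swapAt j) e) (swap-map τ j (permOf n w)) , reduced-cons j (w ++ i ∷ []) h red asc)
    where
    asc : j ⊏ permOf n (w ++ i ∷ [])
    asc = subst (λ v → j ⊏ v) (sym e) (subst₂ ℤ._<_ (sym (get-map τ j (ℕP.<⇒≤ h) (permOf n w))) (sym (get-map τ (suc j) h (permOf n w))) l)
  -- The letter j exchanges precisely the values i and i + 1. The track of `w ++ i ∷ []` is then
  -- already the swapped one and is left in place by j, while the track of `w` is moved onto it;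
  -- from here on they coincide.
  ... | inj₁ (e₀ , e₁) = inj₁ (trans (cong (hstep j) (trans (act-δ (w ++ i ∷ []) (AllP.++⁺ v (hi ∷ [])) red) (cong (Vec.map neg) perm≡)))
      (trans (hstep-id j h (Vec.map neg (swapAt j (permOf n w))) asc)
      (sym (act-δ (j ∷ w) vw r))))
    where
    p = permOf n w
    perm≡ : permOf n (w ++ i ∷ []) ≡ swapAt j p
    perm≡ = trans e (τ-swap j p h e₀ e₁ (perm-injective w v))
    asc : j ⊏ Vec.map neg (swapAt j p)
    asc = subst₂ ℤ._<_ (sym (trans (get-map neg j (ℕP.<⇒≤ h) (swapAt j p)) (cong neg (get-swap₀ j h p))))
      (sym (trans (get-map neg (suc j) h (swapAt j p)) (cong neg (get-swap₁ j h p)))) (ℤP.neg-mono-< a)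

-- Either appending i does not change the action on a strictly decreasing vector, and then the
-- operators agree by `piWord-determined`; or the longer word is still reduced and, the i-th letter
-- fixing the sorted vector, also leads to β, contrary to maximality.
longest-absorbs : ∀ {k} {β : Vec ℤ (suc k)} {w} → IsLongest (suc k) β w → ∀ i → suc i ℕ.< suc k →
  getAt i (sortDesc β) ≡ getAt (suc i) (sortDesc β) → ∀ f → piWord w (piOp i f) ≋ piWord w f
longest-absorbs {k} {β} {w} (v , r , e , longest) i h eq f with Track.tracks (suc k) i h w v r
... | inj₁ same = ≋-trans (≡⇒≋ (sym (piWord-++ w (i ∷ []) f)))
      (piWord-determined δ strict f (AllP.++⁺ v (h ∷ [])) v same)
  where
  open Track (suc k) i h using (δ)
  strict : ∀ j → suc j ℕ.< suc k → getAt (suc j) δ ℤ.< getAt j δ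
  strict j l = subst₂ ℤ._<_
    (sym (trans (get-map neg (suc j) l (permOf (suc k) [])) (cong neg (get-tabulate (suc k) (λ z → + z) (suc j) l))))
    (sym (trans (get-map neg j (ℕP.<⇒≤ l) (permOf (suc k) [])) (cong neg (get-tabulate (suc k) (λ z → + z) j (ℕP.<⇒≤ l)))))
    (ℤP.neg-mono-< (ℤ.+<+ (ℕP.n<1+n j)))
... | inj₂ (_ , red) = ⊥-elim (ℕP.1+n≰n (ℕP.≤-trans (ℕP.≤-reflexive (trans (ℕP.+-comm 1 (length w)) (sym (LP.length-++ w))))
      (longest (w ++ i ∷ []) (AllP.++⁺ v (h ∷ [])) red
        (trans (act-++ w (i ∷ []) (sortDesc β)) (trans (cong (act w) (trans (hstep-swap i h (sortDesc β) (ℤP.≤-reflexive (sym eq))) (swap-eq i h (sortDesc β) eq))) e)))))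

-- Stability of Ẽ under appending a zero

dem-extract : ∀ (v : ℤ → ℤ) x y → + 0 ℤ.≤ x → + 0 ℤ.≤ y →
  dem (λ a b → if a ==ℤ + 0 then v b else + 0) x y ≡ (if y ==ℤ + 0 then v x else + 0)
dem-extract v (+ x) (+ zero) _ _ = trans (ℤP.+-identityʳ _) (trans (∫-single F (suc x) 0 (s≤s z≤n) off)
  (cong v (trans (ℤP.+-identityʳ (+ x + + 0)) (ℤP.+-identityʳ (+ x)))))
  where
  F : ℤ → ℤ
  F = line (λ a b → if a ==ℤ + 0 then v b else + 0) (+ x + + 0)
  off : ∀ t → t ≢ 0 → F (+ t) ≡ + 0
  off zero ne = ⊥-elim (ne refl)
  off (suc t) ne = refl
dem-extract v (+ x) (+ suc y) _ _ = trans (cong₂ _-_ (∫-single F (suc x) 0 (s≤s z≤n) off) (∫-single F (suc y) 0 (s≤s z≤n) off))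
  (ℤP.+-inverseʳ (F (+ 0)))
  where
  F : ℤ → ℤ
  F = line (λ a b → if a ==ℤ + 0 then v b else + 0) (+ x + + suc y)
  off : ∀ t → t ≢ 0 → F (+ t) ≡ + 0
  off zero ne = ⊥-elim (ne refl)
  off (suc t) ne = refl

-- From last exponents x, y the operator produces pairs of sum x + y; after the rotation only the
-- pair (0, x + y) has last exponent 0. Its net coefficient is 1 for y = 0 and 0 for y > 0, as on
-- the right.
σ-ρ-piOp : ∀ {k} (f : Poly (suc (suc k))) → AllNN f → σ (+ 0) (ρ (piOp k f)) ≋ ρ (σ (+ 0) f)
σ-ρ-piOp {k} f nn = eqP λ φ → trans (trans (pair-σ (+ 0) (ρ (piOp k f)) φ) (trans (pair-ρ (piOp k f) _) (pair-piOp k ℕP.≤-refl f _)))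
  (trans (pair-extAll nn (λ c d e p → dual φ d e p)) (sym (trans (pair-ρ (σ (+ 0) f) φ) (pair-σ (+ 0) f _))))
  where
  dual : ∀ φ d e → NN e → Π k (ρ* (σ* (+ 0) φ) d) e ≡ σ* (+ 0) (ρ* φ) d e
  dual φ d = snoc-elim _ λ e y → snoc-elim (λ e → NN (e ∷ʳ y) → Π k (ρ* (σ* (+ 0) φ) d) (e ∷ʳ y) ≡ σ* (+ 0) (ρ* φ) d (e ∷ʳ y))
    (λ e x p → trans (Π-last (ρ* (σ* (+ 0) φ) d) e x y)
      (trans (dem-ext (λ a b → trans (ρ*-∷ʳ (σ* (+ 0) φ) d (e ∷ʳ a) b) (σ*-∷ʳ (+ 0) φ (d + b) ((b + + 1) ∷ e) a)) x y)
      (trans (dem-extract (λ b → φ (d + b) ((b + + 1) ∷ e)) x y (proj₂ (NN-∷ʳ⁻ e x (proj₁ (NN-∷ʳ⁻ (e ∷ʳ x) y p)))) (proj₂ (NN-∷ʳ⁻ (e ∷ʳ x) y p)))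
      (sym (trans (σ*-∷ʳ (+ 0) (ρ* φ) d (e ∷ʳ x) y) (cong (λ z → if y ==ℤ + 0 then z else + 0) (ρ*-∷ʳ φ d e x))))))) e

stable : ∀ {k β f} → IsE k β f → ∃ λ f' → IsE (suc k) (β ∷ʳ + 0) f' × σ (+ 0) f' ≋ f
stable {k} base = onePoly (suc (suc k)) , subst (λ v → IsE (suc k) v (onePoly (suc (suc k)))) (sym (zeroV-∷ʳ (suc k))) base ,
  eqP λ φ → trans (pair-σ (+ 0) (onePoly (suc (suc k))) φ) (cong (λ z → + 1 * z + + 0)
    (trans (cong (σ* (+ 0) φ (+ 0)) (sym (zeroV-∷ʳ (suc k)))) (σ*-∷ʳ (+ 0) φ (+ 0) (zeroV (suc k)) (+ 0))))
stable {k} (hecke {β} i h d) with stable d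
... | f' , d' , e = piOp i f' , subst (λ v → IsE (suc k) v (piOp i f')) (hstep-∷ʳ i h β (+ 0)) (hecke i (ℕP.m≤n⇒m≤1+n h) d') ,
  ≋-trans (σ-piOp (+ 0) i h f') (piOp-cong i h e)
stable {k} (cyclic {β} {f} d) with stable d
-- The letter k first moves the appended 0 in front of the last entry x of β; the rotation then
-- takes x, not the 0, and leaves the 0 at the end.
... | f' , d' , e = ρ (piOp k f') , subst (λ v → IsE (suc k) v (ρ (piOp k f'))) (vec β (IsE-NN d)) (cyclic (hecke k ℕP.≤-refl d')) ,
  ≋-trans (σ-ρ-piOp f' (All.map proj₂ (IsE-NNQ d'))) (ρ-cong e)
  where
  vec : ∀ β → NN β → rot (hstep k (β ∷ʳ + 0)) ≡ rot β ∷ʳ + 0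
  vec = snoc-elim _ λ b x p → trans (cong rot (trans (hstep-swap k ℕP.≤-refl (b ∷ʳ x ∷ʳ + 0)
      (subst₂ ℤ._≤_ (sym (get-last (b ∷ʳ x) (+ 0))) (sym (get-last₂ b x (+ 0))) (proj₂ (NN-∷ʳ⁻ b x p)))) (swap-last b x (+ 0))))
    (trans (rot-∷ʳ (b ∷ʳ + 0) x) (cong (_∷ʳ + 0) (sym (rot-∷ʳ b x))))

-- Setting variables to zero

spec* : ∀ {m} ℓ → (ℤ → Fn ℓ) → ℤ → Fn m
spec* ℓ φ d e = if allB (λ b → b ==ℤ + 0) (List.drop ℓ (toList e)) then φ d (pad ℓ (List.take ℓ (toList e))) else + 0

pair-specialize : ∀ {m} ℓ (f : Poly m) φ → ⟪ specialize ℓ f , φ ⟫ ≡ ⟪ f , spec* ℓ φ ⟫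
pair-specialize ℓ [] φ = refl
pair-specialize ℓ ((c , d , e) ∷ f) φ with allB (λ b → b ==ℤ + 0) (List.drop ℓ (toList e))
... | true = addˡ (c * φ d (pad ℓ (List.take ℓ (toList e)))) (pair-specialize ℓ f φ)
... | false = trans (pair-specialize ℓ f φ) (lem c _)
  where
  lem : ∀ c x → x ≡ c * + 0 + x
  lem = solve-∀

specialize-cong : ∀ {m} ℓ {f g : Poly m} → f ≋ g → specialize ℓ f ≋ specialize ℓ g
specialize-cong ℓ {f} {g} p = eqP λ φ → trans (pair-specialize ℓ f φ) (trans (pair p _) (sym (pair-specialize ℓ g φ)))

specialize-self : ∀ {ℓ} (f : Poly ℓ) → specialize ℓ f ≋ f
specialize-self {ℓ} f = eqP λ φ → trans (pair-specialize ℓ f φ) (pair-ext f (λ d e →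
  trans (cong (λ l → if allB (λ b → b ==ℤ + 0) l then φ d (pad ℓ (List.take ℓ (toList e))) else + 0) (drop-all e)) (cong (φ d) (pad-take e))))
  where
  drop-all : ∀ {n} (e : Vec ℤ n) → List.drop n (toList e) ≡ []
  drop-all [] = refl
  drop-all (x ∷ e) = drop-all e
  pad-take : ∀ {n} (e : Vec ℤ n) → pad n (List.take n (toList e)) ≡ e
  pad-take [] = refl
  pad-take (x ∷ e) = cong (x ∷_) (pad-take e)

specialize-σ : ∀ {m} ℓ → ℓ ℕ.≤ m → (f : Poly (suc m)) → specialize ℓ f ≋ specialize ℓ (σ (+ 0) f)
specialize-σ {m} ℓ h f = eqP λ φ → trans (pair-specialize ℓ f φ) (trans (pair-ext f (λ d → snoc-elim _ λ e x →
    trans (split φ d e x) (sym (σ*-∷ʳ (+ 0) (spec* ℓ φ) d e x))))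
  (sym (trans (pair-specialize ℓ (σ (+ 0) f) φ) (pair-σ (+ 0) f _))))
  where
  take-∷ʳ : ∀ {n} ℓ → ℓ ℕ.≤ n → (e : Vec ℤ n) → ∀ x → List.take ℓ (toList (e ∷ʳ x)) ≡ List.take ℓ (toList e)
  take-∷ʳ zero h e x = refl
  take-∷ʳ (suc ℓ) (s≤s h) (y ∷ e) x = cong (y ∷_) (take-∷ʳ ℓ h e x)
  allB-drop : ∀ {n} ℓ → ℓ ℕ.≤ n → (e : Vec ℤ n) → ∀ x →
    allB (λ b → b ==ℤ + 0) (List.drop ℓ (toList (e ∷ʳ x))) ≡ (x ==ℤ + 0) ∧ allB (λ b → b ==ℤ + 0) (List.drop ℓ (toList e))
  allB-drop zero h [] x = refl
  allB-drop zero h (y ∷ e) x rewrite allB-drop zero z≤n e x with y ==ℤ + 0 | x ==ℤ + 0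
  ... | true | _ = refl
  ... | false | true = refl
  ... | false | false = refl
  allB-drop (suc ℓ) (s≤s h) (y ∷ e) x = allB-drop ℓ h e x
  split : ∀ φ d e x → spec* ℓ φ d (e ∷ʳ x) ≡ (if x ==ℤ + 0 then spec* ℓ φ d e else + 0)
  split φ d e x rewrite take-∷ʳ ℓ h e x | allB-drop ℓ h e x with x ==ℤ + 0
  ... | true = refl
  ... | false = refl

stable-pad : ∀ {k β f} t → IsE k β f → ∃ λ F → IsE (t ℕ.+ k) (pad (suc (t ℕ.+ k)) (toList β)) F × specialize (suc k) F ≋ f
stable-pad {k} {β} {f} zero d = f , subst (λ v → IsE k v f) (sym (pad-toList β)) d , specialize-self f
  where
  pad-toList : ∀ {n} (v : Vec ℤ n) → pad n (toList v) ≡ v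
  pad-toList [] = refl
  pad-toList (x ∷ v) = cong (x ∷_) (pad-toList v)
stable-pad {k} {β} (suc t) d with stable-pad t d
... | F , dF , e with stable dF
... | F' , dF' , e' = F' , subst (λ v → IsE (suc (t ℕ.+ k)) v F') (pad-suc (suc (t ℕ.+ k)) β (s≤s (ℕP.m≤n+m k t))) dF' ,
  ≋-trans (specialize-σ (suc k) (s≤s (ℕP.m≤n+m k t)) F') (≋-trans (specialize-cong (suc k) e') e)
  where
  pad-suc : ∀ {n} m (v : Vec ℤ n) → n ℕ.≤ m → pad m (toList v) ∷ʳ + 0 ≡ pad (suc m) (toList v)
  pad-suc m [] h = trans (cong (_∷ʳ + 0) (pad-[] m)) (trans (zeroV-∷ʳ m) (sym (pad-[] (suc m))))
  pad-suc (suc m) (x ∷ v) (s≤s h) = cong (x ∷_) (pad-suc m v h)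

-- Key expansions

MinLast : ∀ {n} → Vec ℤ (suc n) → Set
MinLast (x ∷ []) = ⊤
MinLast (x ∷ y ∷ v) = last (y ∷ v) ℤ.≤ x × MinLast (y ∷ v)

last-insert-≤ : ∀ {n} x (v : Vec ℤ (suc n)) → MinLast v → last (insertDesc x v) ℤ.≤ x × last (insertDesc x v) ℤ.≤ last v × MinLast (insertDesc x v)
last-insert-≤ x (y ∷ []) m with x ℤ.≤? y
... | yes p = ℤP.≤-refl , p , p , tt
... | no p = ℤP.<⇒≤ (ℤP.≰⇒> p) , ℤP.≤-refl , ℤP.<⇒≤ (ℤP.≰⇒> p) , tt
last-insert-≤ {suc n} x (y ∷ z ∷ v) m@(h , m') with x ℤ.≤? y
... | no p = below , ℤP.≤-refl , below , m
  where
  below : last (z ∷ v) ℤ.≤ x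
  below = ℤP.≤-trans h (ℤP.<⇒≤ (ℤP.≰⇒> p))
... | yes p with insertDesc x (z ∷ v) | last-insert-≤ x (z ∷ v) m'
...   | u ∷ w | a , b , c = a , b , ℤP.≤-trans a p , c

minLast-sort : ∀ {n} (v : Vec ℤ (suc n)) → MinLast (sortDesc v)
minLast-sort (x ∷ []) = tt
minLast-sort (x ∷ y ∷ v) = proj₂ (proj₂ (last-insert-≤ x (sortDesc (y ∷ v)) (minLast-sort (y ∷ v))))

nonneg-sort : ∀ {n} (v : Vec ℤ (suc n)) → + 0 ℤ.≤ last (sortDesc v) → nonneg v ≡ true
nonneg-sort (x ∷ []) h rewrite dec-true (+ 0 ℤ.≤? x) h = refl
nonneg-sort (x ∷ y ∷ v) h with last-insert-≤ x (sortDesc (y ∷ v)) (minLast-sort (y ∷ v))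
... | a , b , _ rewrite dec-true (+ 0 ℤ.≤? x) (ℤP.≤-trans h a) = nonneg-sort (y ∷ v) (ℤP.≤-trans h b)

NN-sort : ∀ {n} (v : Vec ℤ n) → nonneg v ≡ true → NN (sortDesc v)
NN-sort v h = go v (entries v h)
  where
  entries : ∀ {n} (v : Vec ℤ n) → nonneg v ≡ true → NN v
  entries [] h = tt
  entries (x ∷ v) h with + 0 ℤ.≤? x
  ... | yes p = p , entries v h
  entries (x ∷ v) () | no p
  insert : ∀ {n} x (v : Vec ℤ n) → + 0 ℤ.≤ x → NN v → NN (insertDesc x v)
  insert x [] p q = p , q
  insert x (y ∷ v) p (q , r) with x ≤ℤ y
  ... | true = q , insert x v p r
  ... | false = p , q , r
  go : ∀ {n} (v : Vec ℤ n) → NN v → NN (sortDesc v)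
  go [] _ = tt
  go (x ∷ v) (p , q) = insert x (sortDesc v) p (go v q)

scale-cong : ∀ {n} c {f g : Poly n} → f ≋ g → scale c f ≋ scale c g
scale-cong c {f} {g} p = eqP λ φ → trans (pair-scale c f φ) (trans (cong (c *_) (pair p φ)) (sym (pair-scale c g φ)))

piWord-[] : ∀ {n} w → piWord {n} w [] ≡ []
piWord-[] [] = refl
piWord-[] (i ∷ w) = cong (piOp i) (piWord-[] w)

-- If β ≱ 0, the smallest entry of β stands last in β⁺ and is negative, so x^(β⁺) is congruent to 0
-- and with it κ_β. If β ≥ 0, the π_i keep exponents nonnegative. So any key expansion is congruent
-- to its polynomial part, and the latter is nonnegative.
polyPart-spec : ∀ {n} (L : List (KeyEntry (suc n))) → All (λ { (c , β , k) → IsKey (suc n) β k }) L →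
  sumEntries L ∼ polyPart L × ∃ λ p → AllNN p × p ≋ polyPart L
polyPart-spec [] [] = ∼-refl , [] , [] , ≋-refl
polyPart-spec {n} ((c , β , k) ∷ L) ((w , (vw , _) , k≈) ∷ ks) with polyPart-spec L ks
... | s , p , nn , e with nonneg β in eq
... | true = ∼-++ (∼-refl {f = scale c k}) s , scale c (piWord w (mono (sortDesc β))) ++ p ,
      AllP.++⁺ (NNT-scale c (AllNN-piWord w _ (NN-sort β eq ∷ []))) nn ,
      ++-cong (scale-cong c (≋-sym (≈⇒≋ k≈))) e
... | false = ∼-trans (∼-++ (∼-trans (∼-scale c (∼-trans (≋⇒∼ (≈⇒≋ k≈)) (∼-piWord w vw dead))) (≋⇒∼ (empty w))) ∼-refl) s , p , nn , e
  where
  dead : mono (sortDesc β) ∼ []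
  dead with Vec.initLast (sortDesc β) in il
  ... | v , x , e' = ≃⇒∼ (eqL λ φ vl → trans (lem (φ (+ 0) (sortDesc β))) (trans (cong (φ (+ 0)) e') (vl (+ 0) v x
      (ℤP.≰⇒> λ h → absurd (trans (sym eq) (nonneg-sort β (subst (+ 0 ℤ.≤_) (sym (cong (proj₁ ∘ proj₂) il)) h)))))))
    where
    lem : ∀ x → + 1 * x + + 0 ≡ x
    lem = solve-∀
    absurd : false ≡ true → ⊥
    absurd ()
  empty : ∀ w → scale c (piWord w []) ≋ []
  empty w = ≡⇒≋ (cong (scale c) (piWord-[] w))

-- The cases m ≤ ℓ and m > ℓ

get-pad-0 : ∀ n l i → length l ℕ.≤ i → getAt i (padℕ n l) ≡ + 0
get-pad-0 zero l i h = refl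
get-pad-0 (suc n) [] zero h = refl
get-pad-0 (suc n) [] (suc i) h = get-pad-0 n [] i z≤n
get-pad-0 (suc n) (x ∷ l) (suc i) (s≤s h) = get-pad-0 n l i h

-- Both sides have nonnegative exponents and may be compared modulo K, where `polyPart L` can be
-- replaced by the product itself. Then `rotation` expresses the right side by a derivation ending
-- at α, which `IsE-unique` identifies with f.
equal-size : ∀ N (α : Vec ℕ (suc N)) → Vec.sum α ℕ.≤ suc N → ∀ f → IsE N (toZ α) f →
  ∀ w → IsLongest (suc N) (toZ α) w → ∀ d L →
  KeyExpansion (suc N) (productCoeff (suc N) (Δ'ℓ (suc N) (conjugate (toList α)) (Vec.sum α)) (onesThenZeros (suc N) (Vec.sum α)) d) L →
  qPart f d ≋ piWord w (polyPart L)
equal-size N α small f dF w longest@(vw , _ , act≡ , _) d L (keys , exp) =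
  ≋-sym (≋-trans (piWord-cong w vw (≋-sym p≋)) (nonneg-separated (AllNN-piWord w p p-nn) (AllNN-qPart d (IsE-NNQ dF))
    (∼-trans (∼-piWord w vw (∼-trans (≋⇒∼ p≋) (∼-sym s∼))) (main d exp))))
  where
  η = conjugate (toList α)
  part-η = conjugate-partition (toList α)
  r = full η
  len : length r ≡ Vec.sum α
  len = sum-conjugate α

  s∼ : sumEntries L ∼ polyPart L
  s∼ = proj₁ (polyPart-spec L keys)
  p : Poly (suc N)
  p = proj₁ (proj₂ (polyPart-spec L keys))
  p-nn = proj₁ (proj₂ (proj₂ (polyPart-spec L keys)))
  p≋ : p ≋ polyPart L
  p≋ = proj₂ (proj₂ (proj₂ (polyPart-spec L keys)))

  rotated = rotation N r (rows-full N part-η (hd-conjugate α)) (subst (ℕ._≤ suc N) (sym len) small)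
  Y : Poly (suc N)
  Y = proj₁ rotated
  sorted : padℕ (suc N) (lam η) ≡ sortDesc (toZ α)
  sorted = lam-conjugate α
  dY : IsE N (toZ α) (piWord w Y)
  dY = subst (λ β → IsE N β (piWord w Y)) (trans (cong (act w) (trans (cong (padℕ (suc N)) (run-full part-η)) sorted)) act≡)
    (IsE-word w vw (proj₁ (proj₂ rotated)))

  -- The first row is η₁, the number of nonzero entries of the sorted α. From position η₁ on
  -- neighbouring entries are equal, both being 0, so `longest-absorbs` applies.
  absorbs : ∀ {η} → Partition η → padℕ (suc N) (lam η) ≡ sortDesc (toZ α) → AbsorbsFrom (suc N) (full η) w
  absorbs [] _ = tt
  absorbs {a ∷ η'} pt e = subst (λ r → AbsorbsFrom (suc N) r w) (sym (proj₂ (full-head pt)))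
    (λ i a≤i h → longest-absorbs longest i h (trans (zero-at i a≤i) (sym (zero-at (suc i) (ℕP.m≤n⇒m≤1+n a≤i)))))
    where
    zero-at : ∀ i → a ℕ.≤ i → getAt i (sortDesc (toZ α)) ≡ + 0
    zero-at i h = trans (cong (getAt i) (sym e)) (get-pad-0 (suc N) (lam (a ∷ η')) i (ℕP.≤-trans (ℕP.≤-reflexive (length-lam pt)) h))

  product : ℤ → Poly (suc N)
  product = productCoeff (suc N) (Δ'ℓ (suc N) η (Vec.sum α)) (onesThenZeros (suc N) (Vec.sum α))

  product-rows : ∀ d → product (+ d) ≋ G (suc N) r d
  product-rows d = subst (λ m → productCoeff (suc N) (Δ'ℓ (suc N) η m) (onesThenZeros (suc N) m) (+ d) ≋ G (suc N) r d) len
    (≋-trans (≡⇒≋ (cong (λ Ψ → productCoeff (suc N) Ψ (onesThenZeros (suc N) (length r)) (+ d)) (Δ'-roots (suc N) part-η)))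
      (product-G (suc N) r (subst (ℕ._≤ suc N) (sym len) small) d))

  main : ∀ d → product d ≈ sumEntries L → piWord w (sumEntries L) ∼ qPart f d
  main (+ d) exp = ∼-trans (≋⇒∼ (piWord-cong w vw (≋-trans (≋-sym (≈⇒≋ exp)) (product-rows d))))
    (∼-trans (proj₂ (proj₂ rotated) w vw (absorbs part-η sorted) d)
    (≋⇒∼ (≋-trans (≋-sym (qPart-piWord w vw Y (+ d))) (qPart-cong (IsE-unique dY dF) (+ d)))))
  -- In negative q-degree the product is empty, and f has no terms because its q-exponents are
  -- nonnegative.
  main -[1+ d ] exp = ≋⇒∼ (≋-trans (piWord-cong w vw (≋-sym (≈⇒≋ exp))) (≋-trans (≡⇒≋ (piWord-[] w))
    (≋-sym (eqP λ φ → trans (pair-qPart f -[1+ d ] φ) (trans (pair-extAll (IsE-NNQ dF) (λ { c (+ _) e _ → refl ; c -[1+ _ ] e (() , _) }))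
      (pair-0 f (λ _ _ → refl)))))))

extend : ∀ {n} m → Vec ℕ n → Vec ℕ m
extend zero v = []
extend (suc m) [] = 0 ∷ extend m []
extend (suc m) (x ∷ v) = x ∷ extend m v

toZ-extend : ∀ {n} m (v : Vec ℕ n) → toZ (extend m v) ≡ pad m (toList (toZ v))
toZ-extend zero v = refl
toZ-extend (suc m) [] = cong (+ 0 ∷_) (toZ-extend m [])
toZ-extend (suc m) (x ∷ v) = cong (+ x ∷_) (toZ-extend m v)

sum-extend : ∀ {n} m (v : Vec ℕ n) → n ℕ.≤ m → Vec.sum (extend m v) ≡ Vec.sum v
sum-extend zero [] h = refl
sum-extend (suc m) [] h = sum-extend m [] z≤n
sum-extend (suc m) (x ∷ v) (s≤s h) = cong (x ℕ.+_) (sum-extend m v h)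

conjugate-extend : ∀ {n} m (v : Vec ℕ n) → n ℕ.≤ m → conjugate (toList (extend m v)) ≡ conjugate (toList v)
conjugate-extend m v h = trans (cong (applyUpTo _) (max m v h)) (applyUpTo-cong (maxℕ (toList v)) (λ r → cnt r m v h))
  where
  max : ∀ {n} m (v : Vec ℕ n) → n ℕ.≤ m → maxℕ (toList (extend m v)) ≡ maxℕ (toList v)
  max zero [] h = refl
  max (suc m) [] h = max m [] z≤n
  max (suc m) (x ∷ v) (s≤s h) = cong (x ℕ.⊔_) (max m v h)
  cnt : ∀ {n} r m (v : Vec ℕ n) → n ℕ.≤ m → count r (toList (extend m v)) ≡ count r (toList v)
  cnt r zero [] h = refl
  cnt r (suc m) [] h = cnt r m [] z≤n
  cnt r (suc m) (x ∷ v) (s≤s h) rewrite count-∷ r x (toList (extend m v)) | count-∷ r x (toList v) = cong (one-if (suc r ℕ.≤ᵇ x) ℕ.+_) (cnt r m v h)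

qPart-specialize : ∀ {m} ℓ (f : Poly m) d → qPart (specialize ℓ f) d ≋ specialize ℓ (qPart f d)
qPart-specialize ℓ f d = eqP λ φ → trans (trans (pair-qPart (specialize ℓ f) d φ) (pair-specialize ℓ f _))
  (trans (pair-ext f (λ d' e → swap (d ==ℤ d') (allB (λ b → b ==ℤ + 0) (List.drop ℓ (toList e))) _))
  (sym (trans (pair-specialize ℓ (qPart f d) φ) (pair-qPart f d _))))
  where
  swap : ∀ a b (x : ℤ) → (if b then (if a then x else + 0) else + 0) ≡ (if a then (if b then x else + 0) else + 0)
  swap true b x = refl
  swap false true x = refl
  swap false false x = refl

-- The first case is applied to α padded with zeros to length |α|, which changes neither the
-- conjugate nor the size. By `stable-pad`, setting the added variables to 0 in the larger Ẽ gives
-- back f.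
larger-size : ∀ k t (α : Vec ℕ (suc k)) → Vec.sum α ≡ suc (t ℕ.+ k) → ∀ f → IsE k (toZ α) f →
  ∀ w → IsLongest (suc (t ℕ.+ k)) (pad (suc (t ℕ.+ k)) (toList (toZ α))) w → ∀ d L →
  KeyExpansion (suc (t ℕ.+ k)) (productCoeff (suc (t ℕ.+ k)) (Δ'ℓ (suc (t ℕ.+ k)) (conjugate (toList α)) (suc (t ℕ.+ k)))
    (onesThenZeros (suc (t ℕ.+ k)) (suc (t ℕ.+ k))) d) L →
  qPart f d ≋ specialize (suc k) (piWord w (polyPart L))
larger-size k t α sum≡ f dF w longest d L (keys , exp) with stable-pad t dF
... | F , dF' , spec≋ = ≋-trans (qPart-cong (≋-sym spec≋) d) (≋-trans (qPart-specialize (suc k) F d)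
    (specialize-cong (suc k) (equal-size N α' small F (subst (λ v → IsE N v F) (sym (toZ-extend (suc N) α)) dF') w longest' d L
      (keys , subst₂ (λ η m → productCoeff (suc N) (Δ'ℓ (suc N) η m) (onesThenZeros (suc N) m) d ≈ sumEntries L)
        (sym (conjugate-extend (suc N) α k≤)) (sym sum') exp))))
  where
  N = t ℕ.+ k
  k≤ : suc k ℕ.≤ suc N
  k≤ = s≤s (ℕP.m≤n+m k t)
  α' = extend (suc N) α
  sum' : Vec.sum α' ≡ suc N
  sum' = trans (sum-extend (suc N) α k≤) sum≡
  small : Vec.sum α' ℕ.≤ suc N
  small = ℕP.≤-reflexive sum'
  longest' : IsLongest (suc N) (toZ α') w
  longest' = subst (λ β → IsLongest (suc N) β w) (sym (toZ-extend (suc N) α)) longest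

theorem8p11 : ∀ (k : ℕ) (α : Vec ℕ (suc k)) →
    (sum α ≤ suc k →
    ∀ f → IsE k (toZ α) f →
    ∀ w → IsLongest (suc k) (toZ α) w →
    ∀ (d : ℤ) L →
    KeyExpansion (suc k)
    (productCoeff (suc k) (Δ'ℓ (suc k) (conjugate (toList α)) (sum α))
    (onesThenZeros (suc k) (sum α)) d) L →
    qPart f d ≈ piWord w (polyPart L))
    ×
    (suc k < sum α →
    ∀ f → IsE k (toZ α) f →
    ∀ w → IsLongest (sum α) (pad (sum α) (toList (toZ α))) w →
    ∀ (d : ℤ) L →
    KeyExpansion (sum α)
    (productCoeff (sum α) (Δ'ℓ (sum α) (conjugate (toList α)) (sum α))
    (onesThenZeros (sum α) (sum α)) d) L →
    qPart f d ≈ specialize (suc k) (piWord w (polyPart L)))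
theorem8p11 k α =
  (λ small f dF w longest d L exp → ≋⇒≈ (equal-size k α small f dF w longest d L exp)) ,
  (λ large → larger (sum α) refl large)
  where
  -- Replacing `sum α` by a variable m allows it to be matched as a successor and then rewritten as
  -- `suc (t + k)`.
  larger : ∀ m → sum α ≡ m → suc k < m →
    ∀ f → IsE k (toZ α) f → ∀ w → IsLongest m (pad m (toList (toZ α))) w → ∀ (d : ℤ) L →
    KeyExpansion m (productCoeff m (Δ'ℓ m (conjugate (toList α)) m) (onesThenZeros m m) d) L →
    qPart f d ≈ specialize (suc k) (piWord w (polyPart L))
  larger (suc N) sum≡ (s≤s k<N) with ℕP.m≤n⇒∃[o]m+o≡n (ℕP.<⇒≤ k<N)
  ... | t , e with trans (ℕP.+-comm t k) e
  ... | refl = λ f dF w longest d L exp → ≋⇒≈ (larger-size k t α sum≡ f dF w longest d L exp)
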